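{- Let $\Gamma$ be an ordinary subgraph of $\mathcal R$ such that for some $i\ge a_\Gamma$ the number of vertices of $\Gamma$ in row $i+1$ is greater than the number in row $i$. Then $\psi_\Gamma(b_1,\ldots,b_{l_\Gamma})=0$ for all integers $b_1\ge\cdots\ge b_{l_\Gamma}$.
   Context: $\mathcal R$: graph with vertex set $\mathbb Z^2$, row $i=\{(i,j)\}$, edges joining $(i,j)$ to its upper neighbours $(i-1,j)$ and $(i-1,j+1)$. Ordinary subgraph $\Gamma$: finite connected full subgraph such that $(i,j),(i,j+1)\in\Gamma\Rightarrow(i+1,j)\in\Gamma$, and, with $a_\Gamma$ the top row of $\Gamma$, for $i>a_\Gamma$: $(i,j),(i,j+1)\in\Gamma\Rightarrow(i-1,j+1)\in\Gamma$. $l_\Gamma$ = number of vertices of $\Gamma$ in row $a_\Gamma$. $D_\Gamma(b_1,\ldots,b_{l_\Gamma})$: real arrays $(s_{i,j})$ vanishing off $\Gamma$, with row $a_\Gamma$ entries $b_1,\ldots,b_{l_\Gamma}$ left to right, and $s_{i-1,j}\ge s_{i,j}\ge s_{i-1,j+1}$ whenever the relevant vertices are in $\Gamma$ (a finite-dimensional rational polyhedron). For a face $f$, $\Delta_f$ is the subgraph of $\Gamma$ with all vertices of $\Gamma$ and those edges whose two coordinates are equal at a point whose minimal face is $f$. $\varphi_\Gamma(b_1,\ldots,b_{l_\Gamma})(f)=\prod_{l\ge1}(1-t^l)^{d_l}$, where $d_l$ is the number of pairs $(E,i)$ with $E$ a connected component of $\Delta_f$ and $i>a_\Gamma$ such that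 $E$ has exactly $l-1$ vertices in row $i-1$ and $l$ vertices in row $i$. For a face-weight $\varphi$ on a rational polyhedron $P$, with $g(x)=\varphi(\text{minimal face containing }x)$, $S_\varphi(P)=\sum_{a\in P\cap\mathbb Z^{(\mathbb Z^2)}}g(a)e^a$ where $e^a=\prod t_{i,j}^{a_{i,j}}$, and $\sigma_\varphi(P)=QS_\varphi(P)/Q$ is the weighted integer point transform (rational function in the $t_{i,j}$ over $\mathbb Z[t]$; $Q$ any nonzero Laurent polynomial making $QS_\varphi(P)$ a Laurent polynomial). $F$ is the specialization $t_{i,j}\mapsto x_i^{ -1}x_{i+1}$, and $\psi_\Gamma(b_1,\ldots,b_{l_\Gamma})=F\big(\sigma_{\varphi_\Gamma(b_1,\ldots,b_{l_\Gamma})}(D_\Gamma(b_1,\ldots,b_{l_\Gamma}))\big)$, a well-defined rational function in the $x_i$. -}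

module Defs where

open import Data.Bool using (Bool; true; false; _∧_; _∨_; not; if_then_else_)
open import Data.Nat as ℕ using (ℕ; zero; suc)
open import Data.Integer as ℤ using (ℤ; +_; _≤ᵇ_)
open import Data.Product using (Σ; ∃; _×_; _,_; proj₁; proj₂)
open import Data.List using (List; []; _∷_; _++_; map; foldr; filter; filterᵇ; length; concatMap; replicate)
open import Data.Bool.ListAction using (all; any)
open import Data.List.Membership.Propositional using (_∈_)
open import Data.List.Relation.Unary.Unique.Propositional using (Unique)
open import Data.Maybe using (Maybe; just; nothing)
open import Data.Product.Properties using (≡-dec)
open import Relation.Binary.PropositionalEquality using (_≡_)
open import Relation.Binary.Definitions using (DecidableEquality)
open import Relation.Nullary.Decidable using (⌊_⌋)
open import Relation.Nullary using (¬_)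

infix 4 _==ℤ_ _<ᵇℤ_

_==ℤ_ : ℤ → ℤ → Bool
x ==ℤ y = ⌊ x ℤ.≟ y ⌋

_<ᵇℤ_ : ℤ → ℤ → Bool
x <ᵇℤ y = (x ≤ᵇ y) ∧ not (x ==ℤ y)

-- Polynomials in the parameter t over ℤ: coefficient lists, lowest
-- degree first.  Equality is coefficientwise (trailing zeros ignored).

Poly : Set
Poly = List ℤ

coeffP : Poly → ℕ → ℤ
coeffP []       _       = + 0
coeffP (c ∷ _)  zero    = c
coeffP (_ ∷ p)  (suc n) = coeffP p n

_≃P_ : Poly → Poly → Set
p ≃P q = ∀ n → coeffP p n ≡ coeffP q n

addP : Poly → Poly → Poly
addP []       q        = q
addP p        []       = p
addP (a ∷ p)  (b ∷ q)  = (a ℤ.+ b) ∷ addP p q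

mulP : Poly → Poly → Poly
mulP []      q = []
mulP (c ∷ p) q = addP (map (c ℤ.*_) q) (+ 0 ∷ mulP p q)

sumP : List Poly → Poly
sumP = foldr addP []

oneP : Poly
oneP = + 1 ∷ []

oneMinusTPow : ℕ → Poly
oneMinusTPow q = addP oneP (replicate q (+ 0) ++ (ℤ.- (+ 1)) ∷ [])

module Laurent {K : Set} (_≟K_ : DecidableEquality K) where

  -- a monomial is a finite list of (variable, exponent); its exponent
  -- vector is obtained by adding up exponents of equal variables
  Mono : Set
  Mono = List (K × ℤ)

  expo : Mono → K → ℤ
  expo []             k = + 0
  expo ((k' , e) ∷ m) k = (if ⌊ k' ≟K k ⌋ then e else + 0) ℤ.+ expo m k

  keys : Mono → List K
  keys = map proj₁

  infix 4 _≈ᵇ_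

  _≈ᵇ_ : Mono → Mono → Bool
  m ≈ᵇ m' = all (λ k → expo m k ==ℤ expo m' k) (keys (m ++ m'))

  invM : Mono → Mono
  invM = map (λ { (k , e) → (k , ℤ.- e) })

  LPoly : Set
  LPoly = List (Poly × Mono)

  coeffL : LPoly → Mono → Poly
  coeffL []             m = []
  coeffL ((c , μ) ∷ R)  m = addP (if μ ≈ᵇ m then c else []) (coeffL R m)

  IsZeroL : LPoly → Set
  IsZeroL R = ∀ m → coeffL R m ≃P []

V : Set
V = ℤ × ℤ

_≟V_ : DecidableEquality V
_≟V_ = ≡-dec ℤ._≟_ ℤ._≟_

infix 4 _==V_

_==V_ : V → V → Bool
u ==V v = ⌊ u ≟V v ⌋

row col : V → ℤ
row = proj₁
col = proj₂

upperEdge : V → V → Bool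
upperEdge (i , j) (i' , j') = (i' ==ℤ (i ℤ.- + 1)) ∧ ((j' ==ℤ j) ∨ (j' ==ℤ (j ℤ.+ + 1)))

edgeℛ : V → V → Bool
edgeℛ u w = upperEdge u w ∨ upperEdge w u

-- finite full subgraph of ℛ, given by a duplicate-free list of vertices
record Subgraph : Set where
  field
    verts  : List V
    unique : Unique verts
open Subgraph public

memΓ : Subgraph → V → Bool
memΓ Γ v = any (v ==V_) (verts Γ)

reachN : Subgraph → (V → V → Bool) → ℕ → V → V → Bool
reachN Γ adj zero    v w = v ==V w
reachN Γ adj (suc n) v w =
  reachN Γ adj n v w ∨ any (λ u → reachN Γ adj n v u ∧ adj u w) (verts Γ)

-- since Γ has length Γ vertices, paths of < length Γ edges suffice
reach : Subgraph → (V → V → Bool) → V → V → Bool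
reach Γ adj = reachN Γ adj (length (verts Γ))

Connected : Subgraph → Set
Connected Γ = ∀ v w → v ∈ verts Γ → w ∈ verts Γ → reach Γ edgeℛ v w ≡ true

IsTopRow : Subgraph → ℤ → Set
IsTopRow Γ a = (∃ λ v → v ∈ verts Γ × row v ≡ a) × (∀ v → v ∈ verts Γ → a ℤ.≤ row v)

Ordinary : Subgraph → ℤ → Set
Ordinary Γ a =
  IsTopRow Γ a × Connected Γ ×
  (∀ i j → (i , j) ∈ verts Γ → (i , j ℤ.+ + 1) ∈ verts Γ → (i ℤ.+ + 1 , j) ∈ verts Γ) ×
  (∀ i j → a ℤ.< i → (i , j) ∈ verts Γ → (i , j ℤ.+ + 1) ∈ verts Γ → (i ℤ.- + 1 , j ℤ.+ + 1) ∈ verts Γ)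

rowCount : Subgraph → ℤ → ℕ
rowCount Γ i = length (filter (λ v → row v ℤ.≟ i) (verts Γ))

-- The polyhedron D_Γ(b) and its lattice points (points are Laurent
-- monomials in the t_{i,j}, i.e. finitely supported arrays ℤ² → ℤ)

open module LT = Laurent _≟V_ public
  renaming (Mono to TMono; expo to texpo; _≈ᵇ_ to _≈ᵗ_; invM to tinv; LPoly to TLPoly; coeffL to tcoeff; IsZeroL to TIsZero)

nth : List ℤ → ℕ → Maybe ℤ
nth []       _       = nothing
nth (x ∷ _)  zero    = just x
nth (_ ∷ xs) (suc n) = nth xs n

maybeEq : Maybe ℤ → ℤ → Bool
maybeEq (just x) y = x ==ℤ y
maybeEq nothing  y = false

rankTop : Subgraph → ℤ → V → ℕ
rankTop Γ a v = length (filterᵇ (λ w → (row w ==ℤ a) ∧ (col w <ᵇℤ col v)) (verts Γ))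

inD : Subgraph → ℤ → List ℤ → TMono → Bool
inD Γ a bs m =
  all (λ k → (texpo m k ==ℤ + 0) ∨ memΓ Γ k) (LT.keys m)
  ∧ all (λ v → not (row v ==ℤ a) ∨ maybeEq (nth bs (rankTop Γ a v)) (texpo m v)) (verts Γ)
  ∧ all (λ u → all (λ w → ineq u w) (verts Γ)) (verts Γ)
  where
  ineq : V → V → Bool
  ineq (i , j) (i' , j') =
    not (i' ==ℤ (i ℤ.- + 1)) ∨
    ((not (j' ==ℤ j) ∨ (texpo m (i , j) ≤ᵇ texpo m (i' , j'))) ∧
     (not (j' ==ℤ (j ℤ.+ + 1)) ∨ (texpo m (i' , j') ≤ᵇ texpo m (i , j))))

-- The face weight φ_Γ(b), evaluated at a point x (through its minimal
-- face: Δ_f has the edges of Γ whose endpoint coordinates agree at x).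

firsts : {A : Set} → (A → Bool) → (A → A → Bool) → List A → List A
firsts P R []       = []
firsts P R (x ∷ xs) =
  (if P x then x ∷ [] else []) ++ firsts (λ y → P y ∧ not (P x ∧ R x y)) R xs

weight : Subgraph → ℤ → TMono → Poly
weight Γ a m = foldr mulP oneP (map compFactor compReps)
  where
  x : V → ℤ
  x = texpo m
  adjΔ : V → V → Bool
  adjΔ u w = edgeℛ u w ∧ (x u ==ℤ x w)
  rΔ : V → V → Bool
  rΔ = reach Γ adjΔ
  compReps : List V
  compReps = firsts (λ _ → true) rΔ (verts Γ)
  cnt : V → ℤ → ℕ
  cnt v i = length (filterᵇ (λ w → rΔ v w ∧ (row w ==ℤ i)) (verts Γ))
  factor : ℕ → ℕ → Poly
  factor p q = if ⌊ q ℕ.≟ suc p ⌋ then oneMinusTPow q else oneP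
  compFactor : V → Poly
  compFactor v =
    foldr mulP oneP
      (map (λ w → factor (cnt v (row w ℤ.- + 1)) (cnt v (row w)))
           (firsts (λ w → rΔ v w ∧ (a <ᵇℤ row w)) (λ u w → row u ==ℤ row w) (verts Γ)))

-- coefficient of e^m in S_φ(D_Γ(b))
Scoeff : Subgraph → ℤ → List ℤ → TMono → Poly
Scoeff Γ a bs m = if inD Γ a bs m then weight Γ a m else []

QScoeff : Subgraph → ℤ → List ℤ → TLPoly → TMono → Poly
QScoeff Γ a bs Q m = sumP (map (λ { (c , μ) → mulP c (Scoeff Γ a bs (m ++ tinv μ)) }) Q)

IsProductQS : Subgraph → ℤ → List ℤ → TLPoly → TLPoly → Set
IsProductQS Γ a bs Q R = ∀ m → QScoeff Γ a bs Q m ≃P tcoeff R m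

open module LX = Laurent ℤ._≟_ public
  renaming (Mono to XMono; LPoly to XLPoly; IsZeroL to XIsZero)
  using ()

Fmono : TMono → XMono
Fmono = concatMap (λ { ((i , j) , e) → (i , ℤ.- e) ∷ (i ℤ.+ + 1 , e) ∷ [] })

F : TLPoly → XLPoly
F = map (λ { (c , μ) → (c , Fmono μ) })

-- ψ_Γ(b) = F(Q S)/F(Q) vanishes: the rational function σ = (QS)/Q is
-- represented with some Q whose specialization is nonzero, and for every
-- such representation the specialized numerator F(QS) is zero.
PsiVanishes : Subgraph → ℤ → List ℤ → Set
PsiVanishes Γ a bs =
  (Σ TLPoly λ Q → Σ TLPoly λ R → IsProductQS Γ a bs Q R × ¬ XIsZero (F Q)) ×
  (∀ Q R → IsProductQS Γ a bs Q R → ¬ XIsZero (F Q) → XIsZero (F R))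

{-# OPTIONS --safe #-}
module Submission where

-- The rows of an ordinary Γ are intervals, and the lower of two consecutive
-- rows exceeds the part forced by the upper one on neither side (A), on the
-- left (B), on the right (C) or on both (D), so Γ is spelled by a word in A, B,
-- C, D that ends at an empty row; a growing row is a letter D.  Likewise the
-- face weight is a product over pairs of consecutive rows.
--
-- Fix the two neighbours of a row and sum over that row, graded by its total s.
-- For the middle row of DX and of XD (X = A, B, C) the two sums correspond, up
-- to a Laurent factor, under the reflection of s in the total of the neighbours,
-- which after specialization exchanges x_k and x_{k+1}.  So vanishing for
-- ⋯XD⋯ implies vanishing for ⋯DX⋯, and D can be moved to the end of the word,
-- until the row above it is empty.  Then the part of the array below that row
-- can be translated freely: S is annihilated by 1 - e^w, with w the indicator
-- of that part, although the specialization of 1 - e^w is not zero.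

import Data.Bool.Properties
import Data.Integer.Properties as ℤₚ
import Data.List.Membership.DecPropositional
import Data.List.Membership.Propositional
import Data.List.Membership.Propositional.Properties
import Data.List.Properties
import Data.List.Relation.Unary.Unique.Propositional.Properties as Uniqueₚ
import Data.Nat.Properties as ℕₚ
import Data.Nat.Tactic.RingSolver as ℕS
import Data.Unit
import Relation.Nullary.Decidable
import Tactic.RingSolver as RingSolver
open import Defs hiding (keys)
open import Algebra.Bundles using (CommutativeRing)
open import Data.Bool using (Bool; true; false; _∧_; _∨_; not; if_then_else_; T)
open import Data.Bool.ListAction using (all; any)
open import Data.Bool.Properties using (∧-zeroʳ)
open import Data.Empty using (⊥; ⊥-elim)
open import Data.Integer as ℤ using (ℤ; +_; -[1+_]; _≤ᵇ_; _≤_; _+_)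
open import Data.Integer.Tactic.RingSolver using (solve-∀)
open import Data.List using (List; []; _∷_; _++_; map; foldr; filter; filterᵇ; length; concatMap; replicate)
open import Data.List.Membership.Propositional using (_∈_; _∉_)
open import Data.List.Membership.Propositional.Properties using (∈-++⁺ˡ; ∈-++⁺ʳ; ∈-++⁻; ∈-map⁺; ∈-map⁻; ∈-filter⁺; ∈-filter⁻)
open import Data.List.Membership.Propositional.Properties.WithK using (unique∧set⇒bag)
open import Data.List.Properties using (map-++; length-++; length-replicate; ++-assoc)
open import Data.List.Relation.Binary.BagAndSetEquality using (∼bag⇒↭)
open import Data.List.Relation.Binary.Permutation.Propositional using (_↭_; ↭-sym)
open import Data.List.Relation.Binary.Permutation.Propositional.Properties using (↭-length; filter-↭; ∈-resp-↭)
open import Data.List.Relation.Unary.All as All using (All; []; _∷_)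
open import Data.List.Relation.Unary.AllPairs using ([]; _∷_)
open import Data.List.Relation.Unary.Any using (here; there)
open import Data.List.Relation.Unary.Linked using (Linked)
open import Data.List.Relation.Unary.Unique.Propositional using (Unique)
open import Data.Maybe using (Maybe; just; nothing)
open import Data.Nat as ℕ using (ℕ; zero; suc; _>_)
open import Data.Product using (∃; _×_; _,_; proj₁; proj₂)
open import Data.Sum using (_⊎_; inj₁; inj₂)
open import Function using (_∘_; _$_; mk⇔)
open import Level using (0ℓ)
open import Relation.Binary.Definitions using (DecidableEquality; tri<; tri≈; tri>)
open import Relation.Binary.PropositionalEquality using (_≡_; _≢_; refl; sym; trans; cong; cong₂; subst; subst₂; module ≡-Reasoning)
open import Relation.Nullary using (¬_; yes; no; Dec)
open import Relation.Nullary.Decidable using (⌊_⌋)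
open import Tactic.RingSolver.Core.AlmostCommutativeRing using (AlmostCommutativeRing; fromCommutativeRing)

-- ℤ[t] as a commutative ring

-- A row made by `D` is not bounded by its upper neighbour on either side, and where the next letter
-- does not bound it the series over it is infinite. Such a side is paid for by a factor `1 - e^w`
-- that `F` maps to a non-zero-divisor. Hence `Tame` and `Null` carry a list of such factors instead
-- of a fraction. The reflection of the row sum is not proved by a bijection of rows. Reading the
-- values from the largest down, a row between two fixed rows has a state of two Booleans: which row
-- is ahead in each of the two interlacings. For the states (true, false) and (false, true) the sum
-- equals its reflection. The states (false, false) and (true, true) mix, and only two linear
-- combinations of them, which depend on `t` and on the current value, are reflected. These four
-- relations reproduce each other at every value, whatever multiplicities the fixed rows have there.
-- The exchanges with A, B and C then use the same relations and differ only in the end conditions: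
-- whether the row is bounded above and whether it is bounded below.

infix 4 _≋_
-- Wraps the pointwise equality, so that both polynomials can be recovered from the type of a proof.
record _≋_ (p q : Poly) : Set where
  constructor mk≋
  field at : p ≃P q
open _≋_ public

coeff-addP : ∀ p q n → coeffP (addP p q) n ≡ coeffP p n ℤ.+ coeffP q n
coeff-addP [] q n = sym (ℤₚ.+-identityˡ _)
coeff-addP (a ∷ p) [] n = sym (ℤₚ.+-identityʳ _)
coeff-addP (a ∷ p) (b ∷ q) zero = refl
coeff-addP (a ∷ p) (b ∷ q) (suc n) = coeff-addP p q n

coeff-scale : ∀ c p n → coeffP (map (c ℤ.*_) p) n ≡ c ℤ.* coeffP p n
coeff-scale c [] n = sym (ℤₚ.*-zeroʳ c)
coeff-scale c (a ∷ p) zero = refl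
coeff-scale c (a ∷ p) (suc n) = coeff-scale c p n

negP : Poly → Poly
negP = map (ℤ.-_)

coeff-negP : ∀ p n → coeffP (negP p) n ≡ ℤ.- coeffP p n
coeff-negP [] n = refl
coeff-negP (a ∷ p) zero = refl
coeff-negP (a ∷ p) (suc n) = coeff-negP p n

≋-refl : ∀ {p} → p ≋ p
≋-refl = mk≋ λ n → refl

≋-sym : ∀ {p q} → p ≋ q → q ≋ p
≋-sym (mk≋ e) = mk≋ λ n → sym (e n)

≋-trans : ∀ {p q r} → p ≋ q → q ≋ r → p ≋ r
≋-trans (mk≋ e) (mk≋ f) = mk≋ λ n → trans (e n) (f n)

≋-reflexive : ∀ {p q} → p ≡ q → p ≋ q
≋-reflexive refl = ≋-refl

addP-cong : ∀ {p p' q q'} → p ≋ p' → q ≋ q' → addP p q ≋ addP p' q'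
addP-cong {p} {p'} {q} {q'} (mk≋ e) (mk≋ f) = mk≋ λ n →
  trans (coeff-addP p q n) (trans (cong₂ ℤ._+_ (e n) (f n)) (sym (coeff-addP p' q' n)))

addP-comm : ∀ p q → addP p q ≋ addP q p
addP-comm p q = mk≋ λ n →
  trans (coeff-addP p q n) (trans (ℤₚ.+-comm (coeffP p n) _) (sym (coeff-addP q p n)))

addP-assoc : ∀ p q r → addP (addP p q) r ≋ addP p (addP q r)
addP-assoc p q r = mk≋ λ n → begin
  coeffP (addP (addP p q) r) n                  ≡⟨ coeff-addP (addP p q) r n ⟩
  coeffP (addP p q) n ℤ.+ coeffP r n            ≡⟨ cong (ℤ._+ coeffP r n) (coeff-addP p q n) ⟩
  (coeffP p n ℤ.+ coeffP q n) ℤ.+ coeffP r n    ≡⟨ ℤₚ.+-assoc (coeffP p n) _ _ ⟩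
  coeffP p n ℤ.+ (coeffP q n ℤ.+ coeffP r n)    ≡⟨ cong (λ z → coeffP p n ℤ.+ z) (sym (coeff-addP q r n)) ⟩
  coeffP p n ℤ.+ coeffP (addP q r) n            ≡⟨ sym (coeff-addP p (addP q r) n) ⟩
  coeffP (addP p (addP q r)) n                  ∎
  where open ≡-Reasoning

addP-identityʳ : ∀ p → addP p [] ≋ p
addP-identityʳ p = addP-comm p []

addP-inverseʳ : ∀ p → addP p (negP p) ≋ []
addP-inverseʳ p = mk≋ λ n →
  trans (coeff-addP p (negP p) n)
        (trans (cong (λ z → coeffP p n ℤ.+ z) (coeff-negP p n)) (ℤₚ.+-inverseʳ (coeffP p n)))

negP-cong : ∀ {p q} → p ≋ q → negP p ≋ negP q
negP-cong {p} {q} (mk≋ e) = mk≋ λ n → trans (coeff-negP p n) (trans (cong ℤ.-_ (e n)) (sym (coeff-negP q n)))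

scale-cong : ∀ c {p q} → p ≋ q → map (c ℤ.*_) p ≋ map (c ℤ.*_) q
scale-cong c {p} {q} (mk≋ e) = mk≋ λ n →
  trans (coeff-scale c p n) (trans (cong (c ℤ.*_) (e n)) (sym (coeff-scale c q n)))

tail-cong : ∀ {a b p q} → a ≡ b → p ≋ q → (a ∷ p) ≋ (b ∷ q)
tail-cong e (mk≋ f) = mk≋ λ { zero → e ; (suc n) → f n }

scale-distrib-addP : ∀ c p q → map (c ℤ.*_) (addP p q) ≋ addP (map (c ℤ.*_) p) (map (c ℤ.*_) q)
scale-distrib-addP c [] q = ≋-refl
scale-distrib-addP c (a ∷ p) [] = ≋-refl
scale-distrib-addP c (a ∷ p) (b ∷ q) = tail-cong (ℤₚ.*-distribˡ-+ c a b) (scale-distrib-addP c p q)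

addP-interchange : ∀ a b c d → addP (addP a b) (addP c d) ≋ addP (addP a c) (addP b d)
addP-interchange a b c d =
  ≋-trans (addP-assoc a b (addP c d))
  (≋-trans (addP-cong (≋-refl {a})
     (≋-trans (≋-sym (addP-assoc b c d))
     (≋-trans (addP-cong (addP-comm b c) (≋-refl {d})) (addP-assoc c b d))))
  (≋-sym (addP-assoc a c (addP b d))))

mulP-congʳ : ∀ p {q q'} → q ≋ q' → mulP p q ≋ mulP p q'
mulP-congʳ [] e = ≋-refl
mulP-congʳ (c ∷ p) e = addP-cong (scale-cong c e) (tail-cong refl (mulP-congʳ p e))

mulP-distribˡ : ∀ p q r → mulP p (addP q r) ≋ addP (mulP p q) (mulP p r)
mulP-distribˡ [] q r = ≋-refl
mulP-distribˡ (c ∷ p) q r =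
  ≋-trans (addP-cong (scale-distrib-addP c q r) (tail-cong refl (mulP-distribˡ p q r)))
          (addP-interchange (map (c ℤ.*_) q) (map (c ℤ.*_) r) (+ 0 ∷ mulP p q) (+ 0 ∷ mulP p r))

mulP-zeroʳ : ∀ p → mulP p [] ≋ []
mulP-zeroʳ [] = ≋-refl
mulP-zeroʳ (c ∷ p) = ≋-trans (tail-cong refl (mulP-zeroʳ p)) (mk≋ λ { zero → refl ; (suc n) → refl })

-- `mulP` recurses on its left factor; this is the matching recursion on the right, from which
-- commutativity follows by induction.
mulP-consʳ : ∀ p d q → mulP p (d ∷ q) ≋ addP (map (d ℤ.*_) p) (+ 0 ∷ mulP p q)
mulP-consʳ [] d q = mk≋ λ { zero → refl ; (suc n) → refl }
mulP-consʳ (c ∷ p) d q = tail-cong (cong (ℤ._+ + 0) (ℤₚ.*-comm c d))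
  (≋-trans (addP-cong (≋-refl {map (c ℤ.*_) q}) (mulP-consʳ p d q))
  (≋-trans (≋-sym (addP-assoc (map (c ℤ.*_) q) (map (d ℤ.*_) p) _))
  (≋-trans (addP-cong (addP-comm (map (c ℤ.*_) q) (map (d ℤ.*_) p)) ≋-refl)
           (addP-assoc (map (d ℤ.*_) p) (map (c ℤ.*_) q) _))))

mulP-comm : ∀ p q → mulP p q ≋ mulP q p
mulP-comm [] q = ≋-sym (mulP-zeroʳ q)
mulP-comm (c ∷ p) q =
  ≋-trans (addP-cong (≋-refl {map (c ℤ.*_) q}) (tail-cong refl (mulP-comm p q))) (≋-sym (mulP-consʳ q c p))

mulP-cong : ∀ {p p' q q'} → p ≋ p' → q ≋ q' → mulP p q ≋ mulP p' q'
mulP-cong {p} {p'} {q} {q'} e f =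
  ≋-trans (mulP-congʳ p f) (≋-trans (mulP-comm p q') (≋-trans (mulP-congʳ q' e) (mulP-comm q' p')))

mulP-distribʳ : ∀ r p q → mulP (addP p q) r ≋ addP (mulP p r) (mulP q r)
mulP-distribʳ r p q =
  ≋-trans (mulP-comm (addP p q) r)
  (≋-trans (mulP-distribˡ r p q) (addP-cong (mulP-comm r p) (mulP-comm r q)))

scale-scale : ∀ c d p → map (c ℤ.*_) (map (d ℤ.*_) p) ≋ map ((c ℤ.* d) ℤ.*_) p
scale-scale c d [] = ≋-refl
scale-scale c d (a ∷ p) = tail-cong (sym (ℤₚ.*-assoc c d a)) (scale-scale c d p)

mulP-scaleˡ : ∀ c p q → mulP (map (c ℤ.*_) p) q ≋ map (c ℤ.*_) (mulP p q)
mulP-scaleˡ c [] q = ≋-refl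
mulP-scaleˡ c (d ∷ p) q =
  ≋-trans (addP-cong (≋-sym (scale-scale c d q)) (tail-cong (sym (ℤₚ.*-zeroʳ c)) (mulP-scaleˡ c p q)))
          (≋-sym (scale-distrib-addP c (map (d ℤ.*_) q) (+ 0 ∷ mulP p q)))

scale-zero : ∀ p → map (+ 0 ℤ.*_) p ≋ []
scale-zero p = mk≋ λ n → trans (coeff-scale (+ 0) p n) (ℤₚ.*-zeroˡ (coeffP p n))

mulP-assoc : ∀ p q r → mulP (mulP p q) r ≋ mulP p (mulP q r)
mulP-assoc [] q r = ≋-refl
mulP-assoc (c ∷ p) q r =
  ≋-trans (mulP-distribʳ r (map (c ℤ.*_) q) (+ 0 ∷ mulP p q))
          (addP-cong (mulP-scaleˡ c q r)
            (≋-trans (addP-cong (scale-zero r) (≋-refl {+ 0 ∷ mulP (mulP p q) r})) (tail-cong refl (mulP-assoc p q r))))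

mulP-identityˡ : ∀ p → mulP oneP p ≋ p
mulP-identityˡ p =
  ≋-trans (addP-cong {map (+ 1 ℤ.*_) p} {p} {+ 0 ∷ []} {[]}
                     (mk≋ λ n → trans (coeff-scale (+ 1) p n) (ℤₚ.*-identityˡ _))
                     (mk≋ λ { zero → refl ; (suc n) → refl }))
          (addP-identityʳ p)

polyRing : CommutativeRing 0ℓ 0ℓ
polyRing = record
  { Carrier = Poly ; _≈_ = _≋_ ; _+_ = addP ; _*_ = mulP ; -_ = negP ; 0# = [] ; 1# = oneP
  ; isCommutativeRing = record
    { isRing = record
      { +-isAbelianGroup = record
        { isGroup = record
          { isMonoid = record
            { isSemigroup = record
              { isMagma = record
                { isEquivalence = record { refl = ≋-refl ; sym = ≋-sym ; trans = ≋-trans }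
                ; ∙-cong = addP-cong }
              ; assoc = addP-assoc }
            ; identity = (λ p → ≋-refl) , addP-identityʳ }
          ; inverse = (λ p → ≋-trans (addP-comm (negP p) p) (addP-inverseʳ p)) , addP-inverseʳ
          ; ⁻¹-cong = negP-cong }
        ; comm = addP-comm }
      ; *-cong = mulP-cong
      ; *-assoc = mulP-assoc
      ; *-identity = mulP-identityˡ , λ p → ≋-trans (mulP-comm p oneP) (mulP-identityˡ p)
      ; distrib = mulP-distribˡ , mulP-distribʳ }
    ; *-comm = mulP-comm } }

≋-isZero : ∀ p → Maybe ([] ≋ p)
≋-isZero [] = just ≋-refl
≋-isZero (+ 0 ∷ p) with ≋-isZero p
... | just e = just (mk≋ λ { zero → refl ; (suc n) → at e n })
... | nothing = nothing
≋-isZero (_ ∷ p) = nothing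

polyACR : AlmostCommutativeRing 0ℓ 0ℓ
polyACR = fromCommutativeRing polyRing ≋-isZero

-- The operations are made opaque so that unification treats them as injective.
infixl 6 _⊕_ _⊝_
infixl 7 _⊗_
infix 8 ⊖_

opaque
  _⊕_ _⊗_ : Poly → Poly → Poly
  _⊕_ = addP
  _⊗_ = mulP

  ⊖_ : Poly → Poly
  ⊖_ = negP

  ⊕≡addP : ∀ p q → p ⊕ q ≡ addP p q
  ⊕≡addP p q = refl

  ⊗≡mulP : ∀ p q → p ⊗ q ≡ mulP p q
  ⊗≡mulP p q = refl

  ⊕-cong : ∀ {p p' q q'} → p ≋ p' → q ≋ q' → p ⊕ q ≋ p' ⊕ q'
  ⊕-cong = addP-cong

  ⊗-cong : ∀ {p p' q q'} → p ≋ p' → q ≋ q' → p ⊗ q ≋ p' ⊗ q'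
  ⊗-cong = mulP-cong

  ⊖-cong : ∀ {p q} → p ≋ q → ⊖ p ≋ ⊖ q
  ⊖-cong = negP-cong

  ⊕-comm : ∀ p q → p ⊕ q ≋ q ⊕ p
  ⊕-comm = addP-comm

  ⊕-assoc : ∀ p q r → (p ⊕ q) ⊕ r ≋ p ⊕ (q ⊕ r)
  ⊕-assoc = addP-assoc

  ⊕-identityˡ : ∀ p → [] ⊕ p ≋ p
  ⊕-identityˡ p = ≋-refl

  ⊕-identityʳ : ∀ p → p ⊕ [] ≋ p
  ⊕-identityʳ = addP-identityʳ

  ⊕-inverseʳ : ∀ p → p ⊕ ⊖ p ≋ []
  ⊕-inverseʳ = addP-inverseʳ

  ⊗-comm : ∀ p q → p ⊗ q ≋ q ⊗ p
  ⊗-comm = mulP-comm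

  ⊗-assoc : ∀ p q r → (p ⊗ q) ⊗ r ≋ p ⊗ (q ⊗ r)
  ⊗-assoc = mulP-assoc

  ⊗-identityˡ : ∀ p → oneP ⊗ p ≋ p
  ⊗-identityˡ = mulP-identityˡ

  ⊗-zeroˡ : ∀ p → [] ⊗ p ≋ []
  ⊗-zeroˡ p = ≋-refl

  ⊗-zeroʳ : ∀ p → p ⊗ [] ≋ []
  ⊗-zeroʳ = mulP-zeroʳ

  ⊗-distribˡ : ∀ p q r → p ⊗ (q ⊕ r) ≋ p ⊗ q ⊕ p ⊗ r
  ⊗-distribˡ = mulP-distribˡ

_⊝_ : Poly → Poly → Poly
p ⊝ q = p ⊕ ⊖ q

⊗-identityʳ : ∀ p → p ⊗ oneP ≋ p
⊗-identityʳ p = ≋-trans (⊗-comm p oneP) (⊗-identityˡ p)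

⊝-cong : ∀ {p p' q q'} → p ≋ p' → q ≋ q' → p ⊝ q ≋ p' ⊝ q'
⊝-cong e f = ⊕-cong e (⊖-cong f)

p⊝q≋0 : ∀ {p q} → p ≋ q → p ⊝ q ≋ []
p⊝q≋0 {p} e = ≋-trans (⊕-cong ≋-refl (⊖-cong (≋-sym e))) (⊕-inverseʳ p)

opaque
  unfolding _⊕_

  ⊖-zero : ⊖ [] ≋ []
  ⊖-zero = ≋-refl

  ⊝-injective : ∀ {p q} → p ⊝ q ≋ [] → p ≋ q
  ⊝-injective {p} {q} e =
    ≋-trans (lem p q) (≋-trans (addP-cong e (≋-refl {q})) ≋-refl)
    where
    lem : ∀ a b → a ≋ addP (addP a (negP b)) b
    lem = RingSolver.solve-∀ polyACR

-- Linear arithmetic in one move: an inequality follows from a known one with the same difference of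
-- sides, and that equation is left to the ring solver. Sums of known inequalities are fed in
-- through `a` and `b`.
≤-by : ∀ {a b} c d → a ℤ.≤ b → d ℤ.- c ≡ b ℤ.- a → c ℤ.≤ d
≤-by c d h e = ℤₚ.0≤i-j⇒j≤i (subst (+ 0 ℤ.≤_) (sym e) (ℤₚ.i≤j⇒0≤j-i h))

<⇒+1≤ : ∀ {a b} → a ℤ.< b → a ℤ.+ + 1 ℤ.≤ b
<⇒+1≤ {a} h = ℤₚ.≤-trans (ℤₚ.≤-reflexive (ℤₚ.+-comm a (+ 1))) (ℤₚ.i<j⇒suc[i]≤j h)

+1≤⇒< : ∀ {a b} → a ℤ.+ + 1 ℤ.≤ b → a ℤ.< b
+1≤⇒< {a} h = ℤₚ.suc[i]≤j⇒i<j (ℤₚ.≤-trans (ℤₚ.≤-reflexive (ℤₚ.+-comm (+ 1) a)) h)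

-- Boolean tests and their meaning

==ℤ-refl : ∀ x → (x ==ℤ x) ≡ true
==ℤ-refl x with x ℤ.≟ x
... | yes _ = refl
... | no ne = ⊥-elim (ne refl)

==ℤ-sound : ∀ {x y} → (x ==ℤ y) ≡ true → x ≡ y
==ℤ-sound {x} {y} e with x ℤ.≟ y
... | yes p = p

==ℤ-complete : ∀ {x y} → x ≡ y → (x ==ℤ y) ≡ true
==ℤ-complete refl = ==ℤ-refl _

==ℤ-false : ∀ {x y} → x ≢ y → (x ==ℤ y) ≡ false
==ℤ-false {x} {y} ne with x ℤ.≟ y
... | yes p = ⊥-elim (ne p)
... | no _ = refl

∧-true : ∀ {a b} → a ∧ b ≡ true → a ≡ true × b ≡ true
∧-true {true} {true} e = refl , refl

true≢false : ∀ {b} → b ≡ true → b ≡ false → ⊥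
true≢false refl ()

bool-ext : ∀ {a b} → (a ≡ true → b ≡ true) → (b ≡ true → a ≡ true) → a ≡ b
bool-ext {true} {b} f g = sym (f refl)
bool-ext {false} {true} f g = g refl
bool-ext {false} {false} f g = refl

bool-case : ∀ b → b ≡ true ⊎ b ≡ false
bool-case true = inj₁ refl
bool-case false = inj₂ refl

all-sound : ∀ {A : Set} (P : A → Bool) xs → all P xs ≡ true → ∀ {x} → x ∈ xs → P x ≡ true
all-sound P (x ∷ xs) e (here refl) = proj₁ (∧-true e)
all-sound P (x ∷ xs) e (there i) = all-sound P xs (proj₂ (∧-true {P x} e)) i

all-complete : ∀ {A : Set} (P : A → Bool) xs → (∀ {x} → x ∈ xs → P x ≡ true) → all P xs ≡ true
all-complete P [] h = refl
all-complete P (x ∷ xs) h rewrite h (here refl) = all-complete P xs (h ∘ there)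

if-cong : ∀ {b b' : Bool} {p q : Poly} → b ≡ b' → p ≋ q → (if b then p else []) ≋ (if b' then q else [])
if-cong {true} refl e = e
if-cong {false} refl e = ≋-refl

opaque
  unfolding _⊕_

  ⊝-interchange : ∀ a b c d → (a ⊝ b) ⊝ (c ⊝ d) ≋ (a ⊝ c) ⊝ (b ⊝ d)
  ⊝-interchange = RingSolver.solve-∀ polyACR

  ⊖-⊕ : ∀ a b → ⊖ (a ⊕ b) ≋ ⊖ a ⊕ ⊖ b
  ⊖-⊕ = RingSolver.solve-∀ polyACR

-- Exponent vectors and Laurent polynomials

module Exponents {K : Set} (_≟K_ : DecidableEquality K) where

  open Laurent _≟K_ public

  infix 4 _≈_
  record _≈_ (m m' : Mono) : Set where
    constructor mk≈
    field on : ∀ k → expo m k ≡ expo m' k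
  open _≈_ public

  ≈-refl : ∀ {m} → m ≈ m
  ≈-refl = mk≈ λ k → refl

  ≈-sym : ∀ {m m'} → m ≈ m' → m' ≈ m
  ≈-sym (mk≈ e) = mk≈ λ k → sym (e k)

  ≈-trans : ∀ {m m' m''} → m ≈ m' → m' ≈ m'' → m ≈ m''
  ≈-trans (mk≈ e) (mk≈ f) = mk≈ λ k → trans (e k) (f k)

  expo-++ : ∀ m m' k → expo (m ++ m') k ≡ expo m k ℤ.+ expo m' k
  expo-++ [] m' k = sym (ℤₚ.+-identityˡ _)
  expo-++ ((k' , e) ∷ m) m' k =
    trans (cong (λ z → (if ⌊ k' ≟K k ⌋ then e else + 0) ℤ.+ z) (expo-++ m m' k))
          (sym (ℤₚ.+-assoc (if ⌊ k' ≟K k ⌋ then e else + 0) (expo m k) (expo m' k)))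

  expo-inv : ∀ m k → expo (invM m) k ≡ ℤ.- expo m k
  expo-inv [] k = refl
  expo-inv ((k' , e) ∷ m) k with ⌊ k' ≟K k ⌋
  ... | true  = trans (cong (λ z → (ℤ.- e) ℤ.+ z) (expo-inv m k)) (sym (ℤₚ.neg-distrib-+ e (expo m k)))
  ... | false = trans (ℤₚ.+-identityˡ _) (trans (expo-inv m k) (cong ℤ.-_ (sym (ℤₚ.+-identityˡ (expo m k)))))

  expo-here : ∀ k e m → expo ((k , e) ∷ m) k ≡ e ℤ.+ expo m k
  expo-here k e m with k ≟K k
  ... | yes _ = refl
  ... | no ne = ⊥-elim (ne refl)

  expo-there : ∀ {k k'} e m → k' ≢ k → expo ((k' , e) ∷ m) k ≡ expo m k
  expo-there {k} {k'} e m ne with k' ≟K k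
  ... | yes p = ⊥-elim (ne p)
  ... | no _ = ℤₚ.+-identityˡ _

  expo-∉ : ∀ m k → k ∉ keys m → expo m k ≡ + 0
  expo-∉ [] k ni = refl
  expo-∉ ((k' , e) ∷ m) k ni = trans (expo-there e m (λ { refl → ni (here refl) })) (expo-∉ m k (ni ∘ there))

  ∷-cong : ∀ x {m m'} → m ≈ m' → x ∷ m ≈ x ∷ m'
  ∷-cong (k' , e) (mk≈ h) = mk≈ λ k → cong (λ z → (if ⌊ k' ≟K k ⌋ then e else + 0) ℤ.+ z) (h k)

  ∷-swap : ∀ x y m → x ∷ y ∷ m ≈ y ∷ x ∷ m
  ∷-swap (a , d) (b , e) m = mk≈ λ k → lem (if ⌊ a ≟K k ⌋ then d else + 0) (if ⌊ b ≟K k ⌋ then e else + 0) (expo m k)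
    where
    lem : ∀ x y z → x ℤ.+ (y ℤ.+ z) ≡ y ℤ.+ (x ℤ.+ z)
    lem = solve-∀

  ∷-cancel : ∀ k e m → (k , e) ∷ (k , ℤ.- e) ∷ m ≈ m
  ∷-cancel k' e m = mk≈ go
    where
    lem : ∀ x z → x ℤ.+ ((ℤ.- x) ℤ.+ z) ≡ z
    lem = solve-∀
    go : ∀ k → expo ((k' , e) ∷ (k' , ℤ.- e) ∷ m) k ≡ expo m k
    go k with ⌊ k' ≟K k ⌋
    ... | true = lem e (expo m k)
    ... | false = trans (ℤₚ.+-identityˡ _) (ℤₚ.+-identityˡ _)

  infixl 6 _-ᴹ_
  _-ᴹ_ : Mono → Mono → Mono
  m -ᴹ w = m ++ invM w

  expo-minus : ∀ m w k → expo (m -ᴹ w) k ≡ expo m k ℤ.- expo w k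
  expo-minus m w k = trans (expo-++ m (invM w) k) (cong (λ z → expo m k ℤ.+ z) (expo-inv w k))

  minus-cong : ∀ {m m' w w'} → m ≈ m' → w ≈ w' → m -ᴹ w ≈ m' -ᴹ w'
  minus-cong {m} {m'} {w} {w'} (mk≈ e) (mk≈ f) = mk≈ λ k →
    trans (expo-minus m w k) (trans (cong₂ ℤ._-_ (e k) (f k)) (sym (expo-minus m' w' k)))

  minus-swap : ∀ m v w → (m -ᴹ v) -ᴹ w ≈ (m -ᴹ w) -ᴹ v
  minus-swap m v w = mk≈ λ k →
    trans (expo-minus (m -ᴹ v) w k) (trans (cong (ℤ._- expo w k) (expo-minus m v k))
    (trans (lem (expo m k) (expo v k) (expo w k))
    (sym (trans (expo-minus (m -ᴹ w) v k) (cong (ℤ._- expo v k) (expo-minus m w k))))))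
    where
    lem : ∀ a b c → (a ℤ.- b) ℤ.- c ≡ (a ℤ.- c) ℤ.- b
    lem = solve-∀

  minus-++ : ∀ m v w → m -ᴹ (v ++ w) ≈ (m -ᴹ v) -ᴹ w
  minus-++ m v w = mk≈ λ k →
    trans (expo-minus m (v ++ w) k) (trans (cong (λ z → expo m k ℤ.- z) (expo-++ v w k))
    (trans (lem (expo m k) (expo v k) (expo w k))
    (sym (trans (expo-minus (m -ᴹ v) w k) (cong (ℤ._- expo w k) (expo-minus m v k))))))
    where
    lem : ∀ a b c → a ℤ.- (b ℤ.+ c) ≡ (a ℤ.- b) ℤ.- c
    lem = solve-∀

  minus-[] : ∀ m → m -ᴹ [] ≈ m
  minus-[] m = mk≈ λ k → trans (expo-minus m [] k) (ℤₚ.+-identityʳ _)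

  move : ∀ {w μ m} → w ++ μ ≈ m → μ ≈ m -ᴹ w
  move {w} {μ} {m} (mk≈ e) = mk≈ λ k →
    trans (lem (expo w k) (expo μ k)) (trans (cong (ℤ._- expo w k) (trans (sym (expo-++ w μ k)) (e k))) (sym (expo-minus m w k)))
    where
    lem : ∀ a b → b ≡ (a ℤ.+ b) ℤ.- a
    lem = solve-∀

  unmove : ∀ {w μ m} → μ ≈ m -ᴹ w → w ++ μ ≈ m
  unmove {w} {μ} {m} (mk≈ e) = mk≈ λ k →
    trans (expo-++ w μ k) (trans (cong (λ z → expo w k ℤ.+ z) (trans (e k) (expo-minus m w k))) (lem (expo w k) (expo m k)))
    where
    lem : ∀ a b → a ℤ.+ (b ℤ.- a) ≡ b
    lem = solve-∀

  ≈ᵇ-complete : ∀ {m m'} → m ≈ m' → (m ≈ᵇ m') ≡ true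
  ≈ᵇ-complete {m} {m'} (mk≈ e) = all-complete _ (keys (m ++ m')) λ {k} _ → ==ℤ-complete (e k)

  open import Data.List.Membership.DecPropositional _≟K_ using (_∈?_) public

  -- The test inspects only the variables that occur in one of the monomials; at every other
  -- variable both exponents are zero.
  ≈ᵇ-sound : ∀ {m m'} → (m ≈ᵇ m') ≡ true → m ≈ m'
  ≈ᵇ-sound {m} {m'} e = mk≈ go
    where
    go : ∀ k → expo m k ≡ expo m' k
    go k with k ∈? keys (m ++ m')
    ... | yes i = ==ℤ-sound (all-sound (λ k → expo m k ==ℤ expo m' k) (keys (m ++ m')) e i)
    ... | no ni = trans (expo-∉ m k (λ i → ni (subst (k ∈_) (sym (map-++ proj₁ m m')) (∈-++⁺ˡ i))))
                   (sym (expo-∉ m' k (λ i → ni (subst (k ∈_) (sym (map-++ proj₁ m m')) (∈-++⁺ʳ (keys m) i)))))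

  _≈?_ : ∀ m m' → Dec (m ≈ m')
  m ≈? m' with bool-case (m ≈ᵇ m')
  ... | inj₁ e = yes (≈ᵇ-sound e)
  ... | inj₂ e = no λ h → true≢false (≈ᵇ-complete h) e

  ≈ᵇ-iff : ∀ {a b c d} → (a ≈ b → c ≈ d) → (c ≈ d → a ≈ b) → (a ≈ᵇ b) ≡ (c ≈ᵇ d)
  ≈ᵇ-iff f g = bool-ext (λ e → ≈ᵇ-complete (f (≈ᵇ-sound e))) (λ e → ≈ᵇ-complete (g (≈ᵇ-sound e)))

  ≈ᵇ-false : ∀ {m m'} → ¬ (m ≈ m') → (m ≈ᵇ m') ≡ false
  ≈ᵇ-false {m} {m'} n with bool-case (m ≈ᵇ m')
  ... | inj₁ e = ⊥-elim (n (≈ᵇ-sound e))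
  ... | inj₂ e = e

  -- Formal series are functions on lists of variables with exponents; those that depend only on the
  -- exponent vector are the genuine ones.
  Resp : (Mono → Poly) → Set
  Resp f = ∀ {m m'} → m ≈ m' → f m ≋ f m'

  -- multiplication by 1 - e^w
  act : Mono → (Mono → Poly) → Mono → Poly
  act w f m = f m ⊝ f (m -ᴹ w)

  acts : List Mono → (Mono → Poly) → Mono → Poly
  acts ws f = foldr act f ws

  act-cong : ∀ w {f g} → (∀ m → f m ≋ g m) → ∀ m → act w f m ≋ act w g m
  act-cong w h m = ⊝-cong (h m) (h (m -ᴹ w))

  acts-cong : ∀ ws {f g} → (∀ m → f m ≋ g m) → ∀ m → acts ws f m ≋ acts ws g m
  acts-cong [] h = h
  acts-cong (w ∷ ws) h = act-cong w (acts-cong ws h)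

  act-resp : ∀ w {f} → Resp f → Resp (act w f)
  act-resp w r e = ⊝-cong (r e) (r (minus-cong e ≈-refl))

  acts-resp : ∀ ws {f} → Resp f → Resp (acts ws f)
  acts-resp [] r = r
  acts-resp (w ∷ ws) r = act-resp w (acts-resp ws r)

  act-comm : ∀ v w {f} → Resp f → ∀ m → act v (act w f) m ≋ act w (act v f) m
  act-comm v w {f} r m =
    ≋-trans (⊝-cong ≋-refl (⊝-cong ≋-refl (r (minus-swap m v w))))
            (⊝-interchange (f m) (f (m -ᴹ w)) (f (m -ᴹ v)) (f ((m -ᴹ w) -ᴹ v)))

  act-acts : ∀ v ws {f} → Resp f → ∀ m → act v (acts ws f) m ≋ acts ws (act v f) m
  act-acts v [] r m = ≋-refl
  act-acts v (w ∷ ws) r m =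
    ≋-trans (act-comm v w (acts-resp ws r) m) (act-cong w (act-acts v ws r) m)

  acts-++ : ∀ vs ws f m → acts (vs ++ ws) f m ≡ acts vs (acts ws f) m
  acts-++ [] ws f m = refl
  acts-++ (v ∷ vs) ws f m = cong₂ _⊝_ (acts-++ vs ws f m) (acts-++ vs ws f (m -ᴹ v))

  acts-comm : ∀ vs ws {f} → Resp f → ∀ m → acts vs (acts ws f) m ≋ acts ws (acts vs f) m
  acts-comm [] ws r m = ≋-refl
  acts-comm (v ∷ vs) ws r m =
    ≋-trans (act-cong v (acts-comm vs ws r) m) (act-acts v ws (acts-resp vs r) m)

  shiftL : Mono → LPoly → LPoly
  shiftL w = map λ { (c , μ) → (c , w ++ μ) }

  negL : LPoly → LPoly
  negL = map λ { (c , μ) → (⊖ c , μ) }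

  scaleL : Poly → LPoly → LPoly
  scaleL d = map λ { (c , μ) → (d ⊗ c , μ) }

  coeff-∷ : ∀ c μ R m → coeffL ((c , μ) ∷ R) m ≡ (if μ ≈ᵇ m then c else []) ⊕ coeffL R m
  coeff-∷ c μ R m = sym (⊕≡addP _ _)

  coeff-resp : ∀ R → Resp (coeffL R)
  coeff-resp [] e = ≋-refl
  coeff-resp ((c , μ) ∷ R) {m} {m'} e =
    addP-cong (if-cong (≈ᵇ-iff {μ} {m} {μ} {m'} (λ h → ≈-trans h e) (λ h → ≈-trans h (≈-sym e))) (≋-refl {c}))
              (coeff-resp R e)

  coeff-hit : ∀ c μ R m → μ ≈ m → coeffL ((c , μ) ∷ R) m ≋ c ⊕ coeffL R m
  coeff-hit c μ R m e rewrite coeff-∷ c μ R m | ≈ᵇ-complete e = ≋-refl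

  coeff-miss : ∀ c μ R m → ¬ (μ ≈ m) → coeffL ((c , μ) ∷ R) m ≋ coeffL R m
  coeff-miss c μ R m n rewrite ≈ᵇ-false n = ≋-refl

  coeff-++ : ∀ R R' m → coeffL (R ++ R') m ≋ coeffL R m ⊕ coeffL R' m
  coeff-++ [] R' m = ≋-sym (⊕-identityˡ _)
  coeff-++ ((c , μ) ∷ R) R' m rewrite coeff-∷ c μ R m | coeff-∷ c μ (R ++ R') m =
    ≋-trans (⊕-cong ≋-refl (coeff-++ R R' m)) (≋-sym (⊕-assoc _ _ _))

  coeff-negL : ∀ R m → coeffL (negL R) m ≋ ⊖ coeffL R m
  coeff-negL [] m = ≋-sym ⊖-zero
  coeff-negL ((c , μ) ∷ R) m rewrite coeff-∷ c μ R m | coeff-∷ (⊖ c) μ (negL R) m with μ ≈ᵇ m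
  ... | true  = ≋-trans (⊕-cong ≋-refl (coeff-negL R m)) (≋-sym (⊖-⊕ _ _))
  ... | false = ≋-trans (⊕-cong (≋-sym ⊖-zero) (coeff-negL R m)) (≋-sym (⊖-⊕ _ _))

  coeff-scaleL : ∀ d R m → coeffL (scaleL d R) m ≋ d ⊗ coeffL R m
  coeff-scaleL d [] m = ≋-sym (⊗-zeroʳ d)
  coeff-scaleL d ((c , μ) ∷ R) m rewrite coeff-∷ c μ R m | coeff-∷ (d ⊗ c) μ (scaleL d R) m with μ ≈ᵇ m
  ... | true  = ≋-trans (⊕-cong ≋-refl (coeff-scaleL d R m)) (≋-sym (⊗-distribˡ d _ _))
  ... | false = ≋-trans (⊕-cong (≋-sym (⊗-zeroʳ d)) (coeff-scaleL d R m)) (≋-sym (⊗-distribˡ d _ _))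

  coeff-shiftL : ∀ w R m → coeffL (shiftL w R) m ≋ coeffL R (m -ᴹ w)
  coeff-shiftL w [] m = ≋-refl
  coeff-shiftL w ((c , μ) ∷ R) m =
    addP-cong (if-cong (≈ᵇ-iff {w ++ μ} {m} {μ} {m -ᴹ w} move unmove) (≋-refl {c})) (coeff-shiftL w R m)

  actL : Mono → LPoly → LPoly
  actL w R = R ++ negL (shiftL w R)

  actsL : List Mono → LPoly → LPoly
  actsL ws R = foldr actL R ws

  coeff-actL : ∀ w R m → coeffL (actL w R) m ≋ act w (coeffL R) m
  coeff-actL w R m =
    ≋-trans (coeff-++ R (negL (shiftL w R)) m)
            (⊕-cong ≋-refl (≋-trans (coeff-negL (shiftL w R) m) (⊖-cong (coeff-shiftL w R m))))

  coeff-actsL : ∀ ws R m → coeffL (actsL ws R) m ≋ acts ws (coeffL R) m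
  coeff-actsL [] R m = ≋-refl
  coeff-actsL (w ∷ ws) R m =
    ≋-trans (coeff-actL w (actsL ws R) m) (act-cong w (coeff-actsL ws R) m)

  support-bound : ∀ R k → ∃ λ N → ∀ m → N ℕ.< ℤ.∣ expo m k ∣ → coeffL R m ≋ []
  support-bound [] k = 0 , λ m _ → ≋-refl
  support-bound ((c , μ) ∷ R) k with support-bound R k
  ... | N , h = N ℕ.+ ℤ.∣ expo μ k ∣ , λ m lt →
    ≋-trans (coeff-miss c μ R m (λ e → ℕₚ.<⇒≱ lt
               (subst (λ z → ℤ.∣ z ∣ ℕ.≤ N ℕ.+ ℤ.∣ expo μ k ∣) (on e k) (ℕₚ.m≤n+m _ N))))
            (h m (ℕₚ.≤-<-trans (ℕₚ.m≤m+n N _) lt))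

  steps : ℕ → Mono → Mono → Mono
  steps zero    w m = m
  steps (suc n) w m = steps n w m -ᴹ w

  expo-steps : ∀ n w m k → expo (steps n w m) k ≡ expo m k ℤ.- + n ℤ.* expo w k
  expo-steps zero w m k = lem (expo m k) (expo w k)
    where
    lem : ∀ a b → a ≡ a ℤ.- + 0 ℤ.* b
    lem = solve-∀
  expo-steps (suc n) w m k =
    trans (expo-minus (steps n w m) w k)
    (trans (cong (ℤ._- expo w k) (expo-steps n w m k)) (lem (expo m k) (expo w k) (+ n)))
    where
    lem : ∀ a b c → (a ℤ.- c ℤ.* b) ℤ.- b ≡ a ℤ.- (+ 1 ℤ.+ c) ℤ.* b
    lem = solve-∀

  Nonzero : Mono → Set
  Nonzero w = ∃ λ k → expo w k ≢ + 0

  -- Going far enough along the translation we leave the support.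
  act-injective : ∀ w R → Nonzero w → (∀ m → act w (coeffL R) m ≋ []) → ∀ m → coeffL R m ≋ []
  act-injective w R (k , ne) z m with support-bound R k
  ... | N , h = ≋-trans (go n) (h (steps n w m) big)
    where
    -- Every step changes the exponent of `k` by at least 1, so this many steps end beyond the
    -- support bound `N` wherever `m` lies.
    n = suc (ℤ.∣ expo m k ∣ ℕ.+ N)
    go : ∀ n → coeffL R m ≋ coeffL R (steps n w m)
    go zero = ≋-refl
    go (suc n) = ≋-trans (go n) (⊝-injective (z (steps n w m)))
    big : N ℕ.< ℤ.∣ expo (steps n w m) k ∣
    big = ℕₚ.+-cancelˡ-≤ ℤ.∣ expo m k ∣ _ _
      (ℕₚ.≤-trans (ℕₚ.≤-reflexive (ℕₚ.+-suc ℤ.∣ expo m k ∣ N))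
      (ℕₚ.≤-trans nd
      (ℕₚ.≤-trans (ℕₚ.≤-reflexive (cong ℤ.∣_∣ nd-eq))
      (ℕₚ.≤-trans (ℤₚ.∣i+j∣≤∣i∣+∣j∣ (expo m k) (ℤ.- expo (steps n w m) k))
        (ℕₚ.≤-reflexive (cong (ℤ.∣ expo m k ∣ ℕ.+_) (ℤₚ.∣-i∣≡∣i∣ (expo (steps n w m) k))))))))
      where
      lem : ∀ a b → b ≡ a ℤ.- (a ℤ.- b)
      lem = solve-∀
      nd-eq : + n ℤ.* expo w k ≡ expo m k ℤ.- expo (steps n w m) k
      nd-eq = trans (lem (expo m k) _) (cong (λ z → expo m k ℤ.- z) (sym (expo-steps n w m k)))
      nz : ∀ z → z ≢ + 0 → 1 ℕ.≤ ℤ.∣ z ∣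
      nz (+ zero) q = ⊥-elim (q refl)
      nz (+ suc _) q = ℕ.s≤s ℕ.z≤n
      nz -[1+ _ ] q = ℕ.s≤s ℕ.z≤n
      nd : n ℕ.≤ ℤ.∣ + n ℤ.* expo w k ∣
      nd = ℕₚ.≤-trans (ℕₚ.≤-reflexive (sym (ℕₚ.*-identityʳ n)))
           (ℕₚ.≤-trans (ℕₚ.*-monoʳ-≤ n (nz (expo w k) ne)) (ℕₚ.≤-reflexive (sym (ℤₚ.∣i*j∣≡∣i∣*∣j∣ (+ n) (expo w k)))))

  acts-injective : ∀ ws R → All Nonzero ws → (∀ m → acts ws (coeffL R) m ≋ []) → ∀ m → coeffL R m ≋ []
  acts-injective [] R _ z = z
  acts-injective (w ∷ ws) R (nw ∷ nws) z =
    acts-injective ws R nws λ m → ≋-trans (≋-sym (coeff-actsL ws R m))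
      (act-injective w (actsL ws R) nw (λ m → ≋-trans (act-cong w (coeff-actsL ws R) m) (z m)) m)

  -- A Laurent polynomial times a formal series of arbitrary support; `coeff-mulL` identifies it
  -- with `mulL` when the series is itself a Laurent polynomial.
  mulF : LPoly → (Mono → Poly) → Mono → Poly
  mulF [] h m = []
  mulF ((c , μ) ∷ A) h m = c ⊗ h (m -ᴹ μ) ⊕ mulF A h m

  mulL : LPoly → LPoly → LPoly
  mulL [] R = []
  mulL ((c , μ) ∷ A) R = scaleL c (shiftL μ R) ++ mulL A R

  coeff-mulL : ∀ A R m → coeffL (mulL A R) m ≋ mulF A (coeffL R) m
  coeff-mulL [] R m = ≋-refl
  coeff-mulL ((c , μ) ∷ A) R m =
    ≋-trans (coeff-++ (scaleL c (shiftL μ R)) (mulL A R) m)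
      (⊕-cong (≋-trans (coeff-scaleL c (shiftL μ R) m) (⊗-cong ≋-refl (coeff-shiftL μ R m))) (coeff-mulL A R m))

  mulF-cong : ∀ A {f g} → (∀ m → f m ≋ g m) → ∀ m → mulF A f m ≋ mulF A g m
  mulF-cong [] h m = ≋-refl
  mulF-cong ((c , μ) ∷ A) h m = ⊕-cong (⊗-cong ≋-refl (h (m -ᴹ μ))) (mulF-cong A h m)

  mulF-zero : ∀ A {f} → (∀ m → f m ≋ []) → ∀ m → mulF A f m ≋ []
  mulF-zero [] h m = ≋-refl
  mulF-zero ((c , μ) ∷ A) h m =
    ≋-trans (⊕-cong (≋-trans (⊗-cong ≋-refl (h (m -ᴹ μ))) (⊗-zeroʳ c)) (mulF-zero A h m)) (⊕-identityˡ [])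

  mulF-act : ∀ A w {f} → Resp f → ∀ m → act w (mulF A f) m ≋ mulF A (act w f) m
  mulF-act [] w r m = ⊕-inverseʳ []
  mulF-act ((c , μ) ∷ A) w {f} r m =
    ≋-trans (lem c (f (m -ᴹ μ)) (mulF A f m) (f ((m -ᴹ w) -ᴹ μ)) (mulF A f (m -ᴹ w)))
      (⊕-cong (⊗-cong ≋-refl (⊝-cong ≋-refl (r (minus-swap m w μ)))) (mulF-act A w r m))
    where
    opaque
      unfolding _⊕_
      lem : ∀ c a b d e → (c ⊗ a ⊕ b) ⊝ (c ⊗ d ⊕ e) ≋ c ⊗ (a ⊝ d) ⊕ (b ⊝ e)
      lem = RingSolver.solve-∀ polyACR

  mulF-acts : ∀ A ws {f} → Resp f → ∀ m → acts ws (mulF A f) m ≋ mulF A (acts ws f) m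
  mulF-acts A [] r m = ≋-refl
  mulF-acts A (w ∷ ws) r m =
    ≋-trans (act-cong w (mulF-acts A ws r) m) (mulF-act A w (acts-resp ws r) m)

  acts-zero : ∀ ws {f} → (∀ m → f m ≋ []) → ∀ m → acts ws f m ≋ []
  acts-zero [] h = h
  acts-zero (w ∷ ws) h m = ≋-trans (⊝-cong (acts-zero ws h m) (acts-zero ws h (m -ᴹ w))) (⊕-inverseʳ [])

-- Linear maps between exponent lattices

module Linear {K : Set} (_≟K_ : DecidableEquality K) where
  open Exponents _≟K_

  lin : (K → ℤ) → Mono → ℤ
  lin a [] = + 0
  lin a ((k , e) ∷ m) = e ℤ.* a k ℤ.+ lin a m

  lin-ext : ∀ {a b} → (∀ k → a k ≡ b k) → ∀ m → lin a m ≡ lin b m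
  lin-ext h [] = refl
  lin-ext h ((k , e) ∷ m) = cong₂ (λ x y → e ℤ.* x ℤ.+ y) (h k) (lin-ext h m)

  lin-++ : ∀ a m m' → lin a (m ++ m') ≡ lin a m ℤ.+ lin a m'
  lin-++ a [] m' = sym (ℤₚ.+-identityˡ _)
  lin-++ a ((k , e) ∷ m) m' = trans (cong (λ z → e ℤ.* a k ℤ.+ z) (lin-++ a m m')) (sym (ℤₚ.+-assoc (e ℤ.* a k) _ _))

  lin-inv : ∀ a m → lin a (invM m) ≡ ℤ.- lin a m
  lin-inv a [] = refl
  lin-inv a ((k , e) ∷ m) = trans (cong (λ z → (ℤ.- e) ℤ.* a k ℤ.+ z) (lin-inv a m)) (lem e (a k) (lin a m))
    where
    lem : ∀ e x y → (ℤ.- e) ℤ.* x ℤ.+ (ℤ.- y) ≡ ℤ.- (e ℤ.* x ℤ.+ y)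
    lem = solve-∀

  dropKey : K → Mono → Mono
  dropKey k [] = []
  dropKey k ((k' , e) ∷ m) with k' ≟K k
  ... | yes _ = dropKey k m
  ... | no _ = (k' , e) ∷ dropKey k m

  length-dropKey : ∀ k m → length (dropKey k m) ℕ.≤ length m
  length-dropKey k [] = ℕ.z≤n
  length-dropKey k ((k' , e) ∷ m) with k' ≟K k
  ... | yes _ = ℕₚ.m≤n⇒m≤1+n (length-dropKey k m)
  ... | no _ = ℕ.s≤s (length-dropKey k m)

  expo-dropKey-same : ∀ k m → expo (dropKey k m) k ≡ + 0
  expo-dropKey-same k [] = refl
  expo-dropKey-same k ((k' , e) ∷ m) with k' ≟K k
  ... | yes _ = expo-dropKey-same k m
  ... | no ne = trans (expo-there e (dropKey k m) ne) (expo-dropKey-same k m)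

  expo-dropKey-other : ∀ {k k'} m → k ≢ k' → expo (dropKey k m) k' ≡ expo m k'
  expo-dropKey-other [] ne = refl
  expo-dropKey-other {k} {k'} ((k₁ , e) ∷ m) ne with k₁ ≟K k
  ... | yes refl = trans (expo-dropKey-other m ne) (sym (expo-there e m ne))
  ... | no _ = cong (λ z → (if ⌊ k₁ ≟K k' ⌋ then e else + 0) ℤ.+ z) (expo-dropKey-other m ne)

  lin-dropKey : ∀ a k m → lin a m ≡ expo m k ℤ.* a k ℤ.+ lin a (dropKey k m)
  lin-dropKey a k [] = sym (trans (ℤₚ.+-identityʳ _) (ℤₚ.*-zeroˡ (a k)))
  lin-dropKey a k ((k' , e) ∷ m) with k' ≟K k
  ... | yes refl = trans (cong (λ z → e ℤ.* a k ℤ.+ z) (lin-dropKey a k m)) (lem e (a k) (expo m k) (lin a (dropKey k m)))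
    where
    lem : ∀ e x y z → e ℤ.* x ℤ.+ (y ℤ.* x ℤ.+ z) ≡ (e ℤ.+ y) ℤ.* x ℤ.+ z
    lem = solve-∀
  ... | no _ = trans (cong (λ z → e ℤ.* a k' ℤ.+ z) (lin-dropKey a k m)) (lem (e ℤ.* a k') (a k) (expo m k) (lin a (dropKey k m)))
    where
    lem : ∀ e x y z → e ℤ.+ (y ℤ.* x ℤ.+ z) ≡ (+ 0 ℤ.+ y) ℤ.* x ℤ.+ (e ℤ.+ z)
    lem = solve-∀

  -- A list whose exponents all vanish need not be empty. All entries of its first variable are
  -- collected at once, which leaves a strictly shorter list with the same property; `N` bounds the
  -- length for this recursion.
  lin-zero : ∀ N a m → length m ℕ.≤ N → (∀ k → expo m k ≡ + 0) → lin a m ≡ + 0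
  lin-zero N a [] _ _ = refl
  lin-zero (suc N) a m@((k , e) ∷ m') (ℕ.s≤s le) z =
    trans (lin-dropKey a k m)
    (trans (cong₂ (λ x y → x ℤ.* a k ℤ.+ y) (z k)
              (lin-zero N a (dropKey k m) (short k) zero'))
           (trans (ℤₚ.+-identityʳ _) (ℤₚ.*-zeroˡ (a k))))
    where
    short : ∀ k₁ → length (dropKey k m) ℕ.≤ N
    short _ with k ≟K k
    ... | yes _ = ℕₚ.≤-trans (length-dropKey k m') le
    ... | no ne = ⊥-elim (ne refl)
    zero' : ∀ k' → expo (dropKey k m) k' ≡ + 0
    zero' k' with k ≟K k'
    ... | yes refl = expo-dropKey-same k m
    ... | no ne = trans (expo-dropKey-other m ne) (z k')

  lin-cong : ∀ a {m m'} → m ≈ m' → lin a m ≡ lin a m'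
  lin-cong a {m} {m'} e = ℤₚ.i-j≡0⇒i≡j _ _
    (trans (cong (λ z → lin a m ℤ.+ z) (sym (lin-inv a m')))
    (trans (sym (lin-++ a m (invM m')))
           (lin-zero _ a (m -ᴹ m') ℕₚ.≤-refl
             λ k → trans (expo-minus m m' k) (ℤₚ.i≡j⇒i-j≡0 (on e k)))))

module Hom {K K' : Set} (_≟K_ : DecidableEquality K) (_≟K'_ : DecidableEquality K') where
  private
    module S = Exponents _≟K_
    module D = Exponents _≟K'_
  open Linear _≟K_
  open Linear _≟K'_ using () renaming (lin to lin')

  scaleM : ℤ → D.Mono → D.Mono
  scaleM e = map λ { (k , d) → (k , e ℤ.* d) }

  expo-scaleM : ∀ e m k → D.expo (scaleM e m) k ≡ e ℤ.* D.expo m k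
  expo-scaleM e [] k = sym (ℤₚ.*-zeroʳ e)
  expo-scaleM e ((k' , d) ∷ m) k with ⌊ k' ≟K' k ⌋
  ... | true = trans (cong (λ z → e ℤ.* d ℤ.+ z) (expo-scaleM e m k)) (sym (ℤₚ.*-distribˡ-+ e d (D.expo m k)))
  ... | false = trans (ℤₚ.+-identityˡ _) (trans (expo-scaleM e m k) (cong (e ℤ.*_) (sym (ℤₚ.+-identityˡ (D.expo m k)))))

  hom : (K → D.Mono) → S.Mono → D.Mono
  hom φ [] = []
  hom φ ((k , e) ∷ m) = scaleM e (φ k) ++ hom φ m

  expo-hom : ∀ φ m k' → D.expo (hom φ m) k' ≡ lin (λ k → D.expo (φ k) k') m
  expo-hom φ [] k' = refl
  expo-hom φ ((k , e) ∷ m) k' =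
    trans (D.expo-++ (scaleM e (φ k)) (hom φ m) k') (cong₂ ℤ._+_ (expo-scaleM e (φ k) k') (expo-hom φ m k'))

  hom-cong : ∀ φ {m m'} → m S.≈ m' → hom φ m D.≈ hom φ m'
  hom-cong φ {m} {m'} e = D.mk≈ λ k' → trans (expo-hom φ m k') (trans (lin-cong _ e) (sym (expo-hom φ m' k')))

  hom-ext : ∀ {φ φ'} → (∀ k → φ k D.≈ φ' k) → ∀ m → hom φ m D.≈ hom φ' m
  hom-ext {φ} {φ'} h m = D.mk≈ λ k' →
    trans (expo-hom φ m k') (trans (lin-ext (λ k → D.on (h k) k') m) (sym (expo-hom φ' m k')))

  hom-minus : ∀ φ m w → hom φ (m S.-ᴹ w) D.≈ hom φ m D.-ᴹ hom φ w
  hom-minus φ m w = D.mk≈ λ k' → let a = λ k → D.expo (φ k) k' in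
    trans (expo-hom φ (m S.-ᴹ w) k')
    (trans (lin-++ a m (S.invM w))
    (trans (cong (λ z → lin a m ℤ.+ z) (lin-inv a w))
    (sym (trans (D.expo-minus (hom φ m) (hom φ w) k') (cong₂ ℤ._-_ (expo-hom φ m k') (expo-hom φ w k'))))))

  hom-++ : ∀ φ m w → hom φ (m ++ w) D.≈ hom φ m ++ hom φ w
  hom-++ φ m w = D.mk≈ λ k' → let a = λ k → D.expo (φ k) k' in
    trans (expo-hom φ (m ++ w) k')
    (trans (lin-++ a m w)
    (sym (trans (D.expo-++ (hom φ m) (hom φ w) k') (cong₂ ℤ._+_ (expo-hom φ m k') (expo-hom φ w k')))))

  mapL : (S.Mono → D.Mono) → S.LPoly → D.LPoly
  mapL θ [] = []
  mapL θ ((c , μ) ∷ R) = (c , θ μ) ∷ mapL θ R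

  mapL-++ : ∀ θ R R' → mapL θ (R ++ R') ≡ mapL θ R ++ mapL θ R'
  mapL-++ θ [] R' = refl
  mapL-++ θ (x ∷ R) R' = cong (_ ∷_) (mapL-++ θ R R')

  mapL-negL : ∀ θ R → mapL θ (S.negL R) ≡ D.negL (mapL θ R)
  mapL-negL θ [] = refl
  mapL-negL θ (x ∷ R) = cong (_ ∷_) (mapL-negL θ R)

  mapL-scaleL : ∀ θ c R → mapL θ (S.scaleL c R) ≡ D.scaleL c (mapL θ R)
  mapL-scaleL θ c [] = refl
  mapL-scaleL θ c (x ∷ R) = cong (_ ∷_) (mapL-scaleL θ c R)

  coeff-mapL-shiftL : ∀ φ w R n → D.coeffL (mapL (hom φ) (S.shiftL w R)) n ≋ D.coeffL (mapL (hom φ) R) (n D.-ᴹ hom φ w)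
  coeff-mapL-shiftL φ w [] n = ≋-refl
  coeff-mapL-shiftL φ w ((c , μ) ∷ R) n =
    addP-cong (if-cong (D.≈ᵇ-iff {hom φ (w ++ μ)} {n} {hom φ μ} {n D.-ᴹ hom φ w}
                 (λ e → D.move (D.≈-trans (D.≈-sym (hom-++ φ w μ)) e))
                 (λ e → D.≈-trans (hom-++ φ w μ) (D.unmove e))) (≋-refl {c}))
              (coeff-mapL-shiftL φ w R n)

  dropM : S.Mono → S.LPoly → S.LPoly
  dropM μ [] = []
  dropM μ ((c , ν) ∷ R) with ν S.≈? μ
  ... | yes _ = dropM μ R
  ... | no _ = (c , ν) ∷ dropM μ R

  length-dropM : ∀ μ R → length (dropM μ R) ℕ.≤ length R
  length-dropM μ [] = ℕ.z≤n
  length-dropM μ ((c , ν) ∷ R) with ν S.≈? μ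
  ... | yes _ = ℕₚ.m≤n⇒m≤1+n (length-dropM μ R)
  ... | no _ = ℕ.s≤s (length-dropM μ R)

  coeff-dropM-same : ∀ {μ m} R → m S.≈ μ → S.coeffL (dropM μ R) m ≋ []
  coeff-dropM-same [] e = ≋-refl
  coeff-dropM-same {μ} {m} ((c , ν) ∷ R) e with ν S.≈? μ
  ... | yes _ = coeff-dropM-same R e
  ... | no ne = ≋-trans (S.coeff-miss c ν (dropM μ R) m (λ h → ne (S.≈-trans h e))) (coeff-dropM-same R e)

  coeff-dropM-other : ∀ {μ m} R → ¬ (m S.≈ μ) → S.coeffL (dropM μ R) m ≋ S.coeffL R m
  coeff-dropM-other [] ne = ≋-refl
  coeff-dropM-other {μ} {m} ((c , ν) ∷ R) ne with ν S.≈? μ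
  ... | yes e = ≋-trans (coeff-dropM-other R ne) (≋-sym (S.coeff-miss c ν R m (λ h → ne (S.≈-trans (S.≈-sym h) e))))
  ... | no _ = addP-cong (≋-refl {if ν S.≈ᵇ m then c else []}) (coeff-dropM-other R ne)

  module _ (θ : S.Mono → D.Mono) (θ-cong : ∀ {m m'} → m S.≈ m' → θ m D.≈ θ m') where

    push-dropM : ∀ {μ n} R → θ μ D.≈ n →
      D.coeffL (mapL θ R) n ≋ S.coeffL R μ ⊕ D.coeffL (mapL θ (dropM μ R)) n
    push-dropM [] e = ≋-sym (⊕-identityˡ _)
    push-dropM {μ} {n} ((c , ν) ∷ R) e with ν S.≈? μ
    ... | yes h = ≋-trans (D.coeff-hit c (θ ν) (mapL θ R) n (D.≈-trans (θ-cong h) e))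
                  (≋-trans (⊕-cong ≋-refl (push-dropM R e))
                  (≋-trans (≋-sym (⊕-assoc _ _ _)) (⊕-cong (≋-sym (S.coeff-hit c ν R μ h)) ≋-refl)))
    ... | no ne = ≋-trans (≋-reflexive (D.coeff-∷ c (θ ν) (mapL θ R) n))
                  (≋-trans (⊕-cong ≋-refl (push-dropM R e))
                  (≋-trans (rot _ _ _)
                    (⊕-cong (≋-sym (S.coeff-miss c ν R μ ne))
                            (≋-reflexive (sym (D.coeff-∷ c (θ ν) (mapL θ (dropM μ R)) n))))))
      where
      rot : ∀ a b d → a ⊕ (b ⊕ d) ≋ b ⊕ (a ⊕ d)
      rot a b d = ≋-trans (≋-sym (⊕-assoc a b d)) (≋-trans (⊕-cong (⊕-comm a b) ≋-refl) (⊕-assoc b a d))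

    -- Terms with equivalent monomials may be scattered over `R` and cancel only together. The whole
    -- class of the first monomial is removed by `dropM`; its total coefficient is zero by
    -- hypothesis, and a shorter list remains.
    push-zero : ∀ N R n → length R ℕ.≤ N → (∀ m → θ m D.≈ n → S.coeffL R m ≋ []) → D.coeffL (mapL θ R) n ≋ []
    push-zero N [] n _ _ = ≋-refl
    push-zero (suc N) ((c , μ) ∷ R) n (ℕ.s≤s le) z with θ μ D.≈? n
    ... | no ne = ≋-trans (D.coeff-miss c (θ μ) (mapL θ R) n ne)
                  (push-zero N R n le λ m e →
                    ≋-trans (≋-sym (S.coeff-miss c μ R m (λ h → ne (D.≈-trans (θ-cong h) e)))) (z m e))
    ... | yes e = ≋-trans (push-dropM ((c , μ) ∷ R) e)
                  (≋-trans (⊕-cong (z μ e) (push-zero N (dropM μ ((c , μ) ∷ R)) n short rest)) (⊕-identityˡ []))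
      where
      short : length (dropM μ ((c , μ) ∷ R)) ℕ.≤ N
      short with μ S.≈? μ
      ... | yes _ = ℕₚ.≤-trans (length-dropM μ R) le
      ... | no ne = ⊥-elim (ne S.≈-refl)
      rest : ∀ m → θ m D.≈ n → S.coeffL (dropM μ ((c , μ) ∷ R)) m ≋ []
      rest m h with m S.≈? μ
      ... | yes q = coeff-dropM-same ((c , μ) ∷ R) q
      ... | no q = ≋-trans (coeff-dropM-other ((c , μ) ∷ R) q) (z m h)

    push-eq : ∀ R R' n → (∀ m → θ m D.≈ n → S.coeffL R m ≋ S.coeffL R' m) →
      D.coeffL (mapL θ R) n ≋ D.coeffL (mapL θ R') n
    push-eq R R' n h = ⊝-injective
      (≋-trans (⊕-cong ≋-refl (≋-sym (D.coeff-negL (mapL θ R') n)))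
      (≋-trans (≋-sym (D.coeff-++ (mapL θ R) (D.negL (mapL θ R')) n))
      (≋-trans (≋-reflexive (cong (λ z → D.coeffL z n)
                 (sym (trans (mapL-++ θ R (S.negL R')) (cong (mapL θ R ++_) (mapL-negL θ R'))))))
      (push-zero _ (R ++ S.negL R') n ℕₚ.≤-refl λ m e →
        ≋-trans (S.coeff-++ R (S.negL R') m)
        (≋-trans (⊕-cong ≋-refl (S.coeff-negL R' m)) (p⊝q≋0 (h m e)))))))

  coeff-mapL-ext : ∀ {θ θ'} → (∀ m → θ m D.≈ θ' m) → ∀ R n → D.coeffL (mapL θ R) n ≋ D.coeffL (mapL θ' R) n
  coeff-mapL-ext h [] n = ≋-refl
  coeff-mapL-ext {θ} {θ'} h ((c , μ) ∷ R) n =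
    addP-cong (if-cong (D.≈ᵇ-iff {θ μ} {n} {θ' μ} {n} (D.≈-trans (D.≈-sym (h μ))) (D.≈-trans (h μ))) (≋-refl {c}))
              (coeff-mapL-ext h R n)

  coeff-mapL-actL : ∀ φ w R n → D.coeffL (mapL (hom φ) (S.actL w R)) n ≋ D.act (hom φ w) (D.coeffL (mapL (hom φ) R)) n
  coeff-mapL-actL φ w R n
    rewrite mapL-++ (hom φ) R (S.negL (S.shiftL w R)) | mapL-negL (hom φ) (S.shiftL w R) =
    ≋-trans (D.coeff-++ (mapL (hom φ) R) _ n)
            (⊕-cong ≋-refl (≋-trans (D.coeff-negL (mapL (hom φ) (S.shiftL w R)) n) (⊖-cong (coeff-mapL-shiftL φ w R n))))

  coeff-mapL-actsL : ∀ φ ws R n →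
    D.coeffL (mapL (hom φ) (S.actsL ws R)) n ≋ D.acts (map (hom φ) ws) (D.coeffL (mapL (hom φ) R)) n
  coeff-mapL-actsL φ [] R n = ≋-refl
  coeff-mapL-actsL φ (w ∷ ws) R n =
    ≋-trans (coeff-mapL-actL φ w (S.actsL ws R) n) (D.act-cong (hom φ w) (coeff-mapL-actsL φ ws R) n)

  coeff-mapL-mulL : ∀ φ A R n →
    D.coeffL (mapL (hom φ) (S.mulL A R)) n ≋ D.mulF (mapL (hom φ) A) (D.coeffL (mapL (hom φ) R)) n
  coeff-mapL-mulL φ [] R n = ≋-refl
  coeff-mapL-mulL φ ((c , μ) ∷ A) R n
    rewrite mapL-++ (hom φ) (S.scaleL c (S.shiftL μ R)) (S.mulL A R) | mapL-scaleL (hom φ) c (S.shiftL μ R) =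
    ≋-trans (D.coeff-++ (D.scaleL c (mapL (hom φ) (S.shiftL μ R))) _ n)
      (⊕-cong (≋-trans (D.coeff-scaleL c (mapL (hom φ) (S.shiftL μ R)) n) (⊗-cong ≋-refl (coeff-mapL-shiftL φ μ R n)))
              (coeff-mapL-mulL φ A R n))

module Compose {K K' K'' : Set} (_≟K_ : DecidableEquality K) (_≟K'_ : DecidableEquality K') (_≟K''_ : DecidableEquality K'') where
  private
    module S = Exponents _≟K_
    module M = Exponents _≟K'_
    module D = Exponents _≟K''_
    module H₁ = Hom _≟K_ _≟K'_
    module H₂ = Hom _≟K'_ _≟K''_
    module H₃ = Hom _≟K_ _≟K''_
    module L = Linear _≟K_
    module L' = Linear _≟K'_

  lin-scaleM : ∀ a e m → L'.lin a (H₁.scaleM e m) ≡ e ℤ.* L'.lin a m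
  lin-scaleM a e [] = sym (ℤₚ.*-zeroʳ e)
  lin-scaleM a e ((k , d) ∷ m) = trans (cong (λ z → e ℤ.* d ℤ.* a k ℤ.+ z) (lin-scaleM a e m)) (lem e d (a k) (L'.lin a m))
    where
    lem : ∀ e d x y → e ℤ.* d ℤ.* x ℤ.+ e ℤ.* y ≡ e ℤ.* (d ℤ.* x ℤ.+ y)
    lem = solve-∀

  lin-hom : ∀ a φ m → L'.lin a (H₁.hom φ m) ≡ L.lin (λ k → L'.lin a (φ k)) m
  lin-hom a φ [] = refl
  lin-hom a φ ((k , e) ∷ m) =
    trans (L'.lin-++ a (H₁.scaleM e (φ k)) _) (cong₂ ℤ._+_ (lin-scaleM a e (φ k)) (lin-hom a φ m))

  hom-∘ : ∀ ψ φ m → H₂.hom ψ (H₁.hom φ m) D.≈ H₃.hom (H₂.hom ψ ∘ φ) m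
  hom-∘ ψ φ m = D.mk≈ λ k'' →
    trans (H₂.expo-hom ψ (H₁.hom φ m) k'')
    (trans (lin-hom _ φ m)
    (trans (L.lin-ext (λ k → sym (H₂.expo-hom ψ (φ k) k'')) m)
           (sym (H₃.expo-hom (H₂.hom ψ ∘ φ) m k''))))

  mapL-∘ : ∀ θ' θ R → H₂.mapL θ' (H₁.mapL θ R) ≡ H₃.mapL (θ' ∘ θ) R
  mapL-∘ θ' θ [] = refl
  mapL-∘ θ' θ (x ∷ R) = cong (_ ∷_) (mapL-∘ θ' θ R)

-- The specialization as a linear map of exponents, tame and null series

open Exponents _≟V_ public
module X = Exponents ℤ._≟_
module HT = Hom _≟V_ _≟V_
module HF = Hom _≟V_ ℤ._≟_
module HX = Hom ℤ._≟_ ℤ._≟_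
module CTT = Compose _≟V_ _≟V_ _≟V_
module CTF = Compose _≟V_ _≟V_ ℤ._≟_
module CFX = Compose _≟V_ ℤ._≟_ ℤ._≟_

φF : V → XMono
φF (i , j) = (i , ℤ.- + 1) ∷ (i ℤ.+ + 1 , + 1) ∷ []

Fh : Mono → XMono
Fh = HF.hom φF

FL : LPoly → XLPoly
FL = HF.mapL Fh

Fmono≈Fh : ∀ m → Fmono m X.≈ Fh m
Fmono≈Fh [] = X.≈-refl
Fmono≈Fh (((i , j) , e) ∷ m) = X.mk≈ λ k →
  cong₂ (λ x y → (if ⌊ i ℤ.≟ k ⌋ then x else + 0) ℤ.+ y) (lem e)
    (cong₂ (λ x y → (if ⌊ i ℤ.+ + 1 ℤ.≟ k ⌋ then x else + 0) ℤ.+ y) (sym (ℤₚ.*-identityʳ e)) (X.on (Fmono≈Fh m) k))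
  where
  lem : ∀ e → ℤ.- e ≡ e ℤ.* (ℤ.- + 1)
  lem = solve-∀

coeff-F : ∀ R n → X.coeffL (F R) n ≋ X.coeffL (FL R) n
coeff-F R n = ≋-trans (≋-reflexive (cong (λ z → X.coeffL z n) (eq R))) (HF.coeff-mapL-ext Fmono≈Fh R n)
  where
  eq : ∀ R → F R ≡ HF.mapL Fmono R
  eq [] = refl
  eq (x ∷ R) = cong (_ ∷_) (eq R)

NZ : Mono → Set
NZ w = X.Nonzero (Fh w)

ZeroX : XLPoly → Set
ZeroX R = ∀ n → X.coeffL R n ≋ []

-- A tame function becomes finitely supported after multiplication by
-- finitely many 1 - e^w with F(e^w) ≠ 1; it then has a well-defined
-- specialization, and it is null when that specialization vanishes.

record Tame (f : Mono → Poly) : Set where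
  field
    ws : List Mono
    nz : All NZ ws
    sum : LPoly
    eq : ∀ m → coeffL sum m ≋ acts ws f m

record Null (f : Mono → Poly) : Set where
  field
    tame : Tame f
    vanishes : ZeroX (FL (Tame.sum tame))

Null-cong : ∀ {f g} → (∀ m → f m ≋ g m) → Null f → Null g
Null-cong h N = record
  { tame = record { ws = ws ; nz = nz ; sum = sum ; eq = λ m → ≋-trans (eq m) (acts-cong ws h m) }
  ; vanishes = Null.vanishes N }
  where open Tame (Null.tame N)

-- Sums over the fibres of a linear map

module Push (φ : V → Mono) where

  π : Mono → Mono
  π = HT.hom φ

  -- `f` may have infinite support while every single fibre of `π` carries finitely many nonzero
  -- values. `terms` has to agree with `f` on the fibre through `m` only, and may change from fibre
  -- to fibre.
  record FibreSum (f f̂ : Mono → Poly) (m : Mono) : Set where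
    field
      terms : LPoly
      fibre : ∀ m' → π m' ≈ π m → f m' ≋ coeffL terms m'
      total : f̂ m ≋ coeffL (HT.mapL π terms) (π m)

  IsPush : (f f̂ : Mono → Poly) → Set
  IsPush f f̂ = ∀ m → FibreSum f f̂ m

  -- Translation by `w` carries the fibre through `m -ᴹ w` onto the fibre through `m`, so the terms
  -- of the one, shifted, are subtracted from those of the other.
  push-act : ∀ w {f f̂} → IsPush f f̂ → IsPush (act w f) (act w f̂)
  push-act w {f} {f̂} P m = record
    { terms = L₁ ++ negL (shiftL w L₂)
    ; fibre = λ m' e →
        ≋-trans (⊝-cong (FibreSum.fibre (P m) m' e) (FibreSum.fibre (P (m -ᴹ w)) (m' -ᴹ w) (πminus m' e)))
        (≋-sym (≋-trans (coeff-++ L₁ (negL (shiftL w L₂)) m')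
          (⊕-cong ≋-refl (≋-trans (coeff-negL (shiftL w L₂) m') (⊖-cong (coeff-shiftL w L₂ m'))))))
    ; total =
        ≋-trans (⊝-cong (FibreSum.total (P m)) (FibreSum.total (P (m -ᴹ w))))
        (≋-sym (≋-trans (≋-reflexive (cong (λ z → coeffL z (π m))
                  (trans (HT.mapL-++ π L₁ (negL (shiftL w L₂))) (cong (HT.mapL π L₁ ++_) (HT.mapL-negL π (shiftL w L₂))))))
               (≋-trans (coeff-++ (HT.mapL π L₁) (negL (HT.mapL π (shiftL w L₂))) (π m))
               (⊕-cong ≋-refl (≋-trans (coeff-negL (HT.mapL π (shiftL w L₂)) (π m))
                 (⊖-cong (≋-trans (HT.coeff-mapL-shiftL φ w L₂ (π m))
                                  (coeff-resp (HT.mapL π L₂) (≈-sym (HT.hom-minus φ m w))))))))))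
    }
    where
    L₁ = FibreSum.terms (P m)
    L₂ = FibreSum.terms (P (m -ᴹ w))
    πminus : ∀ m' → π m' ≈ π m → π (m' -ᴹ w) ≈ π (m -ᴹ w)
    πminus m' e = ≈-trans (HT.hom-minus φ m' w) (≈-trans (minus-cong e ≈-refl) (≈-sym (HT.hom-minus φ m w)))

  push-acts : ∀ ws {f f̂} → IsPush f f̂ → IsPush (acts ws f) (acts ws f̂)
  push-acts [] P = P
  push-acts (w ∷ ws) P = push-act w (push-acts ws P)

  -- The coefficient of the image at `π m` sees only the fibre through `m`, and there `R` and the
  -- local `terms` have the same coefficients.
  push-sum : ∀ {f f̂} → IsPush f f̂ → ∀ R → (∀ m → coeffL R m ≋ f m) → ∀ m → f̂ m ≋ coeffL (HT.mapL π R) (π m)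
  push-sum P R h m =
    ≋-trans (FibreSum.total (P m))
      (HT.push-eq π (HT.hom-cong φ) (FibreSum.terms (P m)) R (π m)
        λ m' e → ≋-sym (≋-trans (h m') (FibreSum.fibre (P m) m' e)))

  Invariant : (Mono → Poly) → Set
  Invariant h = ∀ m m' → π m ≈ π m' → h m ≋ h m'

  push-invariant : ∀ {f f̂} → IsPush f f̂ → Invariant f̂
  push-invariant P m m' e =
    ≋-trans (FibreSum.total (P m))
    (≋-trans (HT.push-eq π (HT.hom-cong φ) (FibreSum.terms (P m)) (FibreSum.terms (P m')) (π m)
               λ m'' e' → ≋-trans (≋-sym (FibreSum.fibre (P m) m'' e')) (FibreSum.fibre (P m') m'' (≈-trans e' e)))
    (≋-trans (coeff-resp (HT.mapL π (FibreSum.terms (P m'))) e) (≋-sym (FibreSum.total (P m')))))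

  act-invariant : ∀ w {h} → Invariant h → Invariant (act w h)
  act-invariant w I m m' e = ⊝-cong (I m m' e)
    (I (m -ᴹ w) (m' -ᴹ w) (≈-trans (HT.hom-minus φ m w) (≈-trans (minus-cong e ≈-refl) (≈-sym (HT.hom-minus φ m' w)))))

  acts-invariant : ∀ ws {h} → Invariant h → Invariant (acts ws h)
  acts-invariant [] I = I
  acts-invariant (w ∷ ws) I = act-invariant w (acts-invariant ws I)

  invariant-resp : ∀ {h} → Invariant h → Resp h
  invariant-resp I {m} {m'} e = I m m' (HT.hom-cong φ e)

-- If the fibre sums of f and g agree up to a Laurent factor and a linear
-- map τ that acts on x-monomials, then f is null as soon as g is.

module Transfer
  (φπ φτ : V → Mono) (φσ : ℤ → XMono)
  (πτ : ∀ m → HT.hom φπ (HT.hom φτ m) ≈ HT.hom φτ m)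
  (τπ : ∀ m → HT.hom φτ (HT.hom φπ m) ≈ HT.hom φτ m)
  (ττ : ∀ m → HT.hom φτ (HT.hom φτ m) ≈ HT.hom φπ m)
  (Fπ : ∀ m → Fh (HT.hom φπ m) X.≈ Fh m)
  (Fτ : ∀ m → Fh (HT.hom φτ m) X.≈ HX.hom φσ (Fh m))
  where

  open Push φπ

  τ : Mono → Mono
  τ = HT.hom φτ

  ππ : ∀ m → π (π m) ≈ π m
  ππ m = ≈-trans (HT.hom-cong φπ (≈-sym (ττ m))) (≈-trans (πτ (τ m)) (ττ m))

  -- `τ` is its own inverse up to `π`, which `F` does not see. If `F` trivialized `e^(τ w)`, then
  -- applying `σ` would trivialize the image of `τ (τ w)`, which is the image of `w`.
  NZ-τ : ∀ w → NZ w → NZ (τ w)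
  NZ-τ w (k , ne) with X._≈?_ (Fh (τ w)) []
  ... | no n = find (Fh (τ w)) n
    where
    find : ∀ m → ¬ (m X.≈ []) → X.Nonzero m
    find m n with Data.List.Relation.Unary.Any.any? (λ k → Relation.Nullary.Decidable.¬? (X.expo m k ℤ.≟ + 0)) (X.keys m)
    ... | yes a = let (k , _ , p) = Data.List.Membership.Propositional.find a in k , p
    ... | no na = ⊥-elim (n (X.mk≈ λ k → zero-at k))
      where
      zero-at : ∀ k → X.expo m k ≡ + 0
      zero-at k with X._∈?_ k (X.keys m)
      ... | no ni = X.expo-∉ m k ni
      ... | yes i with X.expo m k ℤ.≟ + 0
      ... | yes z = z
      ... | no nz = ⊥-elim (na (Data.List.Membership.Propositional.lose i nz))
  ... | yes z = ⊥-elim (ne (X.on all-zero k))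
    where
    all-zero : Fh w X.≈ []
    all-zero = X.≈-trans (X.≈-sym (Fπ w))
      (X.≈-trans (HF.hom-cong φF (≈-sym (ττ w))) (X.≈-trans (Fτ (τ w)) (HX.hom-cong φσ z)))

  act-∘τ : ∀ v {h} → Invariant h → ∀ m → act (τ v) (h ∘ τ) m ≋ act v h (τ m)
  act-∘τ v I m = ⊝-cong ≋-refl
    (I (τ (m -ᴹ τ v)) (τ m -ᴹ v) (≈-trans (HT.hom-cong φπ (≈-trans (HT.hom-minus φτ m (τ v)) (minus-cong ≈-refl (ττ v))))
       (≈-trans (HT.hom-minus φπ (τ m) (π v))
       (≈-trans (minus-cong ≈-refl (ππ v)) (≈-sym (HT.hom-minus φπ (τ m) v))))))

  acts-∘τ : ∀ vs {h} → Invariant h → ∀ m → acts (map τ vs) (h ∘ τ) m ≋ acts vs h (τ m)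
  acts-∘τ [] I m = ≋-refl
  acts-∘τ (v ∷ vs) I m =
    ≋-trans (act-cong (τ v) (acts-∘τ vs I) m) (act-∘τ v (acts-invariant vs I) m)

  -- `τ` is an involution of the image of `π`: a monomial lands on `π m` after `τ` exactly if it
  -- lands on `π (τ m)` without it.
  coeff-πτ : ∀ R m → coeffL (HT.mapL π (HT.mapL τ R)) (π m) ≋ coeffL (HT.mapL π R) (π (τ m))
  coeff-πτ [] m = ≋-refl
  coeff-πτ ((c , r) ∷ R) m =
    addP-cong (if-cong (≈ᵇ-iff {π (τ r)} {π m} {π r} {π (τ m)}
      (λ e → ≈-trans (≈-sym (ττ r)) (≈-trans (HT.hom-cong φτ (≈-trans (≈-sym (πτ r)) e)) (≈-trans (τπ m) (≈-sym (πτ m)))))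
      (λ e → ≈-trans (πτ r) (≈-trans (≈-sym (τπ r))
        (≈-trans (HT.hom-cong φτ (≈-trans e (πτ m))) (ττ m))))) (≋-refl {c}))
      (coeff-πτ R m)

  FL-π : ∀ R n → X.coeffL (FL (HT.mapL π R)) n ≋ X.coeffL (FL R) n
  FL-π R n = ≋-trans (≋-reflexive (cong (λ z → X.coeffL z n) (CTF.mapL-∘ Fh π R))) (HF.coeff-mapL-ext Fπ R n)

  FL-τ : ∀ R → ZeroX (FL R) → ZeroX (FL (HT.mapL τ R))
  FL-τ R z n = ≋-trans (≋-reflexive (cong (λ z → X.coeffL z n) (CTF.mapL-∘ Fh τ R)))
    (≋-trans (HF.coeff-mapL-ext Fτ R n)
    (≋-trans (≋-reflexive (cong (λ z → X.coeffL z n) (sym (CFX.mapL-∘ (HX.hom φσ) Fh R))))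
             (HX.push-zero (HX.hom φσ) (HX.hom-cong φσ) _ (FL R) n ℕₚ.≤-refl λ m _ → z m)))

  -- `F` factors through `π`, and the images under `π` have no coefficients off the image of `π`, so
  -- comparing them at the points `π m` suffices.
  same-image : ∀ R₁ R₂ → (∀ m → coeffL (HT.mapL π R₁) (π m) ≋ coeffL (HT.mapL π R₂) (π m)) →
    ∀ n → X.coeffL (FL R₁) n ≋ X.coeffL (FL R₂) n
  same-image R₁ R₂ h n =
    ≋-trans (≋-sym (FL-π R₁ n))
    (≋-trans (HF.push-eq Fh (HF.hom-cong φF) (HT.mapL π R₁) (HT.mapL π R₂) n (λ m _ → go m)) (FL-π R₂ n))
    where
    off : ∀ R m → ¬ (π m ≈ m) → coeffL (HT.mapL π R) m ≋ []
    off [] m ne = ≋-refl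
    off ((c , r) ∷ R) m ne = ≋-trans
      (coeff-miss c (π r) (HT.mapL π R) m
        (λ e → ne (≈-trans (HT.hom-cong φπ (≈-sym e)) (≈-trans (ππ r) e)))) (off R m ne)
    go : ∀ m → coeffL (HT.mapL π R₁) m ≋ coeffL (HT.mapL π R₂) m
    go m with π m ≈? m
    ... | yes e = ≋-trans (coeff-resp (HT.mapL π R₁) (≈-sym e)) (≋-trans (h m) (coeff-resp (HT.mapL π R₂) e))
    ... | no ne = ≋-trans (off R₁ m ne) (≋-sym (off R₂ m ne))

  -- Clear all denominators. The polynomial of `f`, times the factors from `us`, from `us'` and from
  -- `g`, and the reflected polynomial of `g`, times `A` and the factors from `f`, have the same
  -- image under `π`, hence under `F`. For the second this image is zero, because `F` turns `τ` into
  -- `σ` and `g` is null. The factors on the first side stay cancellable after `F`, so the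
  -- polynomial of `f` specializes to zero as well.
  transfer : ∀ {f g f̂ ĝ : Mono → Poly} → Resp f → Tame f → Null g →
    ∀ us → All NZ us → IsPush (acts us f) f̂ → IsPush g ĝ →
    ∀ us' A → All NZ us' → (∀ m → acts us' f̂ m ≋ mulF A (ĝ ∘ τ) m) → Null f
  transfer {f} {g} {f̂} {ĝ} rf Tf Ng us nzu Pf Pg us' A nzu' flip = record
    { tame = Tf
    ; vanishes = X.acts-injective (map Fh vs) (FL Rf) (nzmap vs nzvs) λ n →
        ≋-trans (≋-sym (HF.coeff-mapL-actsL φF vs Rf n)) (≋-trans (same-image R₁ R₂ same n) (zero₂ n)) }
    where
    vf = Tame.ws Tf
    Rf = Tame.sum Tf
    vg = Tame.ws (Null.tame Ng)
    Rg = Tame.sum (Null.tame Ng)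
    τg = map τ vg
    -- The factors of `g` enter reflected, because they have to act on `ĝ ∘ τ` instead of `ĝ`.
    vs = us' ++ τg ++ us
    R₁ = actsL vs Rf
    R₂ = actsL vf (mulL A (HT.mapL τ Rg))
    nzmap : ∀ vs → All NZ vs → All X.Nonzero (map Fh vs)
    nzmap [] [] = []
    nzmap (v ∷ vs) (p ∷ ps) = p ∷ nzmap vs ps
    nzτ : ∀ vs → All NZ vs → All NZ (map τ vs)
    nzτ [] [] = []
    nzτ (v ∷ vs) (p ∷ ps) = NZ-τ v p ∷ nzτ vs ps
    app : ∀ {vs vs'} → All NZ vs → All NZ vs' → All NZ (vs ++ vs')
    app [] q = q
    app (p ∷ ps) q = p ∷ app ps q
    nzvs : All NZ vs
    nzvs = app nzu' (app (nzτ vg (Tame.nz (Null.tame Ng))) nzu)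
    rf̂ : Resp f̂
    rf̂ = invariant-resp (push-invariant Pf)
    If : Invariant ĝ
    If = push-invariant Pg
    rĝτ : Resp (ĝ ∘ τ)
    rĝτ {m} {m'} e = If (τ m) (τ m') (HT.hom-cong φπ (HT.hom-cong φτ e))
    zero₂ : ZeroX (FL R₂)
    zero₂ n = ≋-trans (HF.coeff-mapL-actsL φF vf (mulL A (HT.mapL τ Rg)) n)
      (X.acts-zero (map Fh vf) (λ n → ≋-trans (HF.coeff-mapL-mulL φF A (HT.mapL τ Rg) n)
        (X.mulF-zero (HF.mapL Fh A) (FL-τ Rg (Null.vanishes Ng)) n)) n)
    P₁ : IsPush (acts us' (acts τg (acts vf (acts us f)))) (acts us' (acts τg (acts vf f̂)))
    P₁ = push-acts us' (push-acts τg (push-acts vf Pf))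
    R₁-eq : ∀ m → coeffL R₁ m ≋ acts us' (acts τg (acts vf (acts us f))) m
    R₁-eq m = ≋-trans (coeff-actsL vs Rf m)
      (≋-trans (≋-reflexive (acts-++ us' (τg ++ us) (coeffL Rf) m))
      (acts-cong us' (λ m → ≋-trans (≋-reflexive (acts-++ τg us (coeffL Rf) m))
        (acts-cong τg (λ m → ≋-trans (acts-cong us (Tame.eq Tf) m) (acts-comm us vf rf m)) m)) m))
    g-eq : ∀ m → acts vg ĝ m ≋ coeffL (HT.mapL π Rg) (π m)
    g-eq = push-sum (push-acts vg Pg) Rg (Tame.eq (Null.tame Ng))
    lhs : ∀ m → acts us' (acts τg (acts vf f̂)) m ≋ acts vf (mulF A (λ m → coeffL (HT.mapL π (HT.mapL τ Rg)) (π m))) m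
    lhs m =
      ≋-trans (acts-cong us' (acts-comm τg vf rf̂) m)
      (≋-trans (acts-comm us' vf (acts-resp τg rf̂) m)
      (acts-cong vf (λ m →
        ≋-trans (acts-comm us' τg rf̂ m)
        (≋-trans (acts-cong τg flip m)
        (≋-trans (mulF-acts A τg rĝτ m)
        (mulF-cong A (λ m → ≋-trans (acts-∘τ vg If m) (≋-trans (g-eq (τ m)) (≋-sym (coeff-πτ Rg m)))) m)))) m))
    rhs : ∀ m → coeffL (HT.mapL π R₂) (π m) ≋ acts vf (mulF A (λ m → coeffL (HT.mapL π (HT.mapL τ Rg)) (π m))) m
    rhs m = ≋-trans (HT.coeff-mapL-actsL φπ vf (mulL A Q) (π m))
      (≋-trans (acts-cong (map π vf) (HT.coeff-mapL-mulL φπ A Q) (π m))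
      (≋-trans (acts-π vf _ (λ e → mulF-resp (HT.mapL π A) (coeff-resp (HT.mapL π Q)) e) m)
      (acts-cong vf (mulF-π A (coeff-resp (HT.mapL π Q))) m)))
      where
      Q = HT.mapL τ Rg
      mulF-resp : ∀ A {h} → Resp h → Resp (mulF A h)
      mulF-resp [] r e = ≋-refl
      mulF-resp ((c , μ) ∷ A) r e = ⊕-cong (⊗-cong ≋-refl (r (minus-cong e ≈-refl))) (mulF-resp A r e)
      acts-π : ∀ vs h → Resp h → ∀ m → acts (map π vs) h (π m) ≋ acts vs (h ∘ π) m
      acts-π [] h r m = ≋-refl
      acts-π (v ∷ vs) h r m = ⊝-cong (acts-π vs h r m)
        (≋-trans (acts-resp (map π vs) r (≈-sym (HT.hom-minus φπ m v))) (acts-π vs h r (m -ᴹ v)))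
      mulF-π : ∀ A {h} → Resp h → ∀ m → mulF (HT.mapL π A) h (π m) ≋ mulF A (h ∘ π) m
      mulF-π [] r m = ≋-refl
      mulF-π ((c , μ) ∷ A) r m = ⊕-cong (⊗-cong ≋-refl (r (≈-sym (HT.hom-minus φπ m μ)))) (mulF-π A r m)
    same : ∀ m → coeffL (HT.mapL π R₁) (π m) ≋ coeffL (HT.mapL π R₂) (π m)
    same m = ≋-trans (≋-sym (push-sum P₁ R₁ R₁-eq m)) (≋-trans (lhs m) (≋-sym (rhs m)))

-- The reflection of a single row

module RowReflection (k c₀ : ℤ) where

  v₀ : V
  v₀ = (k , c₀)

  data Kind (i : ℤ) : Set where
    on-row : i ≡ k → Kind i
    adjacent : (i ==ℤ k) ≡ false → ((i ==ℤ k ℤ.- + 1) ∨ (i ==ℤ k ℤ.+ + 1)) ≡ true → Kind i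
    distant : (i ==ℤ k) ≡ false → ((i ==ℤ k ℤ.- + 1) ∨ (i ==ℤ k ℤ.+ + 1)) ≡ false → Kind i

  kind : ∀ i → Kind i
  kind i with bool-case (i ==ℤ k) | bool-case ((i ==ℤ k ℤ.- + 1) ∨ (i ==ℤ k ℤ.+ + 1))
  ... | inj₁ e | _ = on-row (==ℤ-sound e)
  ... | inj₂ e | inj₁ f = adjacent e f
  ... | inj₂ e | inj₂ f = distant e f

  -- `π` keeps of row `k` only its sum, stored at `v₀`. `τ` replaces that sum by the total of the
  -- two adjacent rows minus it, which is why a vertex of an adjacent row brings along an extra
  -- `v₀`.
  φπ φτ : V → Mono
  φπ v = if row v ==ℤ k then (v₀ , + 1) ∷ [] else (v , + 1) ∷ []
  φτ v = if row v ==ℤ k then (v₀ , ℤ.- + 1) ∷ []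
         else (if (row v ==ℤ k ℤ.- + 1) ∨ (row v ==ℤ k ℤ.+ + 1) then (v , + 1) ∷ (v₀ , + 1) ∷ [] else (v , + 1) ∷ [])

  -- on x-monomials the reflection of row k exchanges x_k and x_{k+1}
  φσ : ℤ → XMono
  φσ i = if i ==ℤ k then (k ℤ.+ + 1 , + 1) ∷ [] else (if i ==ℤ k ℤ.+ + 1 then (k , + 1) ∷ [] else (i , + 1) ∷ [])

  πτ-gen : ∀ v → HT.hom φπ (φτ v) ≈ φτ v
  πτ-gen (i , j) with kind i
  ... | on-row refl rewrite ==ℤ-refl k | ==ℤ-refl k = ≈-refl
  ... | adjacent e f rewrite e | f | e | ==ℤ-refl k = ≈-refl
  ... | distant e f rewrite e | f | e = ≈-refl

  τπ-gen : ∀ v → HT.hom φτ (φπ v) ≈ φτ v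
  τπ-gen (i , j) with kind i
  ... | on-row refl rewrite ==ℤ-refl k | ==ℤ-refl k = ≈-refl
  ... | adjacent e f rewrite e | e | f = ≈-refl
  ... | distant e f rewrite e | e | f = ≈-refl

  ττ-gen : ∀ v → HT.hom φτ (φτ v) ≈ φπ v
  ττ-gen (i , j) with kind i
  ... | on-row refl rewrite ==ℤ-refl k | ==ℤ-refl k = ≈-refl
  ... | adjacent e f rewrite e | f | e | f | ==ℤ-refl k = ∷-cong _ (∷-cancel v₀ (+ 1) [])
  ... | distant e f rewrite e | f | e | f = ≈-refl

  Fπ-gen : ∀ v → Fh (φπ v) X.≈ φF v
  Fπ-gen (i , j) with kind i
  ... | on-row refl rewrite ==ℤ-refl k = X.≈-refl
  ... | adjacent e f rewrite e = X.≈-refl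
  ... | distant e f rewrite e = X.≈-refl

  private
    k≢k+1 : (k ℤ.+ + 1 ==ℤ k) ≡ false
    k≢k+1 = ==ℤ-false λ e → ℤₚ.<-irrefl (sym e) (ℤₚ.≤-<-trans (ℤₚ.≤-reflexive (sym (ℤₚ.+-identityʳ k))) (ℤₚ.+-monoʳ-< k (ℤ.+<+ (ℕ.s≤s ℕ.z≤n))))
    k+2≢k : (k ℤ.+ + 1 ℤ.+ + 1 ==ℤ k) ≡ false
    k+2≢k = ==ℤ-false λ e → ℤₚ.<-irrefl (sym e) (subst (k ℤ.<_) (sym (ℤₚ.+-assoc k (+ 1) (+ 1))) (ℤₚ.≤-<-trans (ℤₚ.≤-reflexive (sym (ℤₚ.+-identityʳ k))) (ℤₚ.+-monoʳ-< k (ℤ.+<+ (ℕ.s≤s ℕ.z≤n)))))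
    succ-≢ : ∀ {i l} → (i ==ℤ l) ≡ false → (i ℤ.+ + 1 ==ℤ l ℤ.+ + 1) ≡ false
    succ-≢ {i} {l} e = ==ℤ-false λ p → true≢false (==ℤ-complete (trans (lem i) (trans (cong (ℤ._- + 1) p) (sym (lem l))))) e
      where
      lem : ∀ i → i ≡ i ℤ.+ + 1 ℤ.- + 1
      lem = solve-∀
    pred-≢ : ∀ {i l} → (i ==ℤ l ℤ.- + 1) ≡ false → (i ℤ.+ + 1 ==ℤ l) ≡ false
    pred-≢ {i} {l} e = ==ℤ-false λ p → true≢false (==ℤ-complete (trans (lem i) (cong (ℤ._- + 1) p))) e
      where
      lem : ∀ i → i ≡ i ℤ.+ + 1 ℤ.- + 1
      lem = solve-∀
    k-1+1 : k ℤ.- + 1 ℤ.+ + 1 ≡ k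
    k-1+1 = lem k
      where
      lem : ∀ k → k ℤ.- + 1 ℤ.+ + 1 ≡ k
      lem = solve-∀
    k-1≢k+1 : (k ℤ.- + 1 ==ℤ k ℤ.+ + 1) ≡ false
    k-1≢k+1 = ==ℤ-false λ p → true≢false (==ℤ-complete (trans (cong (ℤ._+ + 1) (sym p)) k-1+1)) k+2≢k
    ∨-false : ∀ {a b} → a ∨ b ≡ false → a ≡ false × b ≡ false
    ∨-false {false} {false} e = refl , refl

  Fτ-gen : ∀ v → Fh (φτ v) X.≈ HX.hom φσ (φF v)
  Fτ-gen (i , j) with kind i
  ... | on-row refl rewrite ==ℤ-refl k | k≢k+1 | ==ℤ-refl (k ℤ.+ + 1) = X.∷-swap _ _ []
  ... | distant e f rewrite e | f | proj₂ (∨-false {i ==ℤ k ℤ.- + 1} f) | pred-≢ {i} {k} (proj₁ (∨-false {i ==ℤ k ℤ.- + 1} f)) | succ-≢ e = X.≈-refl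
  ... | adjacent e f with i ℤ.≟ k ℤ.- + 1
  -- In row `k - 1` the two powers of `x_k` in the image of `v + v₀` cancel; in row `k + 1`, the
  -- last case, those of `x_(k+1)` do.
  ... | yes refl rewrite e | k-1+1 | ==ℤ-refl k | k-1≢k+1 = X.∷-cong _ (X.∷-cancel k (+ 1) _)
  ... | no ne with i ℤ.≟ k ℤ.+ + 1
  ... | no ne' = ⊥-elim (true≢false f refl)
  ... | yes refl rewrite e | k≢k+1 | k+2≢k | succ-≢ {k ℤ.+ + 1} {k} k≢k+1 =
    X.≈-trans (X.∷-cong _ (X.∷-cong _ (X.∷-swap _ _ [])))
    (X.≈-trans (X.∷-cong _ (X.∷-swap _ _ _))
    (X.≈-trans (X.∷-cancel (k ℤ.+ + 1) (ℤ.- + 1) _) (X.∷-swap _ _ [])))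

  private
    id-ext : ∀ {φ : V → Mono} ψ φ' → (∀ v → HT.hom ψ (φ v) ≈ φ' v) → ∀ m → HT.hom ψ (HT.hom φ m) ≈ HT.hom φ' m
    id-ext {φ} ψ φ' h m = ≈-trans (CTT.hom-∘ ψ φ m) (HT.hom-ext h m)

  open Transfer φπ φτ φσ (id-ext φπ φτ πτ-gen) (id-ext φτ φτ τπ-gen) (id-ext φτ φπ ττ-gen)
    (λ m → X.≈-trans (CTF.hom-∘ φF φπ m) (HF.hom-ext Fπ-gen m))
    (λ m → X.≈-trans (CTF.hom-∘ φF φτ m) (X.≈-trans (HF.hom-ext Fτ-gen m) (X.≈-sym (CFX.hom-∘ φσ φF m))))
    public
  open Push φπ public

-- Finite sums over boxes and the Laurent polynomials behind them

ΣP : {A : Set} → List A → (A → Poly) → Poly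
ΣP [] ψ = []
ΣP (c ∷ cs) ψ = ψ c ⊕ ΣP cs ψ

ΣP-cong : ∀ {A : Set} (cs : List A) {ψ ψ'} → (∀ c → c ∈ cs → ψ c ≋ ψ' c) → ΣP cs ψ ≋ ΣP cs ψ'
ΣP-cong [] h = ≋-refl
ΣP-cong (c ∷ cs) h = ⊕-cong (h c (here refl)) (ΣP-cong cs λ c i → h c (there i))

ΣP-zero : ∀ {A : Set} (cs : List A) {ψ} → (∀ c → c ∈ cs → ψ c ≋ []) → ΣP cs ψ ≋ []
ΣP-zero [] h = ≋-refl
ΣP-zero (c ∷ cs) h = ≋-trans (⊕-cong (h c (here refl)) (ΣP-zero cs λ c i → h c (there i))) (⊕-identityˡ [])

box : List ℤ → ℕ → (List ℤ → Poly) → Poly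
box cs zero φ = φ []
box cs (suc p) φ = ΣP cs λ c → box cs p λ xs → φ (c ∷ xs)

box-cong : ∀ cs p {φ φ'} → (∀ xs → length xs ≡ p → All (_∈ cs) xs → φ xs ≋ φ' xs) → box cs p φ ≋ box cs p φ'
box-cong cs zero h = h [] refl []
box-cong cs (suc p) h = ΣP-cong cs λ c i → box-cong cs p λ xs e a → h (c ∷ xs) (cong suc e) (i ∷ a)

box-zero : ∀ cs p {φ} → (∀ xs → length xs ≡ p → All (_∈ cs) xs → φ xs ≋ []) → box cs p φ ≋ []
box-zero cs zero h = h [] refl []
box-zero cs (suc p) h = ΣP-zero cs λ c i → box-zero cs p λ xs e a → h (c ∷ xs) (cong suc e) (i ∷ a)

place : Mono → List V → List ℤ → Mono
place o (v ∷ vs) (x ∷ xs) = place ((v , x) ∷ o) vs xs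
place o _ _ = o

-- Cuts a Laurent polynomial out of a series: the arrays that agree with `o` off `vs` and have their
-- entries at `vs` in `cs`.
boxL : (Mono → Poly) → List ℤ → Mono → List V → LPoly
boxLs : (Mono → Poly) → List ℤ → Mono → V → List V → List ℤ → LPoly
boxL f cs o [] = (f o , o) ∷ []
boxL f cs o (v ∷ vs) = boxLs f cs o v vs cs
boxLs f cs o v vs [] = []
boxLs f cs o v vs (c ∷ cs') = boxL f cs ((v , c) ∷ o) vs ++ boxLs f cs o v vs cs'

expo-place-off : ∀ o vs xs v → v ∉ vs → expo (place o vs xs) v ≡ expo o v
expo-place-off o [] xs v ni = refl
expo-place-off o (w ∷ vs) [] v ni = refl
expo-place-off o (w ∷ vs) (x ∷ xs) v ni =
  trans (expo-place-off ((w , x) ∷ o) vs xs v (ni ∘ there)) (expo-there x o λ e → ni (here (sym e)))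

All∉ : ∀ {v : V} {vs} → All (v ≢_) vs → v ∉ vs
All∉ (p ∷ ps) (here refl) = p refl
All∉ (p ∷ ps) (there i) = All∉ ps i

map-expo-place : ∀ o vs xs → Unique vs → length xs ≡ length vs → (∀ {v} → v ∈ vs → expo o v ≡ + 0) →
  map (expo (place o vs xs)) vs ≡ xs
map-expo-place o [] [] u e z = refl
map-expo-place o (v ∷ vs) (x ∷ xs) (nv ∷ u) e z =
  cong₂ _∷_
    (trans (expo-place-off ((v , x) ∷ o) vs xs v (All∉ nv))
      (trans (expo-here v x o) (trans (cong (λ w → x ℤ.+ w) (z (here refl))) (ℤₚ.+-identityʳ x))))
    (map-expo-place ((v , x) ∷ o) vs xs u (ℕₚ.suc-injective e)
      λ {w} i → trans (expo-there {w} {v} x o (λ { refl → All∉ nv i })) (z (there i)))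

boxL-miss : ∀ f cs o vs m v → v ∉ vs → expo o v ≢ expo m v → coeffL (boxL f cs o vs) m ≋ []
boxL-miss f cs o [] m v ni ne = coeff-miss (f o) o [] m λ e → ne (on e v)
boxL-miss f cs o (w ∷ vs) m v ni ne = go cs
  where
  go : ∀ cs' → coeffL (boxLs f cs o w vs cs') m ≋ []
  go [] = ≋-refl
  go (c ∷ cs') = ≋-trans (coeff-++ (boxL f cs ((w , c) ∷ o) vs) _ m)
    (≋-trans (⊕-cong (boxL-miss f cs ((w , c) ∷ o) vs m v (ni ∘ there)
                (λ e → ne (trans (sym (expo-there c o λ q → ni (here (sym q)))) e))) (go cs'))
             (⊕-identityˡ []))

boxL-hit : ∀ {f} → Resp f → ∀ {cs} → Unique cs → ∀ o vs m → Unique vs →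
  (∀ {v} → v ∈ vs → expo o v ≡ + 0) → (∀ v → v ∉ vs → expo o v ≡ expo m v) →
  All (λ v → expo m v ∈ cs) vs ⊎ f m ≋ [] → coeffL (boxL f cs o vs) m ≋ f m
boxL-hit {f} r uc o [] m u z h b =
  ≋-trans (coeff-hit (f o) o [] m (mk≈ λ k → h k λ ())) (≋-trans (⊕-identityʳ _) (r (mk≈ λ k → h k λ ())))
boxL-hit {f} r {cs} uc o (v ∷ vs) m (nv ∷ u) z h b = proj₁ (go cs uc) (b-head b)
  where
  e = expo m v
  hd : ∀ c → expo ((v , c) ∷ o) v ≡ c
  hd c = trans (expo-here v c o) (trans (cong (λ w → c ℤ.+ w) (z (here refl))) (ℤₚ.+-identityʳ c))
  miss : ∀ c → c ≢ e → coeffL (boxL f cs ((v , c) ∷ o) vs) m ≋ []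
  miss c ne = boxL-miss f cs ((v , c) ∷ o) vs m v (All∉ nv) λ q → ne (trans (sym (hd c)) q)
  b-tail : All (λ v → expo m v ∈ cs) (v ∷ vs) ⊎ f m ≋ [] → All (λ v → expo m v ∈ cs) vs ⊎ f m ≋ []
  b-tail (inj₁ (_ ∷ a)) = inj₁ a
  b-tail (inj₂ q) = inj₂ q
  b-head : All (λ v → expo m v ∈ cs) (v ∷ vs) ⊎ f m ≋ [] → e ∈ cs ⊎ f m ≋ []
  b-head (inj₁ (i ∷ _)) = inj₁ i
  b-head (inj₂ q) = inj₂ q
  hit : coeffL (boxL f cs ((v , e) ∷ o) vs) m ≋ f m
  hit = boxL-hit r uc ((v , e) ∷ o) vs m u
    (λ {w} i → trans (expo-there {w} {v} e o (λ { refl → All∉ nv i })) (z (there i)))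
    agree
    (b-tail b)
    where
    agree : ∀ w → w ∉ vs → expo ((v , e) ∷ o) w ≡ expo m w
    agree w ni with v ≟V w
    ... | yes refl = trans (cong (λ w → e ℤ.+ w) (z (here refl))) (ℤₚ.+-identityʳ e)
    ... | no ne = trans (ℤₚ.+-identityˡ _) (h w λ { (here q) → ne (sym q) ; (there i) → ni i })
  split : ∀ c cs' → coeffL (boxLs f cs o v vs (c ∷ cs')) m ≋ coeffL (boxL f cs ((v , c) ∷ o) vs) m ⊕ coeffL (boxLs f cs o v vs cs') m
  split c cs' = coeff-++ (boxL f cs ((v , c) ∷ o) vs) _ m
  go : ∀ cs' → Unique cs' → (e ∈ cs' ⊎ f m ≋ [] → coeffL (boxLs f cs o v vs cs') m ≋ f m) × (e ∉ cs' → coeffL (boxLs f cs o v vs cs') m ≋ [])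
  go [] _ = (λ { (inj₂ q) → ≋-sym q }) , λ _ → ≋-refl
  go (c ∷ cs') (nc ∷ uc') with c ℤ.≟ e | go cs' uc'
  ... | yes refl | _ , off = (λ _ → ≋-trans (split c cs') (≋-trans (⊕-cong hit (off (All∉ℤ nc))) (⊕-identityʳ _)))
                           , λ ni → ⊥-elim (ni (here refl))
    where
    All∉ℤ : ∀ {c : ℤ} {cs} → All (c ≢_) cs → c ∉ cs
    All∉ℤ (p ∷ ps) (here refl) = p refl
    All∉ℤ (p ∷ ps) (there i) = All∉ℤ ps i
  ... | no ne | onn , off =
      (λ { (inj₁ (here q)) → ⊥-elim (ne (sym q))
         ; (inj₁ (there i)) → ≋-trans (split c cs') (≋-trans (⊕-cong (miss c ne) (onn (inj₁ i))) (⊕-identityˡ _))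
         ; (inj₂ q) → ≋-trans (split c cs') (≋-trans (⊕-cong (miss c ne) (onn (inj₂ q))) (⊕-identityˡ _)) })
    , λ ni → ≋-trans (split c cs') (≋-trans (⊕-cong (miss c ne) (off (ni ∘ there))) (⊕-identityˡ _))

boxL-total : ∀ θ f cs o vs n →
  coeffL (HT.mapL θ (boxL f cs o vs)) n ≋
  box cs (length vs) λ xs → if θ (place o vs xs) ≈ᵇ n then f (place o vs xs) else []
boxL-total θ f cs o [] n = addP-identityʳ (if θ o ≈ᵇ n then f o else [])
boxL-total θ f cs o (v ∷ vs) n = go cs
  where
  go : ∀ cs' → coeffL (HT.mapL θ (boxLs f cs o v vs cs')) n ≋
    ΣP cs' λ c → box cs (length vs) λ xs → if θ (place ((v , c) ∷ o) vs xs) ≈ᵇ n then f (place ((v , c) ∷ o) vs xs) else []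
  go [] = ≋-refl
  go (c ∷ cs') = ≋-trans (≋-reflexive (cong (λ z → coeffL z n) (HT.mapL-++ θ (boxL f cs ((v , c) ∷ o) vs) _)))
    (≋-trans (coeff-++ (HT.mapL θ (boxL f cs ((v , c) ∷ o) vs)) _ n)
             (⊕-cong (boxL-total θ f cs ((v , c) ∷ o) vs n) (go cs')))

tP : Poly
tP = + 0 ∷ + 1 ∷ []

tpow : ℕ → Poly
tpow zero = oneP
tpow (suc n) = tP ⊗ tpow n

opaque
  unfolding _⊕_

  tP-shift : ∀ p → tP ⊗ p ≋ + 0 ∷ p
  tP-shift p = ≋-trans (addP-cong {map (+ 0 ℤ.*_) p} {[]} {+ 0 ∷ mulP (+ 1 ∷ []) p} (scale-zero p) ≋-refl)
                       (tail-cong refl (mulP-identityˡ p))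

  oneMinusTPow≋ : ∀ q → oneMinusTPow q ≋ oneP ⊝ tpow q
  oneMinusTPow≋ q = addP-cong (≋-refl {oneP}) (≋-trans (neg q) (negP-cong (≋-sym (pow q))))
    where
    pow : ∀ q → tpow q ≋ replicate q (+ 0) ++ + 1 ∷ []
    pow zero = ≋-refl
    pow (suc q) = ≋-trans (tP-shift (tpow q)) (tail-cong refl (pow q))
    neg : ∀ q → replicate q (+ 0) ++ (ℤ.- + 1) ∷ [] ≋ negP (replicate q (+ 0) ++ + 1 ∷ [])
    neg zero = ≋-refl
    neg (suc q) = tail-cong refl (neg q)

-- Interlacing and weights of rows

-- il p q holds when p₁ ≥ q₁ ≥ p₂ ≥ q₂ ≥ ⋯ with length p ∸ length q ∈ {0, 1}.
il : List ℤ → List ℤ → Bool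
il [] [] = true
il [] (_ ∷ _) = false
il (p ∷ ps) [] = Data.List.null ps
il (p ∷ ps) (q ∷ qs) = (q ≤ᵇ p) ∧ il (q ∷ qs) ps

ilj : Bool → List ℤ → List ℤ → Bool
ilj false x y = il x y
ilj true x y = il y x

chi : Bool → Poly
chi b = if b then oneP else []

cnt : ℤ → List ℤ → ℕ
cnt c xs = length (filterᵇ (c ==ℤ_) xs)

elem : ℤ → List ℤ → Bool
elem c xs = any (c ==ℤ_) xs

fac : ℕ → ℕ → Poly
fac p q = if ⌊ q ℕ.≟ suc p ⌋ then oneMinusTPow q else oneP

-- The contribution of two consecutive rows, `L` above `M`, to the face weight: each value of `M`
-- contributes one factor, charged to its last occurrence in the list.
wtGo : List ℤ → List ℤ → List ℤ → Poly
wtGo L M [] = oneP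
wtGo L M (v ∷ vs) = (if elem v vs then oneP else fac (cnt v L) (cnt v M)) ⊗ wtGo L M vs

wt : List ℤ → List ℤ → Poly
wt L M = wtGo L M M

fac-same : ∀ l → fac l l ≡ oneP
fac-same l with l ℕ.≟ suc l
... | yes e = ⊥-elim (ℕₚ.1+n≢n (sym e))
... | no _ = refl

fac-down : ∀ l → fac (suc l) l ≡ oneP
fac-down l with l ℕ.≟ suc (suc l)
... | yes e = ⊥-elim (ℕₚ.<-irrefl e (ℕ.s≤s (ℕₚ.n≤1+n l)))
... | no _ = refl

fac-up : ∀ l → fac l (suc l) ≡ oneMinusTPow (suc l)
fac-up l with suc l ℕ.≟ suc l
... | yes e = refl
... | no ne = ⊥-elim (ne refl)

Below : ℤ → List ℤ → Set
Below c = All (ℤ._< c)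

≤ᵇ-true : ∀ {a b} → a ℤ.≤ b → (a ≤ᵇ b) ≡ true
≤ᵇ-true {a} {b} h with a ≤ᵇ b | ℤₚ.≤⇒≤ᵇ h
... | true | _ = refl

≤ᵇ-sound : ∀ {a b} → (a ≤ᵇ b) ≡ true → a ℤ.≤ b
≤ᵇ-sound {a} {b} e = ℤₚ.≤ᵇ⇒≤ (subst T (sym e) _)

≤ᵇ-false : ∀ {a b} → b ℤ.< a → (a ≤ᵇ b) ≡ false
≤ᵇ-false {a} {b} h with bool-case (a ≤ᵇ b)
... | inj₁ e = ⊥-elim (ℤₚ.<⇒≱ h (≤ᵇ-sound e))
... | inj₂ e = e

-- tr j l m: how the interlacing state changes at a value taken l times in
-- one row and m times in the other; false means "x ≻ λ", true means "λ ≻ x".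
tr : Bool → ℕ → ℕ → Maybe Bool
tr j zero zero = just j
tr false zero (suc m) = if ⌊ m ℕ.≟ 0 ⌋ then just true else nothing
tr true zero (suc m) = nothing
tr false (suc l) zero = nothing
tr true (suc l) zero = if ⌊ l ℕ.≟ 0 ⌋ then just false else nothing
tr false (suc l) (suc m) = tr false l m
tr true (suc l) (suc m) = tr true l m

tr-same : ∀ j l → tr j l l ≡ just j
tr-same false zero = refl
tr-same true zero = refl
tr-same false (suc l) = tr-same false l
tr-same true (suc l) = tr-same true l

tr-up : ∀ l → tr false l (suc l) ≡ just true
tr-up zero = refl
tr-up (suc l) = tr-up l

tr-down : ∀ l → tr true (suc l) l ≡ just false
tr-down zero = refl
tr-down (suc l) = tr-down l

tr-up-none : ∀ l → tr true l (suc l) ≡ nothing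
tr-up-none zero = refl
tr-up-none (suc l) = tr-up-none l

tr-down-none : ∀ l → tr false (suc l) l ≡ nothing
tr-down-none zero = refl
tr-down-none (suc l) = tr-down-none l

onJust : {A B : Set} → Maybe A → (A → B) → B → B
onJust (just a) f b = f a
onJust nothing f b = b

rep : ℕ → ℤ → List ℤ
rep m c = replicate m c

-- Both rows begin with their copies of the largest value `c`. Each comparison of `il` consumes a
-- copy and exchanges the rows, so only the difference of the two multiplicities decides how the
-- interlacing continues.
il-peel : ∀ c m l {x y} → Below c x → Below c y →
  il (rep m c ++ x) (rep l c ++ y) ≡ onJust (tr false l m) (λ j → ilj j x y) false
il-peel c zero zero bx by = refl
il-peel c zero (suc l) {[]} bx by = refl
il-peel c zero (suc l) {x ∷ xs} (b ∷ bx) by rewrite ≤ᵇ-false b = refl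
il-peel c (suc zero) zero {x} {[]} bx by = lem x
  where
  lem : ∀ x → il (c ∷ x) [] ≡ il [] x
  lem [] = refl
  lem (_ ∷ _) = refl
il-peel c (suc zero) zero {x} {y ∷ ys} bx (b ∷ by) rewrite ≤ᵇ-true (ℤₚ.<⇒≤ b) = refl
il-peel c (suc (suc m)) zero {x} {[]} bx by = refl
il-peel c (suc (suc m)) zero {x} {y ∷ ys} bx (b ∷ by) rewrite ≤ᵇ-false b = ∧-zeroʳ _
il-peel c (suc m) (suc l) {x} {y} bx by rewrite ≤ᵇ-true (ℤₚ.≤-refl {c}) =
  trans (il-peel c (suc l) m by bx) (swap m l)
  where
  -- after one comparison the roles of the two rows are exchanged
  swap : ∀ m l → onJust (tr false m (suc l)) (λ j → ilj j y x) false ≡ onJust (tr false l m) (λ j → ilj j x y) false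
  swap zero zero = refl
  swap zero (suc l) = refl
  swap (suc zero) zero = refl
  swap (suc (suc m)) zero = refl
  swap (suc m) (suc l) = swap m l

ilj-peel : ∀ j c m l {x y} → Below c x → Below c y →
  ilj j (rep m c ++ x) (rep l c ++ y) ≡ onJust (tr j l m) (λ j → ilj j x y) false
ilj-peel false c m l bx by = il-peel c m l bx by
ilj-peel true c m l {x} {y} bx by = trans (il-peel c l m by bx) (swap m l)
  where
  swap : ∀ m l → onJust (tr false m l) (λ j → ilj j y x) false ≡ onJust (tr true l m) (λ j → ilj j x y) false
  swap zero zero = refl
  swap zero (suc zero) = refl
  swap zero (suc (suc l)) = refl
  swap (suc m) zero = refl
  swap (suc m) (suc l) = swap m l

cnt-rep : ∀ c m x → Below c x → cnt c (rep m c ++ x) ≡ m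
cnt-rep c zero [] bx = refl
cnt-rep c zero (x ∷ xs) (b ∷ bx) rewrite ==ℤ-false {c} {x} (λ e → ℤₚ.<-irrefl (sym e) b) = cnt-rep c zero xs bx
cnt-rep c (suc m) x bx rewrite ==ℤ-refl c = cong suc (cnt-rep c m x bx)

cnt-skip : ∀ {v c} m x → v ℤ.< c → cnt v (rep m c ++ x) ≡ cnt v x
cnt-skip zero x lt = refl
cnt-skip {v} {c} (suc m) x lt rewrite ==ℤ-false {v} {c} (λ e → ℤₚ.<-irrefl e lt) = cnt-skip m x lt

elem-below : ∀ c x → Below c x → elem c x ≡ false
elem-below c [] bx = refl
elem-below c (x ∷ xs) (b ∷ bx) rewrite ==ℤ-false {c} {x} (λ e → ℤₚ.<-irrefl (sym e) b) = elem-below c xs bx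

wtGo-skip : ∀ c l m L M vs → Below c vs → wtGo (rep l c ++ L) (rep m c ++ M) vs ≡ wtGo L M vs
wtGo-skip c l m L M [] b = refl
wtGo-skip c l m L M (v ∷ vs) (b ∷ bs)
  rewrite cnt-skip {v} {c} l L b | cnt-skip {v} {c} m M b | wtGo-skip c l m L M vs bs = refl

wt-peel : ∀ c l m L M → Below c L → Below c M → wt (rep l c ++ L) (rep m c ++ M) ≋ fac l m ⊗ wt L M
wt-peel c l zero L M bL bM =
  ≋-trans (≋-reflexive (wtGo-skip c l 0 L M M bM))
          (≋-sym (⊗-identityˡ _))
wt-peel c l (suc m) L M bL bM = go m
  where
  elem-rep : ∀ n → elem c (rep (suc n) c ++ M) ≡ true
  elem-rep n rewrite ==ℤ-refl c = refl
  go : ∀ n → wtGo (rep l c ++ L) (rep (suc m) c ++ M) (rep (suc n) c ++ M) ≋ fac l (suc m) ⊗ wt L M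
  go zero rewrite elem-below c M bM | cnt-rep c l L bL | cnt-rep c (suc m) M bM | wtGo-skip c l (suc m) L M M bM = ≋-refl
  go (suc n) rewrite elem-rep n = ≋-trans (⊗-identityˡ _) (go n)

sumℤ : List ℤ → ℤ
sumℤ [] = + 0
sumℤ (x ∷ xs) = x ℤ.+ sumℤ xs

sum-rep : ∀ m c x → sumℤ (rep m c ++ x) ≡ + m ℤ.* c ℤ.+ sumℤ x
sum-rep zero c x = sym (trans (cong (ℤ._+ sumℤ x) (ℤₚ.*-zeroˡ c)) (ℤₚ.+-identityˡ _))
sum-rep (suc m) c x = trans (cong (λ z → c ℤ.+ z) (sum-rep m c x)) (lem c (+ m) (sumℤ x))
  where
  lem : ∀ c m z → c ℤ.+ (m ℤ.* c ℤ.+ z) ≡ (+ 1 ℤ.+ m) ℤ.* c ℤ.+ z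
  lem = solve-∀

Desc : List ℤ → Set
Desc [] = Data.Unit.⊤
Desc (x ∷ xs) = All (ℤ._≤ x) xs × Desc xs

il-desc : ∀ p q → il p q ≡ true → Desc p × Desc q × (∀ {p₀ ps} → p ≡ p₀ ∷ ps → All (ℤ._≤ p₀) q)
il-desc [] [] e = _ , _ , λ ()
il-desc (p ∷ []) [] e = ([] , _) , _ , λ _ → []
il-desc (p ∷ ps) (q ∷ qs) e = step (≤ᵇ-sound (proj₁ (∧-true {q ≤ᵇ p} e))) (il-desc (q ∷ qs) ps (proj₂ (∧-true {q ≤ᵇ p} e)))
  where
  step : q ℤ.≤ p → Desc (q ∷ qs) × Desc ps × (∀ {q₀ qs'} → q ∷ qs ≡ q₀ ∷ qs' → All (ℤ._≤ q₀) ps) →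
    Desc (p ∷ ps) × Desc (q ∷ qs) × (∀ {p₀ ps'} → p ∷ ps ≡ p₀ ∷ ps' → All (ℤ._≤ p₀) (q ∷ qs))
  step a ((dq , dqs) , dps , h) =
    (All.map (λ le → ℤₚ.≤-trans le a) (h refl) , dps) , (dq , dqs) ,
    λ { refl → a ∷ All.map (λ le → ℤₚ.≤-trans le a) dq }

ilj-desc : ∀ j x y → ilj j x y ≡ true → Desc x × Desc y
ilj-desc false x y e = let (a , b , _) = il-desc x y e in a , b
ilj-desc true x y e = let (a , b , _) = il-desc y x e in b , a

Desc-split : ∀ c x → Desc x → All (ℤ._≤ c) x → ∃ λ m → ∃ λ y → x ≡ rep m c ++ y × Below c y × Desc y
Desc-split c [] d a = 0 , [] , refl , [] , _
Desc-split c (x ∷ xs) (d , ds) (a ∷ as) with x ℤ.≟ c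
... | yes refl with Desc-split c xs ds as
...   | m , y , refl , b , dy = suc m , y , refl , b , dy
Desc-split c (x ∷ xs) (d , ds) (a ∷ as) | no ne =
  0 , x ∷ xs , refl , ℤₚ.≤∧≢⇒< a ne ∷ All.map (λ le → ℤₚ.≤-<-trans le (ℤₚ.≤∧≢⇒< a ne)) d , d , ds

-- The row `x` between `L` above and `N` below. A Boolean is `false` if `x` opens the interlacing
-- with the fixed row concerned, `true` if the fixed row does.
G : Bool → Bool → List ℤ → List ℤ → List ℤ → Poly
G j j' L N x = chi (ilj j x L ∧ ilj j' x N) ⊗ (wt L x ⊗ wt x N)

δ : ℤ → ℤ → Poly
δ s x = chi (s ==ℤ x)

tr-none-lt : ∀ j {l m} → suc (suc m) ℕ.≤ l → tr j l m ≡ nothing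
tr-none-lt false {m = zero} (ℕ.s≤s (ℕ.s≤s le)) = refl
tr-none-lt true {m = zero} (ℕ.s≤s (ℕ.s≤s le)) = refl
tr-none-lt false {m = suc m} (ℕ.s≤s le) = tr-none-lt false le
tr-none-lt true {m = suc m} (ℕ.s≤s le) = tr-none-lt true le

tr-none-gt : ∀ j {l m} → suc (suc l) ℕ.≤ m → tr j l m ≡ nothing
tr-none-gt false {l = zero} (ℕ.s≤s (ℕ.s≤s le)) = refl
tr-none-gt true {l = zero} (ℕ.s≤s (ℕ.s≤s le)) = refl
tr-none-gt false {l = suc l} (ℕ.s≤s le) = tr-none-gt false le
tr-none-gt true {l = suc l} (ℕ.s≤s le) = tr-none-gt true le

-- Interlacing allows the multiplicity of a value in the middle row to differ by at most one from
-- that in either fixed row, so the multiplicities in the fixed rows can differ by at most two.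
data Diff : ℕ → ℕ → Set where
  eq : ∀ {l} → Diff l l
  up₁ : ∀ {l} → Diff l (suc l)
  up₂ : ∀ {l} → Diff l (suc (suc l))
  down₁ : ∀ {k} → Diff (suc k) k
  down₂ : ∀ {k} → Diff (suc (suc k)) k
  far-up : ∀ {l k} → suc (suc (suc l)) ℕ.≤ k → Diff l k
  far-down : ∀ {l k} → suc (suc (suc k)) ℕ.≤ l → Diff l k

diff : ∀ l k → Diff l k
diff zero zero = eq
diff zero (suc zero) = up₁
diff zero (suc (suc zero)) = up₂
diff zero (suc (suc (suc k))) = far-up (ℕ.s≤s (ℕ.s≤s (ℕ.s≤s ℕ.z≤n)))
diff (suc zero) zero = down₁
diff (suc (suc zero)) zero = down₂
diff (suc (suc (suc l))) zero = far-down (ℕ.s≤s (ℕ.s≤s (ℕ.s≤s ℕ.z≤n)))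
diff (suc l) (suc k) with diff l k
... | eq = eq
... | up₁ = up₁
... | up₂ = up₂
... | down₁ = down₁
... | down₂ = down₂
... | far-up h = far-up (ℕ.s≤s h)
... | far-down h = far-down (ℕ.s≤s h)

-- The sum over a row x squeezed between two fixed rows, as a transfer
-- process running through the possible values c from the largest to the
-- smallest.  Occ lists, for each c, how often c occurs in the two fixed rows.

Occ : Set
Occ = List (ℕ × ℕ)

-- The weight of each final pair of states and of the sum that is left over when no value remains.
-- It is a parameter because a row unbounded below needs a combination of several end conditions.
Ends : Set
Ends = Bool → Bool → ℤ → Poly

site : ℤ → Occ → ℤ
site B os = B ℤ.+ + length os

opaque
  Z : Ends → ℤ → Occ → Bool → Bool → ℤ → Poly
  stepZ : Ends → ℤ → ℕ → ℕ → Occ → Bool → ℕ → Bool → ℤ → Poly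
  downZ : Ends → ℤ → ℕ → ℕ → Occ → Bool → ℤ → Poly
  Z E B [] j j' s = E j j' s
  Z E B ((l , k) ∷ os) false j' s = stepZ E B l k os j' l false s ⊕ stepZ E B l k os j' (suc l) true s
  Z E B ((l , k) ∷ os) true j' s = stepZ E B l k os j' l true s ⊕ downZ E B l k os j' s
  stepZ E B l k os j' m j₁ s =
    onJust (tr j' k m) (λ j₁' → (fac l m ⊗ fac m k) ⊗ Z E B os j₁ j₁' (s ℤ.- + m ℤ.* site B os)) []
  -- The passage from `true` to `false` uses one copy fewer than the upper row has, which is
  -- impossible if that row has none.
  downZ E B zero k os j' s = []
  downZ E B (suc l) k os j' s = stepZ E B (suc l) k os j' l false s

  Z-[] : ∀ E B j j' s → Z E B [] j j' s ≡ E j j' s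
  Z-[] E B j j' s = refl

  Z-false : ∀ E B l k os j' s →
    Z E B ((l , k) ∷ os) false j' s ≡ stepZ E B l k os j' l false s ⊕ stepZ E B l k os j' (suc l) true s
  Z-false E B l k os j' s = refl

  Z-true : ∀ E B l k os j' s → Z E B ((l , k) ∷ os) true j' s ≡ stepZ E B l k os j' l true s ⊕ downZ E B l k os j' s
  Z-true E B l k os j' s = refl

  stepZ-def : ∀ E B l k os j' m j₁ s → stepZ E B l k os j' m j₁ s ≡
    onJust (tr j' k m) (λ j₁' → (fac l m ⊗ fac m k) ⊗ Z E B os j₁ j₁' (s ℤ.- + m ℤ.* site B os)) []
  stepZ-def E B l k os j' m j₁ s = refl

  downZ-zero : ∀ E B k os j' s → downZ E B zero k os j' s ≡ []
  downZ-zero E B k os j' s = refl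

  downZ-suc : ∀ E B l k os j' s → downZ E B (suc l) k os j' s ≡ stepZ E B (suc l) k os j' l false s
  downZ-suc E B l k os j' s = refl

tot : ℤ → Occ → ℤ
tot B [] = + 0
tot B ((l , k) ∷ os) = (+ l ℤ.+ + k) ℤ.* site B os ℤ.+ tot B os

omt : ℕ → Poly
omt = oneMinusTPow

-- One step of the process, written out for each difference of the multiplicities. The digits in the
-- names are the initial states, 1 for `true`; `c` is the value treated and `a` the process over the
-- smaller values.
module Expand (E : Ends) (B : ℤ) (os : Occ) where

  c : ℤ
  c = site B os

  a : Bool → Bool → ℤ → Poly
  a = Z E B os

  a≡ : ∀ {j j' x y} → x ≡ y → a j j' x ≋ a j j' y
  a≡ refl = ≋-refl

  just-step : ∀ {l k j' m j₁ s j₁' w x} → tr j' k m ≡ just j₁' → fac l m ⊗ fac m k ≋ w →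
    s ℤ.- + m ℤ.* c ≡ x → stepZ E B l k os j' m j₁ s ≋ w ⊗ a j₁ j₁' x
  just-step {l} {k} {j'} {m} {j₁} {s} e w refl rewrite stepZ-def E B l k os j' m j₁ s | e = ⊗-cong w ≋-refl

  just-step₁ : ∀ {l k j' m j₁ s j₁' x} → tr j' k m ≡ just j₁' → fac l m ≡ oneP → fac m k ≡ oneP →
    s ℤ.- + m ℤ.* c ≡ x → stepZ E B l k os j' m j₁ s ≋ a j₁ j₁' x
  just-step₁ e f g h = ≋-trans (just-step {w = oneP} e (≋-trans (≋-reflexive (cong₂ _⊗_ f g)) (⊗-identityˡ oneP)) h) (⊗-identityˡ _)

  none : ∀ l {k} j' m j₁ s → tr j' k m ≡ nothing → stepZ E B l k os j' m j₁ s ≋ []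
  none l {k} j' m j₁ s e rewrite stepZ-def E B l k os j' m j₁ s | e = ≋-refl

  cF : ∀ {l k j' s p q} → stepZ E B l k os j' l false s ≋ p → stepZ E B l k os j' (suc l) true s ≋ q →
    Z E B ((l , k) ∷ os) false j' s ≋ p ⊕ q
  cF {l} {k} {j'} {s} e f = ≋-trans (≋-reflexive (Z-false E B l k os j' s)) (⊕-cong e f)

  cT : ∀ {l k j' s p q} → stepZ E B l k os j' l true s ≋ p → downZ E B l k os j' s ≋ q →
    Z E B ((l , k) ∷ os) true j' s ≋ p ⊕ q
  cT {l} {k} {j'} {s} e f = ≋-trans (≋-reflexive (Z-true E B l k os j' s)) (⊕-cong e f)

  dn : ∀ {l k j' s q} → stepZ E B (suc l) k os j' l false s ≋ q → downZ E B (suc l) k os j' s ≋ q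
  dn {l} {k} {j'} {s} e = ≋-trans (≋-reflexive (downZ-suc E B l k os j' s)) e

  w-l : ∀ {p q w} → p ≡ w → q ≡ oneP → p ⊗ q ≋ w
  w-l refl refl = ⊗-identityʳ _

  w-r : ∀ {p q w} → p ≡ oneP → q ≡ w → p ⊗ q ≋ w
  w-r refl refl = ⊗-identityˡ _

  private
    next : ∀ s l c → s ℤ.- (+ 1 ℤ.+ l) ℤ.* c ≡ s ℤ.- l ℤ.* c ℤ.- c
    next = solve-∀
    prev : ∀ s l c → s ℤ.- l ℤ.* c ≡ s ℤ.- (+ 1 ℤ.+ l) ℤ.* c ℤ.+ c
    prev = solve-∀

  ex00-eq : ∀ l s → Z E B ((l , l) ∷ os) false false s ≋
    a false false (s ℤ.- + l ℤ.* c) ⊕ omt (suc l) ⊗ a true true (s ℤ.- + l ℤ.* c ℤ.- c)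
  ex00-eq l s = cF (just-step₁ {s = s} (tr-same false l) (fac-same l) (fac-same l) refl)
    (just-step {s = s} (tr-up l) (w-l (fac-up l) (fac-down l)) (next s (+ l) c))

  omt0 : omt 0 ≋ []
  omt0 = mk≋ λ { zero → refl ; (suc n) → refl }

  -- The formula covers `l = 0` as well: the downward passage is missing there, and its factor
  -- `1 - t^0` is zero.
  ex11-eq : ∀ l s → Z E B ((l , l) ∷ os) true true s ≋
    a true true (s ℤ.- + l ℤ.* c) ⊕ omt l ⊗ a false false (s ℤ.- + l ℤ.* c ℤ.+ c)
  ex11-eq zero s = cT (just-step₁ {s = s} (tr-same true 0) (fac-same 0) (fac-same 0) refl)
    (≋-trans (≋-reflexive (downZ-zero E B 0 os true s)) (≋-sym (≋-trans (⊗-cong omt0 ≋-refl) (⊗-zeroˡ _))))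
  ex11-eq (suc l) s = cT (just-step₁ {s = s} (tr-same true (suc l)) (fac-same (suc l)) (fac-same (suc l)) refl)
    (dn (just-step {s = s} (tr-down l) (w-r (fac-down l) (fac-up l)) (prev s (+ l) c)))

  ex00-up : ∀ l s → Z E B ((l , suc l) ∷ os) false false s ≋ omt (suc l) ⊗ a true false (s ℤ.- + l ℤ.* c ℤ.- c)
  ex00-up l s = ≋-trans (cF (none l false l false s (tr-down-none l))
    (just-step {s = s} (tr-same false (suc l)) (w-l (fac-up l) (fac-same (suc l))) (next s (+ l) c))) (⊕-identityˡ _)

  down-none : ∀ l k j' s → (∀ m → suc m ≡ l → tr j' k m ≡ nothing) → downZ E B l k os j' s ≋ []
  down-none zero k j' s h = ≋-reflexive (downZ-zero E B k os j' s)
  down-none (suc l) k j' s h = dn $ none (suc l) j' l false s (h l refl)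

  ex11-up : ∀ l s → Z E B ((l , suc l) ∷ os) true true s ≋ omt (suc l) ⊗ a true false (s ℤ.- + l ℤ.* c)
  ex11-up l s = ≋-trans (cT
    (just-step {s = s} (tr-down l) (w-r (fac-same l) (fac-up l)) refl)
    (down-none l (suc l) true s λ { m refl → tr-none-lt true {suc (suc m)} {m} ℕₚ.≤-refl })) (⊕-identityʳ _)

  ex00-down : ∀ k s → Z E B ((suc k , k) ∷ os) false false s ≋ a false true (s ℤ.- + k ℤ.* c ℤ.- c)
  ex00-down k s = ≋-trans (cF
    (just-step₁ {s = s} (tr-up k) (fac-same (suc k)) (fac-down k) (next s (+ k) c))
    (none (suc k) false (suc (suc k)) true s (tr-none-gt false {k} ℕₚ.≤-refl))) (⊕-identityʳ _)

  ex11-down : ∀ k s → Z E B ((suc k , k) ∷ os) true true s ≋ a false true (s ℤ.- + k ℤ.* c)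
  ex11-down k s = ≋-trans (cT (none (suc k) true (suc k) true s (tr-up-none k))
    (dn (just-step₁ {s = s} (tr-same true k) (fac-down k) (fac-same k) refl))) (⊕-identityˡ _)

  ex00-none : ∀ l k s → suc (suc l) ℕ.≤ k ⊎ suc (suc k) ℕ.≤ l → Z E B ((l , k) ∷ os) false false s ≋ []
  ex00-none l k s h = ≋-trans (cF (none l false l false s (p h)) (none l false (suc l) true s (q h))) (⊕-identityˡ [])
    where
    p : suc (suc l) ℕ.≤ k ⊎ suc (suc k) ℕ.≤ l → tr false k l ≡ nothing
    p (inj₁ le) = tr-none-lt false le
    p (inj₂ le) = tr-none-gt false le
    q : suc (suc l) ℕ.≤ k ⊎ suc (suc k) ℕ.≤ l → tr false k (suc l) ≡ nothing
    q (inj₁ (ℕ.s≤s le)) = lem le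
      where
      lem : ∀ {l k} → suc l ℕ.≤ k → tr false (suc k) (suc l) ≡ nothing
      lem {zero} (ℕ.s≤s le) = refl
      lem {suc l} (ℕ.s≤s le) = lem le
    q (inj₂ le) = tr-none-gt false (ℕₚ.m≤n⇒m≤1+n le)

  ex11-none : ∀ l k s → suc (suc l) ℕ.≤ k ⊎ suc (suc k) ℕ.≤ l → Z E B ((l , k) ∷ os) true true s ≋ []
  ex11-none l k s h = ≋-trans (cT (none l true l true s (p h)) (down-none l k true s (q h))) (⊕-identityˡ [])
    where
    p : suc (suc l) ℕ.≤ k ⊎ suc (suc k) ℕ.≤ l → tr true k l ≡ nothing
    p (inj₁ le) = tr-none-lt true le
    p (inj₂ le) = tr-none-gt true le
    q : suc (suc l) ℕ.≤ k ⊎ suc (suc k) ℕ.≤ l → ∀ m → suc m ≡ l → tr true k m ≡ nothing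
    q (inj₁ le) m refl = tr-none-lt true (ℕₚ.≤-trans (ℕₚ.n≤1+n _) le)
    q (inj₂ (ℕ.s≤s le)) m refl = lem le
      where
      lem : ∀ {m k} → suc k ℕ.≤ m → tr true k m ≡ nothing
      lem {suc m} {zero} (ℕ.s≤s le) = refl
      lem {suc m} {suc k} (ℕ.s≤s le) = lem le

  ex10-eq : ∀ l s → Z E B ((l , l) ∷ os) true false s ≋ a true false (s ℤ.- + l ℤ.* c)
  ex10-eq l s = ≋-trans (cT (just-step₁ {s = s} (tr-same false l) (fac-same l) (fac-same l) refl)
    (down-none l l false s λ { m refl → tr-down-none m })) (⊕-identityʳ _)

  ex10-down₁ : ∀ k s → Z E B ((suc k , k) ∷ os) true false s ≋
    a true true (s ℤ.- + k ℤ.* c ℤ.- c) ⊕ a false false (s ℤ.- + k ℤ.* c)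
  ex10-down₁ k s = cT (just-step₁ {s = s} (tr-up k) (fac-same (suc k)) (fac-down k) (next s (+ k) c))
    (dn (just-step₁ {s = s} (tr-same false k) (fac-down k) (fac-same k) refl))

  ex10-down₂ : ∀ k s → Z E B ((suc (suc k) , k) ∷ os) true false s ≋ a false true (s ℤ.- + k ℤ.* c ℤ.- c)
  ex10-down₂ k s = ≋-trans (cT (none (suc (suc k)) false (suc (suc k)) true s (tr-none-gt false {k} ℕₚ.≤-refl))
    (dn (just-step₁ {s = s} (tr-up k) (fac-down (suc k)) (fac-down k) (next s (+ k) c)))) (⊕-identityˡ _)

  ex10-none : ∀ l k s → suc l ℕ.≤ k ⊎ suc (suc (suc k)) ℕ.≤ l → Z E B ((l , k) ∷ os) true false s ≋ []
  ex10-none l k s h = ≋-trans (cT (none l false l true s (p h)) (down-none l k false s (q h))) (⊕-identityˡ [])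
    where
    lt : ∀ {l k} → suc l ℕ.≤ k → tr false k l ≡ nothing
    lt {zero} (ℕ.s≤s le) = refl
    lt {suc l} (ℕ.s≤s le) = lt le
    p : suc l ℕ.≤ k ⊎ suc (suc (suc k)) ℕ.≤ l → tr false k l ≡ nothing
    p (inj₁ le) = lt le
    p (inj₂ le) = tr-none-gt false (ℕₚ.≤-trans (ℕₚ.n≤1+n _) le)
    q : suc l ℕ.≤ k ⊎ suc (suc (suc k)) ℕ.≤ l → ∀ m → suc m ≡ l → tr false k m ≡ nothing
    q (inj₁ le) m refl = lt (ℕₚ.≤-trans (ℕₚ.n≤1+n _) le)
    q (inj₂ (ℕ.s≤s le)) m refl = tr-none-gt false le

  ex01-eq : ∀ l s → Z E B ((l , l) ∷ os) false true s ≋ a false true (s ℤ.- + l ℤ.* c)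
  ex01-eq l s = ≋-trans (cF (just-step₁ {s = s} (tr-same true l) (fac-same l) (fac-same l) refl)
    (none l true (suc l) true s (tr-up-none l))) (⊕-identityʳ _)

  ex01-up₁ : ∀ l s → Z E B ((l , suc l) ∷ os) false true s ≋
    omt (suc l) ⊗ a false false (s ℤ.- + l ℤ.* c) ⊕ omt (suc l) ⊗ a true true (s ℤ.- + l ℤ.* c ℤ.- c)
  ex01-up₁ l s = cF (just-step {s = s} (tr-down l) (w-r (fac-same l) (fac-up l)) refl)
    (just-step {s = s} (tr-same true (suc l)) (w-l (fac-up l) (fac-same (suc l))) (next s (+ l) c))

  ex01-up₂ : ∀ l s → Z E B ((l , suc (suc l)) ∷ os) false true s ≋
    (omt (suc l) ⊗ omt (suc (suc l))) ⊗ a true false (s ℤ.- + l ℤ.* c ℤ.- c)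
  ex01-up₂ l s = ≋-trans (cF (none l true l false s (tr-none-lt true {suc (suc l)} {l} ℕₚ.≤-refl))
    (just-step {s = s} (tr-down (suc l)) (≋-reflexive (cong₂ _⊗_ (fac-up l) (fac-up (suc l)))) (next s (+ l) c))) (⊕-identityˡ _)

  ex01-none : ∀ l k s → suc k ℕ.≤ l ⊎ suc (suc (suc l)) ℕ.≤ k → Z E B ((l , k) ∷ os) false true s ≋ []
  ex01-none l k s h = ≋-trans (cF (none l true l false s (p h)) (none l true (suc l) true s (q h))) (⊕-identityˡ [])
    where
    gt : ∀ {l k} → suc k ℕ.≤ l → tr true k l ≡ nothing
    gt {suc l} {zero} (ℕ.s≤s le) = refl
    gt {suc l} {suc k} (ℕ.s≤s le) = gt le
    p : suc k ℕ.≤ l ⊎ suc (suc (suc l)) ℕ.≤ k → tr true k l ≡ nothing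
    p (inj₁ le) = gt le
    p (inj₂ le) = tr-none-lt true (ℕₚ.≤-trans (ℕₚ.n≤1+n _) le)
    q : suc k ℕ.≤ l ⊎ suc (suc (suc l)) ℕ.≤ k → tr true k (suc l) ≡ nothing
    q (inj₁ le) = gt (ℕₚ.m≤n⇒m≤1+n le)
    q (inj₂ le) = tr-none-lt true le

opaque
  unfolding _⊕_

  -- The algebra of a step with equal multiplicities, with `T = t^l`: the new first relation is the
  -- old one at two arguments minus `T` times the old second one. The new second relation is a
  -- multiple of the old first one, by `alg₃` and `alg₄`. `t` is generalized to a variable for the
  -- ring solver.
  alg₁ : ∀ T a₀ a₁ p₀ p₁ → (a₀ ⊕ (oneP ⊝ tP ⊗ T) ⊗ p₀) ⊕ (p₁ ⊕ (oneP ⊝ T) ⊗ a₁) ≋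
    ((a₀ ⊕ p₀) ⊕ (a₁ ⊕ p₁)) ⊝ T ⊗ (a₁ ⊕ tP ⊗ p₀)
  alg₁ = go tP
    where
    go : ∀ t T a₀ a₁ p₀ p₁ → (a₀ ⊕ (oneP ⊝ t ⊗ T) ⊗ p₀) ⊕ (p₁ ⊕ (oneP ⊝ T) ⊗ a₁) ≋
      ((a₀ ⊕ p₀) ⊕ (a₁ ⊕ p₁)) ⊝ T ⊗ (a₁ ⊕ t ⊗ p₀)
    go = RingSolver.solve-∀ polyACR

  alg₂ : ∀ T q₀ q₁ v₀ v₁ → (q₀ ⊕ (oneP ⊝ T) ⊗ v₀) ⊕ (v₁ ⊕ (oneP ⊝ tP ⊗ T) ⊗ q₁) ≋
    ((q₀ ⊕ v₀) ⊕ (q₁ ⊕ v₁)) ⊝ T ⊗ (tP ⊗ q₁ ⊕ v₀)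
  alg₂ = go tP
    where
    go : ∀ t T q₀ q₁ v₀ v₁ → (q₀ ⊕ (oneP ⊝ T) ⊗ v₀) ⊕ (v₁ ⊕ (oneP ⊝ t ⊗ T) ⊗ q₁) ≋
      ((q₀ ⊕ v₀) ⊕ (q₁ ⊕ v₁)) ⊝ T ⊗ (t ⊗ q₁ ⊕ v₀)
    go = RingSolver.solve-∀ polyACR

  alg₃ : ∀ T a₁ p₁ → (a₁ ⊕ (oneP ⊝ tP ⊗ T) ⊗ p₁) ⊕ tP ⊗ (p₁ ⊕ (oneP ⊝ T) ⊗ a₁) ≋
    (oneP ⊕ (tP ⊝ tP ⊗ T)) ⊗ (a₁ ⊕ p₁)
  alg₃ = go tP
    where
    go : ∀ t T a₁ p₁ → (a₁ ⊕ (oneP ⊝ t ⊗ T) ⊗ p₁) ⊕ t ⊗ (p₁ ⊕ (oneP ⊝ T) ⊗ a₁) ≋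
      (oneP ⊕ (t ⊝ t ⊗ T)) ⊗ (a₁ ⊕ p₁)
    go = RingSolver.solve-∀ polyACR

  alg₄ : ∀ T q₁ v₁ → tP ⊗ (q₁ ⊕ (oneP ⊝ T) ⊗ v₁) ⊕ (v₁ ⊕ (oneP ⊝ tP ⊗ T) ⊗ q₁) ≋
    (oneP ⊕ (tP ⊝ tP ⊗ T)) ⊗ (q₁ ⊕ v₁)
  alg₄ = go tP
    where
    go : ∀ t T q₁ v₁ → t ⊗ (q₁ ⊕ (oneP ⊝ T) ⊗ v₁) ⊕ (v₁ ⊕ (oneP ⊝ t ⊗ T) ⊗ q₁) ≋
      (oneP ⊕ (t ⊝ t ⊗ T)) ⊗ (q₁ ⊕ v₁)
    go = RingSolver.solve-∀ polyACR

-- The intertwining relations between a row and its reflection s ↦ tot - s;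
-- they are the two lines of a 2×2 R-matrix identity for the ambiguous
-- states (false, false) and (true, true).

record Intertwined (E E' : Ends) (B : ℤ) (os : Occ) : Set where
  private
    c = site B os
    a = Z E B os
    b : Bool → Bool → ℤ → Poly
    b j j' s = Z E' B os j j' (tot B os ℤ.- s)
  field
    R₁ : ∀ s → a false false s ⊕ a true true (s ℤ.- c) ≋ b true true s ⊕ b false false (s ℤ.- c)
    R₂ : ∀ s → a false false (s ℤ.- + 1) ⊕ tP ⊗ a true true (s ℤ.- c) ≋ tP ⊗ b true true (s ℤ.- + 1) ⊕ b false false (s ℤ.- c)
    R₃ : ∀ s → a true false s ≋ b true false s
    R₄ : ∀ s → a false true s ≋ b false true s
open Intertwined

-- Equal multiplicities lead from the ambiguous states back to themselves, so `R₁` and `R₂`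
-- reproduce each other. Multiplicities that differ by one reduce `R₁` and `R₂` to `R₃` or `R₄`, and
-- in turn `R₃` and `R₄` to `R₁`; a difference of two exchanges `R₃` and `R₄`. Hence none of the
-- four relations can be proved alone.
module Step (E E' : Ends) (B : ℤ) (os : Occ) (IH : Intertwined E E' B os) where
  private
    module A = Expand E B os
    module K = Expand E' B os
    c = site B os
    t' = tot B os
    a = Z E B os
    b : Bool → Bool → ℤ → Poly
    b j j' s = Z E' B os j j' (t' ℤ.- s)

    b≡ : ∀ {j j' x y} → x ≡ t' ℤ.- y → Z E' B os j j' x ≋ b j j' y
    b≡ refl = ≋-refl

    c₁ : ∀ {l k} → site B ((l , k) ∷ os) ≡ c ℤ.+ + 1
    c₁ = lem B (+ length os)
      where
      lem : ∀ B n → B ℤ.+ (+ 1 ℤ.+ n) ≡ B ℤ.+ n ℤ.+ + 1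
      lem = solve-∀

    S : ℕ → ℕ → ℤ
    S l k = (+ l ℤ.+ + k) ℤ.* c ℤ.+ t'

    e1 : ∀ s l c t → (l ℤ.+ l) ℤ.* c ℤ.+ t ℤ.- s ℤ.- l ℤ.* c ≡ t ℤ.- (s ℤ.- l ℤ.* c)
    e1 = solve-∀
    e2 : ∀ s l c t → (l ℤ.+ l) ℤ.* c ℤ.+ t ℤ.- s ℤ.- l ℤ.* c ℤ.+ c ≡ t ℤ.- (s ℤ.- l ℤ.* c ℤ.- c)
    e2 = solve-∀
    e3 : ∀ s l c t → (l ℤ.+ l) ℤ.* c ℤ.+ t ℤ.- s ℤ.- l ℤ.* c ℤ.- c ≡ t ℤ.- (s ℤ.- l ℤ.* c ℤ.+ c)
    e3 = solve-∀
    e4 : ∀ s l c t → (l ℤ.+ (+ 1 ℤ.+ l)) ℤ.* c ℤ.+ t ℤ.- s ℤ.- l ℤ.* c ≡ t ℤ.- (s ℤ.- l ℤ.* c ℤ.- c)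
    e4 = solve-∀
    e5 : ∀ s l c t → (l ℤ.+ (+ 1 ℤ.+ l)) ℤ.* c ℤ.+ t ℤ.- s ℤ.- l ℤ.* c ℤ.- c ≡ t ℤ.- (s ℤ.- l ℤ.* c)
    e5 = solve-∀
    e4' : ∀ s l c t → ((+ 1 ℤ.+ l) ℤ.+ l) ℤ.* c ℤ.+ t ℤ.- s ℤ.- l ℤ.* c ≡ t ℤ.- (s ℤ.- l ℤ.* c ℤ.- c)
    e4' = solve-∀
    e5' : ∀ s l c t → ((+ 1 ℤ.+ l) ℤ.+ l) ℤ.* c ℤ.+ t ℤ.- s ℤ.- l ℤ.* c ℤ.- c ≡ t ℤ.- (s ℤ.- l ℤ.* c)
    e5' = solve-∀
    e6 : ∀ s l c t → (l ℤ.+ (+ 2 ℤ.+ l)) ℤ.* c ℤ.+ t ℤ.- s ℤ.- l ℤ.* c ℤ.- c ≡ t ℤ.- (s ℤ.- l ℤ.* c ℤ.- c)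
    e6 = solve-∀
    e6' : ∀ s l c t → ((+ 2 ℤ.+ l) ℤ.+ l) ℤ.* c ℤ.+ t ℤ.- s ℤ.- l ℤ.* c ℤ.- c ≡ t ℤ.- (s ℤ.- l ℤ.* c ℤ.- c)
    e6' = solve-∀

  private
    n1 : ∀ s l c → s ℤ.- (c ℤ.+ + 1) ℤ.- l ℤ.* c ≡ s ℤ.- l ℤ.* c ℤ.- + 1 ℤ.- c
    n1 = solve-∀
    n2 : ∀ s l c → s ℤ.- (c ℤ.+ + 1) ℤ.- l ℤ.* c ℤ.+ c ≡ s ℤ.- l ℤ.* c ℤ.- + 1
    n2 = solve-∀
    n3 : ∀ s l c → s ℤ.- + 1 ℤ.- l ℤ.* c ≡ s ℤ.- l ℤ.* c ℤ.- + 1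
    n3 = solve-∀
    n4 : ∀ s l c → s ℤ.- + 1 ℤ.- l ℤ.* c ℤ.- c ≡ s ℤ.- l ℤ.* c ℤ.- + 1 ℤ.- c
    n4 = solve-∀
    om : ∀ l → omt (suc l) ≋ oneP ⊝ tP ⊗ tpow l
    om l = oneMinusTPow≋ (suc l)

  module Eq (l : ℕ) (s : ℤ) where
    s' = s ℤ.- + l ℤ.* c
    Tl = tpow l
    A00 : Z E B ((l , l) ∷ os) false false s ≋ a false false s' ⊕ (oneP ⊝ tP ⊗ Tl) ⊗ a true true (s' ℤ.- c)
    A00 = ≋-trans (A.ex00-eq l s) (⊕-cong ≋-refl (⊗-cong (om l) ≋-refl))
    A11 : Z E B ((l , l) ∷ os) true true (s ℤ.- (c ℤ.+ + 1)) ≋ a true true (s' ℤ.- + 1 ℤ.- c) ⊕ (oneP ⊝ Tl) ⊗ a false false (s' ℤ.- + 1)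
    A11 = ≋-trans (A.ex11-eq l (s ℤ.- (c ℤ.+ + 1)))
      (⊕-cong (A.a≡ (n1 s (+ l) c)) (⊗-cong (oneMinusTPow≋ l) (A.a≡ (n2 s (+ l) c))))
    A00' : Z E B ((l , l) ∷ os) false false (s ℤ.- + 1) ≋ a false false (s' ℤ.- + 1) ⊕ (oneP ⊝ tP ⊗ Tl) ⊗ a true true (s' ℤ.- + 1 ℤ.- c)
    A00' = ≋-trans (A.ex00-eq l (s ℤ.- + 1)) (⊕-cong (A.a≡ (n3 s (+ l) c)) (⊗-cong (om l) (A.a≡ (n4 s (+ l) c))))
    K11 : Z E' B ((l , l) ∷ os) true true (S l l ℤ.- s) ≋ b true true s' ⊕ (oneP ⊝ Tl) ⊗ b false false (s' ℤ.- c)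
    K11 = ≋-trans (K.ex11-eq l (S l l ℤ.- s))
      (⊕-cong (b≡ (e1 s (+ l) c t')) (⊗-cong (oneMinusTPow≋ l) (b≡ (e2 s (+ l) c t'))))
    K00 : Z E' B ((l , l) ∷ os) false false (S l l ℤ.- (s ℤ.- (c ℤ.+ + 1))) ≋
      b false false (s' ℤ.- + 1 ℤ.- c) ⊕ (oneP ⊝ tP ⊗ Tl) ⊗ b true true (s' ℤ.- + 1)
    K00 = ≋-trans (K.ex00-eq l (S l l ℤ.- (s ℤ.- (c ℤ.+ + 1))))
      (⊕-cong (b≡ (trans (e1 (s ℤ.- (c ℤ.+ + 1)) (+ l) c t') (cong (λ z → t' ℤ.- z) (n1 s (+ l) c))))
              (⊗-cong (om l) (b≡ (trans (e3 (s ℤ.- (c ℤ.+ + 1)) (+ l) c t') (cong (λ z → t' ℤ.- z) (n2 s (+ l) c))))))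
    K11' : Z E' B ((l , l) ∷ os) true true (S l l ℤ.- (s ℤ.- + 1)) ≋ b true true (s' ℤ.- + 1) ⊕ (oneP ⊝ Tl) ⊗ b false false (s' ℤ.- + 1 ℤ.- c)
    K11' = ≋-trans (K.ex11-eq l (S l l ℤ.- (s ℤ.- + 1)))
      (⊕-cong (b≡ (trans (e1 (s ℤ.- + 1) (+ l) c t') (cong (λ z → t' ℤ.- z) (n3 s (+ l) c))))
              (⊗-cong (oneMinusTPow≋ l) (b≡ (trans (e2 (s ℤ.- + 1) (+ l) c t') (cong (λ z → t' ℤ.- z) (n4 s (+ l) c))))))
    r₁ : Z E B ((l , l) ∷ os) false false s ⊕ Z E B ((l , l) ∷ os) true true (s ℤ.- (c ℤ.+ + 1)) ≋
         Z E' B ((l , l) ∷ os) true true (S l l ℤ.- s) ⊕ Z E' B ((l , l) ∷ os) false false (S l l ℤ.- (s ℤ.- (c ℤ.+ + 1)))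
    r₁ = ≋-trans (⊕-cong A00 A11) (≋-trans (alg₁ Tl _ _ _ _)
      (≋-trans (⊝-cong (⊕-cong (R₁ IH s') (R₁ IH (s' ℤ.- + 1))) (⊗-cong ≋-refl (R₂ IH s')))
      (≋-sym (≋-trans (⊕-cong K11 K00) (alg₂ Tl _ _ _ _)))))
    r₂ : Z E B ((l , l) ∷ os) false false (s ℤ.- + 1) ⊕ tP ⊗ Z E B ((l , l) ∷ os) true true (s ℤ.- (c ℤ.+ + 1)) ≋
         tP ⊗ Z E' B ((l , l) ∷ os) true true (S l l ℤ.- (s ℤ.- + 1)) ⊕ Z E' B ((l , l) ∷ os) false false (S l l ℤ.- (s ℤ.- (c ℤ.+ + 1)))
    r₂ = ≋-trans (⊕-cong A00' (⊗-cong ≋-refl A11)) (≋-trans (alg₃ Tl _ _)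
      (≋-trans (⊗-cong ≋-refl (R₁ IH (s' ℤ.- + 1)))
      (≋-sym (≋-trans (⊕-cong (⊗-cong ≋-refl K11') K00) (alg₄ Tl _ _)))))

  private
    m1 : ∀ s l c → s ℤ.- + 1 ℤ.- l ℤ.* c ℤ.- c ≡ s ℤ.- (c ℤ.+ + 1) ℤ.- l ℤ.* c
    m1 = solve-∀
    zz : ∀ {p q r u} → p ≋ [] → q ≋ [] → r ≋ [] → u ≋ [] → p ⊕ q ≋ r ⊕ u
    zz e f g h = ≋-trans (⊕-cong e f) (≋-sym (⊕-cong g h))
    tz : ∀ {p} → p ≋ [] → tP ⊗ p ≋ []
    tz e = ≋-trans (⊗-cong ≋-refl e) (⊗-zeroʳ tP)

  step₁ : ∀ l k → Diff l k → ∀ s →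
    Z E B ((l , k) ∷ os) false false s ⊕ Z E B ((l , k) ∷ os) true true (s ℤ.- (c ℤ.+ + 1)) ≋
    Z E' B ((l , k) ∷ os) true true (S l k ℤ.- s) ⊕ Z E' B ((l , k) ∷ os) false false (S l k ℤ.- (s ℤ.- (c ℤ.+ + 1)))
  step₁ l .l eq s = Eq.r₁ l s
  step₁ l .(suc l) up₁ s = ≋-trans (⊕-cong (A.ex00-up l s) (A.ex11-up l (s ℤ.- (c ℤ.+ + 1))))
    (≋-trans (⊕-cong (⊗-cong ≋-refl (R₃ IH _)) (⊗-cong ≋-refl (R₃ IH _)))
    (≋-sym (⊕-cong (≋-trans (K.ex11-up l (S l (suc l) ℤ.- s)) (⊗-cong ≋-refl (b≡ (e4 s (+ l) c t'))))
                   (≋-trans (K.ex00-up l (S l (suc l) ℤ.- (s ℤ.- (c ℤ.+ + 1)))) (⊗-cong ≋-refl (b≡ (e5 (s ℤ.- (c ℤ.+ + 1)) (+ l) c t')))))))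
  step₁ .(suc k) k down₁ s = ≋-trans (⊕-cong (A.ex00-down k s) (A.ex11-down k (s ℤ.- (c ℤ.+ + 1))))
    (≋-trans (⊕-cong (R₄ IH _) (R₄ IH _))
    (≋-sym (⊕-cong (≋-trans (K.ex11-down k (S (suc k) k ℤ.- s)) (b≡ (e4' s (+ k) c t')))
                   (≋-trans (K.ex00-down k (S (suc k) k ℤ.- (s ℤ.- (c ℤ.+ + 1)))) (b≡ (e5' (s ℤ.- (c ℤ.+ + 1)) (+ k) c t'))))))
  step₁ l k up₂ s = zz (A.ex00-none l k _ h) (A.ex11-none l k _ h) (K.ex11-none l k _ h) (K.ex00-none l k _ h)
    where h = inj₁ ℕₚ.≤-refl
  step₁ l k down₂ s = zz (A.ex00-none l k _ h) (A.ex11-none l k _ h) (K.ex11-none l k _ h) (K.ex00-none l k _ h)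
    where h = inj₂ ℕₚ.≤-refl
  step₁ l k (far-up g) s = zz (A.ex00-none l k _ h) (A.ex11-none l k _ h) (K.ex11-none l k _ h) (K.ex00-none l k _ h)
    where h = inj₁ (ℕₚ.≤-trans (ℕₚ.n≤1+n _) g)
  step₁ l k (far-down g) s = zz (A.ex00-none l k _ h) (A.ex11-none l k _ h) (K.ex11-none l k _ h) (K.ex00-none l k _ h)
    where h = inj₂ (ℕₚ.≤-trans (ℕₚ.n≤1+n _) g)

  private
    swp : ∀ w x → w ⊗ x ⊕ tP ⊗ (w ⊗ x) ≋ tP ⊗ (w ⊗ x) ⊕ w ⊗ x
    swp w x = ⊕-comm _ _

  step₂ : ∀ l k → Diff l k → ∀ s →
    Z E B ((l , k) ∷ os) false false (s ℤ.- + 1) ⊕ tP ⊗ Z E B ((l , k) ∷ os) true true (s ℤ.- (c ℤ.+ + 1)) ≋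
    tP ⊗ Z E' B ((l , k) ∷ os) true true (S l k ℤ.- (s ℤ.- + 1)) ⊕ Z E' B ((l , k) ∷ os) false false (S l k ℤ.- (s ℤ.- (c ℤ.+ + 1)))
  step₂ l .l eq s = Eq.r₂ l s
  step₂ l .(suc l) up₁ s =
    ≋-trans (⊕-cong (≋-trans (A.ex00-up l (s ℤ.- + 1)) (⊗-cong ≋-refl (≋-trans (A.a≡ (m1 s (+ l) c)) (R₃ IH _))))
                    (⊗-cong ≋-refl (≋-trans (A.ex11-up l (s ℤ.- (c ℤ.+ + 1))) (⊗-cong ≋-refl (R₃ IH _)))))
    (≋-trans (swp _ _)
    (≋-sym (⊕-cong (⊗-cong ≋-refl (≋-trans (K.ex11-up l (S l (suc l) ℤ.- (s ℤ.- + 1)))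
                      (⊗-cong ≋-refl (b≡ (trans (e4 (s ℤ.- + 1) (+ l) c t') (cong (λ z → t' ℤ.- z) (m1 s (+ l) c)))))))
                   (≋-trans (K.ex00-up l (S l (suc l) ℤ.- (s ℤ.- (c ℤ.+ + 1)))) (⊗-cong ≋-refl (b≡ (e5 (s ℤ.- (c ℤ.+ + 1)) (+ l) c t')))))))
  step₂ .(suc k) k down₁ s =
    ≋-trans (⊕-cong (≋-trans (A.ex00-down k (s ℤ.- + 1)) (≋-trans (A.a≡ (m1 s (+ k) c)) (R₄ IH _)))
                    (⊗-cong ≋-refl (≋-trans (A.ex11-down k (s ℤ.- (c ℤ.+ + 1))) (R₄ IH _))))
    (≋-trans (⊕-comm _ _)
    (≋-sym (⊕-cong (⊗-cong ≋-refl (≋-trans (K.ex11-down k (S (suc k) k ℤ.- (s ℤ.- + 1)))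
                      (b≡ (trans (e4' (s ℤ.- + 1) (+ k) c t') (cong (λ z → t' ℤ.- z) (m1 s (+ k) c))))))
                   (≋-trans (K.ex00-down k (S (suc k) k ℤ.- (s ℤ.- (c ℤ.+ + 1)))) (b≡ (e5' (s ℤ.- (c ℤ.+ + 1)) (+ k) c t'))))))
  step₂ l k up₂ s = zz (A.ex00-none l k _ h) (tz (A.ex11-none l k _ h)) (tz (K.ex11-none l k _ h)) (K.ex00-none l k _ h)
    where h = inj₁ ℕₚ.≤-refl
  step₂ l k down₂ s = zz (A.ex00-none l k _ h) (tz (A.ex11-none l k _ h)) (tz (K.ex11-none l k _ h)) (K.ex00-none l k _ h)
    where h = inj₂ ℕₚ.≤-refl
  step₂ l k (far-up g) s = zz (A.ex00-none l k _ h) (tz (A.ex11-none l k _ h)) (tz (K.ex11-none l k _ h)) (K.ex00-none l k _ h)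
    where h = inj₁ (ℕₚ.≤-trans (ℕₚ.n≤1+n _) g)
  step₂ l k (far-down g) s = zz (A.ex00-none l k _ h) (tz (A.ex11-none l k _ h)) (tz (K.ex11-none l k _ h)) (K.ex00-none l k _ h)
    where h = inj₂ (ℕₚ.≤-trans (ℕₚ.n≤1+n _) g)

  step₃ : ∀ l k → Diff l k → ∀ s → Z E B ((l , k) ∷ os) true false s ≋ Z E' B ((l , k) ∷ os) true false (S l k ℤ.- s)
  step₃ l .l eq s = ≋-trans (A.ex10-eq l s) (≋-trans (R₃ IH _)
    (≋-sym (≋-trans (K.ex10-eq l (S l l ℤ.- s)) (b≡ (e1 s (+ l) c t')))))
  step₃ .(suc k) k down₁ s = ≋-trans (A.ex10-down₁ k s) (≋-trans (⊕-comm _ _) (≋-trans (R₁ IH _)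
    (≋-trans (⊕-comm _ _) (≋-sym (≋-trans (K.ex10-down₁ k (S (suc k) k ℤ.- s)) (≋-trans (⊕-comm _ _)
      (⊕-cong (b≡ (e4' s (+ k) c t')) (b≡ (e5' s (+ k) c t')))))))))
  step₃ .(suc (suc k)) k down₂ s = ≋-trans (A.ex10-down₂ k s) (≋-trans (R₄ IH _)
    (≋-sym (≋-trans (K.ex10-down₂ k (S (suc (suc k)) k ℤ.- s)) (b≡ (e6' s (+ k) c t')))))
  step₃ l .(suc l) up₁ s = ≋-trans (A.ex10-none l (suc l) _ (inj₁ ℕₚ.≤-refl)) (≋-sym (K.ex10-none l (suc l) _ (inj₁ ℕₚ.≤-refl)))
  step₃ l k up₂ s = ≋-trans (A.ex10-none l k _ (inj₁ (ℕₚ.n≤1+n _))) (≋-sym (K.ex10-none l k _ (inj₁ (ℕₚ.n≤1+n _))))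
  step₃ l k (far-up g) s = ≋-trans (A.ex10-none l k _ h) (≋-sym (K.ex10-none l k _ h))
    where h = inj₁ (ℕₚ.≤-trans (ℕₚ.≤-trans (ℕₚ.n≤1+n _) (ℕₚ.n≤1+n _)) g)
  step₃ l k (far-down g) s = ≋-trans (A.ex10-none l k _ (inj₂ g)) (≋-sym (K.ex10-none l k _ (inj₂ g)))

  private
    fct : ∀ w x y → w ⊗ x ⊕ w ⊗ y ≋ w ⊗ (x ⊕ y)
    fct w x y = ≋-sym (⊗-distribˡ w x y)

  step₄ : ∀ l k → Diff l k → ∀ s → Z E B ((l , k) ∷ os) false true s ≋ Z E' B ((l , k) ∷ os) false true (S l k ℤ.- s)
  step₄ l .l eq s = ≋-trans (A.ex01-eq l s) (≋-trans (R₄ IH _)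
    (≋-sym (≋-trans (K.ex01-eq l (S l l ℤ.- s)) (b≡ (e1 s (+ l) c t')))))
  step₄ l .(suc l) up₁ s = ≋-trans (A.ex01-up₁ l s) (≋-trans (fct _ _ _) (≋-trans (⊗-cong ≋-refl (≋-trans (R₁ IH _) (⊕-comm _ _)))
    (≋-sym (≋-trans (K.ex01-up₁ l (S l (suc l) ℤ.- s)) (≋-trans (fct _ _ _)
      (⊗-cong ≋-refl (⊕-cong (b≡ (e4 s (+ l) c t')) (b≡ (e5 s (+ l) c t')))))))))
  step₄ l .(suc (suc l)) up₂ s = ≋-trans (A.ex01-up₂ l s) (≋-trans (⊗-cong ≋-refl (R₃ IH _))
    (≋-sym (≋-trans (K.ex01-up₂ l (S l (suc (suc l)) ℤ.- s)) (⊗-cong ≋-refl (b≡ (e6 s (+ l) c t'))))))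
  step₄ .(suc k) k down₁ s = ≋-trans (A.ex01-none (suc k) k _ (inj₁ ℕₚ.≤-refl)) (≋-sym (K.ex01-none (suc k) k _ (inj₁ ℕₚ.≤-refl)))
  step₄ l k down₂ s = ≋-trans (A.ex01-none l k _ (inj₁ (ℕₚ.n≤1+n _))) (≋-sym (K.ex01-none l k _ (inj₁ (ℕₚ.n≤1+n _))))
  step₄ l k (far-down g) s = ≋-trans (A.ex01-none l k _ h) (≋-sym (K.ex01-none l k _ h))
    where h = inj₁ (ℕₚ.≤-trans (ℕₚ.≤-trans (ℕₚ.n≤1+n _) (ℕₚ.n≤1+n _)) g)
  step₄ l k (far-up g) s = ≋-trans (A.ex01-none l k _ (inj₂ g)) (≋-sym (K.ex01-none l k _ (inj₂ g)))

  step : ∀ l k → Intertwined E E' B ((l , k) ∷ os)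
  step l k = record
    { R₁ = λ s → subst (λ x → Z E B ((l , k) ∷ os) false false s ⊕ Z E B ((l , k) ∷ os) true true (s ℤ.- x) ≋
        Z E' B ((l , k) ∷ os) true true (S l k ℤ.- s) ⊕ Z E' B ((l , k) ∷ os) false false (S l k ℤ.- (s ℤ.- x)))
        (sym (c₁ {l} {k})) (step₁ l k (diff l k) s)
    ; R₂ = λ s → subst (λ x → Z E B ((l , k) ∷ os) false false (s ℤ.- + 1) ⊕ tP ⊗ Z E B ((l , k) ∷ os) true true (s ℤ.- x) ≋
        tP ⊗ Z E' B ((l , k) ∷ os) true true (S l k ℤ.- (s ℤ.- + 1)) ⊕ Z E' B ((l , k) ∷ os) false false (S l k ℤ.- (s ℤ.- x)))
        (sym (c₁ {l} {k})) (step₂ l k (diff l k) s)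
    ; R₃ = step₃ l k (diff l k)
    ; R₄ = step₄ l k (diff l k) }

intertwined : ∀ {E E' B} → Intertwined E E' B [] → ∀ os → Intertwined E E' B os
intertwined base [] = base
intertwined {E} {E'} {B} base ((l , k) ∷ os) = Step.step E E' B os (intertwined base os) l k

-- The sum over all rows as a run of the transfer process

range : ℤ → ℕ → List ℤ
range B zero = []
range B (suc H) = (B ℤ.+ + H) ∷ range B H

range-below : ∀ B H → Below (B ℤ.+ + H) (range B H)
range-below B zero = []
range-below B (suc H) = lt ∷ All.map (λ h → ℤₚ.<-trans h lt) (range-below B H)
  where
  lt : B ℤ.+ + H ℤ.< B ℤ.+ + suc H
  lt = ℤₚ.+-monoʳ-< B (ℤ.+<+ (ℕₚ.n<1+n H))

∈-range : ∀ B H c → B ℤ.≤ c → c ℤ.< B ℤ.+ + H → c ∈ range B H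
∈-range B zero c le lt = ⊥-elim (ℤₚ.<⇒≱ lt (ℤₚ.≤-trans (ℤₚ.≤-reflexive (ℤₚ.+-identityʳ B)) le))
∈-range B (suc H) c le lt with c ℤ.≟ B ℤ.+ + H
... | yes e = here e
... | no ne = there (∈-range B H c le (ℤₚ.≤∧≢⇒< (≤-by c (B ℤ.+ + H) (<⇒+1≤ lt) (lem B (+ H) c)) ne))
  where
  lem : ∀ B H c → B ℤ.+ H ℤ.- c ≡ B ℤ.+ (+ 1 ℤ.+ H) ℤ.- (c ℤ.+ + 1)
  lem = solve-∀

∈-range⁻ : ∀ B H {c} → c ∈ range B H → B ℤ.≤ c × c ℤ.< B ℤ.+ + H
∈-range⁻ B (suc H) (here refl) = ℤₚ.≤-trans (ℤₚ.≤-reflexive (sym (ℤₚ.+-identityʳ B))) (ℤₚ.+-monoʳ-≤ B (ℤ.+≤+ ℕ.z≤n)) , ℤₚ.+-monoʳ-< B (ℤ.+<+ (ℕₚ.n<1+n H))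
∈-range⁻ B (suc H) (there i) = let (a , b) = ∈-range⁻ B H i in a , ℤₚ.<-trans b (ℤₚ.+-monoʳ-< B (ℤ.+<+ (ℕₚ.n<1+n H)))

range-unique : ∀ B H → Unique (range B H)
range-unique B zero = []
range-unique B (suc H) = All.map (λ h e → ℤₚ.<-irrefl (sym e) h) (range-below B H) ∷ range-unique B H

ΣN : ℕ → (ℕ → Poly) → Poly
ΣN zero ψ = ψ 0
ΣN (suc p) ψ = ψ (suc p) ⊕ ΣN p ψ

ΣN-cong : ∀ p {ψ ψ'} → (∀ m → ψ m ≋ ψ' m) → ΣN p ψ ≋ ΣN p ψ'
ΣN-cong zero h = h 0
ΣN-cong (suc p) h = ⊕-cong (h (suc p)) (ΣN-cong p h)

ΣN-suc : ∀ p ψ → ΣN (suc p) ψ ≋ ΣN p (ψ ∘ suc) ⊕ ψ 0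
ΣN-suc zero ψ = ≋-refl
ΣN-suc (suc p) ψ = ≋-trans (⊕-cong ≋-refl (ΣN-suc p ψ)) (≋-sym (⊕-assoc _ _ _))

opaque
  unfolding _⊕_
  ⊕-interchange : ∀ a b c d → (a ⊕ b) ⊕ (c ⊕ d) ≋ (a ⊕ c) ⊕ (b ⊕ d)
  ⊕-interchange = RingSolver.solve-∀ polyACR

ΣN-⊕ : ∀ p ψ ψ' → ΣN p (λ m → ψ m ⊕ ψ' m) ≋ ΣN p ψ ⊕ ΣN p ψ'
ΣN-⊕ zero ψ ψ' = ≋-refl
ΣN-⊕ (suc p) ψ ψ' = ≋-trans (⊕-cong ≋-refl (ΣN-⊕ p ψ ψ')) (⊕-interchange _ _ _ _)

pick : ℕ → ℕ → (ℕ → Poly) → Poly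
pick p a ψ = if ⌊ a ℕ.≤? p ⌋ then ψ a else []

ΣN-pick : ∀ p a ψ → (∀ m → m ≢ a → ψ m ≋ []) → ΣN p ψ ≋ pick p a ψ
ΣN-pick zero zero ψ h = ≋-refl
ΣN-pick zero (suc a) ψ h = h 0 λ ()
ΣN-pick (suc p) a ψ h with suc p ℕ.≟ a
ΣN-pick (suc p) a ψ h | yes refl with suc p ℕ.≤? suc p
... | yes _ = ≋-trans (⊕-cong ≋-refl (≋-trans (ΣN-pick p (suc p) ψ h) off)) (⊕-identityʳ _)
  where
  off : pick p (suc p) ψ ≋ []
  off with suc p ℕ.≤? p
  ... | yes le = ⊥-elim (ℕₚ.1+n≰n le)
  ... | no _ = ≋-refl
... | no ne = ⊥-elim (ne ℕₚ.≤-refl)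
ΣN-pick (suc p) a ψ h | no ne = ≋-trans (⊕-cong (h (suc p) ne) (ΣN-pick p a ψ h)) (≋-trans (⊕-identityˡ _) same)
  where
  same : pick p a ψ ≋ pick (suc p) a ψ
  same with a ℕ.≤? p | a ℕ.≤? suc p
  ... | yes _ | yes _ = ≋-refl
  ... | no _ | no _ = ≋-refl
  ... | yes le | no nle = ⊥-elim (nle (ℕₚ.m≤n⇒m≤1+n le))
  ... | no nle | yes le = ⊥-elim (nle (ℕₚ.≤-pred (ℕₚ.≤∧≢⇒< le λ e → ne (sym e))))

ΣN-pick₂ : ∀ p a ψ → (∀ m → m ≢ a → m ≢ suc a → ψ m ≋ []) → ΣN p ψ ≋ pick p a ψ ⊕ pick p (suc a) ψ
ΣN-pick₂ p a ψ h =
  ≋-trans (ΣN-cong p split)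
  (≋-trans (ΣN-⊕ p (only a) rest)
  (⊕-cong (≋-trans (ΣN-pick p a (only a) (only-off a)) (pick-cong a {only a} (only-on a)))
          (≋-trans (ΣN-pick p (suc a) rest rest-off) (pick-cong (suc a) {rest} rest-on))))
  where
  only : ℕ → ℕ → Poly
  only b m = if ⌊ m ℕ.≟ b ⌋ then ψ m else []
  rest : ℕ → Poly
  rest m = if ⌊ m ℕ.≟ a ⌋ then [] else ψ m
  only-off : ∀ b m → m ≢ b → only b m ≋ []
  only-off b m ne with m ℕ.≟ b
  ... | yes e = ⊥-elim (ne e)
  ... | no _ = ≋-refl
  only-on : ∀ b → only b b ≋ ψ b
  only-on b with b ℕ.≟ b
  ... | yes e = ≋-refl
  ... | no ne = ⊥-elim (ne refl)
  rest-off : ∀ m → m ≢ suc a → rest m ≋ []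
  rest-off m ne with m ℕ.≟ a
  ... | yes _ = ≋-refl
  ... | no ne' = h m ne' ne
  rest-on : rest (suc a) ≋ ψ (suc a)
  rest-on with suc a ℕ.≟ a
  ... | yes e = ⊥-elim (ℕₚ.1+n≢n e)
  ... | no _ = ≋-refl
  split : ∀ m → ψ m ≋ only a m ⊕ rest m
  split m with m ℕ.≟ a
  ... | yes _ = ≋-sym (⊕-identityʳ _)
  ... | no _ = ≋-sym (⊕-identityˡ _)
  pick-cong : ∀ b {χ} → χ b ≋ ψ b → pick p b χ ≋ pick p b ψ
  pick-cong b e with b ℕ.≤? p
  ... | yes _ = e
  ... | no _ = ≋-refl

box-scale : ∀ cs p w φ → box cs p (λ x → w ⊗ φ x) ≋ w ⊗ box cs p φ
box-scale cs zero w φ = ≋-refl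
box-scale cs (suc p) w φ = go cs
  where
  go : ∀ cs' → ΣP cs' (λ c → box cs p λ xs → w ⊗ φ (c ∷ xs)) ≋ w ⊗ ΣP cs' (λ c → box cs p λ xs → φ (c ∷ xs))
  go [] = ≋-sym (⊗-zeroʳ w)
  go (c ∷ cs') = ≋-trans (⊕-cong (box-scale cs p w λ xs → φ (c ∷ xs)) (go cs')) (≋-sym (⊗-distribˡ w _ _))

box-drop-top : ∀ c cs p φ → (∀ xs → c ∈ xs → φ xs ≋ []) → box (c ∷ cs) p φ ≋ box cs p φ
box-drop-top c cs zero φ h = ≋-refl
box-drop-top c cs (suc p) φ h =
  ≋-trans (⊕-cong (box-zero (c ∷ cs) p λ xs _ _ → h (c ∷ xs) (here refl))
                  (ΣP-cong cs λ x _ → box-drop-top c cs p (λ xs → φ (x ∷ xs)) λ xs i → h (x ∷ xs) (there i)))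
          (⊕-identityˡ _)

-- Sorts the lists by the number `m` of leading copies of `c`. The hypothesis discards every list in
-- which `c` reappears after another value, so that the remaining entries come from `cs`.
box-peel : ∀ c cs p φ → (∀ pre x rest → x ∈ cs → c ∈ rest → φ (pre ++ x ∷ rest) ≋ []) →
  box (c ∷ cs) p φ ≋ ΣN p λ m → box cs (p ℕ.∸ m) λ xs → φ (rep m c ++ xs)
box-peel c cs zero φ h = ≋-refl
box-peel c cs (suc p) φ h =
  ≋-trans (⊕-cong (box-peel c cs p (λ xs → φ (c ∷ xs)) (λ pre x rest i j → h (c ∷ pre) x rest i j))
                  (ΣP-cong cs λ x i → box-drop-top c cs p (λ xs → φ (x ∷ xs)) λ xs j → h [] x xs i j))
          (≋-sym (ΣN-suc p _))

b2n : Bool → ℕ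
b2n false = 0
b2n true = 1

-- Bookkeeping of lengths: it is what ties the final state of the process to the lengths of the
-- rows.
tr-balance : ∀ j l m {j₁} → tr j l m ≡ just j₁ → m ℕ.+ b2n j ≡ l ℕ.+ b2n j₁
tr-balance false zero zero refl = refl
tr-balance true zero zero refl = refl
tr-balance false zero (suc zero) refl = refl
tr-balance true (suc zero) zero refl = refl
tr-balance false (suc l) (suc m) e = cong suc (tr-balance false l m e)
tr-balance true (suc l) (suc m) e = cong suc (tr-balance true l m e)

tr-false-other : ∀ l m → m ≢ l → m ≢ suc l → tr false l m ≡ nothing
tr-false-other zero zero n₁ n₂ = ⊥-elim (n₁ refl)
tr-false-other zero (suc zero) n₁ n₂ = ⊥-elim (n₂ refl)
tr-false-other zero (suc (suc m)) n₁ n₂ = refl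
tr-false-other (suc l) zero n₁ n₂ = refl
tr-false-other (suc l) (suc m) n₁ n₂ = tr-false-other l m (n₁ ∘ cong suc) (n₂ ∘ cong suc)

tr-true-other : ∀ l m → m ≢ l → suc m ≢ l → tr true l m ≡ nothing
tr-true-other zero zero n₁ n₂ = ⊥-elim (n₁ refl)
tr-true-other zero (suc m) n₁ n₂ = refl
tr-true-other (suc zero) zero n₁ n₂ = ⊥-elim (n₂ refl)
tr-true-other (suc (suc l)) zero n₁ n₂ = refl
tr-true-other (suc l) (suc m) n₁ n₂ = tr-true-other l m (n₁ ∘ cong suc) (n₂ ∘ cong suc)

valsL valsR : ℤ → Occ → List ℤ
valsL B [] = []
valsL B ((l , k) ∷ os) = rep l (site B os) ++ valsL B os
valsR B [] = []
valsR B ((l , k) ∷ os) = rep k (site B os) ++ valsR B os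

rep-below : ∀ {c d} m → c ℤ.< d → Below d (rep m c)
rep-below zero lt = []
rep-below (suc m) lt = lt ∷ rep-below m lt

++-All : ∀ {P : ℤ → Set} {xs ys} → All P xs → All P ys → All P (xs ++ ys)
++-All [] q = q
++-All (p ∷ ps) q = p ∷ ++-All ps q

site-lt : ∀ B l k os → site B os ℤ.< site B ((l , k) ∷ os)
site-lt B l k os = ℤₚ.+-monoʳ-< B (ℤ.+<+ (ℕₚ.n<1+n (length os)))

valsL-below : ∀ B os → Below (site B os) (valsL B os)
valsL-below B [] = []
valsL-below B ((l , k) ∷ os) = ++-All (rep-below l (site-lt B l k os)) (All.map (λ h → ℤₚ.<-trans h (site-lt B l k os)) (valsL-below B os))

valsR-below : ∀ B os → Below (site B os) (valsR B os)
valsR-below B [] = []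
valsR-below B ((l , k) ∷ os) = ++-All (rep-below k (site-lt B l k os)) (All.map (λ h → ℤₚ.<-trans h (site-lt B l k os)) (valsR-below B os))

sum-vals : ∀ B os → tot B os ≡ sumℤ (valsL B os) ℤ.+ sumℤ (valsR B os)
sum-vals B [] = refl
sum-vals B ((l , k) ∷ os) =
  trans (cong (λ z → (+ l ℤ.+ + k) ℤ.* site B os ℤ.+ z) (sum-vals B os))
  (trans (lem (+ l) (+ k) (site B os) (sumℤ (valsL B os)) (sumℤ (valsR B os)))
         (sym (cong₂ ℤ._+_ (sum-rep l (site B os) (valsL B os)) (sum-rep k (site B os) (valsR B os)))))
  where
  lem : ∀ l k c x y → (l ℤ.+ k) ℤ.* c ℤ.+ (x ℤ.+ y) ≡ (l ℤ.* c ℤ.+ x) ℤ.+ (k ℤ.* c ℤ.+ y)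
  lem = solve-∀

rowSum : Bool → Bool → List ℤ → List ℤ → ℤ → List ℤ → Poly
rowSum j j' L N s x = δ s (sumℤ x) ⊗ G j j' L N x

δ-shift : ∀ s m c x → δ s (sumℤ (rep m c ++ x)) ≡ δ (s ℤ.- + m ℤ.* c) (sumℤ x)
δ-shift s m c x = cong chi (bool-ext
  (λ e → ==ℤ-complete (trans (cong (ℤ._- + m ℤ.* c) (trans (==ℤ-sound e) (sum-rep m c x))) (l₁ (+ m ℤ.* c) (sumℤ x))))
  (λ e → ==ℤ-complete (trans (l₂ s (+ m ℤ.* c)) (trans (cong (λ z → + m ℤ.* c ℤ.+ z) (==ℤ-sound e)) (sym (sum-rep m c x))))))
  where
  l₁ : ∀ a b → a ℤ.+ b ℤ.- a ≡ b
  l₁ = solve-∀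
  l₂ : ∀ s a → s ≡ a ℤ.+ (s ℤ.- a)
  l₂ = solve-∀

opaque
  unfolding _⊕_
  shuffle : ∀ d h f g u v → d ⊗ (h ⊗ ((f ⊗ u) ⊗ (g ⊗ v))) ≋ (f ⊗ g) ⊗ (d ⊗ (h ⊗ (u ⊗ v)))
  shuffle = RingSolver.solve-∀ polyACR

chi-zero : ∀ {b} p → b ≡ false → chi b ⊗ p ≋ []
chi-zero p refl = ⊗-zeroˡ p

rowSum-peel : ∀ j j' c l k m L N s x → Below c L → Below c N → Below c x →
  rowSum j j' (rep l c ++ L) (rep k c ++ N) s (rep m c ++ x) ≋
  onJust (tr j l m) (λ j₁ → onJust (tr j' k m) (λ j₁' → (fac l m ⊗ fac m k) ⊗ rowSum j₁ j₁' L N (s ℤ.- + m ℤ.* c) x) []) []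
rowSum-peel j j' c l k m L N s x bL bN bx
  rewrite ilj-peel j c m l bx bL | ilj-peel j' c m k bx bN with tr j l m | tr j' k m
... | nothing | _ = ≋-trans (⊗-cong ≋-refl (⊗-zeroˡ _)) (⊗-zeroʳ _)
... | just j₁ | nothing = ≋-trans (⊗-cong ≋-refl (chi-zero _ (∧-zeroʳ _))) (⊗-zeroʳ _)
... | just j₁ | just j₁' =
  ≋-trans (⊗-cong (≋-reflexive (δ-shift s m c x))
            (⊗-cong ≋-refl (⊗-cong (wt-peel c l m L x bL bx) (wt-peel c m k x N bx bN))))
          (shuffle _ _ _ _ _ _)

Desc-split-bad : ∀ pre x rest {c} → x ℤ.< c → c ∈ rest → ¬ Desc (pre ++ x ∷ rest)
Desc-split-bad [] x rest lt i (d , _) = ℤₚ.<⇒≱ lt (All.lookup d i)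
Desc-split-bad (p ∷ pre) x rest lt i (_ , d) = Desc-split-bad pre x rest lt i d

G-zero : ∀ j j' L N x → ¬ (ilj j x L ≡ true × ilj j' x N ≡ true) → G j j' L N x ≋ []
G-zero j j' L N x h = chi-zero _ (lem (bool-case (ilj j x L ∧ ilj j' x N)))
  where
  lem : (ilj j x L ∧ ilj j' x N) ≡ true ⊎ (ilj j x L ∧ ilj j' x N) ≡ false → (ilj j x L ∧ ilj j' x N) ≡ false
  lem (inj₁ e) = ⊥-elim (h (∧-true e))
  lem (inj₂ e) = e

rowSum-zero : ∀ j j' L N s x → ¬ (ilj j x L ≡ true × ilj j' x N ≡ true) → rowSum j j' L N s x ≋ []
rowSum-zero j j' L N s x h = ≋-trans (⊗-cong ≋-refl (G-zero j j' L N x h)) (⊗-zeroʳ _)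

endAt : Bool → Bool → Ends
endAt e e' j j' s = chi (⌊ j Data.Bool.≟ e ⌋ ∧ ⌊ j' Data.Bool.≟ e' ⌋) ⊗ δ s (+ 0)

-- In state `true` the upper row is ahead and has to supply an entry before the state can become
-- `false`; without entries left it stays `true`, and the end condition rejects it.
Z-dead : ∀ B os e' j' s → length (valsL B os) ≡ 0 → Z (endAt false e') B os true j' s ≋ []
Z-dead B [] e' j' s _ = ≋-trans (≋-reflexive (Z-[] _ B true j' s)) (⊗-zeroˡ _)
Z-dead B ((zero , k) ∷ os) e' j' s h =
  ≋-trans (≋-reflexive (Z-true _ B 0 k os j' s))
  (≋-trans (⊕-cong (≋-trans (≋-reflexive (stepZ-def _ B 0 k os j' 0 true s)) step) (≋-reflexive (downZ-zero _ B k os j' s))) (⊕-identityˡ []))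
  where
  step : onJust (tr j' k 0) (λ j₁' → (fac 0 0 ⊗ fac 0 k) ⊗ Z (endAt false e') B os true j₁' (s ℤ.- + 0 ℤ.* site B os)) [] ≋ []
  step with tr j' k 0
  ... | nothing = ≋-refl
  ... | just j₁' = ≋-trans (⊗-cong ≋-refl (Z-dead B os e' j₁' _ h)) (⊗-zeroʳ _)

-- Induction over the values, the largest being split off by `box-peel`. By `tr-balance` the two
-- length equations persist, and at the end they say precisely that the states reached are `e` and
-- `e'`.
box≋Z : ∀ B os e e' j j' p s →
  p ℕ.+ b2n j ≡ length (valsL B os) ℕ.+ b2n e → p ℕ.+ b2n j' ≡ length (valsR B os) ℕ.+ b2n e' →
  box (range B (length os)) p (rowSum j j' (valsL B os) (valsR B os) s) ≋ Z (endAt e e') B os j j' s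
box≋Z B [] e e' j j' zero s h h' = ≋-trans
    (⊗-cong ≋-refl (≋-trans (⊗-cong (≋-reflexive (cong chi (cong₂ _∧_ (il0 j) (il0 j')))) (⊗-identityˡ _)) (⊗-identityˡ _)))
    (≋-trans (⊗-comm _ _) (≋-sym (≋-trans (≋-reflexive (Z-[] (endAt e e') B j j' s)) (ends j e j' e' h h'))))
  where
  il0 : ∀ j → ilj j [] [] ≡ true
  il0 false = refl
  il0 true = refl
  ends : ∀ j e j' e' → b2n j ≡ b2n e → b2n j' ≡ b2n e' → endAt e e' j j' s ≋ oneP ⊗ δ s (+ 0)
  ends false false false false _ _ = ≋-refl
  ends false false true true _ _ = ≋-refl
  ends true true false false _ _ = ≋-refl
  ends true true true true _ _ = ≋-refl
box≋Z B [] e e' j j' (suc p) s h h' = ≋-sym (≋-trans (≋-reflexive (Z-[] (endAt e e') B j j' s)) (dead j e h))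
  where
  dead : ∀ j e → suc p ℕ.+ b2n j ≡ b2n e → endAt e e' j j' s ≋ []
  dead false true _ = ⊗-zeroˡ _
  dead true true q = ⊥-elim (ℕₚ.1+n≢0 (ℕₚ.suc-injective (trans (sym (ℕₚ.+-suc (suc p) 0)) q)))
box≋Z B ((l , k) ∷ os) e e' j j' p s h h' =
  ≋-trans (box-peel c cs p (rowSum j j' (rep l c ++ L) (rep k c ++ N) s) bad)
          (finish j refl)
  where
  c = site B os
  cs = range B (length os)
  L = valsL B os
  N = valsR B os
  E = endAt e e'
  ψ : ℕ → Poly
  ψ m = box cs (p ℕ.∸ m) λ xs → rowSum j j' (rep l c ++ L) (rep k c ++ N) s (rep m c ++ xs)
  bad : ∀ pre x rest → x ∈ cs → c ∈ rest → rowSum j j' (rep l c ++ L) (rep k c ++ N) s (pre ++ x ∷ rest) ≋ []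
  bad pre x rest i i' = rowSum-zero j j' _ _ s _ λ { (q , _) →
    Desc-split-bad pre x rest (All.lookup (range-below B (length os)) i) i' (proj₁ (ilj-desc j (pre ++ x ∷ rest) (rep l c ++ L) q)) }
  len : ∀ l xs → length (rep l c ++ xs) ≡ l ℕ.+ length xs
  len l xs = trans (length-++ (rep l c)) (cong (ℕ._+ length xs) (length-replicate l))
  below : ∀ {q} xs → length xs ≡ q → All (_∈ cs) xs → Below c xs
  below xs _ a = All.map (All.lookup (range-below B (length os))) a
  ψ-none : ∀ m → tr j l m ≡ nothing → ψ m ≋ []
  ψ-none m q = box-zero cs (p ℕ.∸ m) λ xs le a →
    ≋-trans (rowSum-peel j j' c l k m L N s xs (valsL-below B os) (valsR-below B os) (below xs le a))
            (≋-reflexive (cong (λ z → onJust z (λ j₁ → onJust (tr j' k m) (λ j₁' → (fac l m ⊗ fac m k) ⊗ rowSum j₁ j₁' L N (s ℤ.- + m ℤ.* c) xs) []) []) q))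
  arith : ∀ {m} {x y n a d} → m ℕ.≤ p → p ℕ.+ x ≡ a ℕ.+ n ℕ.+ d → m ℕ.+ x ≡ a ℕ.+ y → (p ℕ.∸ m) ℕ.+ y ≡ n ℕ.+ d
  arith {m} {x} {y} {n} {a} {d} le q r = ℕₚ.+-cancelˡ-≡ (m ℕ.+ a) _ _ (begin
    m ℕ.+ a ℕ.+ ((p ℕ.∸ m) ℕ.+ y)   ≡⟨ lem₁ m a (p ℕ.∸ m) y ⟩
    (p ℕ.∸ m ℕ.+ m) ℕ.+ (a ℕ.+ y)   ≡⟨ cong₂ ℕ._+_ (ℕₚ.m∸n+n≡m le) (sym r) ⟩
    p ℕ.+ (m ℕ.+ x)                 ≡⟨ lem₂ p m x ⟩
    m ℕ.+ (p ℕ.+ x)                 ≡⟨ cong (m ℕ.+_) q ⟩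
    m ℕ.+ (a ℕ.+ n ℕ.+ d)           ≡⟨ lem₃ m a n d ⟩
    m ℕ.+ a ℕ.+ (n ℕ.+ d)           ∎)
    where
    open ≡-Reasoning
    lem₁ : ∀ m a q y → m ℕ.+ a ℕ.+ (q ℕ.+ y) ≡ (q ℕ.+ m) ℕ.+ (a ℕ.+ y)
    lem₁ = ℕS.solve-∀
    lem₂ : ∀ p m x → p ℕ.+ (m ℕ.+ x) ≡ m ℕ.+ (p ℕ.+ x)
    lem₂ = ℕS.solve-∀
    lem₃ : ∀ m a n d → m ℕ.+ (a ℕ.+ n ℕ.+ d) ≡ m ℕ.+ a ℕ.+ (n ℕ.+ d)
    lem₃ = ℕS.solve-∀
  hl : p ℕ.+ b2n j ≡ l ℕ.+ length L ℕ.+ b2n e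
  hl = trans h (cong (ℕ._+ b2n e) (len l L))
  hk : p ℕ.+ b2n j' ≡ k ℕ.+ length N ℕ.+ b2n e'
  hk = trans h' (cong (ℕ._+ b2n e') (len k N))
  term : ∀ m j₁ → tr j l m ≡ just j₁ → pick p m ψ ≋ stepZ E B l k os j' m j₁ s
  term m j₁ q with m ℕ.≤? p
  ... | yes le = ≋-trans (box-cong cs (p ℕ.∸ m) λ xs e a →
            ≋-trans (rowSum-peel j j' c l k m L N s xs (valsL-below B os) (valsR-below B os) (below xs e a))
              (≋-reflexive (cong (λ z → onJust z (λ j₁ → onJust (tr j' k m) (λ j₁' → (fac l m ⊗ fac m k) ⊗ rowSum j₁ j₁' L N (s ℤ.- + m ℤ.* c) xs) []) []) q)))
          (≋-trans (inner (tr j' k m) refl) (≋-reflexive (sym (stepZ-def E B l k os j' m j₁ s))))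
    where
    inner : ∀ r → tr j' k m ≡ r →
      box cs (p ℕ.∸ m) (λ xs → onJust r (λ j₁' → (fac l m ⊗ fac m k) ⊗ rowSum j₁ j₁' L N (s ℤ.- + m ℤ.* c) xs) []) ≋
      onJust r (λ j₁' → (fac l m ⊗ fac m k) ⊗ Z E B os j₁ j₁' (s ℤ.- + m ℤ.* c)) []
    inner nothing q' = box-zero cs (p ℕ.∸ m) λ _ _ _ → ≋-refl
    inner (just j₁') q' = ≋-trans (box-scale cs (p ℕ.∸ m) _ _)
      (⊗-cong ≋-refl (box≋Z B os e e' j₁ j₁' (p ℕ.∸ m) _
        (arith le hl (tr-balance j l m q)) (arith le hk (tr-balance j' k m q'))))
  ... | no nle = ≋-sym (≋-trans (≋-reflexive (stepZ-def E B l k os j' m j₁ s)) (outer (tr j' k m)))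
    where
    -- more copies of c than entries left: the remaining state is a dead end
    lt : suc p ℕ.+ length L ℕ.+ b2n e ℕ.≤ p ℕ.+ b2n j₁
    lt = ℕₚ.≤-trans (ℕₚ.+-monoˡ-≤ (b2n e) (ℕₚ.+-monoˡ-≤ (length L) (ℕₚ.≰⇒> nle)))
      (ℕₚ.≤-reflexive (ℕₚ.+-cancelˡ-≡ l _ _ (begin
        l ℕ.+ (m ℕ.+ length L ℕ.+ b2n e) ≡⟨ lem₁ l m (length L) (b2n e) ⟩
        m ℕ.+ (l ℕ.+ length L ℕ.+ b2n e) ≡⟨ cong (m ℕ.+_) (sym hl) ⟩
        m ℕ.+ (p ℕ.+ b2n j)              ≡⟨ lem₂ m p (b2n j) ⟩
        p ℕ.+ (m ℕ.+ b2n j)              ≡⟨ cong (p ℕ.+_) (tr-balance j l m q) ⟩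
        p ℕ.+ (l ℕ.+ b2n j₁)             ≡⟨ lem₂ p l (b2n j₁) ⟩
        l ℕ.+ (p ℕ.+ b2n j₁)             ∎)))
      where
      open ≡-Reasoning
      lem₁ : ∀ l m x y → l ℕ.+ (m ℕ.+ x ℕ.+ y) ≡ m ℕ.+ (l ℕ.+ x ℕ.+ y)
      lem₁ = ℕS.solve-∀
      lem₂ : ∀ m p x → m ℕ.+ (p ℕ.+ x) ≡ p ℕ.+ (m ℕ.+ x)
      lem₂ = ℕS.solve-∀
    lt' : suc (length L ℕ.+ b2n e) ℕ.≤ b2n j₁
    lt' = ℕₚ.+-cancelˡ-≤ p _ _ (ℕₚ.≤-trans (ℕₚ.≤-reflexive (lem p (length L) (b2n e))) lt)
      where
      lem : ∀ p x y → p ℕ.+ (1 ℕ.+ (x ℕ.+ y)) ≡ 1 ℕ.+ p ℕ.+ x ℕ.+ y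
      lem = ℕS.solve-∀
    zeroZ : ∀ j₁ e → suc (length L ℕ.+ b2n e) ℕ.≤ b2n j₁ → ∀ j₁' x → Z (endAt e e') B os j₁ j₁' x ≋ []
    zeroZ true false (ℕ.s≤s le) j₁' x = Z-dead B os e' j₁' x (ℕₚ.n≤0⇒n≡0 (ℕₚ.≤-trans (ℕₚ.m≤m+n _ _) le))
    zeroZ true true (ℕ.s≤s le) j₁' x = ⊥-elim (ℕₚ.1+n≰n (ℕₚ.≤-trans (ℕₚ.m≤n+m 1 (length L)) le))
    outer : ∀ r → onJust r (λ j₁' → (fac l m ⊗ fac m k) ⊗ Z E B os j₁ j₁' (s ℤ.- + m ℤ.* c)) [] ≋ []
    outer nothing = ≋-refl
    outer (just j₁') = ≋-trans (⊗-cong ≋-refl (zeroZ j₁ e lt' j₁' _)) (⊗-zeroʳ _)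
  finish : ∀ i → i ≡ j → ΣN p ψ ≋ Z E B ((l , k) ∷ os) i j' s
  finish false refl = ≋-trans (ΣN-pick₂ p l ψ λ m n₁ n₂ → ψ-none m (tr-false-other l m n₁ n₂))
    (≋-trans (⊕-cong (term l false (tr-same false l)) (term (suc l) true (tr-up l)))
             (≋-reflexive (sym (Z-false E B l k os j' s))))
  finish true refl = ≋-trans (down l refl) (≋-reflexive (sym (Z-true E B l k os j' s)))
    where
    down : ∀ l₀ → l₀ ≡ l → ΣN p ψ ≋ stepZ E B l k os j' l true s ⊕ downZ E B l k os j' s
    down zero refl = ≋-trans (ΣN-pick p 0 ψ λ m n → ψ-none m (tr-true-other 0 m n λ ()))
      (≋-trans (term 0 true refl) (≋-sym (≋-trans (⊕-cong ≋-refl (≋-reflexive (downZ-zero E B k os j' s))) (⊕-identityʳ _))))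
    down (suc l₀) refl = ≋-trans (ΣN-pick₂ p l₀ ψ λ m n₁ n₂ → ψ-none m (tr-true-other (suc l₀) m n₂ (n₁ ∘ ℕₚ.suc-injective)))
      (≋-trans (⊕-comm _ _)
      (⊕-cong (term (suc l₀) true (tr-same true (suc l₀)))
              (≋-trans (term l₀ false (tr-down l₀)) (≋-reflexive (sym (downZ-suc E B l₀ k os j' s))))))

ΣP-⊕ : ∀ {A : Set} (cs : List A) f g → ΣP cs (λ c → f c ⊕ g c) ≋ ΣP cs f ⊕ ΣP cs g
ΣP-⊕ [] f g = ≋-sym (⊕-identityˡ [])
ΣP-⊕ (c ∷ cs) f g = ≋-trans (⊕-cong ≋-refl (ΣP-⊕ cs f g)) (⊕-interchange _ _ _ _)

ΣP-scale : ∀ {A : Set} (cs : List A) w f → ΣP cs (λ c → w ⊗ f c) ≋ w ⊗ ΣP cs f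
ΣP-scale [] w f = ≋-sym (⊗-zeroʳ w)
ΣP-scale (c ∷ cs) w f = ≋-trans (⊕-cong ≋-refl (ΣP-scale cs w f)) (≋-sym (⊗-distribˡ w _ _))

-- Combinations of end conditions

Comb : Set
Comb = List (Poly × Ends × ℤ)

comb : Comb → Ends
comb cs j j' s = ΣP cs λ { (w , E , a) → w ⊗ E j j' (s ℤ.- a) }

private
  swap-⊗ : ∀ f w z → f ⊗ (w ⊗ z) ≋ w ⊗ (f ⊗ z)
  swap-⊗ f w z = ≋-trans (≋-sym (⊗-assoc f w z)) (≋-trans (⊗-cong (⊗-comm f w) ≋-refl) (⊗-assoc w f z))
  arg-swap : ∀ s a b → s ℤ.- a ℤ.- b ≡ s ℤ.- b ℤ.- a
  arg-swap = solve-∀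

-- The process is linear in its end condition, and a shift of the remaining sum commutes with every
-- step, so that it may as well be applied at the start.
Z-comb : ∀ cs B os j j' s → Z (comb cs) B os j j' s ≋ ΣP cs λ { (w , E , a) → w ⊗ Z E B os j j' (s ℤ.- a) }
stepZ-comb : ∀ cs B l k os j' m j₁ s → stepZ (comb cs) B l k os j' m j₁ s ≋ ΣP cs λ { (w , E , a) → w ⊗ stepZ E B l k os j' m j₁ (s ℤ.- a) }
downZ-comb : ∀ cs B l k os j' s → downZ (comb cs) B l k os j' s ≋ ΣP cs λ { (w , E , a) → w ⊗ downZ E B l k os j' (s ℤ.- a) }
Z-comb cs B [] j j' s = ≋-trans (≋-reflexive (Z-[] (comb cs) B j j' s))
  (ΣP-cong cs λ { (w , E , a) _ → ⊗-cong ≋-refl (≋-reflexive (sym (Z-[] E B j j' (s ℤ.- a)))) })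
Z-comb cs B ((l , k) ∷ os) false j' s =
  ≋-trans (≋-reflexive (Z-false (comb cs) B l k os j' s))
  (≋-trans (⊕-cong (stepZ-comb cs B l k os j' l false s) (stepZ-comb cs B l k os j' (suc l) true s))
  (≋-trans (≋-sym (ΣP-⊕ cs _ _))
  (ΣP-cong cs λ { (w , E , a) _ → ≋-trans (≋-sym (⊗-distribˡ w _ _)) (⊗-cong ≋-refl (≋-reflexive (sym (Z-false E B l k os j' (s ℤ.- a))))) })))
Z-comb cs B ((l , k) ∷ os) true j' s =
  ≋-trans (≋-reflexive (Z-true (comb cs) B l k os j' s))
  (≋-trans (⊕-cong (stepZ-comb cs B l k os j' l true s) (downZ-comb cs B l k os j' s))
  (≋-trans (≋-sym (ΣP-⊕ cs _ _))
  (ΣP-cong cs λ { (w , E , a) _ → ≋-trans (≋-sym (⊗-distribˡ w _ _)) (⊗-cong ≋-refl (≋-reflexive (sym (Z-true E B l k os j' (s ℤ.- a))))) })))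
stepZ-comb cs B l k os j' m j₁ s =
  ≋-trans (≋-reflexive (stepZ-def (comb cs) B l k os j' m j₁ s))
  (≋-trans (lem (tr j' k m) λ j₁' → Z-comb cs B os j₁ j₁' (s ℤ.- + m ℤ.* site B os))
  (ΣP-cong cs λ { (w , E , a) _ → ⊗-cong ≋-refl (≋-reflexive (sym (stepZ-def E B l k os j' m j₁ (s ℤ.- a)))) }))
  where
  f = fac l m ⊗ fac m k
  x = + m ℤ.* site B os
  lem : ∀ r → (∀ j₁' → Z (comb cs) B os j₁ j₁' (s ℤ.- x) ≋ ΣP cs λ { (w , E , a) → w ⊗ Z E B os j₁ j₁' (s ℤ.- x ℤ.- a) }) →
    onJust r (λ j₁' → f ⊗ Z (comb cs) B os j₁ j₁' (s ℤ.- x)) [] ≋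
    ΣP cs λ { (w , E , a) → w ⊗ onJust r (λ j₁' → f ⊗ Z E B os j₁ j₁' (s ℤ.- a ℤ.- x)) [] }
  lem nothing h = ≋-sym (ΣP-zero cs λ { (w , E , a) _ → ⊗-zeroʳ w })
  lem (just j₁') h = ≋-trans (⊗-cong ≋-refl (h j₁')) (≋-trans (≋-sym (ΣP-scale cs f _))
    (ΣP-cong cs λ { (w , E , a) _ → ≋-trans (swap-⊗ f w _)
      (⊗-cong ≋-refl (⊗-cong ≋-refl (≋-reflexive (cong (Z E B os j₁ j₁') (arg-swap s x a))))) }))
downZ-comb cs B zero k os j' s = ≋-trans (≋-reflexive (downZ-zero (comb cs) B k os j' s))
  (≋-sym (ΣP-zero cs λ { (w , E , a) _ → ≋-trans (⊗-cong ≋-refl (≋-reflexive (downZ-zero E B k os j' (s ℤ.- a)))) (⊗-zeroʳ w) }))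
downZ-comb cs B (suc l) k os j' s = ≋-trans (≋-reflexive (downZ-suc (comb cs) B l k os j' s))
  (≋-trans (stepZ-comb cs B (suc l) k os j' l false s)
  (ΣP-cong cs λ { (w , E , a) _ → ⊗-cong ≋-refl (≋-reflexive (sym (downZ-suc E B l k os j' (s ℤ.- a)))) }))

-- A row unbounded below is cut off at B; Eζ is the combination of
-- end conditions for which the cut-off does not show, i.e. the eigenvector of
-- the transfer through values that occur in neither fixed row.
E₀ E₁ E₁₀ : Ends
E₀ = endAt false false
E₁ = endAt true true
E₁₀ = endAt true false

cζ : ℤ → Comb
cζ B = (oneP , E₁ , + 1) ∷ (⊖ oneP , E₁ , + 0) ∷ (oneP ⊝ tP , E₀ , B) ∷ []

-- The end condition facing `cζ` on the reflected side: what `R₁` gives when no value is left and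
-- the (true, true) component is set to zero.
cκ : Comb
cκ = (oneP , E₀ , ℤ.- + 1) ∷ (⊖ tP , E₀ , + 0) ∷ []

δ-eq : ∀ {x y} → x ≡ y → δ x (+ 0) ≋ δ y (+ 0)
δ-eq refl = ≋-refl

δ-neg : ∀ x y → y ≡ ℤ.- x → δ x (+ 0) ≋ δ y (+ 0)
δ-neg x y refl = ≋-reflexive (cong chi (bool-ext
  (λ e → ==ℤ-complete (cong ℤ.-_ (==ℤ-sound e)))
  (λ e → ==ℤ-complete (trans (sym (ℤₚ.neg-involutive x)) (cong ℤ.-_ (==ℤ-sound e))))))

opaque
  unfolding _⊕_

  base-alg₁ : ∀ x₁ x₂ d₀ d₁ x₃ y₁ y₂ →
    (oneP ⊗ ([] ⊗ x₁) ⊕ (⊖ oneP ⊗ ([] ⊗ x₂) ⊕ ((oneP ⊝ tP) ⊗ (oneP ⊗ d₀) ⊕ []))) ⊕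
    (oneP ⊗ (oneP ⊗ d₁) ⊕ (⊖ oneP ⊗ (oneP ⊗ d₀) ⊕ ((oneP ⊝ tP) ⊗ ([] ⊗ x₃) ⊕ []))) ≋
    (oneP ⊗ ([] ⊗ y₁) ⊕ (⊖ tP ⊗ ([] ⊗ y₂) ⊕ [])) ⊕ (oneP ⊗ (oneP ⊗ d₁) ⊕ (⊖ tP ⊗ (oneP ⊗ d₀) ⊕ []))
  base-alg₁ = go tP
    where
    go : ∀ t x₁ x₂ d₀ d₁ x₃ y₁ y₂ →
      (oneP ⊗ ([] ⊗ x₁) ⊕ (⊖ oneP ⊗ ([] ⊗ x₂) ⊕ ((oneP ⊝ t) ⊗ (oneP ⊗ d₀) ⊕ []))) ⊕
      (oneP ⊗ (oneP ⊗ d₁) ⊕ (⊖ oneP ⊗ (oneP ⊗ d₀) ⊕ ((oneP ⊝ t) ⊗ ([] ⊗ x₃) ⊕ []))) ≋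
      (oneP ⊗ ([] ⊗ y₁) ⊕ (⊖ t ⊗ ([] ⊗ y₂) ⊕ [])) ⊕ (oneP ⊗ (oneP ⊗ d₁) ⊕ (⊖ t ⊗ (oneP ⊗ d₀) ⊕ []))
    go = RingSolver.solve-∀ polyACR

  base-alg₂ : ∀ x₁ x₂ d₀ d₁ x₃ y₁ y₂ →
    (oneP ⊗ ([] ⊗ x₁) ⊕ (⊖ oneP ⊗ ([] ⊗ x₂) ⊕ ((oneP ⊝ tP) ⊗ (oneP ⊗ d₁) ⊕ []))) ⊕
    tP ⊗ (oneP ⊗ (oneP ⊗ d₁) ⊕ (⊖ oneP ⊗ (oneP ⊗ d₀) ⊕ ((oneP ⊝ tP) ⊗ ([] ⊗ x₃) ⊕ []))) ≋
    tP ⊗ (oneP ⊗ ([] ⊗ y₁) ⊕ (⊖ tP ⊗ ([] ⊗ y₂) ⊕ [])) ⊕ (oneP ⊗ (oneP ⊗ d₁) ⊕ (⊖ tP ⊗ (oneP ⊗ d₀) ⊕ []))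
  base-alg₂ = go tP
    where
    go : ∀ t x₁ x₂ d₀ d₁ x₃ y₁ y₂ →
      (oneP ⊗ ([] ⊗ x₁) ⊕ (⊖ oneP ⊗ ([] ⊗ x₂) ⊕ ((oneP ⊝ t) ⊗ (oneP ⊗ d₁) ⊕ []))) ⊕
      t ⊗ (oneP ⊗ (oneP ⊗ d₁) ⊕ (⊖ oneP ⊗ (oneP ⊗ d₀) ⊕ ((oneP ⊝ t) ⊗ ([] ⊗ x₃) ⊕ []))) ≋
      t ⊗ (oneP ⊗ ([] ⊗ y₁) ⊕ (⊖ t ⊗ ([] ⊗ y₂) ⊕ [])) ⊕ (oneP ⊗ (oneP ⊗ d₁) ⊕ (⊖ t ⊗ (oneP ⊗ d₀) ⊕ []))
    go = RingSolver.solve-∀ polyACR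

  base-alg₃ : ∀ x₁ x₂ x₃ y₁ y₂ →
    oneP ⊗ ([] ⊗ x₁) ⊕ (⊖ oneP ⊗ ([] ⊗ x₂) ⊕ ((oneP ⊝ tP) ⊗ ([] ⊗ x₃) ⊕ [])) ≋
    oneP ⊗ ([] ⊗ y₁) ⊕ (⊖ tP ⊗ ([] ⊗ y₂) ⊕ [])
  base-alg₃ = go tP
    where
    go : ∀ t x₁ x₂ x₃ y₁ y₂ →
      oneP ⊗ ([] ⊗ x₁) ⊕ (⊖ oneP ⊗ ([] ⊗ x₂) ⊕ ((oneP ⊝ t) ⊗ ([] ⊗ x₃) ⊕ [])) ≋
      oneP ⊗ ([] ⊗ y₁) ⊕ (⊖ t ⊗ ([] ⊗ y₂) ⊕ [])
    go = RingSolver.solve-∀ polyACR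

module Base (B : ℤ) where
  c = site B []

  Zn : ∀ E j j' s → Z E B [] j j' s ≋ E j j' s
  Zn E j j' s = ≋-reflexive (Z-[] E B j j' s)

  -- The coefficients of `cζ` are tuned for this. In `R₁` the terms at `s = B` add up to
  -- `(1 - t) - 1 = - t`, in `R₂` the terms at `s = B + 1` to `(1 - t) + t = 1`, as `cκ` demands.
  open-end : Intertwined (comb (cζ B)) (comb cκ) B []
  open-end = record
    { R₁ = λ s → ≋-trans (⊕-cong (Zn _ _ _ s) (Zn _ _ _ (s ℤ.- c)))
        (≋-trans (≋-trans (⊕-cong (⊕-cong ≋-refl (⊕-cong ≋-refl (⊕-cong (⊗-cong ≋-refl (⊗-cong ≋-refl (δ-eq (q₀ s B)))) ≋-refl))) ≋-refl)
                          (base-alg₁ _ _ _ _ _ _ _))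
        (≋-sym (⊕-cong (Zn _ _ _ (+ 0 ℤ.- s)) (≋-trans (Zn _ _ _ (+ 0 ℤ.- (s ℤ.- c)))
          (⊕-cong (⊗-cong ≋-refl (⊗-cong ≋-refl (≋-sym (δ-neg (s ℤ.- c ℤ.- + 1) _ (q₁ (s ℤ.- c))))))
            (⊕-cong (⊗-cong ≋-refl (⊗-cong ≋-refl (≋-sym (δ-neg (s ℤ.- c ℤ.- + 0) _ (q₂ (s ℤ.- c)))))) ≋-refl))))))
    ; R₂ = λ s → ≋-trans (⊕-cong (Zn _ _ _ (s ℤ.- + 1)) (⊗-cong ≋-refl (Zn _ _ _ (s ℤ.- c))))
        (≋-trans (≋-trans (⊕-cong (⊕-cong ≋-refl (⊕-cong ≋-refl (⊕-cong (⊗-cong ≋-refl (⊗-cong ≋-refl (δ-eq (q₃ s B)))) ≋-refl))) ≋-refl)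
                          (base-alg₂ _ _ _ _ _ _ _))
        (≋-sym (⊕-cong (⊗-cong ≋-refl (Zn _ _ _ (+ 0 ℤ.- (s ℤ.- + 1)))) (≋-trans (Zn _ _ _ (+ 0 ℤ.- (s ℤ.- c)))
          (⊕-cong (⊗-cong ≋-refl (⊗-cong ≋-refl (≋-sym (δ-neg (s ℤ.- c ℤ.- + 1) _ (q₁ (s ℤ.- c))))))
            (⊕-cong (⊗-cong ≋-refl (⊗-cong ≋-refl (≋-sym (δ-neg (s ℤ.- c ℤ.- + 0) _ (q₂ (s ℤ.- c)))))) ≋-refl))))))
    ; R₃ = λ s → ≋-trans (Zn _ _ _ s) (≋-trans (base-alg₃ _ _ _ _ _) (≋-sym (Zn _ _ _ (+ 0 ℤ.- s))))
    ; R₄ = λ s → ≋-trans (Zn _ _ _ s) (≋-trans (base-alg₃ _ _ _ _ _) (≋-sym (Zn _ _ _ (+ 0 ℤ.- s)))) }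
    where
    q₀ : ∀ s B → s ℤ.- B ≡ s ℤ.- (B ℤ.+ + 0) ℤ.- + 0
    q₀ = solve-∀
    q₁ : ∀ u → + 0 ℤ.- u ℤ.- (ℤ.- + 1) ≡ ℤ.- (u ℤ.- + 1)
    q₁ = solve-∀
    q₂ : ∀ u → + 0 ℤ.- u ℤ.- + 0 ≡ ℤ.- (u ℤ.- + 0)
    q₂ = solve-∀
    q₃ : ∀ s B → s ℤ.- + 1 ℤ.- B ≡ s ℤ.- (B ℤ.+ + 0) ℤ.- + 1
    q₃ = solve-∀

  closed-end : Intertwined E₁₀ E₁₀ B []
  closed-end = record
    { R₁ = λ s → ≋-trans (⊕-cong (z (Zn E₁₀ false false s)) (z (Zn E₁₀ true true _)))
                 (≋-sym (⊕-cong (z (Zn E₁₀ true true _)) (z (Zn E₁₀ false false _))))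
    ; R₂ = λ s → ≋-trans (⊕-cong (z (Zn E₁₀ false false _)) (tz (z (Zn E₁₀ true true _))))
                 (≋-sym (⊕-cong (tz (z (Zn E₁₀ true true _))) (z (Zn E₁₀ false false _))))
    ; R₃ = λ s → ≋-trans (Zn E₁₀ true false s) (≋-trans (⊗-cong ≋-refl (δ-neg s (+ 0 ℤ.- s) (ℤₚ.+-identityˡ (ℤ.- s)))) (≋-sym (Zn E₁₀ true false _)))
    ; R₄ = λ s → ≋-trans (z (Zn E₁₀ false true s)) (≋-sym (z (Zn E₁₀ false true _))) }
    where
    z : ∀ {p d} → p ≋ [] ⊗ d → p ≋ []
    z e = ≋-trans e (⊗-zeroˡ _)
    tz : ∀ {p} → p ≋ [] → tP ⊗ p ≋ []
    tz e = ≋-trans (⊗-cong ≋-refl e) (⊗-zeroʳ tP)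

opaque
  unfolding _⊕_
  left-alg : ∀ U U₁ P → (U ⊕ (oneP ⊝ tP) ⊗ P) ⊝ U₁ ≋ (U ⊕ P) ⊝ (U₁ ⊕ tP ⊗ P)
  left-alg = go tP
    where
    go : ∀ t U U₁ P → (U ⊕ (oneP ⊝ t) ⊗ P) ⊝ U₁ ≋ (U ⊕ P) ⊝ (U₁ ⊕ t ⊗ P)
    go = RingSolver.solve-∀ polyACR
  left-alg' : ∀ Q Q₁ V → (Q ⊕ V) ⊝ (tP ⊗ Q₁ ⊕ V) ≋ Q ⊝ tP ⊗ Q₁
  left-alg' = go tP
    where
    go : ∀ t Q Q₁ V → (Q ⊕ V) ⊝ (t ⊗ Q₁ ⊕ V) ≋ Q ⊝ t ⊗ Q₁
    go = RingSolver.solve-∀ polyACR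

-- A row unbounded above: compare cut-offs at two successive values.
left-open : ∀ {E E' B os} → Intertwined E E' B os → ∀ s →
  Z E B ((0 , 0) ∷ os) false false s ⊝ Z E B os false false (s ℤ.- + 1) ≋
  Z E' B os true true (tot B os ℤ.- s) ⊝ tP ⊗ Z E' B os true true (tot B os ℤ.- (s ℤ.- + 1))
left-open {E} {E'} {B} {os} I s =
  ≋-trans (⊝-cong (≋-trans (A.ex00-eq 0 s) (⊕-cong (A.a≡ (e₁ s c)) (⊗-cong omt1 (A.a≡ (e₂ s c))))) ≋-refl)
  (≋-trans (left-alg _ _ _)
  (≋-trans (⊝-cong (Intertwined.R₁ I s) (Intertwined.R₂ I s)) (left-alg' _ _ _)))
  where
  module A = Expand E B os
  c = site B os
  e₁ : ∀ s c → s ℤ.- + 0 ℤ.* c ≡ s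
  e₁ = solve-∀
  e₂ : ∀ s c → s ℤ.- + 0 ℤ.* c ℤ.- c ≡ s ℤ.- c
  e₂ = solve-∀
  omt1 : omt 1 ≋ oneP ⊝ tP
  omt1 = ≋-trans (oneMinusTPow≋ 1) (⊝-cong ≋-refl (⊗-identityʳ tP))

-- The reflection identities for the three exchanges

In : ℤ → ℕ → List ℤ → Set
In B H = All (λ x → B ℤ.≤ x × x ℤ.< B ℤ.+ + H)

occupation : ∀ B H L N → Desc L → Desc N → In B H L → In B H N →
  ∃ λ os → length os ≡ H × valsL B os ≡ L × valsR B os ≡ N
occupation B zero [] [] dL dN iL iN = [] , refl , refl , refl
occupation B zero (x ∷ L) N dL dN ((a , b) ∷ iL) iN = ⊥-elim (ℤₚ.<⇒≱ b (ℤₚ.≤-trans (ℤₚ.≤-reflexive (ℤₚ.+-identityʳ B)) a))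
occupation B zero [] (x ∷ N) dL dN iL ((a , b) ∷ iN) = ⊥-elim (ℤₚ.<⇒≱ b (ℤₚ.≤-trans (ℤₚ.≤-reflexive (ℤₚ.+-identityʳ B)) a))
occupation B (suc H) L N dL dN iL iN
  with Desc-split (B ℤ.+ + H) L dL (All.map (λ p → below (proj₂ p)) iL) | Desc-split (B ℤ.+ + H) N dN (All.map (λ p → below (proj₂ p)) iN)
  where
  below : ∀ {x} → x ℤ.< B ℤ.+ + suc H → x ℤ.≤ B ℤ.+ + H
  below {x} lt = ≤-by x (B ℤ.+ + H) (<⇒+1≤ lt) (lem B (+ H) x)
    where
    lem : ∀ B H x → B ℤ.+ H ℤ.- x ≡ B ℤ.+ (+ 1 ℤ.+ H) ℤ.- (x ℤ.+ + 1)
    lem = solve-∀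
... | l , L' , refl , bL , dL' | k , N' , refl , bN , dN'
  with occupation B H L' N' dL' dN' (restrict l L' bL iL) (restrict k N' bN iN)
  where
  drop : ∀ {P : ℤ → Set} l {c xs} → All P (rep l c ++ xs) → All P xs
  drop zero a = a
  drop (suc l) (_ ∷ a) = drop l a
  zip : ∀ {xs} → In B (suc H) xs → Below (B ℤ.+ + H) xs → In B H xs
  zip [] [] = []
  zip ((a , _) ∷ as) (b ∷ bs) = (a , b) ∷ zip as bs
  restrict : ∀ l L' → Below (B ℤ.+ + H) L' → In B (suc H) (rep l (B ℤ.+ + H) ++ L') → In B H L'
  restrict l L' b i = zip (drop l i) b
... | os , refl , refl , refl = (l , k) ∷ os , refl , refl , refl

desc? : ∀ xs → Dec (Desc xs)
desc? [] = yes _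
desc? (x ∷ xs) with All.all? (ℤ._≤? x) xs | desc? xs
... | yes a | yes b = yes (a , b)
... | no a | _ = no λ p → a (proj₁ p)
... | _ | no b = no λ p → b (proj₂ p)

module Flip (L N : List ℤ) (B : ℤ) where

  bx : ℕ → ℕ → Bool → Bool → ℤ → Poly
  bx H p j j' s = box (range B H) p (rowSum j j' L N s)

  tt : ℤ
  tt = sumℤ L ℤ.+ sumℤ N

  bad : ¬ (Desc L × Desc N) → ∀ H p j j' s → bx H p j j' s ≋ []
  bad n H p j j' s = box-zero (range B H) p λ xs _ _ → rowSum-zero j j' L N s xs
    λ { (a , b) → n (proj₂ (ilj-desc j xs L a) , proj₂ (ilj-desc j' xs N b)) }

opaque
  unfolding _⊕_
  open-alg : ∀ u₁ v₁ u₂ v₂ u₃ v₃ t →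
    (oneP ⊗ u₁ ⊕ (⊖ oneP ⊗ u₂ ⊕ ((oneP ⊝ t) ⊗ u₃ ⊕ []))) ⊝ (oneP ⊗ v₁ ⊕ (⊖ oneP ⊗ v₂ ⊕ ((oneP ⊝ t) ⊗ v₃ ⊕ []))) ≋
    (u₁ ⊝ v₁) ⊝ (u₂ ⊝ v₂) ⊕ (oneP ⊝ t) ⊗ (u₃ ⊝ v₃)
  open-alg = RingSolver.solve-∀ polyACR
  open-alg' : ∀ u₁ u₂ u₃ t → oneP ⊗ u₁ ⊕ (⊖ oneP ⊗ u₂ ⊕ ((oneP ⊝ t) ⊗ u₃ ⊕ [])) ≋ u₁ ⊝ u₂ ⊕ (oneP ⊝ t) ⊗ u₃
  open-alg' = RingSolver.solve-∀ polyACR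
  κ-alg : ∀ u v t → oneP ⊗ u ⊕ (⊖ t ⊗ v ⊕ []) ≋ u ⊝ t ⊗ v
  κ-alg = RingSolver.solve-∀ polyACR
  all-zero₁ : ∀ t → ([] ⊝ []) ⊝ ([] ⊝ []) ⊕ (oneP ⊝ t) ⊗ ([] ⊝ []) ≋ ([] ⊝ t ⊗ []) ⊝ t ⊗ ([] ⊝ t ⊗ [])
  all-zero₁ = RingSolver.solve-∀ polyACR
  all-zero₂ : ∀ t → [] ⊝ [] ⊕ (oneP ⊝ t) ⊗ [] ≋ [] ⊝ t ⊗ []
  all-zero₂ = RingSolver.solve-∀ polyACR
  all-zero₃ : ∀ t → [] ⊝ [] ≋ [] ⊝ t ⊗ []
  all-zero₃ = RingSolver.solve-∀ polyACR

RowFn : Set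
RowFn = ℕ → ℕ → Bool → Bool → ℤ → Poly

-- The letter is the move exchanged with `D`; on the left is the middle row of `D` followed by that
-- move, on the right the reflected middle row of the opposite order. In DA the row is unbounded on
-- both sides, in DB below, in DC above. An unbounded top shows as a difference of the cut-offs
-- `suc H` and `H`, an unbounded bottom as the three terms of `cζ`.
FlipA FlipB FlipC : RowFn → ℤ → ℤ → ℕ → ℕ → ℤ → Set
FlipA b tt B H n s =
  (b (suc H) (suc (suc n)) false false (s ℤ.- + 1) ⊝ b H (suc (suc n)) false false (s ℤ.- + 1 ℤ.- + 1)) ⊝
  (b (suc H) (suc (suc n)) false false s ⊝ b H (suc (suc n)) false false (s ℤ.- + 1)) ⊕
  (oneP ⊝ tP) ⊗ (b (suc H) (suc n) false false (s ℤ.- B) ⊝ b H (suc n) false false (s ℤ.- B ℤ.- + 1)) ≋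
  (b H n true true (tt ℤ.- (s ℤ.- + 1)) ⊝ tP ⊗ b H n true true (tt ℤ.- s)) ⊝
  tP ⊗ (b H n true true (tt ℤ.- (s ℤ.- + 1 ℤ.- + 1)) ⊝ tP ⊗ b H n true true (tt ℤ.- (s ℤ.- + 1)))
FlipB b tt B H n s =
  b H (suc n) false true (s ℤ.- + 1) ⊝ b H (suc n) false true s ⊕ (oneP ⊝ tP) ⊗ b H n false true (s ℤ.- B) ≋
  b H n false true (tt ℤ.- (s ℤ.- + 1)) ⊝ tP ⊗ b H n false true (tt ℤ.- s)
FlipC b tt B H n s =
  b (suc H) (suc n) false false s ⊝ b H (suc n) false false (s ℤ.- + 1) ≋
  b H n true true (tt ℤ.- s) ⊝ tP ⊗ b H n true true (tt ℤ.- (s ℤ.- + 1))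

-- The identities are wanted for arbitrary neighbouring lists. No row interlaces with a list that is
-- not descending, and then all the sums vanish.
module ZeroFlips (b : RowFn) (z : ∀ H p j j' s → b H p j j' s ≋ []) where
  zA : ∀ tt B H n s → FlipA b tt B H n s
  zA tt B H n s =
    ≋-trans (⊕-cong (⊝-cong (⊝-cong (z _ _ _ _ _) (z _ _ _ _ _)) (⊝-cong (z _ _ _ _ _) (z _ _ _ _ _)))
                    (⊗-cong ≋-refl (⊝-cong (z _ _ _ _ _) (z _ _ _ _ _))))
    (≋-trans (all-zero₁ tP) (≋-sym (⊝-cong (⊝-cong (z _ _ _ _ _) (⊗-cong ≋-refl (z _ _ _ _ _)))
      (⊗-cong ≋-refl (⊝-cong (z _ _ _ _ _) (⊗-cong ≋-refl (z _ _ _ _ _)))))))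
  zB : ∀ tt B H n s → FlipB b tt B H n s
  zB tt B H n s = ≋-trans (⊕-cong (⊝-cong (z _ _ _ _ _) (z _ _ _ _ _)) (⊗-cong ≋-refl (z _ _ _ _ _)))
    (≋-trans (all-zero₂ tP) (≋-sym (⊝-cong (z _ _ _ _ _) (⊗-cong ≋-refl (z _ _ _ _ _)))))
  zC : ∀ tt B H n s → FlipC b tt B H n s
  zC tt B H n s = ≋-trans (⊝-cong (z _ _ _ _ _) (z _ _ _ _ _)) (≋-trans (all-zero₃ tP) (≋-sym (⊝-cong (z _ _ _ _ _) (⊗-cong ≋-refl (z _ _ _ _ _)))))

module _ (L N : List ℤ) (B : ℤ) (H : ℕ) (iL : In B H L) (iN : In B H N) where
  open Flip L N B

  private
    arg₁ : ∀ t s → t ℤ.- s ℤ.- (ℤ.- + 1) ≡ t ℤ.- (s ℤ.- + 1)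
    arg₁ = solve-∀
    arg₀ : ∀ t s → t ℤ.- s ℤ.- + 0 ≡ t ℤ.- s
    arg₀ = solve-∀
    arg₀' : ∀ s → s ℤ.- + 0 ≡ s
    arg₀' = solve-∀
    arg-sw : ∀ s a → s ℤ.- + 1 ℤ.- a ≡ s ℤ.- a ℤ.- + 1
    arg-sw = solve-∀

  -- `N` bounds the row below, so the lengths force the process to end in (true, false) and
  -- `closed-end` is the base; the open top is handled by `left-open`.
  flipC : ∀ n → length L ≡ n → length N ≡ suc n → ∀ s → FlipC bx tt B H n s
  flipC n eL eN s with desc? L | desc? N
  ... | no d | _ = ZeroFlips.zC bx (bad (d ∘ proj₁)) tt B H n s
  ... | yes _ | no d = ZeroFlips.zC bx (bad (d ∘ proj₂)) tt B H n s
  ... | yes dL | yes dN with occupation B H L N dL dN iL iN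
  ... | os , refl , refl , refl =
    ≋-trans (⊝-cong (box≋Z B ((0 , 0) ∷ os) true false false false (suc n) s (u₁ eL) (u₂ eN))
                    (box≋Z B os true false false false (suc n) (s ℤ.- + 1) (u₁ eL) (u₂ eN)))
    (≋-trans (left-open (intertwined (Base.closed-end B) os) s)
    (≋-sym (⊝-cong (q s) (⊗-cong ≋-refl (q (s ℤ.- + 1))))))
    where
    u₁ : ∀ {l} → l ≡ n → suc n ℕ.+ 0 ≡ l ℕ.+ 1
    u₁ refl = trans (ℕₚ.+-identityʳ _) (ℕₚ.+-comm 1 n)
    u₂ : ∀ {l} → l ≡ suc n → suc n ℕ.+ 0 ≡ l ℕ.+ 0
    u₂ refl = refl
    q : ∀ s → bx H n true true (tt ℤ.- s) ≋ Z E₁₀ B os true true (tot B os ℤ.- s)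
    q s = ≋-trans (≋-reflexive (cong (λ z → bx H n true true (z ℤ.- s)) (sym (sum-vals B os))))
      (box≋Z B os true false true true n (tot B os ℤ.- s) (cong (ℕ._+ 1) (sym eL)) (trans (ℕₚ.+-comm n 1) (trans (sym eN) (sym (ℕₚ.+-identityʳ _)))))

  -- Both ends are open: `left-open` is applied to the end condition `cζ`, and linearity separates
  -- its three terms again.
  flipA : ∀ n → length L ≡ suc n → length N ≡ suc n → ∀ s → FlipA bx tt B H n s
  flipA n eL eN s with desc? L | desc? N
  ... | no d | _ = ZeroFlips.zA bx (bad (d ∘ proj₁)) tt B H n s
  ... | yes _ | no d = ZeroFlips.zA bx (bad (d ∘ proj₂)) tt B H n s
  ... | yes dL | yes dN with occupation B H L N dL dN iL iN
  ... | os , refl , refl , refl =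
    ≋-trans (⊕-cong (⊝-cong (⊝-cong (e1 ((0 , 0) ∷ os) eL eN (s ℤ.- + 1)) (≋-trans (e1 os eL eN (s ℤ.- + 1 ℤ.- + 1)) ≋-refl))
                            (⊝-cong (≋-trans (e1 ((0 , 0) ∷ os) eL eN s) (≋-reflexive (cong (Z E₁ B ((0 , 0) ∷ os) false false) (sym (arg₀' s)))))
                                    (≋-trans (e1 os eL eN (s ℤ.- + 1)) (≋-reflexive (cong (Z E₁ B os false false) (sym (arg₀' (s ℤ.- + 1))))))))
                    (⊗-cong ≋-refl (⊝-cong (e0 ((0 , 0) ∷ os) eL eN (s ℤ.- B))
                      (≋-trans (e0 os eL eN (s ℤ.- B ℤ.- + 1)) (≋-reflexive (cong (Z E₀ B os false false) (sym (arg-sw s B))))))))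
    (≋-trans (≋-sym (open-alg _ _ _ _ _ _ tP))
    (≋-trans (≋-sym (⊝-cong (Z-comb (cζ B) B ((0 , 0) ∷ os) false false s) (Z-comb (cζ B) B os false false (s ℤ.- + 1))))
    (≋-trans (left-open (intertwined (Base.open-end B) os) s)
             (⊝-cong (κ s) (⊗-cong ≋-refl (κ (s ℤ.- + 1)))))))
    where
    v₁ : ∀ {l} → l ≡ suc n → suc (suc n) ℕ.+ 0 ≡ l ℕ.+ 1
    v₁ refl = trans (ℕₚ.+-identityʳ _) (ℕₚ.+-comm 1 (suc n))
    v₀ : ∀ {l} → l ≡ suc n → suc n ℕ.+ 0 ≡ l ℕ.+ 0
    v₀ refl = refl
    e1 : ∀ os' → length (valsL B os') ≡ suc n → length (valsR B os') ≡ suc n → ∀ s →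
      box (range B (length os')) (suc (suc n)) (rowSum false false (valsL B os') (valsR B os') s) ≋ Z E₁ B os' false false s
    e1 os' p q s = box≋Z B os' true true false false (suc (suc n)) s (v₁ p) (v₁ q)
    e0 : ∀ os' → length (valsL B os') ≡ suc n → length (valsR B os') ≡ suc n → ∀ s →
      box (range B (length os')) (suc n) (rowSum false false (valsL B os') (valsR B os') s) ≋ Z E₀ B os' false false s
    e0 os' p q s = box≋Z B os' false false false false (suc n) s (v₀ p) (v₀ q)
    q0 : ∀ u → Z E₀ B os true true (tot B os ℤ.- u) ≋ bx H n true true (tt ℤ.- u)
    q0 u = ≋-sym (≋-trans (≋-reflexive (cong (λ z → bx H n true true (z ℤ.- u)) (sym (sum-vals B os))))
      (box≋Z B os false false true true n (tot B os ℤ.- u) (trans (ℕₚ.+-comm n 1) (trans (sym eL) (sym (ℕₚ.+-identityʳ _)))) (trans (ℕₚ.+-comm n 1) (trans (sym eN) (sym (ℕₚ.+-identityʳ _))))))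
    κ : ∀ u → Z (comb cκ) B os true true (tot B os ℤ.- u) ≋ bx H n true true (tt ℤ.- (u ℤ.- + 1)) ⊝ tP ⊗ bx H n true true (tt ℤ.- u)
    κ u = ≋-trans (Z-comb cκ B os true true (tot B os ℤ.- u))
      (≋-trans (κ-alg _ _ tP)
      (⊝-cong (≋-trans (≋-reflexive (cong (Z E₀ B os true true) (arg₁ (tot B os) u))) (q0 (u ℤ.- + 1)))
              (⊗-cong ≋-refl (≋-trans (≋-reflexive (cong (Z E₀ B os true true) (arg₀ (tot B os) u))) (q0 u)))))

  -- `N` bounds the row above, so the process starts in the unambiguous state (false, true), and
  -- `R₄` with the end condition `cζ` is already the claim.
  flipB : ∀ n → length L ≡ n → length N ≡ suc n → ∀ s → FlipB bx tt B H n s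
  flipB n eL eN s with desc? L | desc? N
  ... | no d | _ = ZeroFlips.zB bx (bad (d ∘ proj₁)) tt B H n s
  ... | yes _ | no d = ZeroFlips.zB bx (bad (d ∘ proj₂)) tt B H n s
  ... | yes dL | yes dN with occupation B H L N dL dN iL iN
  ... | os , refl , refl , refl =
    ≋-trans (⊕-cong (⊝-cong (e1 (s ℤ.- + 1)) (≋-trans (e1 s) (≋-reflexive (cong (Z E₁ B os false true) (sym (arg₀' s))))))
                    (⊗-cong ≋-refl (e0 (s ℤ.- B))))
    (≋-trans (≋-sym (open-alg' _ _ _ tP))
    (≋-trans (≋-sym (Z-comb (cζ B) B os false true s))
    (≋-trans (Intertwined.R₄ (intertwined (Base.open-end B) os) s)
    (≋-trans (Z-comb cκ B os false true (tot B os ℤ.- s))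
    (≋-trans (κ-alg _ _ tP)
    (⊝-cong (≋-trans (≋-reflexive (cong (Z E₀ B os false true) (arg₁ (tot B os) s))) (q0 (s ℤ.- + 1)))
            (⊗-cong ≋-refl (≋-trans (≋-reflexive (cong (Z E₀ B os false true) (arg₀ (tot B os) s))) (q0 s)))))))))
    where
    e1 : ∀ s → bx H (suc n) false true s ≋ Z E₁ B os false true s
    e1 s = box≋Z B os true true false true (suc n) s (v eL) (w eN)
      where
      v : ∀ {l} → l ≡ n → suc n ℕ.+ 0 ≡ l ℕ.+ 1
      v refl = trans (ℕₚ.+-identityʳ _) (ℕₚ.+-comm 1 n)
      w : ∀ {l} → l ≡ suc n → suc n ℕ.+ 1 ≡ l ℕ.+ 1
      w refl = refl
    e0 : ∀ s → bx H n false true s ≋ Z E₀ B os false true s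
    e0 s = box≋Z B os false false false true n s (v eL) (w eN)
      where
      v : ∀ {l} → l ≡ n → n ℕ.+ 0 ≡ l ℕ.+ 0
      v refl = refl
      w : ∀ {l} → l ≡ suc n → n ℕ.+ 1 ≡ l ℕ.+ 0
      w refl = trans (ℕₚ.+-comm n 1) (sym (ℕₚ.+-identityʳ _))
    q0 : ∀ u → Z E₀ B os false true (tot B os ℤ.- u) ≋ bx H n false true (tt ℤ.- u)
    q0 u = ≋-sym (≋-trans (≋-reflexive (cong (λ z → bx H n false true (z ℤ.- u)) (sym (sum-vals B os)))) (e0 (tot B os ℤ.- u)))

-- Supports, row sums and the fibres of the row projection

memV : List V → V → Bool
memV vs v = any (v ==V_) vs

any-sound : ∀ {A : Set} (P : A → Bool) xs → any P xs ≡ true → ∃ λ x → x ∈ xs × P x ≡ true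
any-sound P (x ∷ xs) e with bool-case (P x)
... | inj₁ q = x , here refl , q
... | inj₂ q rewrite q = let (y , i , r) = any-sound P xs e in y , there i , r

any-complete : ∀ {A : Set} (P : A → Bool) xs {x} → x ∈ xs → P x ≡ true → any P xs ≡ true
any-complete P (x ∷ xs) (here refl) q rewrite q = refl
any-complete P (x ∷ xs) (there i) q with P x
... | true = refl
... | false = any-complete P xs i q

==V-refl : ∀ v → (v ==V v) ≡ true
==V-refl v with v ≟V v
... | yes _ = refl
... | no ne = ⊥-elim (ne refl)

==V-sound : ∀ {u v} → (u ==V v) ≡ true → u ≡ v
==V-sound {u} {v} e with u ≟V v
... | yes p = p

memV-complete : ∀ {vs v} → v ∈ vs → memV vs v ≡ true
memV-complete {vs} {v} i = any-complete (v ==V_) vs i (==V-refl v)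

memV-sound : ∀ {vs v} → memV vs v ≡ true → v ∈ vs
memV-sound {vs} {v} e = let (u , i , q) = any-sound (v ==V_) vs e in subst (_∈ vs) (sym (==V-sound q)) i

offZ : (V → Bool) → Mono → Bool
offZ Q m = all (λ k → (expo m k ==ℤ + 0) ∨ Q k) (keys m)

offZ-sound : ∀ Q m → offZ Q m ≡ true → ∀ v → Q v ≡ false → expo m v ≡ + 0
offZ-sound Q m e v q with v ∈? keys m
... | no ni = expo-∉ m v ni
... | yes i with expo m v ==ℤ + 0 in r | all-sound (λ k → (expo m k ==ℤ + 0) ∨ Q k) (keys m) e i
... | true | _ = ==ℤ-sound r
... | false | s = ⊥-elim (true≢false s q)

offZ-complete : ∀ Q m → (∀ v → Q v ≡ false → expo m v ≡ + 0) → offZ Q m ≡ true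
offZ-complete Q m h = all-complete _ (keys m) λ {v} _ → go v
  where
  go : ∀ v → (expo m v ==ℤ + 0) ∨ Q v ≡ true
  go v with bool-case (Q v)
  ... | inj₁ q rewrite q = Data.Bool.Properties.∨-zeroʳ _
  ... | inj₂ q rewrite ==ℤ-complete (h v q) = refl

offZ-false : ∀ Q m → offZ Q m ≡ false → ∃ λ v → Q v ≡ false × expo m v ≢ + 0
offZ-false Q m e = go (keys m) e
  where
  go : ∀ ks → all (λ k → (expo m k ==ℤ + 0) ∨ Q k) ks ≡ false → ∃ λ v → Q v ≡ false × expo m v ≢ + 0
  go (k ∷ ks) e with expo m k ℤ.≟ + 0 | Q k in q
  ... | yes _ | _ = go ks e
  ... | no _ | true = go ks e
  ... | no ne | false = k , q , ne

rowIs : ℤ → V → ℤ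
rowIs i v = if row v ==ℤ i then + 1 else + 0

open Linear _≟V_ public using (lin; lin-cong; lin-++; lin-inv; lin-ext)

rowsum : ℤ → Mono → ℤ
rowsum i m = lin (rowIs i) m

offRow : ℤ → Mono → Mono
offRow i [] = []
offRow i ((v , e) ∷ m) = if row v ==ℤ i then offRow i m else (v , e) ∷ offRow i m

expo-offRow-on : ∀ i m v → row v ≡ i → expo (offRow i m) v ≡ + 0
expo-offRow-on i [] v q = refl
expo-offRow-on i ((w , e) ∷ m) v q with row w ℤ.≟ i
... | yes _ = expo-offRow-on i m v q
... | no ne = trans (expo-there {v} {w} e (offRow i m) (λ { refl → ne q })) (expo-offRow-on i m v q)

expo-offRow-off : ∀ i m v → row v ≢ i → expo (offRow i m) v ≡ expo m v
expo-offRow-off i [] v q = refl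
expo-offRow-off i ((w , e) ∷ m) v q with row w ℤ.≟ i
... | yes p = trans (expo-offRow-off i m v q) (sym (expo-there {v} {w} e m (λ { refl → q p })))
... | no _ = cong (λ z → (if ⌊ w ≟V v ⌋ then e else + 0) ℤ.+ z) (expo-offRow-off i m v q)

rowsum-offRow : ∀ i m → rowsum i (offRow i m) ≡ + 0
rowsum-offRow i [] = refl
rowsum-offRow i ((w , e) ∷ m) with row w ==ℤ i in q
... | true = rowsum-offRow i m
... | false rewrite q = trans (cong₂ ℤ._+_ (ℤₚ.*-zeroʳ e) (rowsum-offRow i m)) refl

vals : Mono → List V → List ℤ
vals m vs = map (expo m) vs

rowsum-place : ∀ i o vs xs → All (λ v → row v ≡ i) vs → length xs ≡ length vs → rowsum i (place o vs xs) ≡ sumℤ xs ℤ.+ rowsum i o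
rowsum-place i o [] [] a e = sym (ℤₚ.+-identityˡ _)
rowsum-place i o (v ∷ vs) (x ∷ xs) (refl ∷ a) e =
  trans (rowsum-place i ((v , x) ∷ o) vs xs a (ℕₚ.suc-injective e))
  (trans (cong (λ z → sumℤ xs ℤ.+ (x ℤ.* z ℤ.+ rowsum i o)) one) (lem x (sumℤ xs) (rowsum i o)))
  where
  one : rowIs i v ≡ + 1
  one rewrite ==ℤ-refl i = refl
  lem : ∀ x s r → s ℤ.+ (x ℤ.* + 1 ℤ.+ r) ≡ x ℤ.+ s ℤ.+ r
  lem = solve-∀

length-vals : ∀ m vs → length (vals m vs) ≡ length vs
length-vals m vs = Data.List.Properties.length-map (expo m) vs

vals-cong : ∀ m m' vs → (∀ {v} → v ∈ vs → expo m v ≡ expo m' v) → vals m vs ≡ vals m' vs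
vals-cong m m' [] h = refl
vals-cong m m' (v ∷ vs) h = cong₂ _∷_ (h (here refl)) (vals-cong m m' vs (h ∘ there))

replace-row : ∀ i m vs → All (λ v → row v ≡ i) vs → Unique vs → (∀ v → row v ≡ i → v ∉ vs → expo m v ≡ + 0) →
  m ≈ place (offRow i m) vs (vals m vs)
replace-row i m vs a u h = mk≈ go
  where
  o = offRow i m
  pl = map-expo-place o vs (vals m vs) u (length-vals m vs) λ {v} j → expo-offRow-on i m v (All.lookup a j)
  look : ∀ ws {v} → vals (place o vs (vals m vs)) ws ≡ vals m ws → v ∈ ws → expo (place o vs (vals m vs)) v ≡ expo m v
  look (w ∷ ws) e (here refl) = proj₁ (Data.List.Properties.∷-injective e)
  look (w ∷ ws) e (there j) = look ws (proj₂ (Data.List.Properties.∷-injective e)) j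
  go : ∀ v → expo m v ≡ expo (place o vs (vals m vs)) v
  go v with v ∈? vs
  ... | yes j = sym (look vs pl j)
  ... | no nj = sym (trans (expo-place-off o vs (vals m vs) v nj) (base v nj))
    where
    base : ∀ v → v ∉ vs → expo o v ≡ expo m v
    base v nj with row v ℤ.≟ i
    ... | yes q = trans (expo-offRow-on i m v q) (sym (h v q nj))
    ... | no q = expo-offRow-off i m v q

rowsum-vals : ∀ i m vs → All (λ v → row v ≡ i) vs → Unique vs → (∀ v → row v ≡ i → v ∉ vs → expo m v ≡ + 0) →
  rowsum i m ≡ sumℤ (vals m vs)
rowsum-vals i m vs a u h =
  trans (lin-cong (rowIs i) (replace-row i m vs a u h))
  (trans (rowsum-place i (offRow i m) vs (vals m vs) a (length-vals m vs))
  (trans (cong (λ z → sumℤ (vals m vs) ℤ.+ z) (rowsum-offRow i m)) (ℤₚ.+-identityʳ _)))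

module RowFibre (k c₀ : ℤ) where
  open RowReflection k c₀ public

  expo-π : ∀ m v → expo (π m) v ≡ lin (λ w → expo (φπ w) v) m
  expo-π m v = HT.expo-hom φπ m v

  lin-unit : ∀ v m → lin (λ w → expo ((w , + 1) ∷ []) v) m ≡ expo m v
  lin-unit v [] = refl
  lin-unit v ((w , e) ∷ m) = cong₂ ℤ._+_ (unit ⌊ w ≟V v ⌋) (lin-unit v m)
    where
    unit : ∀ b → e ℤ.* ((if b then + 1 else + 0) ℤ.+ + 0) ≡ (if b then e else + 0)
    unit true = ℤₚ.*-identityʳ e
    unit false = ℤₚ.*-zeroʳ e

  expo-π-off : ∀ m v → row v ≢ k → expo (π m) v ≡ expo m v
  expo-π-off m v q = trans (expo-π m v) (trans (lin-ext same m) (lin-unit v m))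
    where
    same : ∀ w → expo (φπ w) v ≡ expo ((w , + 1) ∷ []) v
    same w with row w ℤ.≟ k
    ... | no _ = refl
    ... | yes p = trans (expo-there {v} {v₀} (+ 1) [] (λ { refl → q refl })) (sym (expo-there {v} {w} (+ 1) [] λ { refl → q p }))

  expo-π-v₀ : ∀ m → expo (π m) v₀ ≡ rowsum k m
  expo-π-v₀ m = trans (expo-π m v₀) (lin-ext same m)
    where
    same : ∀ w → expo (φπ w) v₀ ≡ rowIs k w
    same w with row w ℤ.≟ k
    ... | yes _ = trans (expo-here v₀ (+ 1) []) refl
    ... | no p = expo-there {v₀} {w} (+ 1) [] λ { refl → p refl }

  expo-π-row : ∀ m v → row v ≡ k → v ≢ v₀ → expo (π m) v ≡ + 0
  expo-π-row m v q ne = trans (expo-π m v) (trans (lin-ext same m) (lin-0 m))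
    where
    same : ∀ w → expo (φπ w) v ≡ + 0
    same w with row w ℤ.≟ k
    ... | yes _ = expo-there {v} {v₀} (+ 1) [] (λ e → ne (sym e))
    ... | no p = expo-there {v} {w} (+ 1) [] λ { refl → p q }
    lin-0 : ∀ m → lin (λ _ → + 0) m ≡ + 0
    lin-0 [] = refl
    lin-0 ((w , e) ∷ m) = cong₂ ℤ._+_ (ℤₚ.*-zeroʳ e) (lin-0 m)

  π-ext : ∀ m m' → (∀ v → row v ≢ k → expo m v ≡ expo m' v) → rowsum k m ≡ rowsum k m' → π m ≈ π m'
  π-ext m m' h r = mk≈ go
    where
    go : ∀ v → expo (π m) v ≡ expo (π m') v
    go v with row v ℤ.≟ k
    ... | no q = trans (expo-π-off m v q) (trans (h v q) (sym (expo-π-off m' v q)))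
    ... | yes q with v ≟V v₀
    ... | yes refl = trans (expo-π-v₀ m) (trans r (sym (expo-π-v₀ m')))
    ... | no ne = trans (expo-π-row m v q ne) (sym (expo-π-row m' v q ne))

  π-off : ∀ m m' → π m ≈ π m' → ∀ v → row v ≢ k → expo m v ≡ expo m' v
  π-off m m' e v q = trans (sym (expo-π-off m v q)) (trans (on e v) (expo-π-off m' v q))

  π-sum : ∀ m m' → π m ≈ π m' → rowsum k m ≡ rowsum k m'
  π-sum m m' e = trans (sym (expo-π-v₀ m)) (trans (on e v₀) (expo-π-v₀ m'))

  expo-τ-off : ∀ m v → row v ≢ k → expo (τ m) v ≡ expo m v
  expo-τ-off m v q = trans (HT.expo-hom φτ m v) (trans (lin-ext same m) (lin-unit v m))
    where
    skip : ∀ e → expo ((v₀ , e) ∷ []) v ≡ + 0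
    skip e = expo-there {v} {v₀} e [] λ { refl → q refl }
    same : ∀ w → expo (φτ w) v ≡ expo ((w , + 1) ∷ []) v
    same w with kind (row w)
    ... | on-row refl rewrite ==ℤ-refl k = trans (skip (ℤ.- + 1)) (sym (expo-there {v} {w} (+ 1) [] λ { refl → q refl }))
    ... | adjacent e f rewrite e | f = cong (λ z → (if ⌊ w ≟V v ⌋ then + 1 else + 0) ℤ.+ z) (skip (+ 1))
    ... | distant e f rewrite e | f = refl

  -- The reflection of the sum in the transfer process, expressed by arrays. Whole rows are summed
  -- here, inside and outside the shape.
  rowsum-τ : ∀ m → rowsum k (τ m) ≡ rowsum (k ℤ.- + 1) m ℤ.+ rowsum (k ℤ.+ + 1) m ℤ.- rowsum k m
  rowsum-τ [] = refl
  rowsum-τ ((w , e) ∷ m) =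
    trans (lin-++ (rowIs k) (HT.scaleM e (φτ w)) (τ m))
    (trans (cong₂ ℤ._+_ (head (kind (row w))) (rowsum-τ m))
           (lem e (rowIs (k ℤ.- + 1) w) (rowIs (k ℤ.+ + 1) w) (rowIs k w) _ _ _))
    where
    lem : ∀ e a b c x y z → e ℤ.* (a ℤ.+ b ℤ.- c) ℤ.+ (x ℤ.+ y ℤ.- z) ≡ e ℤ.* a ℤ.+ x ℤ.+ (e ℤ.* b ℤ.+ y) ℤ.- (e ℤ.* c ℤ.+ z)
    lem = solve-∀
    k≢ : ∀ d → d ≢ + 0 → (k ==ℤ k ℤ.+ d) ≡ false
    k≢ d ne = ==ℤ-false λ p → ne (trans (l₁ k d) (trans (cong (ℤ._- k) (sym p)) (ℤₚ.+-inverseʳ k)))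
      where
      l₁ : ∀ k d → d ≡ k ℤ.+ d ℤ.- k
      l₁ = solve-∀
    a₁ : ∀ e → e ℤ.* (ℤ.- + 1) ℤ.* + 1 ℤ.+ + 0 ≡ e ℤ.* (+ 0 ℤ.+ + 0 ℤ.- + 1)
    a₁ = solve-∀
    a₂ : ∀ e → e ℤ.* + 1 ℤ.* + 0 ℤ.+ (e ℤ.* + 1 ℤ.* + 1 ℤ.+ + 0) ≡ e ℤ.* (+ 1 ℤ.+ + 0 ℤ.- + 0)
    a₂ = solve-∀
    a₃ : ∀ e → e ℤ.* + 1 ℤ.* + 0 ℤ.+ (e ℤ.* + 1 ℤ.* + 1 ℤ.+ + 0) ≡ e ℤ.* (+ 0 ℤ.+ + 1 ℤ.- + 0)
    a₃ = solve-∀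
    a₄ : ∀ e → e ℤ.* + 1 ℤ.* + 0 ℤ.+ + 0 ≡ e ℤ.* (+ 0 ℤ.+ + 0 ℤ.- + 0)
    a₄ = solve-∀
    head : Kind (row w) → lin (rowIs k) (HT.scaleM e (φτ w)) ≡ e ℤ.* (rowIs (k ℤ.- + 1) w ℤ.+ rowIs (k ℤ.+ + 1) w ℤ.- rowIs k w)
    head (on-row q) rewrite q | ==ℤ-refl k | ==ℤ-refl k | k≢ (ℤ.- + 1) (λ ()) | k≢ (+ 1) (λ ()) = a₁ e
    head (distant p f) rewrite p with row w ==ℤ k ℤ.- + 1 | row w ==ℤ k ℤ.+ + 1
    ... | false | false rewrite p = a₄ e
    head (adjacent p f) with row w ℤ.≟ k ℤ.- + 1 | row w ℤ.≟ k ℤ.+ + 1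
    ... | yes q | yes q' = ⊥-elim (absurd (trans (sym q) q'))
      where
      absurd : k ℤ.- + 1 ≢ k ℤ.+ + 1
      absurd p = two (trans (l₂ k) (trans (cong (λ z → z ℤ.- (k ℤ.- + 1)) (sym p)) (ℤₚ.+-inverseʳ (k ℤ.- + 1))))
        where
        two : + 2 ≢ + 0
        two ()
        l₂ : ∀ k → + 2 ≡ k ℤ.+ + 1 ℤ.- (k ℤ.- + 1)
        l₂ = solve-∀
    ... | yes q | no q' rewrite p | ==ℤ-refl k | p = a₂ e
    ... | no q | yes q' rewrite p | ==ℤ-refl k | p = a₃ e

  RowFree : (Mono → Poly) → Set
  RowFree C = ∀ m m' → (∀ v → row v ≢ k → expo m v ≡ expo m' v) → C m ≋ C m'

  inCols : List V → V → Bool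
  inCols cols v = not (row v ==ℤ k) ∨ memV cols v

  -- Isolates one row: `C` gathers everything that does not involve row `k`, and `Γ` is the weight
  -- of row `k` between its two neighbours. The support test concerns row `k` only.
  rowFn : (Mono → Poly) → List V → List V → List V → (List ℤ → List ℤ → List ℤ → Poly) → Mono → Poly
  rowFn C up down cols Γ m = C m ⊗ (chi (offZ (inCols cols) m) ⊗ Γ (vals m up) (vals m down) (vals m cols))

  module _ {C : Mono → Poly} (free : RowFree C) {up down cols : List V}
    (aup : All (λ v → row v ≢ k) up) (adown : All (λ v → row v ≢ k) down)
    (acols : All (λ v → row v ≡ k) cols) (ucols : Unique cols) (Γ : List ℤ → List ℤ → List ℤ → Poly) where

    private
      h = rowFn C up down cols Γ

    inCols-false : ∀ v → inCols cols v ≡ false → row v ≡ k × v ∉ cols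
    inCols-false v e with row v ℤ.≟ k
    ... | yes q = q , λ i → true≢false (memV-complete i) e

    inCols-row : ∀ v → row v ≡ k → v ∉ cols → inCols cols v ≡ false
    inCols-row v q ni with row v ℤ.≟ k
    ... | no n = ⊥-elim (n q)
    ... | yes _ with bool-case (memV cols v)
    ... | inj₁ e = ⊥-elim (ni (memV-sound e))
    ... | inj₂ e = e

    offZ-resp : ∀ {m m'} → m ≈ m' → offZ (inCols cols) m ≡ offZ (inCols cols) m'
    offZ-resp {m} {m'} e = bool-ext
      (λ q → offZ-complete _ m' λ v r → trans (sym (on e v)) (offZ-sound _ m q v r))
      (λ q → offZ-complete _ m λ v r → trans (on e v) (offZ-sound _ m' q v r))

    rowFn-resp : Resp h
    rowFn-resp {m} {m'} e = ⊗-cong (free m m' λ v _ → on e v)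
      (⊗-cong (≋-reflexive (cong chi (offZ-resp e)))
        (≋-reflexive (trans (cong₂ (λ x y → Γ x y (vals m cols)) (vals-cong m m' up λ {v} _ → on e v) (vals-cong m m' down λ {v} _ → on e v))
                            (cong (Γ (vals m' up) (vals m' down)) (vals-cong m m' cols λ {v} _ → on e v)))))

    -- On a fibre of `π` all other rows are fixed and the sum of row `k` is prescribed, so the fibre
    -- sum runs over the candidates for row `k` that have this sum. The hypothesis states that
    -- candidates with entries outside `cs` have weight zero, which makes a finite box sufficient.
    rowFibre : ∀ m cs → Unique cs →
      (∀ x → length x ≡ length cols → sumℤ x ≡ rowsum k m → ¬ All (_∈ cs) x → Γ (vals m up) (vals m down) x ≋ []) →
      FibreSum h (λ _ → C m ⊗ box cs (length cols) λ x → δ (rowsum k m) (sumℤ x) ⊗ Γ (vals m up) (vals m down) x) m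
    rowFibre m cs uc valid = record { terms = boxL h cs o cols ; fibre = fib ; total = ≋-sym tot' }
      where
      o = offRow k m
      o-cols : ∀ {v} → v ∈ cols → expo o v ≡ + 0
      o-cols {v} i = expo-offRow-on k m v (All.lookup acols i)
      valsUp : ∀ m' → (∀ v → row v ≢ k → expo m' v ≡ expo m v) → vals m' up ≡ vals m up
      valsUp m' q = vals-cong m' m up λ {v} i → q v (All.lookup aup i)
      valsDown : ∀ m' → (∀ v → row v ≢ k → expo m' v ≡ expo m v) → vals m' down ≡ vals m down
      valsDown m' q = vals-cong m' m down λ {v} i → q v (All.lookup adown i)
      fib : ∀ m' → π m' ≈ π m → h m' ≋ coeffL (boxL h cs o cols) m'
      fib m' e with bool-case (offZ (inCols cols) m')
      ... | inj₂ bad = ≋-trans (≋-trans (⊗-cong ≋-refl (chi-zero _ bad)) (⊗-zeroʳ _)) (≋-sym miss)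
        where
        w = offZ-false (inCols cols) m' bad
        miss : coeffL (boxL h cs o cols) m' ≋ []
        miss = let (v , q , ne) = w ; (r , ni) = inCols-false v q in
          boxL-miss h cs o cols m' v ni λ eq → ne (trans (sym eq) (expo-offRow-on k m v r))
      ... | inj₁ good = ≋-sym (boxL-hit rowFn-resp uc o cols m' ucols o-cols agree inside)
        where
        agree : ∀ v → v ∉ cols → expo o v ≡ expo m' v
        agree v ni with row v ℤ.≟ k
        ... | yes q = trans (expo-offRow-on k m v q) (sym (offZ-sound _ m' good v (inCols-row v q ni)))
        ... | no q = trans (expo-offRow-off k m v q) (sym (π-off m' m e v q))
        inside : All (λ v → expo m' v ∈ cs) cols ⊎ h m' ≋ []
        inside with All.all? (λ v → Data.List.Membership.DecPropositional._∈?_ ℤ._≟_ (expo m' v) cs) cols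
        ... | yes a = inj₁ a
        ... | no na = inj₂ (≋-trans (⊗-cong ≋-refl (≋-trans (⊗-cong ≋-refl
              (≋-trans (≋-reflexive (cong₂ (λ x y → Γ x y (vals m' cols)) (valsUp m' (π-off m' m e)) (valsDown m' (π-off m' m e))))
                (valid (vals m' cols) (length-vals m' cols)
                  (trans (sym (rowsum-vals k m' cols acols ucols λ v q ni → offZ-sound _ m' good v (inCols-row v q ni))) (π-sum m' m e))
                  (λ a → na (unmap cols a))))) (⊗-zeroʳ _))) (⊗-zeroʳ _))
          where
          unmap : ∀ vs → All (_∈ cs) (vals m' vs) → All (λ v → expo m' v ∈ cs) vs
          unmap [] [] = []
          unmap (v ∷ vs) (p ∷ ps) = p ∷ unmap vs ps
      tot' : coeffL (HT.mapL π (boxL h cs o cols)) (π m) ≋ C m ⊗ box cs (length cols) λ x → δ (rowsum k m) (sumℤ x) ⊗ Γ (vals m up) (vals m down) x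
      tot' = ≋-trans (boxL-total π h cs o cols (π m))
        (≋-trans (box-cong cs (length cols) λ xs le _ → point xs le) (box-scale cs (length cols) (C m) _))
        where
        point : ∀ xs → length xs ≡ length cols →
          (if π (place o cols xs) ≈ᵇ π m then h (place o cols xs) else []) ≋ C m ⊗ (δ (rowsum k m) (sumℤ xs) ⊗ Γ (vals m up) (vals m down) xs)
        point xs le = ≋-trans (if-cong {p = h p'} cond value) (ifmul (rowsum k m ==ℤ sumℤ xs))
          where
          p' = place o cols xs
          off : ∀ v → row v ≢ k → expo p' v ≡ expo m v
          off v q = trans (expo-place-off o cols xs v (λ i → q (All.lookup acols i))) (expo-offRow-off k m v q)
          rs : rowsum k p' ≡ sumℤ xs
          rs = trans (rowsum-place k o cols xs acols le) (trans (cong (λ z → sumℤ xs ℤ.+ z) (rowsum-offRow k m)) (ℤₚ.+-identityʳ _))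
          cond : (π p' ≈ᵇ π m) ≡ (rowsum k m ==ℤ sumℤ xs)
          cond = bool-ext (λ e → ==ℤ-complete (trans (sym (π-sum p' m (≈ᵇ-sound {π p'} {π m} e))) rs))
                          (λ e → ≈ᵇ-complete (π-ext p' m off (trans rs (sym (==ℤ-sound e)))))
          value : h p' ≋ C m ⊗ Γ (vals m up) (vals m down) xs
          value = ⊗-cong (free p' m off) (≋-trans (⊗-cong (≋-reflexive (cong chi
              (offZ-complete _ p' λ v q → let (r , ni) = inCols-false v q in trans (expo-place-off o cols xs v ni) (expo-offRow-on k m v r)))) ≋-refl)
            (≋-trans (⊗-identityˡ _) (≋-reflexive (trans (cong₂ (λ x y → Γ x y (vals p' cols)) (valsUp p' off) (valsDown p' off))
              (cong (Γ (vals m up) (vals m down)) (map-expo-place o cols xs ucols le o-cols))))))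
          ifmul : ∀ b → (if b then C m ⊗ Γ (vals m up) (vals m down) xs else []) ≋ C m ⊗ (chi b ⊗ Γ (vals m up) (vals m down) xs)
          ifmul true = ⊗-cong ≋-refl (≋-sym (⊗-identityˡ _))
          ifmul false = ≋-sym (≋-trans (⊗-cong ≋-refl (⊗-zeroˡ _)) (⊗-zeroʳ _))

-- Cut-offs for the sum over one row

sumAbs : List ℤ → ℕ
sumAbs [] = 0
sumAbs (x ∷ xs) = ℤ.∣ x ∣ ℕ.+ sumAbs xs

∣∣≤sumAbs : ∀ {x xs} → x ∈ xs → ℤ.∣ x ∣ ℕ.≤ sumAbs xs
∣∣≤sumAbs {xs = _ ∷ xs} (here refl) = ℕₚ.m≤m+n _ _
∣∣≤sumAbs {xs = y ∷ xs} (there i) = ℕₚ.≤-trans (∣∣≤sumAbs i) (ℕₚ.m≤n+m _ ℤ.∣ y ∣)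

∣x∣≤⇒≤ : ∀ x {M} → ℤ.∣ x ∣ ℕ.≤ M → x ℤ.≤ + M
∣x∣≤⇒≤ (+ n) h = ℤ.+≤+ h
∣x∣≤⇒≤ -[1+ n ] h = ℤ.-≤+

∣x∣≤⇒≥ : ∀ x {M} → ℤ.∣ x ∣ ℕ.≤ M → ℤ.- + M ℤ.≤ x
∣x∣≤⇒≥ x {M} h = ≤-by (ℤ.- + M) x (∣x∣≤⇒≤ (ℤ.- x) (ℕₚ.≤-trans (ℕₚ.≤-reflexive (ℤₚ.∣-i∣≡∣i∣ x)) h)) (lem x (+ M))
  where
  lem : ∀ x M → x ℤ.- (ℤ.- M) ≡ M ℤ.- (ℤ.- x)
  lem = solve-∀

sum-upper : ∀ K x → All (ℤ._≤ K) x → sumℤ x ℤ.≤ + length x ℤ.* K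
sum-upper K [] [] = ℤₚ.≤-reflexive (sym (ℤₚ.*-zeroˡ K))
sum-upper K (x ∷ xs) (p ∷ ps) = ℤₚ.≤-trans (ℤₚ.+-mono-≤ p (sum-upper K xs ps)) (ℤₚ.≤-reflexive (lem K (+ length xs)))
  where
  lem : ∀ K n → K ℤ.+ n ℤ.* K ≡ (+ 1 ℤ.+ n) ℤ.* K
  lem = solve-∀

sum-lower : ∀ K x → + 0 ℤ.≤ K → All (ℤ._≤ K) x → ∀ {y} → y ∈ x → sumℤ x ℤ.≤ y ℤ.+ + length x ℤ.* K
sum-lower K (x ∷ xs) z (p ∷ ps) (here refl) = ℤₚ.+-monoʳ-≤ x (ℤₚ.≤-trans (sum-upper K xs ps)
  (≤-by (+ length xs ℤ.* K) (+ suc (length xs) ℤ.* K) z (lem K (+ length xs))))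
  where
  lem : ∀ K n → (+ 1 ℤ.+ n) ℤ.* K ℤ.- n ℤ.* K ≡ K ℤ.- + 0
  lem = solve-∀
sum-lower K (x ∷ xs) z (p ∷ ps) {y} (there i) = ℤₚ.≤-trans (ℤₚ.+-mono-≤ p (sum-lower K xs z ps i)) (ℤₚ.≤-reflexive (lem K (+ length xs) y))
  where
  lem : ∀ K n y → K ℤ.+ (y ℤ.+ n ℤ.* K) ≡ y ℤ.+ (+ 1 ℤ.+ n) ℤ.* K
  lem = solve-∀

top : List ℤ → List ℤ → ℕ
top L N = sumAbs L ℕ.+ sumAbs N

opaque
  -- `- bound` lies below the entries of `L` and `N`, and below the entries of any row with at most
  -- `p` entries, all at most `suc (top L N)`, whose sum is in `us`. The extra 2 provides the strict
  -- inequality in `box-vanish`.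
  bound : ℕ → List ℤ → List ℤ → List ℤ → ℕ
  bound p us L N = (2 ℕ.+ suc (top L N)) ℕ.+ (p ℕ.* suc (top L N) ℕ.+ sumAbs us)

  height : ℕ → List ℤ → List ℤ → List ℤ → ℕ
  height p us L N = bound p us L N ℕ.+ suc (top L N)

  height≡ : ∀ p us L N → height p us L N ≡ bound p us L N ℕ.+ suc (top L N)
  height≡ p us L N = refl

  top≤bound : ∀ p us L N → top L N ℕ.≤ bound p us L N
  top≤bound p us L N = ℕₚ.≤-trans (ℕₚ.m≤n+m _ 3) (ℕₚ.m≤m+n _ _)

  pK+∣u∣≤bound : ∀ {q p us u} L N → q ℕ.≤ p → u ∈ us → 2 ℕ.+ (q ℕ.* suc (top L N) ℕ.+ ℤ.∣ u ∣) ℕ.≤ bound p us L N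
  pK+∣u∣≤bound {q} {p} L N le i = ℕₚ.+-mono-≤ (ℕₚ.m≤m+n 2 (suc (top L N))) (ℕₚ.+-mono-≤ (ℕₚ.*-monoˡ-≤ (suc (top L N)) le) (∣∣≤sumAbs i))

bottom : ℕ → List ℤ → List ℤ → List ℤ → ℤ
bottom p us L N = ℤ.- + bound p us L N

-- `us` lists all row sums that one window has to serve at once; `t` adds one value at the top, for
-- the larger of the two cut-offs that are compared.
window : ℕ → ℕ → List ℤ → List ℤ → List ℤ → List ℤ
window t p us L N = range (bottom p us L N) (t ℕ.+ height p us L N)

bottom+height : ∀ p us L N → bottom p us L N ℤ.+ + height p us L N ≡ + suc (top L N)
bottom+height p us L N = trans (cong (λ z → bottom p us L N ℤ.+ + z) (height≡ p us L N)) (lem (+ bound p us L N) (+ suc (top L N)))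
  where
  lem : ∀ b k → (ℤ.- b) ℤ.+ (b ℤ.+ k) ≡ k
  lem = solve-∀

L-in : ∀ p us L N → In (bottom p us L N) (height p us L N) L
L-in p us L N = All.tabulate λ {x} i →
  let h : ℤ.∣ x ∣ ℕ.≤ top L N
      h = ℕₚ.≤-trans (∣∣≤sumAbs i) (ℕₚ.m≤m+n _ _) in
  ∣x∣≤⇒≥ x (ℕₚ.≤-trans h (top≤bound p us L N)) ,
  ℤₚ.≤-<-trans (∣x∣≤⇒≤ x h) (subst (+ top L N ℤ.<_) (sym (bottom+height p us L N)) (ℤ.+<+ (ℕₚ.n<1+n _)))

N-in : ∀ p us L N → In (bottom p us L N) (height p us L N) N
N-in p us L N = All.tabulate λ {x} i →
  let h : ℤ.∣ x ∣ ℕ.≤ top L N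
      h = ℕₚ.≤-trans (∣∣≤sumAbs i) (ℕₚ.m≤n+m _ (sumAbs L)) in
  ∣x∣≤⇒≥ x (ℕₚ.≤-trans h (top≤bound p us L N)) ,
  ℤₚ.≤-<-trans (∣x∣≤⇒≤ x h) (subst (+ top L N ℤ.<_) (sym (bottom+height p us L N)) (ℤ.+<+ (ℕₚ.n<1+n _)))

inside : ∀ t p us L N x → t ℕ.≤ 1 → length x ℕ.≤ p → sumℤ x ∈ us → All (ℤ._≤ + (t ℕ.+ top L N)) x → All (_∈ window t p us L N) x
inside t p us L N x ht le i a = All.tabulate λ {y} j → ∈-range _ _ y (lower j) (upper j)
  where
  K : ℕ
  K = suc (top L N)
  b = bound p us L N
  K≥ : All (ℤ._≤ + K) x
  K≥ = All.map (λ h → ℤₚ.≤-trans h (ℤ.+≤+ (ℕₚ.+-monoˡ-≤ (top L N) ht))) a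
  big : + length x ℤ.* + K ℤ.+ (ℤ.- sumℤ x) ℤ.≤ + b
  big = ℤₚ.≤-trans (ℤₚ.+-mono-≤ (ℤₚ.≤-reflexive (sym (ℤₚ.pos-* (length x) K)))
          (∣x∣≤⇒≤ (ℤ.- sumℤ x) (ℕₚ.≤-reflexive (ℤₚ.∣-i∣≡∣i∣ (sumℤ x)))))
        (ℤ.+≤+ (ℕₚ.≤-trans (ℕₚ.m≤n+m _ 2) (pK+∣u∣≤bound {length x} {p} L N le i)))
  lower : ∀ {y} → y ∈ x → ℤ.- + b ℤ.≤ y
  lower {y} j = ≤-by (ℤ.- + b) y (ℤₚ.+-mono-≤ (sum-lower (+ K) x (ℤ.+≤+ ℕ.z≤n) K≥ j) big) (lem y (sumℤ x) (+ length x ℤ.* + K) (+ b))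
    where
    lem : ∀ y s q b → y ℤ.- (ℤ.- b) ≡ (y ℤ.+ q) ℤ.+ b ℤ.- (s ℤ.+ (q ℤ.+ (ℤ.- s)))
    lem = solve-∀
  upper : ∀ {y} → y ∈ x → y ℤ.< bottom p us L N ℤ.+ + (t ℕ.+ height p us L N)
  upper {y} j = subst (y ℤ.<_) (trans (cong (λ z → + t ℤ.+ z) (sym (bottom+height p us L N))) (lem (+ t) (bottom p us L N) (+ height p us L N)))
    (ℤₚ.≤-<-trans (All.lookup a j) (ℤ.+<+ (ℕₚ.+-monoʳ-< t (ℕₚ.n<1+n (top L N)))))
    where
    lem : ∀ t b h → t ℤ.+ (b ℤ.+ h) ≡ b ℤ.+ (t ℤ.+ h)
    lem = solve-∀

-- beyond the cut-off: a sum so large that no row attains it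
box-vanish : ∀ j j' L N p us q s u t → t ℕ.≤ 1 → q ℕ.≤ p → s ∈ us → u ℤ.≤ + 1 →
  box (window t p us L N) q (rowSum j j' L N (s ℤ.- bottom p us L N ℤ.- u)) ≋ []
box-vanish j j' L N p us q s u t ht le i hu = box-zero (window t p us L N) q λ x e a →
  ≋-trans (⊗-cong (≋-reflexive (cong chi (==ℤ-false λ eq → ℤₚ.<⇒≢ (big x e a) (sym eq)))) ≋-refl) (⊗-zeroˡ _)
  where
  K = suc (top L N)
  b = bound p us L N
  wtop : bottom p us L N ℤ.+ + (t ℕ.+ height p us L N) ℤ.≤ + K ℤ.+ + 1
  wtop = ℤₚ.≤-trans (ℤₚ.≤-reflexive (trans (lem (+ t) (bottom p us L N) (+ height p us L N)) (cong (λ z → z ℤ.+ + t) (bottom+height p us L N))))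
                    (ℤₚ.+-monoʳ-≤ (+ K) (ℤ.+≤+ ht))
    where
    lem : ∀ t b h → b ℤ.+ (t ℤ.+ h) ≡ b ℤ.+ h ℤ.+ t
    lem = solve-∀
  up : ∀ {y} → y ∈ window t p us L N → y ℤ.≤ + K
  up {y} i = ≤-by y (+ K) (ℤₚ.≤-trans (<⇒+1≤ (proj₂ (∈-range⁻ (bottom p us L N) (t ℕ.+ height p us L N) i))) wtop) (lem (+ K) y)
    where
    lem : ∀ k y → k ℤ.- y ≡ k ℤ.+ + 1 ℤ.- (y ℤ.+ + 1)
    lem = solve-∀
  size : + q ℤ.* + K ℤ.+ (ℤ.- s) ℤ.+ + 2 ℤ.≤ + b
  size = ℤₚ.≤-trans (ℤₚ.+-monoˡ-≤ (+ 2) (ℤₚ.+-mono-≤ (ℤₚ.≤-reflexive (sym (ℤₚ.pos-* q K)))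
          (∣x∣≤⇒≤ (ℤ.- s) (ℕₚ.≤-reflexive (ℤₚ.∣-i∣≡∣i∣ s)))))
        (ℤ.+≤+ (ℕₚ.≤-trans (ℕₚ.≤-reflexive (ℕₚ.+-comm (q ℕ.* K ℕ.+ ℤ.∣ s ∣) 2)) (pK+∣u∣≤bound {q} {p} L N le i)))
  big : ∀ x → length x ≡ q → All (_∈ window t p us L N) x → sumℤ x ℤ.< s ℤ.- bottom p us L N ℤ.- u
  big x refl a = +1≤⇒< (≤-by _ _ (ℤₚ.+-mono-≤ (ℤₚ.+-mono-≤ (sum-upper (+ K) x (All.map up a)) size) hu)
    (lem (sumℤ x) (+ length x ℤ.* + K) s (+ b) u))
    where
    lem : ∀ x q s b u → s ℤ.- (ℤ.- b) ℤ.- u ℤ.- (x ℤ.+ + 1) ≡ q ℤ.+ b ℤ.+ + 1 ℤ.- (x ℤ.+ (q ℤ.+ (ℤ.- s) ℤ.+ + 2) ℤ.+ u)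
    lem = solve-∀

il-ub : ∀ p q {M} → il p q ≡ true → All (ℤ._≤ M) p → All (ℤ._≤ M) q
il-ub [] [] e a = []
il-ub (p ∷ ps) q e (h ∷ _) = All.map (λ le → ℤₚ.≤-trans le h) (proj₂ (proj₂ (il-desc (p ∷ ps) q e)) refl)

L-ub : ∀ L N → All (ℤ._≤ + top L N) L
L-ub L N = All.tabulate λ {x} i → ∣x∣≤⇒≤ x (ℕₚ.≤-trans (∣∣≤sumAbs i) (ℕₚ.m≤m+n _ _))

N-ub : ∀ L N → All (ℤ._≤ + top L N) N
N-ub L N = All.tabulate λ {x} i → ∣x∣≤⇒≤ x (ℕₚ.≤-trans (∣∣≤sumAbs i) (ℕₚ.m≤n+m _ (sumAbs L)))

G-true-ub : ∀ j L N x → G j true L N x ≋ [] ⊎ All (ℤ._≤ + (0 ℕ.+ top L N)) x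
G-true-ub j L N x with bool-case (il N x)
... | inj₁ e = inj₂ (il-ub N x e (N-ub L N))
... | inj₂ e = inj₁ (G-zero j true L N x λ p → true≢false (proj₂ p) e)

-- The effect on `G` of the factor `1 - e^v`, where `v` is the first vertex of the row: its entry is
-- the one that is unbounded above.
G₁ : List ℤ → List ℤ → List ℤ → Poly
G₁ L N [] = []
G₁ L N (x ∷ xs) = G false false L N (x ∷ xs) ⊝ G false false L N ((x ℤ.- + 1) ∷ xs)

G-top : ∀ L N c xs → Below c L → Below c N → Below c xs → G false false L N (c ∷ xs) ≋ (fac 0 1 ⊗ fac 1 0) ⊗ G true true L N xs
G-top L N c xs bL bN bx =
  ≋-trans (≋-sym (≋-trans (⊗-cong (≋-reflexive (cong chi (==ℤ-refl s))) ≋-refl) (⊗-identityˡ _)))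
  (≋-trans (rowSum-peel false false c 0 0 1 L N s xs bL bN bx)
  (⊗-cong ≋-refl (≋-trans (⊗-cong (≋-reflexive (cong chi (==ℤ-complete (lem c (sumℤ xs))))) ≋-refl) (⊗-identityˡ _))))
  where
  s = sumℤ (c ∷ xs)
  lem : ∀ c x → c ℤ.+ x ℤ.- + 1 ℤ.* c ≡ x
  lem = solve-∀

-- The entries after the first are bounded by those of `L`. Once the first entry and its predecessor
-- exceed both fixed rows, the weight no longer depends on the first entry, by `G-top`, and the
-- difference cancels.
G₁-ub : ∀ L N x → L ≢ [] → G₁ L N x ≋ [] ⊎ All (ℤ._≤ + (1 ℕ.+ top L N)) x
G₁-ub L N [] ne = inj₂ []
G₁-ub [] N (x ∷ xs) ne = ⊥-elim (ne refl)
G₁-ub L@(l ∷ L') N (x ∷ xs) ne with All.all? (ℤ._≤? + top L N) xs | x ℤ.≤? + suc (top L N)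
... | no bad | _ = inj₁ (p⊝q≋0 (≋-trans (z x) (≋-sym (z (x ℤ.- + 1)))))
  where
  z : ∀ y → G false false L N (y ∷ xs) ≋ []
  z y = G-zero false false L N (y ∷ xs) λ p → bad (il-ub L xs (proj₂ (∧-true {l ≤ᵇ y} (proj₁ p))) (L-ub L N))
... | yes a | yes h = inj₂ (h ∷ All.map (λ q → ℤₚ.≤-trans q (ℤ.+≤+ (ℕₚ.n≤1+n _))) a)
... | yes a | no h = inj₁ (p⊝q≋0 (≋-trans (G-top L N x xs (lift (ub₁ x big)) (liftN (ub₁ x big)) (up (ub₁ x big) a))
    (≋-sym (G-top L N (x ℤ.- + 1) xs (lift (ub₂ big)) (liftN (ub₂ big)) (up (ub₂ big) a)))))
  where
  big : + suc (top L N) ℤ.< x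
  big = ℤₚ.≰⇒> h
  ub₁ : ∀ y → + suc (top L N) ℤ.< y → + top L N ℤ.< y
  ub₁ y lt = ℤₚ.<-trans (ℤ.+<+ (ℕₚ.n<1+n _)) lt
  ub₂ : + suc (top L N) ℤ.< x → + top L N ℤ.< x ℤ.- + 1
  ub₂ lt = +1≤⇒< (≤-by (+ top L N ℤ.+ + 1) (x ℤ.- + 1) (<⇒+1≤ lt) (lem (+ top L N) x))
    where
    lem : ∀ t x → x ℤ.- + 1 ℤ.- (t ℤ.+ + 1) ≡ x ℤ.- (+ 1 ℤ.+ t ℤ.+ + 1)
    lem = solve-∀
  up : ∀ {y zs} → + top L N ℤ.< y → All (ℤ._≤ + top L N) zs → Below y zs
  up lt = All.map λ q → ℤₚ.≤-<-trans q lt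
  lift : ∀ {y} → + top L N ℤ.< y → Below y L
  lift lt = up lt (L-ub L N)
  liftN : ∀ {y} → + top L N ℤ.< y → Below y N
  liftN lt = up lt (N-ub L N)

-- Summing G₁ amounts to comparing two cut-offs of the sum of G.

ΣP-shift : ∀ B H ψ → ΣP (range B (suc H)) (λ x → ψ (x ℤ.- + 1)) ≋ ΣP (range B H) ψ ⊕ ψ (B ℤ.- + 1)
ΣP-shift B zero ψ = ≋-trans (⊕-identityʳ _) (≋-trans (≋-reflexive (cong ψ (lem B))) (≋-sym (⊕-identityˡ _)))
  where
  lem : ∀ B → B ℤ.+ + 0 ℤ.- + 1 ≡ B ℤ.- + 1
  lem = solve-∀
ΣP-shift B (suc H) ψ = ≋-trans (⊕-cong (≋-reflexive (cong ψ (lem B (+ H)))) (ΣP-shift B H ψ)) (≋-sym (⊕-assoc _ _ _))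
  where
  lem : ∀ B H → B ℤ.+ (+ 1 ℤ.+ H) ℤ.- + 1 ≡ B ℤ.+ H
  lem = solve-∀

box-⊝ : ∀ cs p φ φ' → box cs p (λ x → φ x ⊝ φ' x) ≋ box cs p φ ⊝ box cs p φ'
box-⊝ cs zero φ φ' = ≋-refl
box-⊝ cs (suc p) φ φ' = go cs
  where
  z₁ : [] ≋ [] ⊝ []
  z₁ = ≋-sym (⊕-inverseʳ [])
  lem : ∀ a b c d → (a ⊝ b) ⊕ (c ⊝ d) ≋ (a ⊕ c) ⊝ (b ⊕ d)
  lem a b c d = ≋-trans (⊕-interchange a (⊖ b) c (⊖ d)) (⊕-cong ≋-refl (≋-sym (⊖-⊕ b d)))
  go : ∀ cs' → ΣP cs' (λ c → box cs p λ xs → φ (c ∷ xs) ⊝ φ' (c ∷ xs)) ≋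
    ΣP cs' (λ c → box cs p λ xs → φ (c ∷ xs)) ⊝ ΣP cs' (λ c → box cs p λ xs → φ' (c ∷ xs))
  go [] = z₁
  go (c ∷ cs') = ≋-trans (⊕-cong (box-⊝ cs p (λ xs → φ (c ∷ xs)) λ xs → φ' (c ∷ xs)) (go cs')) (lem _ _ _ _)

opaque
  unfolding _⊕_
  ⊗-⊝ : ∀ d a b → d ⊗ (a ⊝ b) ≋ d ⊗ a ⊝ d ⊗ b
  ⊗-⊝ = RingSolver.solve-∀ polyACR

box-G₁ : ∀ L N B H q s → L ≢ [] → In B H L →
  box (range B (suc H)) (suc q) (λ x → δ s (sumℤ x) ⊗ G₁ L N x) ≋
  box (range B (suc H)) (suc q) (rowSum false false L N s) ⊝ box (range B H) (suc q) (rowSum false false L N (s ℤ.- + 1))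
box-G₁ [] N B H q s ne iL = ⊥-elim (ne refl)
box-G₁ L@(l ∷ L') N B H q s ne ((lb , _) ∷ iL) =
  ≋-trans (box-cong (range B (suc H)) (suc q) {φ = λ x → δ s (sumℤ x) ⊗ G₁ L N x} {φ' = λ x → rowSum false false L N s x ⊝ shifted x} λ { (x ∷ xs) e a → ⊗-⊝ _ _ _ })
  (≋-trans (box-⊝ (range B (suc H)) (suc q) (rowSum false false L N s) shifted) (⊝-cong ≋-refl second))
  where
  shifted : List ℤ → Poly
  shifted [] = []
  shifted (x ∷ xs) = δ s (x ℤ.+ sumℤ xs) ⊗ G false false L N ((x ℤ.- + 1) ∷ xs)
  ψ : ℤ → Poly
  ψ y = box (range B (suc H)) q λ xs → rowSum false false L N (s ℤ.- + 1) (y ∷ xs)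
  δ₁ : ∀ x z → δ s (x ℤ.+ z) ≡ δ (s ℤ.- + 1) (x ℤ.- + 1 ℤ.+ z)
  δ₁ x z = cong chi (bool-ext (λ e → ==ℤ-complete (trans (cong (ℤ._- + 1) (==ℤ-sound e)) (l₁ x z)))
    (λ e → ==ℤ-complete (trans (l₂ s) (trans (cong (ℤ._+ + 1) (==ℤ-sound e)) (l₃ x z)))))
    where
    l₁ : ∀ x z → x ℤ.+ z ℤ.- + 1 ≡ x ℤ.- + 1 ℤ.+ z
    l₁ = solve-∀
    l₂ : ∀ s → s ≡ s ℤ.- + 1 ℤ.+ + 1
    l₂ = solve-∀
    l₃ : ∀ x z → x ℤ.- + 1 ℤ.+ z ℤ.+ + 1 ≡ x ℤ.+ z
    l₃ = solve-∀
  second : box (range B (suc H)) (suc q) shifted ≋ box (range B H) (suc q) (rowSum false false L N (s ℤ.- + 1))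
  second = ≋-trans (ΣP-cong (range B (suc H)) λ x _ → box-cong (range B (suc H)) q λ xs _ _ → ⊗-cong (≋-reflexive (δ₁ x (sumℤ xs))) ≋-refl)
    (≋-trans (ΣP-shift B H ψ)
    -- Two boundary effects vanish: a row whose first entry is below the top value cannot contain
    -- the top value later on, and the first entry `B - 1` is smaller than the first entry of `L`.
    (≋-trans (⊕-cong (ΣP-cong (range B H) λ y i → box-drop-top (B ℤ.+ + H) (range B H) q (λ xs → rowSum false false L N (s ℤ.- + 1) (y ∷ xs)) λ xs j →
                        rowSum-zero false false L N _ (y ∷ xs) λ p → Desc-split-bad [] y xs (All.lookup (range-below B H) i) j (proj₁ (ilj-desc false (y ∷ xs) L (proj₁ p))))
                     (box-zero (range B (suc H)) q λ xs _ _ → rowSum-zero false false L N _ ((B ℤ.- + 1) ∷ xs) λ p →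
                        ℤₚ.<⇒≱ low (ℤₚ.≤-trans lb (≤ᵇ-sound (proj₁ (∧-true {l ≤ᵇ (B ℤ.- + 1)} (proj₁ p)))))))
             (⊕-identityʳ _)))
    where
    low : B ℤ.- + 1 ℤ.< B
    low = +1≤⇒< (ℤₚ.≤-reflexive (l₄ B))
      where
      l₄ : ∀ B → B ℤ.- + 1 ℤ.+ + 1 ≡ B
      l₄ = solve-∀

opaque
  rowBox : List ℤ → List ℤ → ℤ → RowFn
  rowBox L N B = Flip.bx L N B

  rowBox-def : ∀ L N B H p j j' s → rowBox L N B H p j j' s ≡ box (range B H) p (rowSum j j' L N s)
  rowBox-def L N B H p j j' s = refl

  rowBox-A : ∀ L N B H → In B H L → In B H N → ∀ n → length L ≡ suc n → length N ≡ suc n → ∀ s →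
    FlipA (rowBox L N B) (sumℤ L ℤ.+ sumℤ N) B H n s
  rowBox-A = flipA

  rowBox-B : ∀ L N B H → In B H L → In B H N → ∀ n → length L ≡ n → length N ≡ suc n → ∀ s →
    FlipB (rowBox L N B) (sumℤ L ℤ.+ sumℤ N) B H n s
  rowBox-B = flipB

  rowBox-C : ∀ L N B H → In B H L → In B H N → ∀ n → length L ≡ n → length N ≡ suc n → ∀ s →
    FlipC (rowBox L N B) (sumℤ L ℤ.+ sumℤ N) B H n s
  rowBox-C = flipC

  rowBox-G₁ : ∀ L N B H q s → L ≢ [] → In B H L →
    box (range B (suc H)) (suc q) (λ x → δ s (sumℤ x) ⊗ G₁ L N x) ≋
    rowBox L N B (suc H) (suc q) false false s ⊝ rowBox L N B H (suc q) false false (s ℤ.- + 1)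
  rowBox-G₁ = box-G₁

  rowBox-vanish : ∀ j j' L N p us q s u t → t ℕ.≤ 1 → q ℕ.≤ p → s ∈ us → u ℤ.≤ + 1 →
    rowBox L N (bottom p us L N) (t ℕ.+ height p us L N) q j j' (s ℤ.- bottom p us L N ℤ.- u) ≋ []
  rowBox-vanish = box-vanish

-- From the reflection identities to null series

module RowFlip (k c₀ : ℤ) where
  open RowFibre k c₀ public

  -- The fibre sum does not depend on the polynomial that represents the fibre, so windows may be
  -- enlarged at will.
  fibre-unique : ∀ {f x y m} → FibreSum f x m → FibreSum f y m → x m ≋ y m
  fibre-unique {m = m} X Y =
    ≋-trans (FibreSum.total X)
    (≋-trans (HT.push-eq π (HT.hom-cong φπ) (FibreSum.terms X) (FibreSum.terms Y) (π m)
               λ m' e → ≋-trans (≋-sym (FibreSum.fibre X m' e)) (FibreSum.fibre Y m' e))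
             (≋-sym (FibreSum.total Y)))

  push-cong : ∀ {f g f̂} → (∀ m → f m ≋ g m) → IsPush f f̂ → IsPush g f̂
  push-cong h P m = record
    { terms = FibreSum.terms (P m)
    ; fibre = λ m' e → ≋-trans (≋-sym (h m')) (FibreSum.fibre (P m) m' e)
    ; total = FibreSum.total (P m) }

  Agree : Mono → Mono → Set
  Agree m m' = ∀ v → row v ≢ k → expo m' v ≡ expo m v

  v₁ : Mono
  v₁ = (v₀ , + 1) ∷ []

  NZ-v₁ : NZ v₁
  NZ-v₁ = k , λ e → neg (trans (sym (X.expo-here k (ℤ.- + 1) ((k ℤ.+ + 1 , + 1) ∷ []))) (trans e refl))
    where
    neg : ℤ.- + 1 ℤ.+ X.expo ((k ℤ.+ + 1 , + 1) ∷ []) k ≢ + 0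
    neg rewrite ==ℤ-false {k ℤ.+ + 1} {k} (λ e → ℤₚ.<-irrefl (sym e) (+1≤⇒< ℤₚ.≤-refl)) = λ ()

  agree-minus : ∀ m w → (∀ v → row v ≢ k → expo w v ≡ + 0) → Agree m (m -ᴹ w)
  agree-minus m w h v q = trans (expo-minus m w v) (trans (cong (λ z → expo m v ℤ.- z) (h v q)) (ℤₚ.+-identityʳ _))

  v₁-off : ∀ v → row v ≢ k → expo v₁ v ≡ + 0
  v₁-off v q = expo-there {v} {v₀} (+ 1) [] λ { refl → q refl }

  v₁v₁-off : ∀ v → row v ≢ k → expo (v₁ ++ v₁) v ≡ + 0
  v₁v₁-off v q = trans (expo-++ v₁ v₁ v) (cong₂ ℤ._+_ (v₁-off v q) (v₁-off v q))

  rowsum-minus : ∀ i m w → rowsum i (m -ᴹ w) ≡ rowsum i m ℤ.- rowsum i w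
  rowsum-minus i m w = trans (lin-++ (rowIs i) m (invM w)) (cong (λ z → rowsum i m ℤ.+ z) (lin-inv (rowIs i) w))

  rowsum-v₁ : rowsum k v₁ ≡ + 1
  rowsum-v₁ rewrite ==ℤ-refl k = refl

  sum₁ : ∀ m → rowsum k (m -ᴹ v₁) ≡ rowsum k m ℤ.- + 1
  sum₁ m = trans (rowsum-minus k m v₁) (cong (λ z → rowsum k m ℤ.- z) rowsum-v₁)

  sum₂ : ∀ m → rowsum k (m -ᴹ (v₁ ++ v₁)) ≡ rowsum k m ℤ.- + 1 ℤ.- + 1
  sum₂ m = trans (rowsum-minus k m (v₁ ++ v₁)) (trans (cong (λ z → rowsum k m ℤ.- z)
    (trans (lin-++ (rowIs k) v₁ v₁) (cong₂ ℤ._+_ rowsum-v₁ rowsum-v₁))) (lem (rowsum k m)))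
    where
    lem : ∀ s → s ℤ.- (+ 1 ℤ.+ + 1) ≡ s ℤ.- + 1 ℤ.- + 1
    lem = solve-∀

  -- The window in `hat` depends on the array through its row sum and its neighbouring rows. `value`
  -- evaluates `hat` at several arrays that agree off row `k` in one common window, the form in
  -- which the reflection identities are stated.
  module Hat {C : Mono → Poly} (free : RowFree C) {up down cols : List V}
    (aup : All (λ v → row v ≢ k) up) (adown : All (λ v → row v ≢ k) down)
    (acols : All (λ v → row v ≡ k) cols) (ucols : Unique cols) (Γ : List ℤ → List ℤ → List ℤ → Poly)
    (t : ℕ) (ht : t ℕ.≤ 1)
    (ub : ∀ L N x → length L ≡ length up → length N ≡ length down → Γ L N x ≋ [] ⊎ All (ℤ._≤ + (t ℕ.+ top L N)) x) where

    hatAt : ℕ → List ℤ → Mono → Poly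
    hatAt p us m = C m ⊗ box (window t p us (vals m up) (vals m down)) (length cols)
      λ x → δ (rowsum k m) (sumℤ x) ⊗ Γ (vals m up) (vals m down) x

    hat : Mono → Poly
    hat m = hatAt (length cols) (rowsum k m ∷ []) m

    fibreAt : ∀ p us m → length cols ℕ.≤ p → rowsum k m ∈ us → FibreSum (rowFn C up down cols Γ) (λ _ → hatAt p us m) m
    fibreAt p us m le i = rowFibre free aup adown acols ucols Γ m (window t p us (vals m up) (vals m down)) (range-unique _ _) valid
      where
      valid : ∀ x → length x ≡ length cols → sumℤ x ≡ rowsum k m → ¬ All (_∈ window t p us (vals m up) (vals m down)) x →
        Γ (vals m up) (vals m down) x ≋ []
      valid x e s n with ub (vals m up) (vals m down) x (length-vals m up) (length-vals m down)
      ... | inj₁ z = z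
      ... | inj₂ a = ⊥-elim (n (inside t p us (vals m up) (vals m down) x ht (ℕₚ.≤-trans (ℕₚ.≤-reflexive e) le) (subst (_∈ us) (sym s) i) a))

    isPush : IsPush (rowFn C up down cols Γ) hat
    isPush m = record { terms = FibreSum.terms S ; fibre = FibreSum.fibre S ; total = FibreSum.total S }
      where S = fibreAt (length cols) (rowsum k m ∷ []) m ℕₚ.≤-refl (here refl)

    value : ∀ p us m m' {s} → length cols ℕ.≤ p → Agree m m' → rowsum k m' ≡ s → s ∈ us →
      hat m' ≋ C m ⊗ box (window t p us (vals m up) (vals m down)) (length cols) λ x → δ s (sumℤ x) ⊗ Γ (vals m up) (vals m down) x
    value p us m m' le ag refl i =
      ≋-trans (fibre-unique (isPush m') (fibreAt p us m' le i))
      (⊗-cong (free m' m ag)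
        (≋-reflexive (cong₂ (λ L N → box (window t p us L N) (length cols) λ x → δ (rowsum k m') (sumℤ x) ⊗ Γ L N x)
          (vals-cong m' m up λ {v} j → ag v (All.lookup aup j)) (vals-cong m' m down λ {v} j → ag v (All.lookup adown j)))))

    dead : ∀ m m' → Agree m m' → C m ≋ [] → hat m' ≋ []
    dead m m' ag z = ≋-trans (⊗-cong (≋-trans (free m' m ag) z) ≋-refl) (⊗-zeroˡ _)

  agree-τ : ∀ m m' → Agree m m' → Agree m (τ m')
  agree-τ m m' ag v q = trans (expo-τ-off m' v q) (ag v q)

  opaque
    unfolding _⊕_
    alg-C : ∀ c t X q₀ q₁ → X ≋ q₀ ⊝ t ⊗ q₁ → c ⊗ X ≋ oneP ⊗ (c ⊗ q₀) ⊕ (⊖ t ⊗ (c ⊗ q₁) ⊕ [])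
    alg-C c t X q₀ q₁ e = ≋-trans (mulP-cong (≋-refl {c}) e) (go c t q₀ q₁)
      where
      go : ∀ c t q₀ q₁ → c ⊗ (q₀ ⊝ t ⊗ q₁) ≋ oneP ⊗ (c ⊗ q₀) ⊕ (⊖ t ⊗ (c ⊗ q₁) ⊕ [])
      go = RingSolver.solve-∀ polyACR

    -- `X₀` and `X₁` are the sums at `s` and `s - 1`, so the left side is `act v₁`, the negative of
    -- the left side of `FlipA`; `z` is the term beyond the cut-off.
    alg-A : ∀ c t X₀ X₁ z q₀ q₁ q₂ → z ≋ [] →
      X₁ ⊝ X₀ ⊕ (oneP ⊝ t) ⊗ z ≋ (q₁ ⊝ t ⊗ q₀) ⊝ t ⊗ (q₂ ⊝ t ⊗ q₁) →
      c ⊗ X₀ ⊝ c ⊗ X₁ ≋ t ⊗ (c ⊗ q₀) ⊕ (⊖ (oneP ⊕ t ⊗ t) ⊗ (c ⊗ q₁) ⊕ (t ⊗ (c ⊗ q₂) ⊕ []))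
    alg-A c t X₀ X₁ z q₀ q₁ q₂ ez e =
      ≋-trans (go₁ c t X₀ X₁ z)
      (≋-trans (⊕-cong (⊖-cong (⊗-cong (≋-refl {c}) e)) (⊗-cong (≋-refl {c ⊗ (oneP ⊝ t)}) ez)) (go₂ c t q₀ q₁ q₂))
      where
      go₁ : ∀ c t X₀ X₁ z → c ⊗ X₀ ⊝ c ⊗ X₁ ≋ ⊖ (c ⊗ (X₁ ⊝ X₀ ⊕ (oneP ⊝ t) ⊗ z)) ⊕ (c ⊗ (oneP ⊝ t)) ⊗ z
      go₁ = RingSolver.solve-∀ polyACR
      go₂ : ∀ c t q₀ q₁ q₂ → ⊖ (c ⊗ ((q₁ ⊝ t ⊗ q₀) ⊝ t ⊗ (q₂ ⊝ t ⊗ q₁))) ⊕ (c ⊗ (oneP ⊝ t)) ⊗ [] ≋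
        t ⊗ (c ⊗ q₀) ⊕ (⊖ (oneP ⊕ t ⊗ t) ⊗ (c ⊗ q₁) ⊕ (t ⊗ (c ⊗ q₂) ⊕ []))
      go₂ = RingSolver.solve-∀ polyACR

    alg-B : ∀ c t X₀ X₁ z q₀ q₁ → z ≋ [] → X₁ ⊝ X₀ ⊕ (oneP ⊝ t) ⊗ z ≋ q₁ ⊝ t ⊗ q₀ →
      c ⊗ X₀ ⊝ c ⊗ X₁ ≋ t ⊗ (c ⊗ q₀) ⊕ (⊖ oneP ⊗ (c ⊗ q₁) ⊕ [])
    alg-B c t X₀ X₁ z q₀ q₁ ez e =
      ≋-trans (go₁ c t X₀ X₁ z)
      (≋-trans (⊕-cong (⊖-cong (⊗-cong (≋-refl {c}) e)) (⊗-cong (≋-refl {c ⊗ (oneP ⊝ t)}) ez)) (go₂ c t q₀ q₁))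
      where
      go₁ : ∀ c t X₀ X₁ z → c ⊗ X₀ ⊝ c ⊗ X₁ ≋ ⊖ (c ⊗ (X₁ ⊝ X₀ ⊕ (oneP ⊝ t) ⊗ z)) ⊕ (c ⊗ (oneP ⊝ t)) ⊗ z
      go₁ = RingSolver.solve-∀ polyACR
      go₂ : ∀ c t q₀ q₁ → ⊖ (c ⊗ (q₁ ⊝ t ⊗ q₀)) ⊕ (c ⊗ (oneP ⊝ t)) ⊗ [] ≋
        t ⊗ (c ⊗ q₀) ⊕ (⊖ oneP ⊗ (c ⊗ q₁) ⊕ [])
      go₂ = RingSolver.solve-∀ polyACR

    dead-⊝ : [] ⊝ [] ≋ []
    dead-⊝ = ≋-refl

  mulF-dead : ∀ A {h : Mono → Poly} m → (∀ w → w ∈ map proj₂ A → h (m -ᴹ w) ≋ []) → mulF A h m ≋ []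
  mulF-dead [] m z = ≋-refl
  mulF-dead ((c , w) ∷ A) m z =
    ≋-trans (⊕-cong (≋-trans (⊗-cong ≋-refl (z w (here refl))) (⊗-zeroʳ c)) (mulF-dead A m λ w i → z w (there i))) (⊕-identityˡ [])

  -- `v₀ ∷ rest` is row `k` when `D` comes first, `κcols` when `D` comes second. `supp` bridges a
  -- gap: `τ` adds up the adjacent rows entirely, whereas the weights see them only at `up` and
  -- `down`.
  module Flips {C : Mono → Poly} (free : RowFree C) {up down rest κcols : List V}
    (aup : All (λ v → row v ≡ k ℤ.- + 1) up) (adown : All (λ v → row v ≡ k ℤ.+ + 1) down)
    (uup : Unique up) (udown : Unique down)
    (acols : All (λ v → row v ≡ k) (v₀ ∷ rest)) (ucols : Unique (v₀ ∷ rest))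
    (aκ : All (λ v → row v ≡ k) κcols) (uκ : Unique κcols)
    (supp : ∀ m → C m ≋ [] ⊎
      (∀ v → row v ≡ k ℤ.- + 1 → v ∉ up → expo m v ≡ + 0) × (∀ v → row v ≡ k ℤ.+ + 1 → v ∉ down → expo m v ≡ + 0)) where

    Supported : Mono → Set
    Supported m = (∀ v → row v ≡ k ℤ.- + 1 → v ∉ up → expo m v ≡ + 0) × (∀ v → row v ≡ k ℤ.+ + 1 → v ∉ down → expo m v ≡ + 0)

    private
      cols = v₀ ∷ rest
      up≢ : All (λ v → row v ≢ k) up
      up≢ = All.map (λ { refl e → ℤₚ.<-irrefl e (+1≤⇒< (ℤₚ.≤-reflexive (lem k))) }) aup
        where
        lem : ∀ k → k ℤ.- + 1 ℤ.+ + 1 ≡ k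
        lem = solve-∀
      down≢ : All (λ v → row v ≢ k) down
      down≢ = All.map (λ { refl e → ℤₚ.<-irrefl (sym e) (+1≤⇒< ℤₚ.≤-refl) }) adown

    tt : Mono → ℤ
    tt m = sumℤ (vals m up) ℤ.+ sumℤ (vals m down)

    sum-τ : ∀ m m' {s} →
      (∀ v → row v ≡ k ℤ.- + 1 → v ∉ up → expo m v ≡ + 0) × (∀ v → row v ≡ k ℤ.+ + 1 → v ∉ down → expo m v ≡ + 0) →
      Agree m m' → rowsum k m' ≡ s → rowsum k (τ m') ≡ tt m ℤ.- s
    sum-τ m m' (zu , zd) ag refl = trans (rowsum-τ m') (cong (ℤ._- rowsum k m') (cong₂ ℤ._+_ u d))
      where
      u : rowsum (k ℤ.- + 1) m' ≡ sumℤ (vals m up)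
      u = trans (rowsum-vals (k ℤ.- + 1) m' up aup uup λ v q ni → trans (ag v (row≢ v q)) (zu v q ni))
            (cong sumℤ (vals-cong m' m up λ {v} j → ag v (All.lookup up≢ j)))
        where
        row≢ : ∀ (v : V) → row v ≡ k ℤ.- + 1 → row v ≢ k
        row≢ v q e = ℤₚ.<-irrefl (trans (sym q) e) (+1≤⇒< (ℤₚ.≤-reflexive (lem k)))
          where
          lem : ∀ k → k ℤ.- + 1 ℤ.+ + 1 ≡ k
          lem = solve-∀
      d : rowsum (k ℤ.+ + 1) m' ≡ sumℤ (vals m down)
      d = trans (rowsum-vals (k ℤ.+ + 1) m' down adown udown λ v q ni → trans (ag v (row≢ v q)) (zd v q ni))
            (cong sumℤ (vals-cong m' m down λ {v} j → ag v (All.lookup down≢ j)))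
        where
        row≢ : ∀ (v : V) → row v ≡ k ℤ.+ + 1 → row v ≢ k
        row≢ v q e = ℤₚ.<-irrefl (sym (trans (sym q) e)) (+1≤⇒< ℤₚ.≤-refl)

    -- `v₀` is the first vertex of the row, so the shift by `v₁` lowers the first entry and changes
    -- nothing else.
    act-G₁ : ∀ m → act v₁ (rowFn C up down cols (G false false)) m ≋ rowFn C up down cols G₁ m
    act-G₁ m =
      ≋-trans (⊝-cong ≋-refl (⊗-cong (free (m -ᴹ v₁) m ag) (⊗-cong (≋-reflexive (cong chi off)) (≋-reflexive
        (trans (cong₂ (λ L N → G false false L N (vals (m -ᴹ v₁) cols)) (vals-cong (m -ᴹ v₁) m up λ {v} j → ag v (All.lookup up≢ j))
                 (vals-cong (m -ᴹ v₁) m down λ {v} j → ag v (All.lookup down≢ j)))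
          (cong (G false false (vals m up) (vals m down)) (cong₂ _∷_
            (trans (expo-minus m v₁ v₀) (cong (λ z → expo m v₀ ℤ.- z) (expo-here v₀ (+ 1) [])))
            (vals-cong (m -ᴹ v₁) m rest same))))))))
      (≋-sym (≋-trans (⊗-cong ≋-refl (⊗-⊝ _ _ _)) (⊗-⊝ _ _ _)))
      where
      ag = agree-minus m v₁ v₁-off
      same : ∀ {v} → v ∈ rest → expo (m -ᴹ v₁) v ≡ expo m v
      same {v} i = trans (expo-minus m v₁ v) (trans (cong (λ z → expo m v ℤ.- z)
        (expo-there {v} {v₀} (+ 1) [] λ { refl → All∉ (hd ucols) i })) (ℤₚ.+-identityʳ _))
        where
        hd : ∀ {vs} → Unique (v₀ ∷ vs) → All (v₀ ≢_) vs
        hd (p ∷ _) = p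
      oth : ∀ v → inCols cols v ≡ false → expo (m -ᴹ v₁) v ≡ expo m v
      oth v q = trans (expo-minus m v₁ v) (trans (cong (λ z → expo m v ℤ.- z)
        (expo-there {v} {v₀} (+ 1) [] λ { refl → proj₂ (inCols-false free up≢ down≢ acols ucols (G false false) v q) (here refl) })) (ℤₚ.+-identityʳ _))
      off : offZ (inCols cols) (m -ᴹ v₁) ≡ offZ (inCols cols) m
      off = bool-ext (λ e → offZ-complete _ m λ v q → trans (sym (oth v q)) (offZ-sound _ (m -ᴹ v₁) e v q))
                     (λ e → offZ-complete _ (m -ᴹ v₁) λ v q → trans (oth v q) (offZ-sound _ m e v q))

    private
      fF gF : Bool → Mono → Poly
      fF b = rowFn C up down cols (G false b)
      G01 : List ℤ → List ℤ → List ℤ → Poly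
      G01 = G false true

      0≤1 : 0 ℕ.≤ 1
      0≤1 = ℕ.z≤n
      gF b = rowFn C up down κcols (G b true)

      nonempty : ∀ {L : List ℤ} → length up ≢ 0 → length L ≡ length up → L ≢ []
      nonempty ne e refl = ne (sym e)

      module Hκ (b : Bool) = Hat free up≢ down≢ aκ uκ (G b true) 0 0≤1 (λ L N x _ _ → G-true-ub b L N x)
      module H₁ (ne : length up ≢ 0) = Hat free up≢ down≢ acols ucols G₁ 1 ℕₚ.≤-refl (λ L N x e _ → G₁-ub L N x (nonempty ne e))
      module H₀ = Hat free up≢ down≢ acols ucols G01 0 0≤1 (λ L N x _ _ → G-true-ub false L N x)

      resp : ∀ b → Resp (fF b)
      resp b = rowFn-resp free up≢ down≢ acols ucols (G false b)

      ag₀ : ∀ m → Agree m (m -ᴹ [])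
      ag₀ m = agree-minus m [] λ _ _ → refl
      ag₁ : ∀ m → Agree m (m -ᴹ v₁)
      ag₁ m = agree-minus m v₁ v₁-off
      ag₂ : ∀ m → Agree m (m -ᴹ (v₁ ++ v₁))
      ag₂ m = agree-minus m (v₁ ++ v₁) v₁v₁-off
      s₀ : ∀ m → rowsum k (m -ᴹ []) ≡ rowsum k m
      s₀ m = trans (rowsum-minus k m []) (ℤₚ.+-identityʳ _)

    -- The row is open above, which is paid for by the factor `1 - e^v₁` in `us`. The Laurent
    -- factor, read off from `FlipC`, is `1 - t e^v₁`.
    nullC : ∀ n → length up ≡ suc n → length down ≡ suc (suc n) → length rest ≡ suc n → length κcols ≡ suc n →
      Tame (fF false) → Null (gF true) → Null (fF false)
    nullC n eu ed er eκ T N = transfer (resp false) T N (v₁ ∷ []) (NZ-v₁ ∷ [])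
      (push-cong (λ m → ≋-sym (act-G₁ m)) H.isPush) Q.isPush [] A [] flip
      where
      ne : length up ≢ 0
      ne e = ℕₚ.1+n≢0 (trans (sym eu) e)
      module H = H₁ ne
      module Q = Hκ true
      A : LPoly
      A = (oneP , []) ∷ (⊖ tP , v₁) ∷ []
      flipBy : ∀ m → C m ≋ [] ⊎ Supported m → H.hat m ≋ mulF A (Q.hat ∘ τ) m
      flip : ∀ m → H.hat m ≋ mulF A (Q.hat ∘ τ) m
      flip m = flipBy m (supp m)
      flipBy m (inj₁ z) = ≋-trans (H.dead m m (λ v _ → refl) z) (≋-sym (mulF-dead A {Q.hat ∘ τ} m
          λ { .([]) (here refl) → Q.dead m (τ (m -ᴹ [])) (agree-τ m (m -ᴹ []) (ag₀ m)) z ; .(v₁) (there (here refl)) → Q.dead m (τ (m -ᴹ v₁)) (agree-τ m (m -ᴹ v₁) (ag₁ m)) z }))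
      flipBy m (inj₂ z) =
        ≋-trans (H.value p us m m (ℕₚ.≤-reflexive (cong suc er)) (λ v _ → refl) refl (here refl))
        (≋-trans (alg-C (C m) tP _ _ _ (≋-trans boxes key))
        (≋-sym (⊕-cong (⊗-cong ≋-refl (q₀ (m -ᴹ []) s (ag₀ m) (s₀ m) (there (here refl))))
                       (⊕-cong (⊗-cong ≋-refl (q₀ (m -ᴹ v₁) (s ℤ.- + 1) (ag₁ m) (sum₁ m) (there (there (here refl))))) ≋-refl))))
        where
        s = rowsum k m
        L = vals m up
        R = vals m down
        p = suc (suc n)
        us = s ∷ tt m ℤ.- s ∷ tt m ℤ.- (s ℤ.- + 1) ∷ []
        B = bottom p us L R
        h = height p us L R
        key : FlipC (rowBox L R B) (tt m) B h (suc n) s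
        key = rowBox-C L R B h (L-in p us L R) (N-in p us L R) (suc n) (trans (length-vals m up) eu) (trans (length-vals m down) ed) s
        boxes : box (window 1 p us L R) (length cols) (λ x → δ s (sumℤ x) ⊗ G₁ L R x) ≋
          rowBox L R B (suc h) (suc (suc n)) false false s ⊝ rowBox L R B h (suc (suc n)) false false (s ℤ.- + 1)
        boxes = ≋-trans (≋-reflexive (cong (λ z → box (window 1 p us L R) (suc z) (λ x → δ s (sumℤ x) ⊗ G₁ L R x)) er))
          (rowBox-G₁ L R B h (suc n) s (nonempty ne (length-vals m up)) (L-in p us L R))
        q₀ : ∀ m' u → Agree m m' → rowsum k m' ≡ u → tt m ℤ.- u ∈ us →
          Q.hat (τ m') ≋ C m ⊗ rowBox L R B h (suc n) true true (tt m ℤ.- u)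
        q₀ m' u ag e i = ≋-trans (Q.value p us m (τ m') (ℕₚ.≤-trans (ℕₚ.≤-reflexive eκ) (ℕₚ.n≤1+n _)) (agree-τ m m' ag) (sum-τ m m' z ag e) i)
          (⊗-cong ≋-refl (≋-trans (≋-reflexive (cong (λ z → box (range B h) z (rowSum true true L R (tt m ℤ.- u))) eκ)) (≋-reflexive (sym (rowBox-def L R B h _ true true (tt m ℤ.- u))))))

    -- The row is open on both sides: the factor in `us` takes care of the top and makes the fibre
    -- sums finite, the one in `us'` takes care of the bottom. With `e = e^v₁` the Laurent factor is
    -- `(t - e)(1 - t e)`, the product of those in `nullB` and `nullC`.
    nullA : ∀ n → length up ≡ suc n → length down ≡ suc n → length rest ≡ suc n → length κcols ≡ n →
      Tame (fF false) → Null (gF true) → Null (fF false)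
    nullA n eu ed er eκ T N = transfer (resp false) T N (v₁ ∷ []) (NZ-v₁ ∷ [])
      (push-cong (λ m → ≋-sym (act-G₁ m)) H.isPush) Q.isPush (v₁ ∷ []) A (NZ-v₁ ∷ []) flip
      where
      ne : length up ≢ 0
      ne e = ℕₚ.1+n≢0 (trans (sym eu) e)
      module H = H₁ ne
      module Q = Hκ true
      A : LPoly
      A = (tP , []) ∷ (⊖ (oneP ⊕ tP ⊗ tP) , v₁) ∷ (tP , v₁ ++ v₁) ∷ []
      flipBy : ∀ m → C m ≋ [] ⊎ Supported m → acts (v₁ ∷ []) H.hat m ≋ mulF A (Q.hat ∘ τ) m
      flip : ∀ m → acts (v₁ ∷ []) H.hat m ≋ mulF A (Q.hat ∘ τ) m
      flip m = flipBy m (supp m)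
      flipBy m (inj₁ z) = ≋-trans (≋-trans (⊝-cong (H.dead m m (λ v _ → refl) z) (H.dead m (m -ᴹ v₁) (ag₁ m) z)) dead-⊝) (≋-sym (mulF-dead A {Q.hat ∘ τ} m
          λ { .([]) (here refl) → Q.dead m (τ (m -ᴹ [])) (agree-τ m (m -ᴹ []) (ag₀ m)) z
            ; .(v₁) (there (here refl)) → Q.dead m (τ (m -ᴹ v₁)) (agree-τ m (m -ᴹ v₁) (ag₁ m)) z
            ; .(v₁ ++ v₁) (there (there (here refl))) → Q.dead m (τ (m -ᴹ (v₁ ++ v₁))) (agree-τ m (m -ᴹ (v₁ ++ v₁)) (ag₂ m)) z }))
      flipBy m (inj₂ z) =
        ≋-trans (⊝-cong (≋-trans (H.value p us m m (ℕₚ.≤-reflexive (cong suc er)) (λ v _ → refl) refl (here refl)) (⊗-cong ≋-refl (boxes s)))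
                        (≋-trans (H.value p us m (m -ᴹ v₁) (ℕₚ.≤-reflexive (cong suc er)) (ag₁ m) (sum₁ m) (there (here refl))) (⊗-cong ≋-refl (boxes (s ℤ.- + 1)))))
        (≋-trans (alg-A (C m) tP _ _ _ _ _ _ gone key)
        (≋-sym (⊕-cong (⊗-cong ≋-refl (q₀ (m -ᴹ []) s (ag₀ m) (s₀ m) (there (there (here refl)))))
               (⊕-cong (⊗-cong ≋-refl (q₀ (m -ᴹ v₁) (s ℤ.- + 1) (ag₁ m) (sum₁ m) (there (there (there (here refl))))))
               (⊕-cong (⊗-cong ≋-refl (q₀ (m -ᴹ (v₁ ++ v₁)) (s ℤ.- + 1 ℤ.- + 1) (ag₂ m) (sum₂ m) (there (there (there (there (here refl))))))) ≋-refl)))))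
        where
        s = rowsum k m
        L = vals m up
        R = vals m down
        p = suc (suc n)
        -- The sums at which the two sides are evaluated: two before the reflection, since `act v₁`
        -- is applied, and three after it, one for each term of `A`.
        us = s ∷ s ℤ.- + 1 ∷ tt m ℤ.- s ∷ tt m ℤ.- (s ℤ.- + 1) ∷ tt m ℤ.- (s ℤ.- + 1 ℤ.- + 1) ∷ []
        B = bottom p us L R
        h = height p us L R
        key : FlipA (rowBox L R B) (tt m) B h n s
        key = rowBox-A L R B h (L-in p us L R) (N-in p us L R) n (trans (length-vals m up) eu) (trans (length-vals m down) ed) s
        boxes : ∀ s → box (window 1 p us L R) (length cols) (λ x → δ s (sumℤ x) ⊗ G₁ L R x) ≋
          rowBox L R B (suc h) (suc (suc n)) false false s ⊝ rowBox L R B h (suc (suc n)) false false (s ℤ.- + 1)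
        boxes s = ≋-trans (≋-reflexive (cong (λ z → box (window 1 p us L R) (suc z) (λ x → δ s (sumℤ x) ⊗ G₁ L R x)) er))
          (rowBox-G₁ L R B h (suc n) s (nonempty ne (length-vals m up)) (L-in p us L R))
        gone : rowBox L R B (suc h) (suc n) false false (s ℤ.- B) ⊝ rowBox L R B h (suc n) false false (s ℤ.- B ℤ.- + 1) ≋ []
        gone = ≋-trans (⊝-cong
          (≋-trans (≋-reflexive (cong (rowBox L R B (suc h) (suc n) false false) (sym (ℤₚ.+-identityʳ (s ℤ.- B)))))
                   (rowBox-vanish false false L R p us (suc n) s (+ 0) 1 ℕₚ.≤-refl (ℕₚ.n≤1+n _) (here refl) (ℤ.+≤+ ℕ.z≤n)))
          (rowBox-vanish false false L R p us (suc n) s (+ 1) 0 0≤1 (ℕₚ.n≤1+n _) (here refl) ℤₚ.≤-refl)) dead-⊝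
        q₀ : ∀ m' u → Agree m m' → rowsum k m' ≡ u → tt m ℤ.- u ∈ us →
          Q.hat (τ m') ≋ C m ⊗ rowBox L R B h n true true (tt m ℤ.- u)
        q₀ m' u ag e i = ≋-trans (Q.value p us m (τ m') (ℕₚ.≤-trans (ℕₚ.≤-reflexive eκ) (ℕₚ.m≤n+m _ 2)) (agree-τ m m' ag) (sum-τ m m' z ag e) i)
          (⊗-cong ≋-refl (≋-trans (≋-reflexive (cong (λ z → box (range B h) z (rowSum true true L R (tt m ℤ.- u))) eκ)) (≋-reflexive (sym (rowBox-def L R B h _ true true (tt m ℤ.- u))))))

    -- The row is open below only. A prescribed sum together with the bound from above leaves
    -- finitely many rows, so the fibre sums exist without a factor in `us`; the factor in `us'`
    -- comes from `cζ`.
    nullB : ∀ n → length up ≡ n → length down ≡ suc n → length rest ≡ n → length κcols ≡ n →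
      Tame (fF true) → Null (gF false) → Null (fF true)
    nullB n eu ed er eκ T N = transfer (resp true) T N [] [] H₀.isPush Q.isPush (v₁ ∷ []) A (NZ-v₁ ∷ []) flip
      where
      module Q = Hκ false
      A : LPoly
      A = (tP , []) ∷ (⊖ oneP , v₁) ∷ []
      flipBy : ∀ m → C m ≋ [] ⊎ Supported m → acts (v₁ ∷ []) H₀.hat m ≋ mulF A (Q.hat ∘ τ) m
      flip : ∀ m → acts (v₁ ∷ []) H₀.hat m ≋ mulF A (Q.hat ∘ τ) m
      flip m = flipBy m (supp m)
      flipBy m (inj₁ z) = ≋-trans (≋-trans (⊝-cong (H₀.dead m m (λ v _ → refl) z) (H₀.dead m (m -ᴹ v₁) (ag₁ m) z)) dead-⊝) (≋-sym (mulF-dead A {Q.hat ∘ τ} m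
          λ { .([]) (here refl) → Q.dead m (τ (m -ᴹ [])) (agree-τ m (m -ᴹ []) (ag₀ m)) z
            ; .(v₁) (there (here refl)) → Q.dead m (τ (m -ᴹ v₁)) (agree-τ m (m -ᴹ v₁) (ag₁ m)) z }))
      flipBy m (inj₂ z) =
        ≋-trans (⊝-cong (≋-trans (H₀.value p us m m (ℕₚ.≤-reflexive (cong suc er)) (λ v _ → refl) refl (here refl)) (⊗-cong ≋-refl (boxes s)))
                        (≋-trans (H₀.value p us m (m -ᴹ v₁) (ℕₚ.≤-reflexive (cong suc er)) (ag₁ m) (sum₁ m) (there (here refl))) (⊗-cong ≋-refl (boxes (s ℤ.- + 1)))))
        (≋-trans (alg-B (C m) tP _ _ _ _ _ gone key)
        (≋-sym (⊕-cong (⊗-cong ≋-refl (q₀ (m -ᴹ []) s (ag₀ m) (s₀ m) (there (there (here refl)))))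
               (⊕-cong (⊗-cong ≋-refl (q₀ (m -ᴹ v₁) (s ℤ.- + 1) (ag₁ m) (sum₁ m) (there (there (there (here refl)))))) ≋-refl))))
        where
        s = rowsum k m
        L = vals m up
        R = vals m down
        p = suc n
        us = s ∷ s ℤ.- + 1 ∷ tt m ℤ.- s ∷ tt m ℤ.- (s ℤ.- + 1) ∷ []
        B = bottom p us L R
        h = height p us L R
        key : FlipB (rowBox L R B) (tt m) B h n s
        key = rowBox-B L R B h (L-in p us L R) (N-in p us L R) n (trans (length-vals m up) eu) (trans (length-vals m down) ed) s
        boxes : ∀ s → box (window 0 p us L R) (length cols) (rowSum false true L R s) ≋ rowBox L R B h (suc n) false true s
        boxes s = ≋-reflexive (trans (cong (λ z → box (window 0 p us L R) (suc z) (rowSum false true L R s)) er) (sym (rowBox-def L R B h (suc n) false true s)))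
        gone : rowBox L R B h n false true (s ℤ.- B) ≋ []
        gone = ≋-trans (≋-reflexive (cong (rowBox L R B h n false true) (sym (ℤₚ.+-identityʳ (s ℤ.- B)))))
          (rowBox-vanish false true L R p us n s (+ 0) 0 0≤1 (ℕₚ.n≤1+n _) (here refl) (ℤ.+≤+ ℕ.z≤n))
        q₀ : ∀ m' u → Agree m m' → rowsum k m' ≡ u → tt m ℤ.- u ∈ us →
          Q.hat (τ m') ≋ C m ⊗ rowBox L R B h n false true (tt m ℤ.- u)
        q₀ m' u ag e i = ≋-trans (Q.value p us m (τ m') (ℕₚ.≤-trans (ℕₚ.≤-reflexive eκ) (ℕₚ.n≤1+n _)) (agree-τ m m' ag) (sum-τ m m' z ag e) i)
          (⊗-cong ≋-refl (≋-trans (≋-reflexive (cong (λ z → box (range B h) z (rowSum false true L R (tt m ℤ.- u))) eκ)) (≋-reflexive (sym (rowBox-def L R B h _ false true (tt m ℤ.- u))))))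

-- Functions of the order type of an array are tame

unit : List V → Mono
unit = map λ v → (v , + 1)

expo-unit-∉ : ∀ U v → v ∉ U → expo (unit U) v ≡ + 0
expo-unit-∉ [] v n = refl
expo-unit-∉ (u ∷ U) v n = trans (expo-there {v} {u} (+ 1) (unit U) λ e → n (here (sym e))) (expo-unit-∉ U v (n ∘ there))

expo-unit-∈ : ∀ U v → Unique U → v ∈ U → expo (unit U) v ≡ + 1
expo-unit-∈ (u ∷ U) .u (nu ∷ uU) (here refl) =
  trans (expo-here u (+ 1) (unit U)) (cong (λ z → + 1 ℤ.+ z) (expo-unit-∉ U u (All∉ nu)))
expo-unit-∈ (u ∷ U) v (nu ∷ uU) (there i) =
  trans (expo-there {v} {u} (+ 1) (unit U) (λ { refl → All∉ nu i })) (expo-unit-∈ U v uU i)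

expo-Fh : ∀ m i → X.expo (Fh m) i ≡ rowsum (i ℤ.- + 1) m ℤ.- rowsum i m
expo-Fh m i = trans (HF.expo-hom φF m i) (go m)
  where
  sc : ∀ v → X.expo (φF v) i ≡ rowIs (i ℤ.- + 1) v ℤ.- rowIs i v
  sc (a , b) = trans (lem (a ==ℤ i) (a ℤ.+ + 1 ==ℤ i)) (cong (λ z → (if z then + 1 else + 0) ℤ.- rowIs i (a , b)) shift)
    where
    lem : ∀ p q → (if p then ℤ.- + 1 else + 0) ℤ.+ ((if q then + 1 else + 0) ℤ.+ + 0) ≡ (if q then + 1 else + 0) ℤ.- (if p then + 1 else + 0)
    lem true true = refl
    lem true false = refl
    lem false true = refl
    lem false false = refl
    l₁ : ∀ a → a ≡ a ℤ.+ + 1 ℤ.- + 1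
    l₁ = solve-∀
    l₂ : ∀ i → i ℤ.- + 1 ℤ.+ + 1 ≡ i
    l₂ = solve-∀
    shift : (a ℤ.+ + 1 ==ℤ i) ≡ (a ==ℤ i ℤ.- + 1)
    shift = bool-ext (λ e → ==ℤ-complete (trans (l₁ a) (cong (ℤ._- + 1) (==ℤ-sound e))))
                  (λ e → ==ℤ-complete (trans (cong (ℤ._+ + 1) (==ℤ-sound e)) (l₂ i)))
  go : ∀ m → lin (λ v → X.expo (φF v) i) m ≡ rowsum (i ℤ.- + 1) m ℤ.- rowsum i m
  go [] = refl
  go ((v , e) ∷ m) = trans (cong₂ (λ x y → e ℤ.* x ℤ.+ y) (sc v) (go m)) (lem e (rowIs (i ℤ.- + 1) v) (rowIs i v) (rowsum (i ℤ.- + 1) m) (rowsum i m))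
    where
    lem : ∀ e a b x y → e ℤ.* (a ℤ.- b) ℤ.+ (x ℤ.- y) ≡ e ℤ.* a ℤ.+ x ℤ.- (e ℤ.* b ℤ.+ y)
    lem = solve-∀

min-row : ∀ u U → ∃ λ v → v ∈ u ∷ U × (∀ {w} → w ∈ u ∷ U → row v ℤ.≤ row w)
min-row u [] = u , here refl , λ { (here refl) → ℤₚ.≤-refl }
min-row u (u' ∷ U) with min-row u' U
... | v , i , h with row u ℤ.≤? row v
... | yes le = u , here refl , λ { (here refl) → ℤₚ.≤-refl ; (there j) → ℤₚ.≤-trans le (h j) }
... | no nle = v , there i , λ { (here refl) → ℤₚ.<⇒≤ (ℤₚ.≰⇒> nle) ; (there j) → h j }

rowsum-unit-zero : ∀ i U → (∀ {w} → w ∈ U → row w ≢ i) → rowsum i (unit U) ≡ + 0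
rowsum-unit-zero i [] h = refl
rowsum-unit-zero i (u ∷ U) h rewrite ==ℤ-false (h (here refl)) = trans (ℤₚ.+-identityˡ _) (rowsum-unit-zero i U (h ∘ there))

rowsum-unit-≥0 : ∀ i U → + 0 ℤ.≤ rowsum i (unit U)
rowsum-unit-≥0 i [] = ℤₚ.≤-refl
rowsum-unit-≥0 i (u ∷ U) = ℤₚ.+-mono-≤ (nn (row u ==ℤ i)) (rowsum-unit-≥0 i U)
  where
  nn : ∀ b → + 0 ℤ.≤ + 1 ℤ.* (if b then + 1 else + 0)
  nn true = ℤ.+≤+ ℕ.z≤n
  nn false = ℤ.+≤+ ℕ.z≤n

rowsum-unit-≥1 : ∀ U v → v ∈ U → + 1 ℤ.≤ rowsum (row v) (unit U)
rowsum-unit-≥1 (u ∷ U) .u (here refl) rewrite ==ℤ-refl (row u) = ℤₚ.+-mono-≤ (ℤₚ.≤-refl {+ 1}) (rowsum-unit-≥0 (row u) U)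
rowsum-unit-≥1 (u ∷ U) v (there i) = ℤₚ.+-mono-≤ (nn (row u ==ℤ row v)) (rowsum-unit-≥1 U v i)
  where
  nn : ∀ b → + 0 ℤ.≤ + 1 ℤ.* (if b then + 1 else + 0)
  nn true = ℤ.+≤+ ℕ.z≤n
  nn false = ℤ.+≤+ ℕ.z≤n

-- only the topmost row of U contributes to the exponent of x_i there
NZ-unit : ∀ u U → NZ (unit (u ∷ U))
NZ-unit u U with min-row u U
... | v , i , h = row v , λ e → ℤₚ.<⇒≱ (ℤ.+<+ (ℕ.s≤s ℕ.z≤n)) (ℤₚ.≤-trans (rowsum-unit-≥1 (u ∷ U) v i) (ℤₚ.≤-reflexive (zero-sum e)))
  where
  above : rowsum (row v ℤ.- + 1) (unit (u ∷ U)) ≡ + 0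
  above = rowsum-unit-zero (row v ℤ.- + 1) (u ∷ U) λ j e → ℤₚ.<⇒≱ (+1≤⇒< (ℤₚ.≤-reflexive (lem (row v)))) (ℤₚ.≤-trans (h j) (ℤₚ.≤-reflexive e))
    where
    lem : ∀ r → r ℤ.- + 1 ℤ.+ + 1 ≡ r
    lem = solve-∀
  zero-sum : X.expo (Fh (unit (u ∷ U))) (row v) ≡ + 0 → rowsum (row v) (unit (u ∷ U)) ≡ + 0
  zero-sum e = trans (lem (rowsum (row v) (unit (u ∷ U)))) (cong ℤ.-_ (trans (cong (ℤ._- rowsum (row v) (unit (u ∷ U))) (sym above)) (trans (sym (expo-Fh (unit (u ∷ U)) (row v))) e)))
    where
    lem : ∀ r → r ≡ ℤ.- (+ 0 ℤ.- r)
    lem = solve-∀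

subs subs⁺ : List V → List (List V)
subs [] = [] ∷ []
subs (v ∷ vs) = map (v ∷_) (subs vs) ++ subs vs
subs⁺ [] = []
subs⁺ (v ∷ vs) = map (v ∷_) (subs vs) ++ subs⁺ vs

filter∈subs : ∀ P vs → filterᵇ P vs ∈ subs vs
filter∈subs P [] = here refl
filter∈subs P (v ∷ vs) with P v
... | true = ∈-++⁺ˡ (∈-map⁺ (v ∷_) (filter∈subs P vs))
... | false = ∈-++⁺ʳ (map (v ∷_) (subs vs)) (filter∈subs P vs)

filter∈subs⁺ : ∀ P vs {v} → v ∈ vs → P v ≡ true → filterᵇ P vs ∈ subs⁺ vs
filter∈subs⁺ P (v ∷ vs) i e with P v in q
... | true = ∈-++⁺ˡ (∈-map⁺ (v ∷_) (filter∈subs P vs))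
filter∈subs⁺ P (v ∷ vs) (here refl) e | false = ⊥-elim (true≢false e q)
filter∈subs⁺ P (v ∷ vs) (there i) e | false = ∈-++⁺ʳ (map (v ∷_) (subs vs)) (filter∈subs⁺ P vs i e)

subs-⊆ : ∀ vs U → U ∈ subs vs → (Unique vs → Unique U) × (∀ {v} → v ∈ U → v ∈ vs)
subs-⊆ [] U (here refl) = (λ u → u) , λ ()
subs-⊆ (v ∷ vs) U i with ∈-++⁻ (map (v ∷_) (subs vs)) i
... | inj₂ j = let (a , b) = subs-⊆ vs U j in (λ { (_ ∷ u) → a u }) , λ k → there (b k)
... | inj₁ j with ∈-map⁻ (v ∷_) j
... | U' , k , refl = let (a , b) = subs-⊆ vs U' k in
  (λ { (nv ∷ u) → All.tabulate (λ l e → All∉ nv (subst (_∈ vs) (sym e) (b l))) ∷ a u }) , λ { (here p) → here p ; (there l) → there (b l) }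

subs⁺-spec : ∀ vs U → U ∈ subs⁺ vs → U ∈ subs vs × ∃ λ u → ∃ λ U' → U ≡ u ∷ U'
subs⁺-spec (v ∷ vs) U i with ∈-++⁻ (map (v ∷_) (subs vs)) i
... | inj₂ j = let (a , b) = subs⁺-spec vs U j in ∈-++⁺ʳ (map (v ∷_) (subs vs)) a , b
... | inj₁ j with ∈-map⁻ (v ∷_) j
... | U' , k , refl = ∈-++⁺ˡ j , v , U' , refl

-- Contains every point at which a product of `k` factors `1 - e^w` with 0/1 vectors `w`, taken at
-- `m`, evaluates its argument.
Near : ℕ → Mono → Mono → Set
Near k m m' = ∀ v → expo m' v ℤ.≤ expo m v × expo m v ℤ.≤ expo m' v ℤ.+ + k

ZeroOne : Mono → Set
ZeroOne w = ∀ v → + 0 ℤ.≤ expo w v × expo w v ℤ.≤ + 1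

near-weaken : ∀ k m m' → Near k m m' → Near (suc k) m m'
near-weaken k m m' n v = let (a , b) = n v in a , ℤₚ.≤-trans b (ℤₚ.+-monoʳ-≤ (expo m' v) (ℤ.+≤+ (ℕₚ.n≤1+n k)))

near-minus : ∀ k m w m' → ZeroOne w → Near k (m -ᴹ w) m' → Near (suc k) m m'
near-minus k m w m' z n v = ℤₚ.≤-trans a (ℤₚ.≤-trans (ℤₚ.≤-reflexive (expo-minus m w v)) (≤-by _ (expo m v) z₀ (l₁ (expo m v) (expo w v)))) ,
  ≤-by (expo m v) (expo m' v ℤ.+ + suc k) (ℤₚ.+-mono-≤ (ℤₚ.≤-trans (ℤₚ.≤-reflexive (sym (expo-minus m w v))) b) z₁) (l₂ (expo m v) (expo w v) (expo m' v) (+ k))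
  where
  a = proj₁ (n v)
  b = proj₂ (n v)
  z₀ = proj₁ (z v)
  z₁ = proj₂ (z v)
  l₁ : ∀ x w → x ℤ.- (x ℤ.- w) ≡ w ℤ.- + 0
  l₁ = solve-∀
  l₂ : ∀ x w y k → y ℤ.+ (+ 1 ℤ.+ k) ℤ.- x ≡ (y ℤ.+ k) ℤ.+ + 1 ℤ.- (x ℤ.- w ℤ.+ w)
  l₂ = solve-∀

near-refl : ∀ m → Near 0 m m
near-refl m v = ℤₚ.≤-refl , ℤₚ.≤-reflexive (sym (ℤₚ.+-identityʳ _))

acts-local : ∀ ws g m → All ZeroOne ws → (∀ m' → Near (length ws) m m' → g m' ≋ []) → acts ws g m ≋ []
acts-local [] g m z h = h m (near-refl m)
acts-local (w ∷ ws) g m (zw ∷ z) h = ≋-trans (⊝-cong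
  (acts-local ws g m z λ m' n → h m' (near-weaken (length ws) m m' n))
  (acts-local ws g (m -ᴹ w) z λ m' n → h m' (near-minus (length ws) m w m' zw n))) (⊕-inverseʳ [])

-- Commute the factor of `u` to the innermost place; the other factors then evaluate `act u f` only
-- at points near `m`, where it vanishes.
acts-kill : ∀ ws f m u → Resp f → All ZeroOne ws → u ∈ ws → (∀ m' → Near (length ws) m m' → act u f m' ≋ []) → acts ws f m ≋ []
acts-kill (w ∷ ws) f m .w r (zw ∷ z) (here refl) h = ≋-trans (act-acts w ws r m)
  (acts-local ws (act w f) m z λ m' n → h m' (near-weaken (length ws) m m' n))
acts-kill (w ∷ ws) f m u r (zw ∷ z) (there i) h = ≋-trans (⊝-cong
  (acts-kill ws f m u r z i λ m' n → h m' (near-weaken (length ws) m m' n))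
  (acts-kill ws f (m -ᴹ w) u r z i λ m' n → h m' (near-minus (length ws) m w m' zw n))) (⊕-inverseʳ [])

count : (V → Bool) → List V → ℕ
count P vs = length (filterᵇ P vs)

count-mono : ∀ P Q vs → (∀ v → P v ≡ true → Q v ≡ true) → count P vs ℕ.≤ count Q vs
count-mono P Q [] h = ℕ.z≤n
count-mono P Q (v ∷ vs) h with P v in p | Q v in q
... | true | true = ℕ.s≤s (count-mono P Q vs h)
... | true | false = ⊥-elim (true≢false (h v p) q)
... | false | true = ℕₚ.m≤n⇒m≤1+n (count-mono P Q vs h)
... | false | false = count-mono P Q vs h

count-strict : ∀ P Q vs {v} → (∀ v → P v ≡ true → Q v ≡ true) → v ∈ vs → P v ≡ false → Q v ≡ true → suc (count P vs) ℕ.≤ count Q vs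
count-strict P Q (v ∷ vs) h i p q with P v in p' | Q v in q'
count-strict P Q (v ∷ vs) h i p q | true | false = ⊥-elim (true≢false (h v p') q')
count-strict P Q (v ∷ vs) h (here refl) p q | true | true = ⊥-elim (true≢false p' p)
count-strict P Q (v ∷ vs) h (there i) p q | true | true = ℕ.s≤s (count-strict P Q vs h i p q)
count-strict P Q (v ∷ vs) h i p q | false | true = ℕ.s≤s (count-mono P Q vs h)
count-strict P Q (v ∷ vs) h (here refl) p q | false | false = ⊥-elim (true≢false q q')
count-strict P Q (v ∷ vs) h (there i) p q | false | false = count-strict P Q vs h i p q

count-≤ : ∀ P vs → count P vs ℕ.≤ length vs
count-≤ P [] = ℕ.z≤n
count-≤ P (v ∷ vs) with P v
... | true = ℕ.s≤s (count-≤ P vs)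
... | false = ℕₚ.m≤n⇒m≤1+n (count-≤ P vs)

count-pos : ∀ P vs {v} → v ∈ vs → P v ≡ true → 1 ℕ.≤ count P vs
count-pos P (v ∷ vs) i e with P v in q
... | true = ℕ.s≤s ℕ.z≤n
count-pos P (v ∷ vs) (here refl) e | false = ⊥-elim (true≢false e q)
count-pos P (v ∷ vs) (there i) e | false = count-pos P vs i e

-- Pigeonhole: descend from some `y v` in steps of `K`. Either an interval of length `K` just below
-- the threshold is free of values, or each step passes a new element of `vs`, and `length vs` steps
-- would pass more elements than there are.
module Gap (y : V → ℤ) (vs : List V) (K : ℕ) where

  Above : ℤ → V → Bool
  Above θ v = θ ≤ᵇ y v

  GapAt : ℤ → Set
  GapAt θ = ∀ {v} → v ∈ vs → θ ℤ.≤ y v ⊎ y v ℤ.< θ ℤ.- + K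

  gap? : ∀ θ → GapAt θ ⊎ ∃ λ v → v ∈ vs × y v ℤ.< θ × θ ℤ.- + K ℤ.≤ y v
  gap? θ = go vs
    where
    go : ∀ ws → (∀ {v} → v ∈ ws → θ ℤ.≤ y v ⊎ y v ℤ.< θ ℤ.- + K) ⊎ ∃ λ v → v ∈ ws × y v ℤ.< θ × θ ℤ.- + K ℤ.≤ y v
    go [] = inj₁ λ ()
    go (w ∷ ws) with θ ℤ.≤? y w | y w ℤ.<? θ ℤ.- + K | go ws
    ... | no p | no q | _ = inj₂ (w , here refl , ℤₚ.≰⇒> p , ℤₚ.≮⇒≥ q)
    ... | _ | _ | inj₂ (v , i , a , b) = inj₂ (v , there i , a , b)
    ... | yes p | _ | inj₁ h = inj₁ λ { (here refl) → inj₁ p ; (there i) → h i }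
    ... | _ | yes q | inj₁ h = inj₁ λ { (here refl) → inj₂ q ; (there i) → h i }

  search : ∀ n θ → (∃ λ θ' → θ' ℤ.≤ θ × θ ℤ.- + n ℤ.* + K ℤ.≤ θ' × GapAt θ') ⊎
    n ℕ.+ count (Above θ) vs ℕ.≤ count (Above (θ ℤ.- + n ℤ.* + K)) vs
  search zero θ = inj₂ (count-mono _ _ vs λ v e → ≤ᵇ-true (ℤₚ.≤-trans (ℤₚ.≤-reflexive (lem θ (+ K))) (≤ᵇ-sound e)))
    where
    lem : ∀ θ K → θ ℤ.- + 0 ℤ.* K ≡ θ
    lem = solve-∀
  search (suc n) θ with gap? θ
  ... | inj₁ g = inj₁ (θ , ℤₚ.≤-refl , ≤-by _ θ (ℤ.+≤+ (ℕ.z≤n {suc n ℕ.* K})) (trans (lem θ (+ suc n ℤ.* + K)) (cong (ℤ._- + 0) (sym (ℤₚ.pos-* (suc n) K)))) , g)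
    where
    lem : ∀ θ z → θ ℤ.- (θ ℤ.- z) ≡ z ℤ.- + 0
    lem = solve-∀
  ... | inj₂ (v , i , a , b) with search n (θ ℤ.- + K)
  ... | inj₁ (θ' , le , ge , g) = inj₁ (θ' , ℤₚ.≤-trans le (≤-by _ θ (ℤ.+≤+ (ℕ.z≤n {K})) (l₁ θ (+ K))) , ℤₚ.≤-trans (ℤₚ.≤-reflexive (l₂ θ (+ n) (+ K))) ge , g)
    where
    l₁ : ∀ θ K → θ ℤ.- (θ ℤ.- K) ≡ K ℤ.- + 0
    l₁ = solve-∀
    l₂ : ∀ θ n K → θ ℤ.- (+ 1 ℤ.+ n) ℤ.* K ≡ θ ℤ.- K ℤ.- n ℤ.* K
    l₂ = solve-∀
  ... | inj₂ h = inj₂ (ℕₚ.≤-trans (ℕₚ.≤-reflexive (sym (ℕₚ.+-suc n _)))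
      (ℕₚ.≤-trans (ℕₚ.+-monoʳ-≤ n (count-strict (Above θ) (Above (θ ℤ.- + K)) vs
          (λ w e → ≤ᵇ-true (ℤₚ.≤-trans (≤-by _ θ (ℤ.+≤+ (ℕ.z≤n {K})) (l₁ θ (+ K))) (≤ᵇ-sound e))) i (≤ᵇ-false a) (≤ᵇ-true b)))
      (ℕₚ.≤-trans h (ℕₚ.≤-reflexive (cong (λ z → count (Above z) vs) (sym (l₂ θ (+ n) (+ K))))))))
    where
    l₁ : ∀ θ K → θ ℤ.- (θ ℤ.- K) ≡ K ℤ.- + 0
    l₁ = solve-∀
    l₂ : ∀ θ n K → θ ℤ.- (+ 1 ℤ.+ n) ℤ.* K ≡ θ ℤ.- K ℤ.- n ℤ.* K
    l₂ = solve-∀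

  gap : ∀ {v} → v ∈ vs → ∃ λ θ → θ ℤ.≤ y v × y v ℤ.- + length vs ℤ.* + K ℤ.≤ θ × GapAt θ
  gap {v} i with search (length vs) (y v)
  ... | inj₁ g = g
  ... | inj₂ h = ⊥-elim (ℕₚ.<⇒≱ (ℕₚ.≤-trans (ℕₚ.≤-reflexive (ℕₚ.+-comm 1 (length vs))) (ℕₚ.+-monoʳ-≤ (length vs) (count-pos (Above (y v)) vs i (≤ᵇ-true {y v} {y v} ℤₚ.≤-refl))))
                          (ℕₚ.≤-trans h (count-≤ _ vs)))

-- Order type relative to the constants `bs`, which stand for the prescribed entries of the top row.
record SameOrder (vs : List V) (bs : List ℤ) (m m' : Mono) : Set where
  field
    within : ∀ {u v} → u ∈ vs → v ∈ vs → (expo m u ≤ᵇ expo m v) ≡ (expo m' u ≤ᵇ expo m' v)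
    below : ∀ {u b} → u ∈ vs → b ∈ bs → (expo m u ≤ᵇ b) ≡ (expo m' u ≤ᵇ b)
    above : ∀ {u b} → u ∈ vs → b ∈ bs → (b ≤ᵇ expo m u) ≡ (b ≤ᵇ expo m' u)
    outside : ∀ v → v ∉ vs → expo m v ≡ expo m' v

-- The factors are `1 - e^U` for all non-empty sets `U` of vertices. If an entry is far from zero,
-- the entries have a gap wider than the number of factors. The block `U` beyond the gap can then
-- move by one without changing the order type, at `m` and at all points the other factors reach, so
-- the factor of `U` annihilates `f` there. What survives lies in a box.
module OrderType (f : Mono → Poly) (vs : List V) (uvs : Unique vs) (bs : List ℤ)
  (ord : ∀ m m' → SameOrder vs bs m m' → f m ≋ f m')
  (off : ∀ m v → v ∉ vs → expo m v ≢ + 0 → f m ≋ []) where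

  resp : Resp f
  resp {m} {m'} e = ord m m' (record
    { within = λ {u} {v} _ _ → cong₂ _≤ᵇ_ (on e u) (on e v)
    ; below = λ {u} {b} _ _ → cong (_≤ᵇ b) (on e u)
    ; above = λ {u} {b} _ _ → cong (b ≤ᵇ_) (on e u)
    ; outside = λ v _ → on e v })

  ws : List Mono
  ws = map unit (subs⁺ vs)

  ws-spec : ∀ {w} → w ∈ ws → ∃ λ U → w ≡ unit U × Unique U × (∀ {v} → v ∈ U → v ∈ vs) × NZ w
  ws-spec i with ∈-map⁻ unit i
  ... | U , j , refl with subs⁺-spec vs U j
  ... | k , u , U' , refl = let (a , b) = subs-⊆ vs U k in U , refl , a uvs , b , NZ-unit u U'

  ws-nz : All NZ ws
  ws-nz = All.tabulate λ i → proj₂ (proj₂ (proj₂ (proj₂ (ws-spec i))))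

  ws-01 : All ZeroOne ws
  ws-01 = All.tabulate λ i → let (U , e , u , _ , _) = ws-spec i in subst ZeroOne (sym e) (zo U u)
    where
    zo : ∀ U → Unique U → ZeroOne (unit U)
    zo U u v with v ∈? U
    ... | yes i rewrite expo-unit-∈ U v u i = ℤ.+≤+ ℕ.z≤n , ℤₚ.≤-refl
    ... | no n rewrite expo-unit-∉ U v n = ℤₚ.≤-refl , ℤ.+≤+ ℕ.z≤n

  -- A gap of width `K` survives `n` steps of the factors plus one step of the block. In `D`, the
  -- search for a gap may use up `length vs` such widths, one more keeps the block away from the
  -- constants, and the constants themselves are bounded by `sumAbs bs`.
  n = length ws
  K : ℕ
  K = suc n
  D : ℕ
  D = length vs ℕ.* K ℕ.+ K ℕ.+ sumAbs bs

  -- moving the block U by one step does not change any comparison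
  module Block (P : V → Bool) (m' : Mono)
    (sep : ∀ {u z} → u ∈ vs → P u ≡ true → (∃ λ v → v ∈ vs × P v ≡ false × z ≡ expo m' v) ⊎ z ∈ bs →
      z ℤ.< expo m' u ℤ.- + 1 ⊎ expo m' u ℤ.< z) where

    U = filterᵇ P vs

    uU : Unique U
    uU = proj₁ (subs-⊆ vs U (filter∈subs P vs)) uvs

    U-mem : ∀ {v} → v ∈ vs → P v ≡ true → v ∈ U
    U-mem {v} i e = Data.List.Membership.Propositional.Properties.∈-filter⁺ (λ v → Relation.Nullary.Decidable.T? (P v)) i (subst T (sym e) _)

    U-out : ∀ {v} → P v ≡ false → v ∉ U
    U-out {v} e i = subst T e (proj₂ (Data.List.Membership.Propositional.Properties.∈-filter⁻ (λ v → Relation.Nullary.Decidable.T? (P v)) {xs = vs} i))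

    m'' = m' -ᴹ unit U

    in-shift : ∀ {v} → v ∈ vs → P v ≡ true → expo m'' v ≡ expo m' v ℤ.- + 1
    in-shift {v} i e = trans (expo-minus m' (unit U) v) (cong (λ z → expo m' v ℤ.- z) (expo-unit-∈ U v uU (U-mem i e)))

    out-shift : ∀ {v} → P v ≡ false → expo m'' v ≡ expo m' v
    out-shift {v} e = trans (expo-minus m' (unit U) v) (trans (cong (λ z → expo m' v ℤ.- z) (expo-unit-∉ U v (U-out e))) (ℤₚ.+-identityʳ _))

    cmp₁ : ∀ a z → z ℤ.< a ℤ.- + 1 ⊎ a ℤ.< z → (a ≤ᵇ z) ≡ (a ℤ.- + 1 ≤ᵇ z)
    cmp₁ a z (inj₁ lt) = trans (≤ᵇ-false (ℤₚ.<-≤-trans lt (a-1≤a a))) (sym (≤ᵇ-false lt))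
      where
      a-1≤a : ∀ a → a ℤ.- + 1 ℤ.≤ a
      a-1≤a a = ≤-by _ a (ℤ.+≤+ (ℕ.z≤n {1})) (l a)
        where
        l : ∀ a → a ℤ.- (a ℤ.- + 1) ≡ + 1 ℤ.- + 0
        l = solve-∀
    cmp₁ a z (inj₂ lt) = trans (≤ᵇ-true (ℤₚ.<⇒≤ lt)) (sym (≤ᵇ-true (≤-by _ z (ℤₚ.+-mono-≤ (ℤₚ.<⇒≤ lt) (ℤ.+≤+ (ℕ.z≤n {1}))) (l a z))))
      where
      l : ∀ a z → z ℤ.- (a ℤ.- + 1) ≡ z ℤ.+ + 1 ℤ.- (a ℤ.+ + 0)
      l = solve-∀

    cmp₂ : ∀ a z → z ℤ.< a ℤ.- + 1 ⊎ a ℤ.< z → (z ≤ᵇ a) ≡ (z ≤ᵇ a ℤ.- + 1)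
    cmp₂ a z (inj₁ lt) = trans (≤ᵇ-true (≤-by z a (ℤₚ.+-mono-≤ (ℤₚ.<⇒≤ lt) (ℤ.+≤+ (ℕ.z≤n {1}))) (l a z))) (sym (≤ᵇ-true (ℤₚ.<⇒≤ lt)))
      where
      l : ∀ a z → a ℤ.- z ≡ a ℤ.- + 1 ℤ.+ + 1 ℤ.- (z ℤ.+ + 0)
      l = solve-∀
    cmp₂ a z (inj₂ lt) = trans (≤ᵇ-false lt) (sym (≤ᵇ-false (+1≤⇒< (≤-by _ z (ℤₚ.+-mono-≤ (<⇒+1≤ lt) (ℤ.+≤+ (ℕ.z≤n {1}))) (l a z)))))
      where
      l : ∀ a z → z ℤ.- (a ℤ.- + 1 ℤ.+ + 1) ≡ z ℤ.+ + 1 ℤ.- (a ℤ.+ + 1 ℤ.+ + 0)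
      l = solve-∀

    shift-both : ∀ a b → (a ≤ᵇ b) ≡ (a ℤ.- + 1 ≤ᵇ b ℤ.- + 1)
    shift-both a b = bool-ext (λ e → ≤ᵇ-true (ℤₚ.+-monoˡ-≤ (ℤ.- + 1) (≤ᵇ-sound {a} {b} e)))
      (λ e → ≤ᵇ-true (≤-by a b (≤ᵇ-sound {a ℤ.- + 1} {b ℤ.- + 1} e) (l a b)))
      where
      l : ∀ a b → b ℤ.- a ≡ b ℤ.- + 1 ℤ.- (a ℤ.- + 1)
      l = solve-∀

    same : SameOrder vs bs m' m''
    same = record { within = w ; below = bl ; above = ab ; outside = λ v ni → sym (trans (expo-minus m' (unit U) v)
        (trans (cong (λ z → expo m' v ℤ.- z) (expo-unit-∉ U v λ i → ni (proj₂ (subs-⊆ vs U (filter∈subs P vs)) i))) (ℤₚ.+-identityʳ _))) }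
      where
      w : ∀ {u v} → u ∈ vs → v ∈ vs → (expo m' u ≤ᵇ expo m' v) ≡ (expo m'' u ≤ᵇ expo m'' v)
      w {u} {v} i j with bool-case (P u) | bool-case (P v)
      ... | inj₁ p | inj₁ q = trans (shift-both (expo m' u) (expo m' v)) (sym (cong₂ _≤ᵇ_ (in-shift i p) (in-shift j q)))
      ... | inj₂ p | inj₂ q = sym (cong₂ _≤ᵇ_ (out-shift p) (out-shift q))
      ... | inj₁ p | inj₂ q = trans (cmp₁ (expo m' u) (expo m' v) (sep i p (inj₁ (v , j , q , refl)))) (sym (cong₂ _≤ᵇ_ (in-shift i p) (out-shift q)))
      ... | inj₂ p | inj₁ q = trans (cmp₂ (expo m' v) (expo m' u) (sep j q (inj₁ (u , i , p , refl)))) (sym (cong₂ _≤ᵇ_ (out-shift p) (in-shift j q)))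
      bl : ∀ {u b} → u ∈ vs → b ∈ bs → (expo m' u ≤ᵇ b) ≡ (expo m'' u ≤ᵇ b)
      bl {u} {b} i j with bool-case (P u)
      ... | inj₁ p = trans (cmp₁ (expo m' u) b (sep i p (inj₂ j))) (cong (_≤ᵇ b) (sym (in-shift i p)))
      ... | inj₂ p = cong (_≤ᵇ b) (sym (out-shift p))
      ab : ∀ {u b} → u ∈ vs → b ∈ bs → (b ≤ᵇ expo m' u) ≡ (b ≤ᵇ expo m'' u)
      ab {u} {b} i j with bool-case (P u)
      ... | inj₁ p = trans (cmp₂ (expo m' u) b (sep i p (inj₂ j))) (cong (b ≤ᵇ_) (sym (in-shift i p)))
      ... | inj₂ p = cong (b ≤ᵇ_) (sym (out-shift p))

    invariant : act (unit U) f m' ≋ []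
    invariant = p⊝q≋0 (ord m' m'' same)

  bs-bound : ∀ {b} → b ∈ bs → b ℤ.≤ + sumAbs bs × ℤ.- + sumAbs bs ℤ.≤ b
  bs-bound {b} i = ∣x∣≤⇒≤ b (∣∣≤sumAbs i) , ∣x∣≤⇒≥ b (∣∣≤sumAbs i)

  D≡ : + D ≡ + length vs ℤ.* + K ℤ.+ + K ℤ.+ + sumAbs bs
  D≡ = cong (λ z → z ℤ.+ + K ℤ.+ + sumAbs bs) (ℤₚ.pos-* (length vs) K)

  far-above : ∀ m v → v ∈ vs → + D ℤ.< expo m v → acts ws f m ≋ []
  far-above m v i lt with Gap.gap (expo m) vs K i
  ... | θ , le , ge , g = acts-kill ws f m (unit (filterᵇ P vs)) resp ws-01
      (∈-map⁺ unit (filter∈subs⁺ P vs i (≤ᵇ-true le))) (λ m' nr → Block.invariant P m' (sep m' nr))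
    where
    P : V → Bool
    P w = θ ≤ᵇ expo m w
    big : + sumAbs bs ℤ.+ + K ℤ.+ + 1 ℤ.≤ θ
    big = ≤-by _ θ (ℤₚ.+-mono-≤ ge (ℤₚ.≤-trans (ℤₚ.+-monoˡ-≤ (+ 1) (ℤₚ.≤-reflexive (sym D≡))) (<⇒+1≤ lt))) (l θ (expo m v) (+ length vs ℤ.* + K) (+ K) (+ sumAbs bs))
      where
      l : ∀ θ x q K s → θ ℤ.- (s ℤ.+ K ℤ.+ + 1) ≡ θ ℤ.+ x ℤ.- (x ℤ.- q ℤ.+ (q ℤ.+ K ℤ.+ s ℤ.+ + 1))
      l = solve-∀
    sep : ∀ m' → Near n m m' → ∀ {u z} → u ∈ vs → P u ≡ true → (∃ λ v → v ∈ vs × P v ≡ false × z ≡ expo m' v) ⊎ z ∈ bs →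
      z ℤ.< expo m' u ℤ.- + 1 ⊎ expo m' u ℤ.< z
    sep m' nr {u} {z} j p h = inj₁ (+1≤⇒< (≤-by _ _ (ℤₚ.+-mono-≤ (ℤₚ.+-mono-≤ (<⇒+1≤ (zlt h)) (≤ᵇ-sound p)) (proj₂ (nr u)))
        (l z θ (expo m u) (expo m' u) (+ n))))
      where
      l : ∀ z θ x y n → y ℤ.- + 1 ℤ.- (z ℤ.+ + 1) ≡ θ ℤ.- (+ 1 ℤ.+ n) ℤ.+ x ℤ.+ (y ℤ.+ n) ℤ.- (z ℤ.+ + 1 ℤ.+ θ ℤ.+ x)
      l = solve-∀
      zlt : (∃ λ v → v ∈ vs × P v ≡ false × z ≡ expo m' v) ⊎ z ∈ bs → z ℤ.< θ ℤ.- + K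
      zlt (inj₁ (w , k , q , refl)) with g k
      ... | inj₁ r = ⊥-elim (true≢false (≤ᵇ-true r) q)
      ... | inj₂ r = ℤₚ.≤-<-trans (proj₁ (nr w)) r
      zlt (inj₂ k) = +1≤⇒< (≤-by _ _ (ℤₚ.+-mono-≤ (proj₁ (bs-bound k)) big) (l' z (+ sumAbs bs) (+ K) θ))
        where
        l' : ∀ z s K θ → θ ℤ.- K ℤ.- (z ℤ.+ + 1) ≡ s ℤ.+ θ ℤ.- (z ℤ.+ (s ℤ.+ K ℤ.+ + 1))
        l' = solve-∀

  -- The gap is sought in the negated array, and the block consists of the smallest entries. Nearby
  -- points have smaller entries than `m`, so here it is the entries above the gap that could
  -- approach the block.
  far-below : ∀ m v → v ∈ vs → expo m v ℤ.< ℤ.- + D → acts ws f m ≋ []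
  far-below m v i lt with Gap.gap (λ w → ℤ.- expo m w) vs K i
  ... | θ , le , ge , g = acts-kill ws f m (unit (filterᵇ P vs)) resp ws-01
      (∈-map⁺ unit (filter∈subs⁺ P vs i (≤ᵇ-true le))) (λ m' nr → Block.invariant P m' (sep m' nr))
    where
    P : V → Bool
    P w = θ ≤ᵇ ℤ.- expo m w
    big : + sumAbs bs ℤ.+ + K ℤ.+ + 1 ℤ.≤ θ
    big = ≤-by _ θ (ℤₚ.+-mono-≤ ge (<⇒+1≤ lt)) (trans (l θ (expo m v) (+ length vs ℤ.* + K) (+ K) (+ sumAbs bs)) (cong (λ z → θ ℤ.+ (ℤ.- z) ℤ.- ((ℤ.- expo m v) ℤ.- + length vs ℤ.* + K ℤ.+ (expo m v ℤ.+ + 1))) (sym D≡)))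
      where
      l : ∀ θ x q K s → θ ℤ.- (s ℤ.+ K ℤ.+ + 1) ≡ θ ℤ.+ (ℤ.- (q ℤ.+ K ℤ.+ s)) ℤ.- ((ℤ.- x) ℤ.- q ℤ.+ (x ℤ.+ + 1))
      l = solve-∀
    sep : ∀ m' → Near n m m' → ∀ {u z} → u ∈ vs → P u ≡ true → (∃ λ v → v ∈ vs × P v ≡ false × z ≡ expo m' v) ⊎ z ∈ bs →
      z ℤ.< expo m' u ℤ.- + 1 ⊎ expo m' u ℤ.< z
    sep m' nr {u} {z} j p (inj₂ k) = inj₂ (+1≤⇒< (≤-by _ _
        (ℤₚ.+-mono-≤ (ℤₚ.+-mono-≤ (ℤₚ.+-mono-≤ (ℤₚ.+-mono-≤ (proj₁ (nr u)) (≤ᵇ-sound p)) big) (proj₂ (bs-bound k))) (ℤ.+≤+ (ℕ.z≤n {K})))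
        (l z θ (expo m u) (expo m' u) (+ K) (+ sumAbs bs))))
      where
      l : ∀ z θ x y K s → z ℤ.- (y ℤ.+ + 1) ≡ x ℤ.+ (ℤ.- x) ℤ.+ θ ℤ.+ z ℤ.+ K ℤ.- (y ℤ.+ θ ℤ.+ (s ℤ.+ K ℤ.+ + 1) ℤ.+ (ℤ.- s) ℤ.+ + 0)
      l = solve-∀
    sep m' nr {u} {z} j p (inj₁ (w , k , q , refl)) with g k
    ... | inj₁ r = ⊥-elim (true≢false (≤ᵇ-true r) q)
    ... | inj₂ r = inj₂ (+1≤⇒< (≤-by _ _
        (ℤₚ.+-mono-≤ (ℤₚ.+-mono-≤ (ℤₚ.+-mono-≤ (ℤₚ.+-mono-≤ (proj₁ (nr u)) (≤ᵇ-sound p)) (<⇒+1≤ r)) (proj₂ (nr w))) (ℤ.+≤+ (ℕ.z≤n {1})))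
        (l (expo m' w) θ (expo m u) (expo m' u) (expo m w) (+ n))))
      where
      l : ∀ z θ x y v n → z ℤ.- (y ℤ.+ + 1) ≡ x ℤ.+ (ℤ.- x) ℤ.+ (θ ℤ.- (+ 1 ℤ.+ n)) ℤ.+ (z ℤ.+ n) ℤ.+ + 1 ℤ.- (y ℤ.+ θ ℤ.+ ((ℤ.- v) ℤ.+ + 1) ℤ.+ v ℤ.+ + 0)
      l = solve-∀

  tame : Tame f
  tame = record { ws = ws ; nz = ws-nz ; sum = boxL g cs [] vs ; eq = agree }
    where
    g = acts ws f
    -- The range runs from `- D` to `D` inclusive.
    H = D ℕ.+ suc D
    cs = range (ℤ.- + D) H
    off-g : ∀ m v → v ∉ vs → expo m v ≢ + 0 → g m ≋ []
    off-g m v ni ne = go ws (λ i → i) m ne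
      where
      go : ∀ ws' → (∀ {w} → w ∈ ws' → w ∈ ws) → ∀ m → expo m v ≢ + 0 → acts ws' f m ≋ []
      go [] h m ne = off m v ni ne
      go (w ∷ ws') h m ne = ≋-trans (⊝-cong (go ws' (h ∘ there) m ne)
        (go ws' (h ∘ there) (m -ᴹ w) λ e → ne (trans (sym (trans (expo-minus m w v) (trans (cong (λ z → expo m v ℤ.- z) wv) (ℤₚ.+-identityʳ _)))) e))) (⊕-inverseʳ [])
        where
        wv : expo w v ≡ + 0
        wv = let (U , e , _ , sub , _) = ws-spec (h (here refl)) in trans (cong (λ z → expo z v) e) (expo-unit-∉ U v λ i → ni (sub i))
    in-box : ∀ m → All (λ v → expo m v ∈ cs) vs ⊎ g m ≋ []
    in-box m = go vs (λ i → i)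
      where
      go : ∀ ws' → (∀ {w} → w ∈ ws' → w ∈ vs) → All (λ v → expo m v ∈ cs) ws' ⊎ g m ≋ []
      go [] h = inj₁ []
      go (v ∷ ws') h with expo m v ℤ.≤? + D | ℤ.- + D ℤ.≤? expo m v | go ws' (h ∘ there)
      ... | _ | _ | inj₂ z = inj₂ z
      ... | no a | _ | _ = inj₂ (far-above m v (h (here refl)) (ℤₚ.≰⇒> a))
      ... | _ | no b | _ = inj₂ (far-below m v (h (here refl)) (ℤₚ.≰⇒> b))
      ... | yes a | yes b | inj₁ c = inj₁ (∈-range (ℤ.- + D) H (expo m v) b (+1≤⇒< (≤-by _ _ a (l (expo m v) (+ D)))) ∷ c)
        where
        l : ∀ x D → (ℤ.- D) ℤ.+ (D ℤ.+ (+ 1 ℤ.+ D)) ℤ.- (x ℤ.+ + 1) ≡ D ℤ.- x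
        l = solve-∀
    agree : ∀ m → coeffL (boxL g cs [] vs) m ≋ g m
    agree m with bool-case (offZ (memV vs) m)
    ... | inj₁ z = boxL-hit (acts-resp ws resp) (range-unique _ H) [] vs m uvs (λ _ → refl)
        (λ v ni → sym (offZ-sound (memV vs) m z v (not-mem v ni))) (in-box m)
      where
      not-mem : ∀ v → v ∉ vs → memV vs v ≡ false
      not-mem v ni with bool-case (memV vs v)
      ... | inj₁ e = ⊥-elim (ni (memV-sound e))
      ... | inj₂ e = e
    ... | inj₂ z = let (v , q , ne) = offZ-false (memV vs) m z
                       ni = λ i → true≢false (memV-complete i) q in
      ≋-trans (boxL-miss g cs [] vs m v ni (λ e → ne (sym e))) (≋-sym (off-g m v ni ne))

-- Shapes: consecutive rows, each extending the previous one on neither side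
-- (A), on the left (B), on the right (C) or on both sides (D).

data Move : Set where
  sA sB sC sD : Move

-- The vertices of the next row below two neighbours at columns `j` and `j + 1` is at column `j`, so
-- the forced part starts at the same column `l` and has one vertex less; a left extension starts at
-- `l - 1`.
nextL : Move → ℤ → ℤ
nextL sA l = l
nextL sB l = l ℤ.- + 1
nextL sC l = l
nextL sD l = l ℤ.- + 1

nextN : Move → ℕ → ℕ
nextN sA n = ℕ.pred n
nextN sB n = n
nextN sC n = n
nextN sD n = suc n

rowV : ℤ → ℤ → ℕ → List V
rowV i l zero = []
rowV i l (suc n) = (i , l) ∷ rowV i (l ℤ.+ + 1) n

-- The interlacing is opened by the lower row if it extends to the left (B and D), and by the upper
-- row otherwise.
W : Move → List ℤ → List ℤ → Poly
W sA x y = chi (il x y) ⊗ wt x y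
W sB x y = chi (il y x) ⊗ wt x y
W sC x y = chi (il x y) ⊗ wt x y
W sD x y = chi (il y x) ⊗ wt x y

below : ℤ → ℤ → ℕ → List Move → List V
below i l n [] = []
below i l n (s ∷ w) = rowV (i ℤ.+ + 1) (nextL s l) (nextN s n) ++ below (i ℤ.+ + 1) (nextL s l) (nextN s n) w

shapeV : ℤ → ℤ → ℕ → List Move → List V
shapeV i l n w = rowV i l n ++ below i l n w

P : ℤ → ℤ → ℕ → List Move → Mono → Poly
P i l n [] m = oneP
P i l n (s ∷ w) m =
  W s (vals m (rowV i l n)) (vals m (rowV (i ℤ.+ + 1) (nextL s l) (nextN s n))) ⊗ P (i ℤ.+ + 1) (nextL s l) (nextN s n) w m

afterI : ℤ → List Move → ℤ
afterI i [] = i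
afterI i (s ∷ w) = afterI (i ℤ.+ + 1) w

afterL : ℤ → List Move → ℤ
afterL l [] = l
afterL l (s ∷ w) = afterL (nextL s l) w

afterN : ℕ → List Move → ℕ
afterN n [] = n
afterN n (s ∷ w) = afterN (nextN s n) w

afterN-++ : ∀ n w w' → afterN n (w ++ w') ≡ afterN (afterN n w) w'
afterN-++ n [] w' = refl
afterN-++ n (s ∷ w) w' = afterN-++ (nextN s n) w w'

P-++ : ∀ i l n w w' m → P i l n (w ++ w') m ≋ P i l n w m ⊗ P (afterI i w) (afterL l w) (afterN n w) w' m
P-++ i l n [] w' m = ≋-sym (⊗-identityˡ _)
P-++ i l n (s ∷ w) w' m = ≋-trans (⊗-cong ≋-refl (P-++ (i ℤ.+ + 1) (nextL s l) (nextN s n) w w' m)) (≋-sym (⊗-assoc _ _ _))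

below-++ : ∀ i l n w w' → below i l n (w ++ w') ≡ below i l n w ++ below (afterI i w) (afterL l w) (afterN n w) w'
below-++ i l n [] w' = refl
below-++ i l n (s ∷ w) w' =
  trans (cong (rowV (i ℤ.+ + 1) (nextL s l) (nextN s n) ++_) (below-++ (i ℤ.+ + 1) (nextL s l) (nextN s n) w w'))
        (sym (++-assoc (rowV (i ℤ.+ + 1) (nextL s l) (nextN s n)) _ _))

rowV-row : ∀ i l n → All (λ v → row v ≡ i) (rowV i l n)
rowV-row i l zero = []
rowV-row i l (suc n) = refl ∷ rowV-row i (l ℤ.+ + 1) n

rowV-length : ∀ i l n → length (rowV i l n) ≡ n
rowV-length i l zero = refl
rowV-length i l (suc n) = cong suc (rowV-length i (l ℤ.+ + 1) n)

rowV-cols : ∀ i l n → All (λ v → l ℤ.≤ col v) (rowV i l n)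
rowV-cols i l zero = []
rowV-cols i l (suc n) = ℤₚ.≤-refl ∷ All.map (λ h → ℤₚ.≤-trans (≤-by l _ (ℤ.+≤+ (ℕ.z≤n {1})) (lem l)) h) (rowV-cols i (l ℤ.+ + 1) n)
  where
  lem : ∀ l → l ℤ.+ + 1 ℤ.- l ≡ + 1 ℤ.- + 0
  lem = solve-∀

rowV-unique : ∀ i l n → Unique (rowV i l n)
rowV-unique i l zero = []
rowV-unique i l (suc n) = All.map (λ h e → ℤₚ.<⇒≱ (+1≤⇒< ℤₚ.≤-refl) (ℤₚ.≤-trans h (ℤₚ.≤-reflexive (sym (cong col e))))) (rowV-cols i (l ℤ.+ + 1) n) ∷ rowV-unique i (l ℤ.+ + 1) n

i<i+1 : ∀ i → i ℤ.< i ℤ.+ + 1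
i<i+1 i = +1≤⇒< ℤₚ.≤-refl

below-row : ∀ i l n w → All (λ v → i ℤ.< row v) (below i l n w)
below-row i l n [] = []
below-row i l n (s ∷ w) = app (All.map (λ { refl → i<i+1 i }) (rowV-row (i ℤ.+ + 1) (nextL s l) (nextN s n)))
  (All.map (ℤₚ.<-trans (i<i+1 i)) (below-row (i ℤ.+ + 1) (nextL s l) (nextN s n) w))
  where
  app : ∀ {Q : V → Set} {xs ys} → All Q xs → All Q ys → All Q (xs ++ ys)
  app [] q = q
  app (p ∷ ps) q = p ∷ app ps q

below-unique : ∀ i l n w → Unique (below i l n w)
shape-unique : ∀ i l n w → Unique (shapeV i l n w)
below-unique i l n [] = []
below-unique i l n (s ∷ w) = shape-unique (i ℤ.+ + 1) (nextL s l) (nextN s n) w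
shape-unique i l n w = Uniqueₚ.++⁺ (rowV-unique i l n) (below-unique i l n w)
  λ { (a , b) → ℤₚ.<-irrefl (sym (All.lookup (rowV-row i l n) a)) (All.lookup (below-row i l n w) b) }

after≥ : ∀ i w → i ℤ.≤ afterI i w
after≥ i [] = ℤₚ.≤-refl
after≥ i (s ∷ w) = ℤₚ.≤-trans (ℤₚ.<⇒≤ (i<i+1 i)) (after≥ (i ℤ.+ + 1) w)

shape-last : ∀ i l n w v → v ∈ shapeV i l n w →
  row v ℤ.≤ afterI i w × (row v ≡ afterI i w → v ∈ rowV (afterI i w) (afterL l w) (afterN n w))
shape-last i l n [] v h with ∈-++⁻ (rowV i l n) h
... | inj₁ a = ℤₚ.≤-reflexive (All.lookup (rowV-row i l n) a) , λ _ → a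
shape-last i l n (s ∷ w) v h with ∈-++⁻ (rowV i l n) h
... | inj₂ b = shape-last (i ℤ.+ + 1) (nextL s l) (nextN s n) w v b
... | inj₁ a = ℤₚ.<⇒≤ lt , λ e → ⊥-elim (ℤₚ.<-irrefl e lt)
  where
  lt : row v ℤ.< afterI (i ℤ.+ + 1) w
  lt = ℤₚ.<-≤-trans (subst (ℤ._< i ℤ.+ + 1) (sym (All.lookup (rowV-row i l n) a)) (i<i+1 i)) (after≥ (i ℤ.+ + 1) w)

P-vals : ∀ i l n w m m' → (∀ {v} → v ∈ shapeV i l n w → expo m v ≡ expo m' v) → P i l n w m ≡ P i l n w m'
P-vals i l n [] m m' h = refl
P-vals i l n (s ∷ w) m m' h = cong₂ _⊗_
  (cong₂ (W s) (vals-cong m m' (rowV i l n) λ j → h (∈-++⁺ˡ j))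
               (vals-cong m m' (rowV (i ℤ.+ + 1) (nextL s l) (nextN s n)) λ j → h (∈-++⁺ʳ (rowV i l n) (∈-++⁺ˡ j))))
  (P-vals (i ℤ.+ + 1) (nextL s l) (nextN s n) w m m' λ j → h (∈-++⁺ʳ (rowV i l n) j))

==ℤ-≤ᵇ : ∀ x y → (x ==ℤ y) ≡ (x ≤ᵇ y) ∧ (y ≤ᵇ x)
==ℤ-≤ᵇ x y = bool-ext (λ e → to (==ℤ-sound e)) λ e → let (a , b) = ∧-true {x ≤ᵇ y} e in ==ℤ-complete (ℤₚ.≤-antisym (≤ᵇ-sound a) (≤ᵇ-sound b))
  where
  to : x ≡ y → (x ≤ᵇ y) ∧ (y ≤ᵇ x) ≡ true
  to refl rewrite ≤ᵇ-true (ℤₚ.≤-refl {x}) = refl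

module _ (x x' : V → ℤ) where

  SameCmp : List V → List V → Set
  SameCmp us ws = ∀ {u w} → u ∈ us → w ∈ ws → (x u ≤ᵇ x w) ≡ (x' u ≤ᵇ x' w) × (x w ≤ᵇ x u) ≡ (x' w ≤ᵇ x' u)

  cmp-sym : ∀ {us ws} → SameCmp us ws → SameCmp ws us
  cmp-sym h i j = let (a , b) = h j i in b , a

  il-ord : ∀ us ws → SameCmp us ws → il (map x us) (map x ws) ≡ il (map x' us) (map x' ws)
  il-ord [] [] h = refl
  il-ord [] (_ ∷ _) h = refl
  il-ord (u ∷ []) [] h = refl
  il-ord (u ∷ _ ∷ _) [] h = refl
  il-ord (u ∷ us) (w ∷ ws) h = cong₂ _∧_ (proj₂ (h (here refl) (here refl))) (il-ord (w ∷ ws) us λ i j → let (a , b) = h (there j) i in b , a)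

  eq-ord : ∀ {us ws u w} → SameCmp us ws → u ∈ us → w ∈ ws → (x u ==ℤ x w) ≡ (x' u ==ℤ x' w)
  eq-ord {u = u} {w} h i j = trans (==ℤ-≤ᵇ (x u) (x w)) (trans (cong₂ _∧_ (proj₁ (h i j)) (proj₂ (h i j))) (sym (==ℤ-≤ᵇ (x' u) (x' w))))

  cnt-ord : ∀ u ws → (∀ {w} → w ∈ ws → (x u ==ℤ x w) ≡ (x' u ==ℤ x' w)) → cnt (x u) (map x ws) ≡ cnt (x' u) (map x' ws)
  cnt-ord u [] h = refl
  cnt-ord u (w ∷ ws) h with x u ==ℤ x w | x' u ==ℤ x' w | h (here refl)
  ... | true | true | _ = cong suc (cnt-ord u ws (h ∘ there))
  ... | false | false | _ = cnt-ord u ws (h ∘ there)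

  elem-ord : ∀ u ws → (∀ {w} → w ∈ ws → (x u ==ℤ x w) ≡ (x' u ==ℤ x' w)) → elem (x u) (map x ws) ≡ elem (x' u) (map x' ws)
  elem-ord u [] h = refl
  elem-ord u (w ∷ ws) h = cong₂ _∨_ (h (here refl)) (elem-ord u ws (h ∘ there))

  wt-ord : ∀ us ws → SameCmp us ws → SameCmp ws ws → wt (map x us) (map x ws) ≡ wt (map x' us) (map x' ws)
  wt-ord us ws h h' = go ws (λ i → i)
    where
    go : ∀ vs → (∀ {v} → v ∈ vs → v ∈ ws) → wtGo (map x us) (map x ws) (map x vs) ≡ wtGo (map x' us) (map x' ws) (map x' vs)
    go [] s = refl
    go (v ∷ vs) s = cong₂ _⊗_
      (trans (cong (λ b → if b then oneP else fac (cnt (x v) (map x us)) (cnt (x v) (map x ws))) (elem-ord v vs λ j → eq-ord h' (s (here refl)) (s (there j))))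
             (cong₂ (λ p q → if elem (x' v) (map x' vs) then oneP else fac p q)
               (cnt-ord v us λ j → eq-ord (cmp-sym h) (s (here refl)) j) (cnt-ord v ws λ j → eq-ord h' (s (here refl)) j)))
      (go vs (s ∘ there))

  W-ord : ∀ s us ws → SameCmp us ws → SameCmp ws ws → W s (map x us) (map x ws) ≡ W s (map x' us) (map x' ws)
  W-ord sA us ws h h' = cong₂ (λ b p → chi b ⊗ p) (il-ord us ws h) (wt-ord us ws h h')
  W-ord sB us ws h h' = cong₂ (λ b p → chi b ⊗ p) (il-ord ws us (cmp-sym h)) (wt-ord us ws h h')
  W-ord sC us ws h h' = cong₂ (λ b p → chi b ⊗ p) (il-ord us ws h) (wt-ord us ws h h')
  W-ord sD us ws h h' = cong₂ (λ b p → chi b ⊗ p) (il-ord ws us (cmp-sym h)) (wt-ord us ws h h')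

P-ord : ∀ i l n w m m' → (∀ {u v} → u ∈ shapeV i l n w → v ∈ shapeV i l n w → (expo m u ≤ᵇ expo m v) ≡ (expo m' u ≤ᵇ expo m' v)) →
  P i l n w m ≡ P i l n w m'
P-ord i l n [] m m' h = refl
P-ord i l n (s ∷ w) m m' h = cong₂ _⊗_
  (W-ord (expo m) (expo m') s (rowV i l n) (rowV (i ℤ.+ + 1) (nextL s l) (nextN s n))
    (λ a b → h (up a) (dn b) , h (dn b) (up a)) (λ a b → h (dn a) (dn b) , h (dn b) (dn a)))
  (P-ord (i ℤ.+ + 1) (nextL s l) (nextN s n) w m m' λ a b → h (∈-++⁺ʳ (rowV i l n) a) (∈-++⁺ʳ (rowV i l n) b))
  where
  up : ∀ {v} → v ∈ rowV i l n → v ∈ shapeV i l n (s ∷ w)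
  up = ∈-++⁺ˡ
  dn : ∀ {v} → v ∈ rowV (i ℤ.+ + 1) (nextL s l) (nextN s n) → v ∈ shapeV i l n (s ∷ w)
  dn a = ∈-++⁺ʳ (rowV i l n) (∈-++⁺ˡ a)

-- The series of a shape and its behaviour under exchanges

Tops : Set
Tops = List (V × Maybe ℤ)

topOK : Tops → Mono → Bool
topOK ts m = all (λ { (v , b) → maybeEq b (expo m v) }) ts

consts : Tops → List ℤ
consts [] = []
consts ((v , just b) ∷ ts) = b ∷ consts ts
consts ((v , nothing) ∷ ts) = consts ts

topOK-ord : ∀ ts m m' → (∀ {v b} → (v , just b) ∈ ts → (b ==ℤ expo m v) ≡ (b ==ℤ expo m' v)) → topOK ts m ≡ topOK ts m'
topOK-ord [] m m' h = refl
topOK-ord ((v , just b) ∷ ts) m m' h = cong₂ _∧_ (h (here refl)) (topOK-ord ts m m' (h ∘ there))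
topOK-ord ((v , nothing) ∷ ts) m m' h = refl

const-∈ : ∀ ts {v b} → (v , just b) ∈ ts → b ∈ consts ts
const-∈ ((v , just b) ∷ ts) (here refl) = here refl
const-∈ ((v , just b) ∷ ts) (there i) = there (const-∈ ts i)
const-∈ ((v , nothing) ∷ ts) (there i) = const-∈ ts i

chi-∧ : ∀ a b → chi (a ∧ b) ≋ chi a ⊗ chi b
chi-∧ true b = ≋-sym (⊗-identityˡ _)
chi-∧ false b = ≋-sym (⊗-zeroˡ _)

module Shape (a l₀ : ℤ) (n₀ : ℕ) (ts : Tops) (tops : ∀ {t} → t ∈ ts → proj₁ t ∈ rowV a l₀ n₀) where

  vsOf : List Move → List V
  vsOf w = shapeV a l₀ n₀ w

  -- Defined for every word, since the exchanges produce shapes with empty rows in the middle, which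
  -- come from no ordinary subgraph.
  S : List Move → Mono → Poly
  S w m = chi (offZ (memV (vsOf w)) m) ⊗ (chi (topOK ts m) ⊗ P a l₀ n₀ w m)

  not-mem : ∀ {vs v} → v ∉ vs → memV vs v ≡ false
  not-mem {vs} {v} ni with bool-case (memV vs v)
  ... | inj₁ e = ⊥-elim (ni (memV-sound e))
  ... | inj₂ e = e

  mem-not : ∀ {vs v} → memV vs v ≡ false → v ∉ vs
  mem-not e i = true≢false (memV-complete i) e

  S-ord : ∀ w m m' → SameOrder (vsOf w) (consts ts) m m' → S w m ≋ S w m'
  S-ord w m m' so = ⊗-cong (≋-reflexive (cong chi offs))
    (⊗-cong (≋-reflexive (cong chi (topOK-ord ts m m' λ {v} {b} i → trans (==ℤ-≤ᵇ b (expo m v))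
        (trans (cong₂ _∧_ (SameOrder.above so (∈-++⁺ˡ (tops i)) (const-∈ ts i)) (SameOrder.below so (∈-++⁺ˡ (tops i)) (const-∈ ts i)))
               (sym (==ℤ-≤ᵇ b (expo m' v)))))))
      (≋-reflexive (P-ord a l₀ n₀ w m m' (SameOrder.within so))))
    where
    offs : offZ (memV (vsOf w)) m ≡ offZ (memV (vsOf w)) m'
    offs = bool-ext (λ e → offZ-complete _ m' λ v q → trans (sym (SameOrder.outside so v (mem-not q))) (offZ-sound _ m e v q))
                    (λ e → offZ-complete _ m λ v q → trans (SameOrder.outside so v (mem-not q)) (offZ-sound _ m' e v q))

  S-off : ∀ w m v → v ∉ vsOf w → expo m v ≢ + 0 → S w m ≋ []
  S-off w m v ni ne = chi-zero _ (bad (bool-case (offZ (memV (vsOf w)) m)))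
    where
    bad : offZ (memV (vsOf w)) m ≡ true ⊎ offZ (memV (vsOf w)) m ≡ false → offZ (memV (vsOf w)) m ≡ false
    bad (inj₁ e) = ⊥-elim (ne (offZ-sound _ m e v (not-mem ni)))
    bad (inj₂ e) = e

  -- Interlacing, coincidence of entries and the pinned top row can all be read off from comparisons
  -- of entries with each other and with the constants.
  S-tame : ∀ w → Tame (S w)
  S-tame w = OrderType.tame (S w) (vsOf w) (shape-unique a l₀ n₀ w) (consts ts) (S-ord w) (S-off w)

  Tame-cong : ∀ {f g} → (∀ m → f m ≋ g m) → Tame f → Tame g
  Tame-cong h T = record { ws = Tame.ws T ; nz = Tame.nz T ; sum = Tame.sum T ; eq = λ m → ≋-trans (Tame.eq T m) (acts-cong (Tame.ws T) h m) }

  -- Below an empty row everything can be translated freely.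
  module Periodic (w₁ w₂ : List Move) (empty : afterN n₀ w₁ ≡ 0) where
    private
      i = afterI a w₁
      l = afterL l₀ w₁
      w = w₁ ++ sD ∷ w₂
      l' = l ℤ.- + 1
    -- Below an empty row `D` starts again with a single vertex; `U` is everything from that vertex
    -- on.
    U : List V
    U = shapeV (i ℤ.+ + 1) l' 1 w₂

    vs-split : vsOf w ≡ vsOf w₁ ++ U
    vs-split = trans (cong (rowV a l₀ n₀ ++_) (trans (below-++ a l₀ n₀ w₁ (sD ∷ w₂))
        (cong (λ z → below a l₀ n₀ w₁ ++ (rowV (i ℤ.+ + 1) l' (suc z) ++ below (i ℤ.+ + 1) l' (suc z) w₂)) empty)))
      (sym (++-assoc (rowV a l₀ n₀) (below a l₀ n₀ w₁) U))

    U-row : ∀ {v} → v ∈ U → i ℤ.< row v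
    U-row {v} h with ∈-++⁻ (rowV (i ℤ.+ + 1) l' 1) h
    ... | inj₁ p = subst (i ℤ.<_) (sym (All.lookup (rowV-row (i ℤ.+ + 1) l' 1) p)) (i<i+1 i)
    ... | inj₂ q = ℤₚ.<-trans (i<i+1 i) (All.lookup (below-row (i ℤ.+ + 1) l' 1 w₂) q)

    U-unique : Unique U
    U-unique = shape-unique (i ℤ.+ + 1) l' 1 w₂

    high : ∀ {v} → row v ℤ.≤ i → v ∉ U
    high le h = ℤₚ.<⇒≱ (U-row h) le

    fixed : ∀ m v → v ∉ U → expo (m -ᴹ unit U) v ≡ expo m v
    fixed m v ni = trans (expo-minus m (unit U) v) (trans (cong (λ z → expo m v ℤ.- z) (expo-unit-∉ U v ni)) (ℤₚ.+-identityʳ _))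

    moved : ∀ m v → v ∈ U → expo (m -ᴹ unit U) v ≡ expo m v ℤ.- + 1
    moved m v h = trans (expo-minus m (unit U) v) (cong (λ z → expo m v ℤ.- z) (expo-unit-∈ U v U-unique h))

    shift-both : ∀ x y → (x ≤ᵇ y) ≡ (x ℤ.- + 1 ≤ᵇ y ℤ.- + 1)
    shift-both x y = bool-ext (λ e → ≤ᵇ-true (ℤₚ.+-monoˡ-≤ (ℤ.- + 1) (≤ᵇ-sound {x} {y} e)))
      (λ e → ≤ᵇ-true (≤-by x y (≤ᵇ-sound {x ℤ.- + 1} {y ℤ.- + 1} e) (lem x y)))
      where
      lem : ∀ x y → y ℤ.- x ≡ y ℤ.- + 1 ℤ.- (x ℤ.- + 1)
      lem = solve-∀

    U-cmp : ∀ m {u v} → u ∈ U → v ∈ U → (expo m u ≤ᵇ expo m v) ≡ (expo (m -ᴹ unit U) u ≤ᵇ expo (m -ᴹ unit U) v)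
    U-cmp m {u} {v} p q = trans (shift-both (expo m u) (expo m v)) (sym (cong₂ _≤ᵇ_ (moved m u p) (moved m v q)))

    P-shift : ∀ m → P i l 0 (sD ∷ w₂) m ≡ P i l 0 (sD ∷ w₂) (m -ᴹ unit U)
    P-shift m = cong₂ _⊗_
      (W-ord (expo m) (expo (m -ᴹ unit U)) sD [] (rowV (i ℤ.+ + 1) l' 1) (λ ()) λ p q → U-cmp m (∈-++⁺ˡ p) (∈-++⁺ˡ q) , U-cmp m (∈-++⁺ˡ q) (∈-++⁺ˡ p))
      (P-ord (i ℤ.+ + 1) l' 1 w₂ m (m -ᴹ unit U) (U-cmp m))

    periodic : ∀ m → S w m ≋ S w (m -ᴹ unit U)
    periodic m = ⊗-cong (≋-reflexive (cong chi offs))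
      (⊗-cong (≋-reflexive (cong chi (topOK-ord ts m (m -ᴹ unit U) λ {v} {b} t → cong (b ==ℤ_) (sym (fixed m v (high (ℤₚ.≤-trans (ℤₚ.≤-reflexive (All.lookup (rowV-row a l₀ n₀) (tops t))) (after≥ a w₁))))))))
      (≋-trans (P-++ a l₀ n₀ w₁ (sD ∷ w₂) m)
      (≋-trans (⊗-cong (≋-reflexive (P-vals a l₀ n₀ w₁ m (m -ᴹ unit U) λ {v} h → sym (fixed m v (high (proj₁ (shape-last a l₀ n₀ w₁ v h))))))
        (≋-reflexive (trans (cong (λ z → P i l z (sD ∷ w₂) m) empty) (trans (P-shift m) (cong (λ z → P i l z (sD ∷ w₂) (m -ᴹ unit U)) (sym empty))))))
        (≋-sym (P-++ a l₀ n₀ w₁ (sD ∷ w₂) (m -ᴹ unit U))))))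
      where
      out : ∀ v → memV (vsOf w) v ≡ false → v ∉ U
      out v q h = mem-not q (subst (v ∈_) (sym vs-split) (∈-++⁺ʳ (vsOf w₁) h))
      offs : offZ (memV (vsOf w)) m ≡ offZ (memV (vsOf w)) (m -ᴹ unit U)
      offs = bool-ext (λ e → offZ-complete _ (m -ᴹ unit U) λ v q → trans (fixed m v (out v q)) (offZ-sound _ m e v q))
                      (λ e → offZ-complete _ m λ v q → trans (sym (fixed m v (out v q))) (offZ-sound _ (m -ᴹ unit U) e v q))

    null : Null (S w)
    null = record
      -- The series times `1 - e^U` is zero, so the numerator is the empty polynomial.
      { tame = record { ws = unit U ∷ [] ; nz = NZ-unit (i ℤ.+ + 1 , l') (below (i ℤ.+ + 1) l' 1 w₂) ∷ [] ; sum = []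
                      ; eq = λ m → ≋-sym (p⊝q≋0 (periodic m)) }
      ; vanishes = λ n → ≋-refl }

  -- Exchanging two letters changes the shape in row `k` only. `C` is the context common to both
  -- words, and the base vertex for the reflection is the leftmost vertex of row `k` when `D` comes
  -- first.
  module Exchange (w₁ w₃ : List Move) (n' : ℕ) (e : afterN n₀ w₁ ≡ suc n') where
    i = afterI a w₁
    l = afterL l₀ w₁
    k = i ℤ.+ + 1
    open RowFlip k (l ℤ.- + 1) using (module Flips; rowFn; inCols; RowFree)

    up : List V
    up = rowV i l (suc n')

    module _ (ld : ℤ) (nd : ℕ) where
      down : List V
      down = rowV (k ℤ.+ + 1) ld nd

      tailV : List V
      tailV = shapeV (k ℤ.+ + 1) ld nd w₃

      Qo : V → Bool
      Qo v = (row v ==ℤ k) ∨ memV (vsOf w₁ ++ tailV) v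

      C : Mono → Poly
      C m = chi (offZ Qo m) ⊗ (chi (topOK ts m) ⊗ (P a l₀ n₀ w₁ m ⊗ P (k ℤ.+ + 1) ld nd w₃ m))

      pre-row : ∀ {v} → v ∈ vsOf w₁ → row v ≢ k
      pre-row {v} h q = ℤₚ.<⇒≱ (i<i+1 i) (ℤₚ.≤-trans (ℤₚ.≤-reflexive (sym q)) (proj₁ (shape-last a l₀ n₀ w₁ v h)))

      tail-row : ∀ {v} → v ∈ tailV → k ℤ.+ + 1 ℤ.≤ row v
      tail-row {v} h with ∈-++⁻ down h
      ... | inj₁ p = ℤₚ.≤-reflexive (sym (All.lookup (rowV-row (k ℤ.+ + 1) ld nd) p))
      ... | inj₂ p = ℤₚ.<⇒≤ (All.lookup (below-row (k ℤ.+ + 1) ld nd w₃) p)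

      tail-≢ : ∀ {v} → v ∈ tailV → row v ≢ k
      tail-≢ h q = ℤₚ.<⇒≱ (i<i+1 k) (ℤₚ.≤-trans (tail-row h) (ℤₚ.≤-reflexive q))

      Qo-false : ∀ v → Qo v ≡ false → row v ≢ k × v ∉ vsOf w₁ ++ tailV
      Qo-false v q with row v ℤ.≟ k
      ... | no n = n , mem-not q

      free : RowFree C
      free m m' h = ⊗-cong (≋-reflexive (cong chi offs))
        (⊗-cong (≋-reflexive (cong chi (topOK-ord ts m m' λ {v} {b} t → cong (b ==ℤ_) (h v (pre-row (∈-++⁺ˡ (tops t)))))))
        (⊗-cong (≋-reflexive (P-vals a l₀ n₀ w₁ m m' λ {v} j → h v (pre-row j)))
                (≋-reflexive (P-vals (k ℤ.+ + 1) ld nd w₃ m m' λ {v} j → h v (tail-≢ j)))))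
        where
        offs : offZ Qo m ≡ offZ Qo m'
        offs = bool-ext (λ e → offZ-complete _ m' λ v q → trans (sym (h v (proj₁ (Qo-false v q)))) (offZ-sound _ m e v q))
                        (λ e → offZ-complete _ m λ v q → trans (h v (proj₁ (Qo-false v q))) (offZ-sound _ m' e v q))

      supp : ∀ m → C m ≋ [] ⊎ (∀ v → row v ≡ k ℤ.- + 1 → v ∉ up → expo m v ≡ + 0) × (∀ v → row v ≡ k ℤ.+ + 1 → v ∉ down → expo m v ≡ + 0)
      supp m with bool-case (offZ Qo m)
      ... | inj₂ bad = inj₁ (chi-zero _ bad)
      ... | inj₁ good = inj₂ ((λ v q ni → offZ-sound Qo m good v (out v (r₁ q) λ h → case₁ q ni (∈-++⁻ (vsOf w₁) h)))
                            , (λ v q ni → offZ-sound Qo m good v (out v (r₂ q) λ h → case₂ q ni (∈-++⁻ (vsOf w₁) h))))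
        where
        lem : ∀ i → i ℤ.+ + 1 ℤ.- + 1 ≡ i
        lem = solve-∀
        r₁ : ∀ {x} → x ≡ k ℤ.- + 1 → x ≢ k
        r₁ refl q = ℤₚ.<-irrefl (trans (sym (lem i)) q) (i<i+1 i)
        r₂ : ∀ {x} → x ≡ k ℤ.+ + 1 → x ≢ k
        r₂ refl q = ℤₚ.<-irrefl (sym q) (i<i+1 k)
        out : ∀ v → row v ≢ k → v ∉ vsOf w₁ ++ tailV → Qo v ≡ false
        out v r n rewrite ==ℤ-false r = not-mem n
        case₁ : ∀ {v} → row v ≡ k ℤ.- + 1 → v ∉ up → v ∈ vsOf w₁ ⊎ v ∈ tailV → ⊥
        case₁ {v} q ni (inj₁ h) = ni (subst (λ z → v ∈ rowV i l z) e (proj₂ (shape-last a l₀ n₀ w₁ v h) (trans q (lem i))))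
        case₁ {v} q ni (inj₂ h) = ℤₚ.<⇒≱ (ℤₚ.<-trans (i<i+1 i) (i<i+1 k)) (ℤₚ.≤-trans (tail-row h) (ℤₚ.≤-reflexive (trans q (lem i))))
        case₂ : ∀ {v} → row v ≡ k ℤ.+ + 1 → v ∉ down → v ∈ vsOf w₁ ⊎ v ∈ tailV → ⊥
        case₂ {v} q ni (inj₁ h) = ℤₚ.<⇒≱ (ℤₚ.<-trans (i<i+1 i) (i<i+1 k)) (ℤₚ.≤-trans (ℤₚ.≤-reflexive (sym q)) (proj₁ (shape-last a l₀ n₀ w₁ v h)))
        case₂ {v} q ni (inj₂ h) with ∈-++⁻ down h
        ... | inj₁ p = ni p
        ... | inj₂ p = ℤₚ.<-irrefl (sym q) (All.lookup (below-row (k ℤ.+ + 1) ld nd w₃) p)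

      aup : All (λ v → row v ≡ k ℤ.- + 1) up
      aup = All.map (λ q → trans q (lem i)) (rowV-row i l (suc n'))
        where
        lem : ∀ i → i ≡ i ℤ.+ + 1 ℤ.- + 1
        lem = solve-∀

      opaque
        unfolding _⊕_
        rearrange : ∀ z t p₁ d x p₃ q c g → z ≋ q ⊗ c → d ⊗ x ≋ g →
          z ⊗ (t ⊗ (p₁ ⊗ (d ⊗ (x ⊗ p₃)))) ≋ (q ⊗ (t ⊗ (p₁ ⊗ p₃))) ⊗ (c ⊗ g)
        rearrange z t p₁ d x p₃ q c g e₁ e₂ =
          ≋-trans (⊗-cong e₁ (≋-refl {t ⊗ (p₁ ⊗ (d ⊗ (x ⊗ p₃)))}))
          (≋-trans (go q c t p₁ d x p₃) (⊗-cong (≋-refl {q ⊗ (t ⊗ (p₁ ⊗ p₃))}) (⊗-cong (≋-refl {c}) e₂)))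
          where
          go : ∀ q c t p₁ d x p₃ → (q ⊗ c) ⊗ (t ⊗ (p₁ ⊗ (d ⊗ (x ⊗ p₃)))) ≋ (q ⊗ (t ⊗ (p₁ ⊗ p₃))) ⊗ (c ⊗ (d ⊗ x))
          go = RingSolver.solve-∀ polyACR

        weights : ∀ c₁ c₂ w₁ w₂ → (c₁ ⊗ w₁) ⊗ (c₂ ⊗ w₂) ≋ (c₁ ⊗ c₂) ⊗ (w₁ ⊗ w₂)
        weights = RingSolver.solve-∀ polyACR

      -- Row `k` enters the series through two neighbouring factors of `P` and through the support
      -- condition; the factors merge into `G` by `hW`, and the support condition splits.
      as-rowFn : ∀ s s' lm nm j j' → nextL s l ≡ lm → nextN s (suc n') ≡ nm → nextL s' lm ≡ ld → nextN s' nm ≡ nd →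
        (∀ x y z → W s x y ⊗ W s' y z ≋ G j j' x z y) →
        ∀ m → S (w₁ ++ s ∷ s' ∷ w₃) m ≋ rowFn C up down (rowV k lm nm) (G j j') m
      as-rowFn s s' lm nm j j' refl refl refl refl hW m =
        ≋-trans (⊗-cong ≋-refl (⊗-cong ≋-refl (≋-trans (P-++ a l₀ n₀ w₁ (s ∷ s' ∷ w₃) m)
          (≋-reflexive (cong (λ z → P a l₀ n₀ w₁ m ⊗ P i l z (s ∷ s' ∷ w₃) m) e)))))
        (rearrange _ _ _ _ _ _ _ _ _ (≋-trans (≋-reflexive (cong chi split)) (chi-∧ _ _)) (hW _ _ _))
        where
        cols = rowV k lm nm
        vs = vsOf (w₁ ++ s ∷ s' ∷ w₃)
        vs≡ : vs ≡ vsOf w₁ ++ (cols ++ tailV)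
        vs≡ = trans (cong (rowV a l₀ n₀ ++_) (trans (below-++ a l₀ n₀ w₁ (s ∷ s' ∷ w₃)) (cong (λ z → below a l₀ n₀ w₁ ++ below i l z (s ∷ s' ∷ w₃)) e)))
          (sym (++-assoc (rowV a l₀ n₀) (below a l₀ n₀ w₁) _))
        in-vs : ∀ {v} → v ∈ vs → (row v ≡ k × v ∈ cols) ⊎ (row v ≢ k × v ∈ vsOf w₁ ++ tailV)
        in-vs {v} h with ∈-++⁻ (vsOf w₁) (subst (v ∈_) vs≡ h)
        ... | inj₁ p = inj₂ (pre-row p , ∈-++⁺ˡ p)
        ... | inj₂ p with ∈-++⁻ cols p
        ... | inj₁ q = inj₁ (All.lookup (rowV-row k lm nm) q , q)
        ... | inj₂ q = inj₂ (tail-≢ q , ∈-++⁺ʳ (vsOf w₁) q)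
        cols-vs : ∀ {v} → v ∈ cols → v ∈ vs
        cols-vs {v} p = subst (v ∈_) (sym vs≡) (∈-++⁺ʳ (vsOf w₁) (∈-++⁺ˡ p))
        rest-vs : ∀ {v} → v ∈ vsOf w₁ ++ tailV → v ∈ vs
        rest-vs {v} p with ∈-++⁻ (vsOf w₁) p
        ... | inj₁ q = subst (v ∈_) (sym vs≡) (∈-++⁺ˡ q)
        ... | inj₂ q = subst (v ∈_) (sym vs≡) (∈-++⁺ʳ (vsOf w₁) (∈-++⁺ʳ cols q))
        split : offZ (memV vs) m ≡ offZ Qo m ∧ offZ (inCols cols) m
        split = bool-ext to from
          where
          qo : ∀ v → Qo v ≡ false → memV vs v ≡ false
          qo v q = not-mem λ h → bad (in-vs h)
            where
            bad : (row v ≡ k × v ∈ cols) ⊎ (row v ≢ k × v ∈ vsOf w₁ ++ tailV) → ⊥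
            bad (inj₁ (r , _)) = proj₁ (Qo-false v q) r
            bad (inj₂ (_ , h)) = proj₂ (Qo-false v q) h
          ic : ∀ v → inCols cols v ≡ false → row v ≡ k × memV cols v ≡ false
          ic v q with row v ℤ.≟ k
          ... | yes r = r , q
          ic' : ∀ v → inCols cols v ≡ false → memV vs v ≡ false
          ic' v q = not-mem λ h → bad (in-vs h)
            where
            bad : (row v ≡ k × v ∈ cols) ⊎ (row v ≢ k × v ∈ vsOf w₁ ++ tailV) → ⊥
            bad (inj₁ (_ , h)) = mem-not (proj₂ (ic v q)) h
            bad (inj₂ (r , _)) = r (proj₁ (ic v q))
          to : offZ (memV vs) m ≡ true → offZ Qo m ∧ offZ (inCols cols) m ≡ true
          to z rewrite offZ-complete Qo m (λ v q → offZ-sound _ m z v (qo v q)) = offZ-complete _ m λ v q → offZ-sound _ m z v (ic' v q)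
          from : offZ Qo m ∧ offZ (inCols cols) m ≡ true → offZ (memV vs) m ≡ true
          from z = offZ-complete _ m λ v q → go v q
            where
            z₁ = proj₁ (∧-true {offZ Qo m} z)
            z₂ = proj₂ (∧-true {offZ Qo m} z)
            go : ∀ v → memV vs v ≡ false → expo m v ≡ + 0
            go v q with bool-case (row v ==ℤ k)
            ... | inj₁ r = offZ-sound _ m z₂ v (trans (cong (λ b → not b ∨ memV cols v) r) (not-mem λ h → mem-not q (cols-vs h)))
            ... | inj₂ r = offZ-sound _ m z₁ v (trans (cong (λ b → b ∨ memV (vsOf w₁ ++ tailV) v) r) (not-mem λ h → mem-not q (rest-vs h)))

    hW : ∀ c c' x y z → (chi c ⊗ wt x y) ⊗ (chi c' ⊗ wt y z) ≋ chi (c ∧ c') ⊗ (wt x y ⊗ wt y z)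
    hW c c' x y z = ≋-trans (weights (+ 0) 0 _ _ _ _) (⊗-cong (≋-sym (chi-∧ c c')) ≋-refl)

    exchange : ∀ s → s ≢ sD → Null (S (w₁ ++ s ∷ sD ∷ w₃)) → Null (S (w₁ ++ sD ∷ s ∷ w₃))
    exchange sD ne N = ⊥-elim (ne refl)
    exchange sA _ N = Null-cong (λ m → ≋-sym (f≋ m))
      (Flips.nullA (free ld nd) (aup ld nd) (rowV-row _ ld nd) (rowV-unique i l (suc n')) (rowV-unique _ ld nd)
        (rowV-row k (l ℤ.- + 1) (suc (suc n'))) (rowV-unique k (l ℤ.- + 1) (suc (suc n'))) (rowV-row k l n') (rowV-unique k l n') (supp ld nd)
        n' (rowV-length i l (suc n')) (rowV-length _ ld nd) (rowV-length k (l ℤ.- + 1 ℤ.+ + 1) (suc n')) (rowV-length k l n')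
        (Tame-cong f≋ (S-tame (w₁ ++ sD ∷ sA ∷ w₃))) (Null-cong (as-rowFn ld nd sA sD l n' true true refl refl refl refl (λ x y z → hW (il x y) (il z y) x y z)) N))
      where
      ld = l ℤ.- + 1
      nd = suc n'
      f≋ = as-rowFn ld nd sD sA (l ℤ.- + 1) (suc (suc n')) false false refl refl refl refl (λ x y z → hW (il y x) (il y z) x y z)
    exchange sB _ N = Null-cong (λ m → ≋-sym (f≋ m))
      (Flips.nullB (free ld nd) (aup ld nd) (rowV-row _ ld nd) (rowV-unique i l (suc n')) (rowV-unique _ ld nd)
        (rowV-row k (l ℤ.- + 1) (suc (suc n'))) (rowV-unique k (l ℤ.- + 1) (suc (suc n'))) (rowV-row k (l ℤ.- + 1) (suc n')) (rowV-unique k (l ℤ.- + 1) (suc n')) (supp ld nd)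
        (suc n') (rowV-length i l (suc n')) (rowV-length _ ld nd) (rowV-length k (l ℤ.- + 1 ℤ.+ + 1) (suc n')) (rowV-length k (l ℤ.- + 1) (suc n'))
        (Tame-cong f≋ (S-tame (w₁ ++ sD ∷ sB ∷ w₃))) (Null-cong (as-rowFn ld nd sB sD (l ℤ.- + 1) (suc n') false true refl refl refl refl (λ x y z → hW (il y x) (il z y) x y z)) N))
      where
      ld = l ℤ.- + 1 ℤ.- + 1
      nd = suc (suc n')
      f≋ = as-rowFn ld nd sD sB (l ℤ.- + 1) (suc (suc n')) false true refl refl refl refl (λ x y z → hW (il y x) (il z y) x y z)
    exchange sC _ N = Null-cong (λ m → ≋-sym (f≋ m))
      (Flips.nullC (free ld nd) (aup ld nd) (rowV-row _ ld nd) (rowV-unique i l (suc n')) (rowV-unique _ ld nd)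
        (rowV-row k (l ℤ.- + 1) (suc (suc n'))) (rowV-unique k (l ℤ.- + 1) (suc (suc n'))) (rowV-row k l (suc n')) (rowV-unique k l (suc n')) (supp ld nd)
        n' (rowV-length i l (suc n')) (rowV-length _ ld nd) (rowV-length k (l ℤ.- + 1 ℤ.+ + 1) (suc n')) (rowV-length k l (suc n'))
        (Tame-cong f≋ (S-tame (w₁ ++ sD ∷ sC ∷ w₃))) (Null-cong (as-rowFn ld nd sC sD l (suc n') true true refl refl refl refl (λ x y z → hW (il x y) (il z y) x y z)) N))
      where
      ld = l ℤ.- + 1
      nd = suc (suc n')
      f≋ = as-rowFn ld nd sD sC (l ℤ.- + 1) (suc (suc n')) false false refl refl refl refl (λ x y z → hW (il y x) (il y z) x y z)

  -- Move D down until the row above it is empty.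
  null-D : ∀ w₂ w₁ → afterN n₀ (w₁ ++ sD ∷ w₂) ℕ.≤ 1 → Null (S (w₁ ++ sD ∷ w₂))
  null-D w₂ w₁ le = go w₂ (afterN n₀ w₁) refl le
    where
    assoc : ∀ s w₃ → (w₁ ++ s ∷ []) ++ sD ∷ w₃ ≡ w₁ ++ s ∷ sD ∷ w₃
    assoc s w₃ = ++-assoc w₁ (s ∷ []) (sD ∷ w₃)
    go : ∀ w₂ n → n ≡ afterN n₀ w₁ → afterN n₀ (w₁ ++ sD ∷ w₂) ℕ.≤ 1 → Null (S (w₁ ++ sD ∷ w₂))
    go w₂ zero q le = Periodic.null w₁ w₂ (sym q)
    -- A final `D` under a non-empty row would leave at least two vertices, against the bound.
    go [] (suc n) q le = ⊥-elim (ℕₚ.<⇒≱ (ℕ.s≤s (ℕ.s≤s ℕ.z≤n)) (subst (ℕ._≤ 1) (trans (afterN-++ n₀ w₁ (sD ∷ [])) (cong suc (sym q))) le))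
    -- No exchange of `D` with `D` is needed: the same word is null on account of its next `D`.
    go (sD ∷ w₃) (suc n) q le = subst (λ z → Null (S z)) (assoc sD w₃)
      (null-D w₃ (w₁ ++ sD ∷ []) (subst (λ z → afterN n₀ z ℕ.≤ 1) (sym (assoc sD w₃)) le))
    go (sA ∷ w₃) (suc n) q le = Exchange.exchange w₁ w₃ n (sym q) sA (λ ()) (subst (λ z → Null (S z)) (assoc sA w₃)
      (null-D w₃ (w₁ ++ sA ∷ []) (subst (λ z → afterN n₀ z ℕ.≤ 1) (sym (assoc sA w₃)) same)))
      where
      -- `A` followed by `D` restores the number of vertices only in a non-empty row, because `pred`
      -- stops at zero.
      fix : ∀ {x} → suc n ≡ x → x ≡ suc (ℕ.pred x)
      fix refl = refl
      same : afterN n₀ (w₁ ++ sA ∷ sD ∷ w₃) ℕ.≤ 1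
      same = subst (ℕ._≤ 1) (trans (afterN-++ n₀ w₁ (sD ∷ sA ∷ w₃)) (trans (cong (λ z → afterN z w₃) (fix q)) (sym (afterN-++ n₀ w₁ (sA ∷ sD ∷ w₃))))) le
    go (sB ∷ w₃) (suc n) q le = Exchange.exchange w₁ w₃ n (sym q) sB (λ ()) (subst (λ z → Null (S z)) (assoc sB w₃)
      (null-D w₃ (w₁ ++ sB ∷ []) (subst (λ z → afterN n₀ z ℕ.≤ 1) (sym (assoc sB w₃)) same)))
      where
      same : afterN n₀ (w₁ ++ sB ∷ sD ∷ w₃) ℕ.≤ 1
      same = subst (ℕ._≤ 1) (trans (afterN-++ n₀ w₁ (sD ∷ sB ∷ w₃)) (sym (afterN-++ n₀ w₁ (sB ∷ sD ∷ w₃)))) le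
    go (sC ∷ w₃) (suc n) q le = Exchange.exchange w₁ w₃ n (sym q) sC (λ ()) (subst (λ z → Null (S z)) (assoc sC w₃)
      (null-D w₃ (w₁ ++ sC ∷ []) (subst (λ z → afterN n₀ z ℕ.≤ 1) (sym (assoc sC w₃)) same)))
      where
      same : afterN n₀ (w₁ ++ sC ∷ sD ∷ w₃) ℕ.≤ 1
      same = subst (ℕ._≤ 1) (trans (afterN-++ n₀ w₁ (sD ∷ sC ∷ w₃)) (sym (afterN-++ n₀ w₁ (sC ∷ sD ∷ w₃)))) le

-- The rows of an ordinary subgraph

record Dn (u w : V) : Set where
  constructor dn
  field
    next : row w ≡ row u ℤ.+ + 1
    side : col u ≡ col w ⊎ col u ≡ col w ℤ.+ + 1

upperEdge-sound : ∀ u w → upperEdge u w ≡ true → Dn w u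
upperEdge-sound (i , j) (i' , j') e = go (∧-true {i' ==ℤ (i ℤ.- + 1)} e)
  where
  lem : ∀ i → i ≡ i ℤ.- + 1 ℤ.+ + 1
  lem = solve-∀
  or : (j' ==ℤ j) ∨ (j' ==ℤ (j ℤ.+ + 1)) ≡ true → j' ≡ j ⊎ j' ≡ j ℤ.+ + 1
  or q with bool-case (j' ==ℤ j)
  ... | inj₁ r = inj₁ (==ℤ-sound r)
  ... | inj₂ r rewrite r = inj₂ (==ℤ-sound q)
  go : _ × _ → _
  go (p , q) = dn (trans (lem i) (cong (ℤ._+ + 1) (sym (==ℤ-sound p)))) (or q)

upperEdge-complete : ∀ u w → Dn w u → upperEdge u w ≡ true
upperEdge-complete (i , j) (i' , j') (dn p q) = cong₂ _∧_ (==ℤ-complete {i'} {i ℤ.- + 1} (trans (lem i') (cong (ℤ._- + 1) (sym p)))) (go q)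
  where
  lem : ∀ i → i ≡ i ℤ.+ + 1 ℤ.- + 1
  lem = solve-∀
  go : j' ≡ j ⊎ j' ≡ j ℤ.+ + 1 → (j' ==ℤ j) ∨ (j' ==ℤ (j ℤ.+ + 1)) ≡ true
  go (inj₁ r) rewrite ==ℤ-complete r = refl
  go (inj₂ r) rewrite ==ℤ-complete r = Data.Bool.Properties.∨-zeroʳ _

edge-sound : ∀ u w → edgeℛ u w ≡ true → Dn w u ⊎ Dn u w
edge-sound u w e with bool-case (upperEdge u w)
... | inj₁ p = inj₁ (upperEdge-sound u w p)
... | inj₂ p rewrite p = inj₂ (upperEdge-sound w u e)

edge-down : ∀ u w → Dn u w → edgeℛ u w ≡ true
edge-down u w d rewrite upperEdge-complete w u d = Data.Bool.Properties.∨-zeroʳ _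

data Path (Γ : Subgraph) (adj : V → V → Bool) (v : V) : V → Set where
  here : Path Γ adj v v
  step : ∀ {u w} → Path Γ adj v u → u ∈ verts Γ → adj u w ≡ true → Path Γ adj v w

reachN-path : ∀ Γ adj n v w → reachN Γ adj n v w ≡ true → Path Γ adj v w
reachN-path Γ adj zero v w e with ==V-sound {v} {w} e
... | refl = here
reachN-path Γ adj (suc n) v w e with bool-case (reachN Γ adj n v w)
... | inj₁ p = reachN-path Γ adj n v w p
... | inj₂ p rewrite p =
  let (u , i , q) = any-sound (λ u → reachN Γ adj n v u ∧ adj u w) (verts Γ) e
      (r , s) = ∧-true {reachN Γ adj n v u} q in
  step (reachN-path Γ adj n v u r) i s

key-min : ∀ (key : V → ℤ) u U → ∃ λ v → v ∈ u ∷ U × (∀ {w} → w ∈ u ∷ U → key v ℤ.≤ key w)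
key-min key u [] = u , here refl , λ { (here refl) → ℤₚ.≤-refl }
key-min key u (u' ∷ U) with key-min key u' U
... | v , i , h with key u ℤ.≤? key v
... | yes le = u , here refl , λ { (here refl) → ℤₚ.≤-refl ; (there j) → ℤₚ.≤-trans le (h j) }
... | no nle = v , there i , λ { (here refl) → ℤₚ.<⇒≤ (ℤₚ.≰⇒> nle) ; (there j) → h j }

module OrdinaryGraph (Γ : Subgraph) (a : ℤ) (ord : Ordinary Γ a) where

  private
    isTop = proj₁ ord
    conn = proj₁ (proj₂ ord)

  down-closed : ∀ i j → (i , j) ∈ verts Γ → (i , j ℤ.+ + 1) ∈ verts Γ → (i ℤ.+ + 1 , j) ∈ verts Γ
  down-closed = proj₁ (proj₂ (proj₂ ord))

  up-closed : ∀ i j → a ℤ.< i → (i , j) ∈ verts Γ → (i , j ℤ.+ + 1) ∈ verts Γ → (i ℤ.- + 1 , j ℤ.+ + 1) ∈ verts Γ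
  up-closed = proj₂ (proj₂ (proj₂ ord))

  t₀ : V
  t₀ = proj₁ (proj₁ isTop)

  t₀∈ : t₀ ∈ verts Γ
  t₀∈ = proj₁ (proj₂ (proj₁ isTop))

  t₀-row : row t₀ ≡ a
  t₀-row = proj₂ (proj₂ (proj₁ isTop))

  a≤ : ∀ {v} → v ∈ verts Γ → a ℤ.≤ row v
  a≤ {v} = proj₂ isTop v

  infix 4 _↓_
  data _↓_ (u : V) : V → Set where
    stop : u ↓ u
    down : ∀ {w z} → Dn u w → w ∈ verts Γ → w ↓ z → u ↓ z

  ↓-snoc : ∀ {u w z} → u ↓ w → Dn w z → z ∈ verts Γ → u ↓ z
  ↓-snoc stop d i = down d i stop
  ↓-snoc (down e j p) d i = down e j (↓-snoc p d i)

  ↓-row : ∀ {u z} → u ↓ z → row u ℤ.≤ row z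
  ↓-row stop = ℤₚ.≤-refl
  ↓-row (down (dn e _) _ p) = ℤₚ.≤-trans (ℤₚ.<⇒≤ (subst (_ ℤ.<_) (sym e) (i<i+1 _))) (↓-row p)

  private
    cancel : ∀ x y → x ℤ.+ + 1 ≡ y ℤ.+ + 1 → x ≡ y
    cancel x y e = trans (lem x) (trans (cong (ℤ._- + 1) e) (sym (lem y)))
      where
      lem : ∀ x → x ≡ x ℤ.+ + 1 ℤ.- + 1
      lem = solve-∀
    -1+1 : ∀ x → x ℤ.- + 1 ℤ.+ + 1 ≡ x
    -1+1 = solve-∀
    +1-1 : ∀ x → x ℤ.+ + 1 ℤ.- + 1 ≡ x
    +1-1 = solve-∀

  -- Two distinct lower neighbours of a vertex stand next to each other in their row, so downward
  -- closure supplies the vertex below both.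
  diamond : ∀ {w p q} → Dn w p → Dn w q → p ∈ verts Γ → q ∈ verts Γ →
    p ≡ q ⊎ ∃ λ r → r ∈ verts Γ × Dn p r × Dn q r
  diamond {w} {p} {q} (dn e f) (dn e' f') i j with f | f'
  ... | inj₁ c | inj₁ c' = inj₁ (cong₂ _,_ (trans e (sym e')) (trans (sym c) c'))
  ... | inj₂ c | inj₂ c' = inj₁ (cong₂ _,_ (trans e (sym e')) (cancel _ _ (trans (sym c) c')))
  ... | inj₁ c | inj₂ c' = inj₂ ((row q ℤ.+ + 1 , col q) ,
      down-closed (row q) (col q) j (subst (_∈ verts Γ) (cong₂ _,_ (trans e (sym e')) (trans (sym c) c')) i) ,
      dn (cong (ℤ._+ + 1) (trans e' (sym e))) (inj₂ (trans (sym c) c')) , dn refl (inj₁ refl))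
  ... | inj₂ c | inj₁ c' = inj₂ ((row p ℤ.+ + 1 , col p) ,
      down-closed (row p) (col p) i (subst (_∈ verts Γ) (cong₂ _,_ (trans e' (sym e)) (trans (sym c') c)) j) ,
      dn refl (inj₁ refl) , dn (cong (ℤ._+ + 1) (trans e (sym e'))) (inj₂ (trans (sym c') c)))

  strip : ∀ {w p z} → Dn w p → p ∈ verts Γ → w ↓ z → ∃ λ z' → p ↓ z' × (z ≡ z' ⊎ (Dn z z' × z' ∈ verts Γ))
  strip {p = p} d i stop = p , stop , inj₂ (d , i)
  strip d i (down {b} e j s) with diamond d e i j
  ... | inj₁ refl = _ , s , inj₁ refl
  ... | inj₂ (r , k , dp , db) = let (z' , t , h) = strip db k s in z' , down dp k t , h

  Joined : V → V → Set
  Joined u w = ∃ λ z → u ↓ z × w ↓ z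

  joined-step : ∀ {u w w'} → Joined u w → w ∈ verts Γ → w' ∈ verts Γ → Dn w' w ⊎ Dn w w' → Joined u w'
  joined-step (z , p , q) i i' (inj₁ d) = z , p , down d i q
  joined-step (z , p , q) i i' (inj₂ d) with strip d i' q
  ... | z' , r , inj₁ refl = z' , p , r
  ... | z' , r , inj₂ (e , j) = z' , ↓-snoc p e j , r

  -- Confluence along a path of Γ: a common descendant survives a step upwards trivially, and a step
  -- downwards by completing diamonds with `strip`.
  joined : ∀ {u w} → u ∈ verts Γ → w ∈ verts Γ → Joined u w
  joined {u} {w} i j = go (reachN-path Γ edgeℛ (length (verts Γ)) u w (conn u w i j)) j
    where
    go : ∀ {w} → Path Γ edgeℛ u w → w ∈ verts Γ → Joined u w
    go here j = u , stop , stop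
    go (step {v} {w} p k e) j = joined-step (go p k) k j (edge-sound v w e)

  -- Induction along the descents to the common vertex `z`. The next row contains, by induction,
  -- both columns `c - 1` and `c`, since the descents started on either side of `c`; upward closure
  -- lifts these two to column `c` of the given row.
  convex' : ∀ {u w z} → u ↓ z → w ↓ z → row u ≡ row w → u ∈ verts Γ → w ∈ verts Γ →
    ∀ c → col u ℤ.≤ c → c ℤ.≤ col w → (row u , c) ∈ verts Γ
  convex' {u} {w} p q r i j c le le' with c ℤ.≟ col u | c ℤ.≟ col w
  ... | yes refl | _ = i
  ... | no _ | yes refl = subst (λ z → (z , col w) ∈ verts Γ) (sym r) j
  convex' {u} {w} stop stop r i j c le le' | no n₁ | no n₂ = ⊥-elim (n₁ (ℤₚ.≤-antisym le' le))
  convex' {u} {w} stop (down (dn e _) _ q) r i j c le le' | no n₁ | no n₂ = ⊥-elim (ℤₚ.<⇒≱ (i<i+1 (row w)) (ℤₚ.≤-trans (ℤₚ.≤-reflexive (sym e)) (ℤₚ.≤-trans (↓-row q) (ℤₚ.≤-reflexive r))))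
  convex' {u} {w} (down (dn e _) _ p) stop r i j c le le' | no n₁ | no n₂ = ⊥-elim (ℤₚ.<⇒≱ (i<i+1 (row u)) (ℤₚ.≤-trans (ℤₚ.≤-reflexive (sym e)) (ℤₚ.≤-trans (↓-row p) (ℤₚ.≤-reflexive (sym r)))))
  convex' {u} {w} (down {u₁} (dn e f) k p) (down {w₁} (dn e' f') k' q) r i j c le le' | no n₁ | no n₂ =
    subst (_∈ verts Γ) (cong₂ _,_ (trans (cong (ℤ._- + 1) e) (+1-1 (row u))) (-1+1 c))
      (up-closed (row u₁) (c ℤ.- + 1) (subst (a ℤ.<_) (sym e) (ℤₚ.≤-<-trans (a≤ i) (i<i+1 (row u))))
        (convex' p q (trans e (trans (cong (ℤ._+ + 1) r) (sym e'))) k k' (c ℤ.- + 1) lo₁ (ℤₚ.≤-trans (ℤₚ.<⇒≤ c-1<c) hi))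
        (subst (λ z → (row u₁ , z) ∈ verts Γ) (sym (-1+1 c))
          (convex' p q (trans e (trans (cong (ℤ._+ + 1) r) (sym e'))) k k' c (ℤₚ.≤-trans lo₁ (ℤₚ.<⇒≤ c-1<c)) hi)))
    where
    c-1<c : c ℤ.- + 1 ℤ.< c
    c-1<c = +1≤⇒< (ℤₚ.≤-reflexive (-1+1 c))
    colu : col u ℤ.≤ c ℤ.- + 1
    colu = ≤-by (col u) (c ℤ.- + 1) (<⇒+1≤ (ℤₚ.≤∧≢⇒< le (n₁ ∘ sym))) (lem (col u) c)
      where
      lem : ∀ x c → c ℤ.- + 1 ℤ.- x ≡ c ℤ.- (x ℤ.+ + 1)
      lem = solve-∀
    lo₁ : col u₁ ℤ.≤ c ℤ.- + 1
    lo₁ = ℤₚ.≤-trans (le₁ f) colu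
      where
      le₁ : col u ≡ col u₁ ⊎ col u ≡ col u₁ ℤ.+ + 1 → col u₁ ℤ.≤ col u
      le₁ (inj₁ s) = ℤₚ.≤-reflexive (sym s)
      le₁ (inj₂ s) = ℤₚ.≤-trans (ℤₚ.<⇒≤ (i<i+1 _)) (ℤₚ.≤-reflexive (sym s))
    hi : c ℤ.≤ col w₁
    hi = le₂ f'
      where
      le₂ : col w ≡ col w₁ ⊎ col w ≡ col w₁ ℤ.+ + 1 → c ℤ.≤ col w₁
      le₂ (inj₁ s) = ℤₚ.≤-trans le' (ℤₚ.≤-reflexive s)
      le₂ (inj₂ s) = ≤-by c (col w₁) (ℤₚ.≤-trans (<⇒+1≤ (ℤₚ.≤∧≢⇒< le' n₂)) (ℤₚ.≤-reflexive s)) (lem c (col w₁))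
        where
        lem : ∀ c x → x ℤ.- c ≡ x ℤ.+ + 1 ℤ.- (c ℤ.+ + 1)
        lem = solve-∀

  convex : ∀ {u w} → u ∈ verts Γ → w ∈ verts Γ → row u ≡ row w → ∀ c → col u ℤ.≤ c → c ℤ.≤ col w → (row u , c) ∈ verts Γ
  convex i j r = let (z , p , q) = joined i j in convex' p q r i j

  crossing : ∀ {t z} → t ↓ z → t ∈ verts Γ → ∀ r → row t ℤ.< r → r ℤ.≤ row z →
    ∃ λ p → ∃ λ q → p ∈ verts Γ × q ∈ verts Γ × Dn p q × row q ≡ r
  crossing stop i r lt le = ⊥-elim (ℤₚ.<⇒≱ lt le)
  crossing {t} (down {w} d j s) i r lt le with row w ℤ.≟ r
  ... | yes e = t , w , i , j , d , e
  ... | no ne = crossing s j r (ℤₚ.≤∧≢⇒< (ℤₚ.≤-trans (ℤₚ.≤-reflexive (Dn.next d)) (<⇒+1≤ lt)) ne) le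

  row-crossing : ∀ {w} → w ∈ verts Γ → ∀ r → a ℤ.< r → r ℤ.≤ row w → ∃ λ p → ∃ λ q → p ∈ verts Γ × q ∈ verts Γ × Dn p q × row q ≡ r
  row-crossing j r lt le = let (z , p , q) = joined t₀∈ j in crossing p t₀∈ r (subst (ℤ._< r) (sym t₀-row) lt) (ℤₚ.≤-trans le (↓-row q))

  -- Some descent from the top row enters the row of `w`, at a vertex `q` with an upper neighbour.
  -- If `q` is not `w`, convexity gives a neighbour of `w` in its row on the side of `q`, and upward
  -- closure gives the vertex above the two.
  upper : ∀ {w} → w ∈ verts Γ → a ℤ.< row w → ∃ λ p → p ∈ verts Γ × Dn p w
  upper {w} j lt = go (row-crossing j (row w) lt ℤₚ.≤-refl)
    where
    lem : ∀ r → r ≡ r ℤ.- + 1 ℤ.+ + 1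
    lem = solve-∀
    go : (∃ λ p → ∃ λ q → p ∈ verts Γ × q ∈ verts Γ × Dn p q × row q ≡ row w) → ∃ λ p → p ∈ verts Γ × Dn p w
    go (p , q , ip , iq , d , e) with ℤₚ.<-cmp (col w) (col q)
    ... | tri≈ _ s _ = p , ip , dn (trans (sym e) (Dn.next d)) (subst (λ z → col p ≡ z ⊎ col p ≡ z ℤ.+ + 1) (sym s) (Dn.side d))
    ... | tri< s _ _ = (row w ℤ.- + 1 , col w ℤ.+ + 1) ,
        up-closed (row w) (col w) lt j (convex j iq (sym e) (col w ℤ.+ + 1) (ℤₚ.<⇒≤ (i<i+1 _)) (<⇒+1≤ s)) ,
        dn (lem (row w)) (inj₂ refl)
    ... | tri> _ _ s = (row w ℤ.- + 1 , col w) ,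
        subst (λ z → (row w ℤ.- + 1 , z) ∈ verts Γ) (-1+1 (col w))
          (up-closed (row w) (col w ℤ.- + 1) lt
            (subst (λ z → (z , col w ℤ.- + 1) ∈ verts Γ) e (convex iq j e (col w ℤ.- + 1) (≤-by _ _ (<⇒+1≤ s) (l₁ (col w) (col q))) (ℤₚ.<⇒≤ (+1≤⇒< (ℤₚ.≤-reflexive (-1+1 (col w)))))))
            (subst (λ z → (row w , z) ∈ verts Γ) (sym (-1+1 (col w))) j)) ,
        dn (lem (row w)) (inj₁ refl)
      where
      l₁ : ∀ x y → x ℤ.- + 1 ℤ.- y ≡ x ℤ.- (y ℤ.+ + 1)
      l₁ = solve-∀

∈-rowV : ∀ i l n j → l ℤ.≤ j → j ℤ.< l ℤ.+ + n → (i , j) ∈ rowV i l n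
∈-rowV i l zero j le lt = ⊥-elim (ℤₚ.<⇒≱ lt (ℤₚ.≤-trans (ℤₚ.≤-reflexive (ℤₚ.+-identityʳ l)) le))
∈-rowV i l (suc n) j le lt with j ℤ.≟ l
... | yes refl = here refl
... | no ne = there (∈-rowV i (l ℤ.+ + 1) n j (<⇒+1≤ (ℤₚ.≤∧≢⇒< le (ne ∘ sym))) (subst (j ℤ.<_) (lem l (+ n)) lt))
  where
  lem : ∀ l n → l ℤ.+ (+ 1 ℤ.+ n) ≡ l ℤ.+ + 1 ℤ.+ n
  lem = solve-∀

∈-rowV⁻ : ∀ i l n {v} → v ∈ rowV i l n → row v ≡ i × l ℤ.≤ col v × col v ℤ.< l ℤ.+ + n
∈-rowV⁻ i l (suc n) (here refl) = refl , ℤₚ.≤-refl , subst (ℤ._< l ℤ.+ + suc n) (ℤₚ.+-identityʳ l) (ℤₚ.+-monoʳ-< l (ℤ.+<+ (ℕ.s≤s ℕ.z≤n)))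
∈-rowV⁻ i l (suc n) (there h) = let (e , a , b) = ∈-rowV⁻ i (l ℤ.+ + 1) n h in
  e , ℤₚ.≤-trans (ℤₚ.<⇒≤ (i<i+1 l)) a , subst (_ ℤ.<_) (lem l (+ n)) b
  where
  lem : ∀ l n → l ℤ.+ + 1 ℤ.+ n ≡ l ℤ.+ (+ 1 ℤ.+ n)
  lem = solve-∀

unique-↭ : {xs ys : List V} → Unique xs → Unique ys → (∀ {v} → v ∈ xs → v ∈ ys) → (∀ {v} → v ∈ ys → v ∈ xs) → xs ↭ ys
unique-↭ u u' f g = ∼bag⇒↭ (unique∧set⇒bag u u' (mk⇔ f g))

-- Spelling an ordinary subgraph by a word

module Word (Γ : Subgraph) (a : ℤ) (ord : Ordinary Γ a) where
  open OrdinaryGraph Γ a ord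

  RowIs : ℤ → ℤ → ℕ → Set
  RowIs i l n = ∀ v → row v ≡ i → (v ∈ verts Γ → v ∈ rowV i l n) × (v ∈ rowV i l n → v ∈ verts Γ)

  rowCount-is : ∀ {i l n} → RowIs i l n → rowCount Γ i ≡ n
  rowCount-is {i} {l} {n} h = trans
    (↭-length (unique-↭ (Uniqueₚ.filter⁺ (λ v → row v ℤ.≟ i) (unique Γ)) (rowV-unique i l n)
      (λ {v} j → let (k , e) = ∈-filter⁻ (λ v → row v ℤ.≟ i) j in proj₁ (h v e) k)
      (λ {v} j → let e = All.lookup (rowV-row i l n) j in ∈-filter⁺ (λ v → row v ℤ.≟ i) (proj₂ (h v e) j) e)))
    (rowV-length i l n)

  interval : ∀ i l n → (∀ c → l ℤ.≤ c → c ℤ.< l ℤ.+ + n → (i , c) ∈ verts Γ) →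
    (∀ c → (i , c) ∈ verts Γ → l ℤ.≤ c × c ℤ.< l ℤ.+ + n) → RowIs i l n
  interval i l n f g v refl =
    (λ j → let (x , y) = g (col v) j in ∈-rowV i l n (col v) x y) ,
    (λ j → let (_ , x , y) = ∈-rowV⁻ i l n j in f (col v) x y)

  topRow : ∃ λ l → ∃ λ n → RowIs a l n
  topRow = go (key-min' col rows t∈) (key-min' (λ v → ℤ.- col v) rows t∈)
    where
    rows = filter (λ v → row v ℤ.≟ a) (verts Γ)
    t∈ : t₀ ∈ rows
    t∈ = ∈-filter⁺ (λ v → row v ℤ.≟ a) t₀∈ t₀-row
    key-min' : ∀ (key : V → ℤ) xs → t₀ ∈ xs → ∃ λ v → v ∈ xs × (∀ {w} → w ∈ xs → key v ℤ.≤ key w)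
    key-min' key (x ∷ xs) _ = key-min key x xs
    l₁ : ∀ l r → l ℤ.+ (+ 1 ℤ.+ (r ℤ.- l)) ≡ r ℤ.+ + 1
    l₁ = solve-∀
    l₂ : ∀ l r → r ℤ.- l ≡ ℤ.- l ℤ.- (ℤ.- r)
    l₂ = solve-∀
    l₃ : ∀ l r → r ℤ.- l ℤ.- + 0 ≡ r ℤ.- l
    l₃ = solve-∀
    go : (∃ λ v → v ∈ rows × (∀ {w} → w ∈ rows → col v ℤ.≤ col w)) →
         (∃ λ v → v ∈ rows × (∀ {w} → w ∈ rows → ℤ.- col v ℤ.≤ ℤ.- col w)) → ∃ λ l → ∃ λ n → RowIs a l n
    go (p , ip , hp) (q , iq , hq) = col p , suc ℤ.∣ col q ℤ.- col p ∣ ,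
      interval a (col p) _
        (λ c x y → subst (λ z → (z , c) ∈ verts Γ) rp (convex (proj₁ (∈-filter⁻ _ ip)) (proj₁ (∈-filter⁻ _ iq)) (trans rp (sym rq)) c x (≤-by c (col q) (<⇒+1≤ (subst (c ℤ.<_) end y)) (l₄ c (col q)))))
        (λ c j → hp (∈-filter⁺ _ j refl) , subst (c ℤ.<_) (sym end) (ℤₚ.≤-<-trans (≤-by c (col q) (hq (∈-filter⁺ _ j refl)) (l₂ c (col q))) (i<i+1 (col q))))
      where
      rp = proj₂ (∈-filter⁻ (λ v → row v ℤ.≟ a) {xs = verts Γ} ip)
      rq = proj₂ (∈-filter⁻ (λ v → row v ℤ.≟ a) {xs = verts Γ} iq)
      l₄ : ∀ c q → q ℤ.- c ≡ q ℤ.+ + 1 ℤ.- (c ℤ.+ + 1)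
      l₄ = solve-∀
      end : col p ℤ.+ + suc ℤ.∣ col q ℤ.- col p ∣ ≡ col q ℤ.+ + 1
      end = trans (cong (λ z → col p ℤ.+ (+ 1 ℤ.+ z)) (ℤₚ.0≤i⇒+∣i∣≡i (≤-by (+ 0) (col q ℤ.- col p) (hp iq) (l₃ (col p) (col q))))) (l₁ (col p) (col q))

  module NextRow (i l : ℤ) (n : ℕ) (a≤i : a ℤ.≤ i) (h : RowIs i l (suc n)) where

    private
      k = i ℤ.+ + 1

    mid : ∀ c → l ℤ.≤ c → c ℤ.< l ℤ.+ + n → (k , c) ∈ verts Γ
    mid c x y = down-closed i c (proj₂ (h (i , c) refl) (∈-rowV i l (suc n) c x (ℤₚ.<-trans y lt)))
      (proj₂ (h (i , c ℤ.+ + 1) refl) (∈-rowV i l (suc n) (c ℤ.+ + 1) (ℤₚ.≤-trans x (ℤₚ.<⇒≤ (i<i+1 c))) (ℤₚ.≤-<-trans (<⇒+1≤ y) lt)))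
      where
      lt : l ℤ.+ + n ℤ.< l ℤ.+ + suc n
      lt = ℤₚ.+-monoʳ-< l (ℤ.+<+ ℕₚ.≤-refl)

    bounds : ∀ c → (k , c) ∈ verts Γ → l ℤ.- + 1 ℤ.≤ c × c ℤ.≤ l ℤ.+ + n
    bounds c j = go (upper j (ℤₚ.≤-<-trans a≤i (i<i+1 i)))
      where
      l₁ : ∀ l c → c ℤ.- (l ℤ.- + 1) ≡ c ℤ.- l ℤ.+ + 1
      l₁ = solve-∀
      l₂ : ∀ l c → c ℤ.- (l ℤ.- + 1) ≡ c ℤ.+ + 1 ℤ.- l
      l₂ = solve-∀
      l₃ : ∀ l n c → l ℤ.+ n ℤ.- c ≡ l ℤ.+ (+ 1 ℤ.+ n) ℤ.- (c ℤ.+ + 1)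
      l₃ = solve-∀
      fit : ∀ p → col p ≡ c ⊎ col p ≡ c ℤ.+ + 1 → l ℤ.≤ col p × col p ℤ.< l ℤ.+ + suc n → l ℤ.- + 1 ℤ.≤ c × c ℤ.≤ l ℤ.+ + n
      fit p (inj₁ refl) (x , y) = ℤₚ.≤-trans (≤-by (l ℤ.- + 1) l (ℤ.+≤+ (ℕ.z≤n {1})) (l₄ l)) x , ≤-by c (l ℤ.+ + n) (<⇒+1≤ y) (l₃ l (+ n) c)
        where
        l₄ : ∀ l → l ℤ.- (l ℤ.- + 1) ≡ + 1 ℤ.- + 0
        l₄ = solve-∀
      fit p (inj₂ refl) (x , y) = ≤-by (l ℤ.- + 1) c x (l₂ l c) , ℤₚ.≤-trans (ℤₚ.<⇒≤ (i<i+1 c)) (≤-by (c ℤ.+ + 1) (l ℤ.+ + n) (<⇒+1≤ y) (l₃ l (+ n) (c ℤ.+ + 1)))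
      eqrow : ∀ x → k ≡ x ℤ.+ + 1 → x ≡ i
      eqrow x e = trans (l₅ x) (trans (cong (ℤ._- + 1) (sym e)) (sym (l₅ i)))
        where
        l₅ : ∀ x → x ≡ x ℤ.+ + 1 ℤ.- + 1
        l₅ = solve-∀
      go : (∃ λ p → p ∈ verts Γ × Dn p (k , c)) → l ℤ.- + 1 ℤ.≤ c × c ℤ.≤ l ℤ.+ + n
      go (p , ip , dn e d) = fit p d (proj₂ (∈-rowV⁻ i l (suc n) (proj₁ (h p (eqrow (row p) e)) ip)))

    private
      -1+1 : ∀ l → l ℤ.- + 1 ℤ.+ + 1 ≡ l
      -1+1 = solve-∀
      e₁ : ∀ l n → l ℤ.- + 1 ℤ.+ (+ 1 ℤ.+ n) ≡ l ℤ.+ n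
      e₁ = solve-∀
      e₂ : ∀ l n → l ℤ.- + 1 ℤ.+ (+ 2 ℤ.+ n) ≡ l ℤ.+ n ℤ.+ + 1
      e₂ = solve-∀
      e₃ : ∀ l n → l ℤ.+ (+ 1 ℤ.+ n) ≡ l ℤ.+ n ℤ.+ + 1
      e₃ = solve-∀
      <+1 : ∀ {x y} → x ℤ.≤ y → x ℤ.< y ℤ.+ + 1
      <+1 {x} {y} p = ℤₚ.≤-<-trans p (i<i+1 y)
      low : ∀ {c} → l ℤ.- + 1 ℤ.≤ c → c ≢ l ℤ.- + 1 → l ℤ.≤ c
      low {c} p ne = subst (ℤ._≤ c) (-1+1 l) (<⇒+1≤ (ℤₚ.≤∧≢⇒< p (ne ∘ sym)))
      high : ∀ {c} → c ℤ.< l ℤ.+ + n ℤ.+ + 1 → c ≢ l ℤ.+ + n → c ℤ.< l ℤ.+ + n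
      high {c} p ne = ℤₚ.≤∧≢⇒< (≤-by c (l ℤ.+ + n) (<⇒+1≤ p) (l₁ c (l ℤ.+ + n))) ne
        where
        l₁ : ∀ c x → x ℤ.- c ≡ x ℤ.+ + 1 ℤ.- (c ℤ.+ + 1)
        l₁ = solve-∀

    -- The columns `l` to `l + n - 1` are forced by downward closure, and the existence of upper
    -- neighbours leaves only `l - 1` and `l + n` as further candidates; which of them belong to Γ
    -- determines the letter.
    extend : ∃ λ s → RowIs k (nextL s l) (nextN s (suc n))
    extend with (k , l ℤ.- + 1) ∈? verts Γ | (k , l ℤ.+ + n) ∈? verts Γ
    ... | yes L | yes R = sD , interval k (l ℤ.- + 1) (suc (suc n)) fill
          (λ c j → proj₁ (bounds c j) , subst (c ℤ.<_) (sym (e₂ l (+ n))) (<+1 (proj₂ (bounds c j))))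
      where
      fill : ∀ c → l ℤ.- + 1 ℤ.≤ c → c ℤ.< l ℤ.- + 1 ℤ.+ + suc (suc n) → (k , c) ∈ verts Γ
      fill c x y with c ℤ.≟ l ℤ.- + 1 | c ℤ.≟ l ℤ.+ + n
      ... | yes refl | _ = L
      ... | no _ | yes refl = R
      ... | no p | no q = mid c (low x p) (high (subst (c ℤ.<_) (e₂ l (+ n)) y) q)
    ... | yes L | no R = sB , interval k (l ℤ.- + 1) (suc n) fill
          (λ c j → proj₁ (bounds c j) , subst (c ℤ.<_) (sym (e₁ l (+ n))) (ℤₚ.≤∧≢⇒< (proj₂ (bounds c j)) λ { refl → R j }))
      where
      fill : ∀ c → l ℤ.- + 1 ℤ.≤ c → c ℤ.< l ℤ.- + 1 ℤ.+ + suc n → (k , c) ∈ verts Γ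
      fill c x y with c ℤ.≟ l ℤ.- + 1
      ... | yes refl = L
      ... | no p = mid c (low x p) (subst (c ℤ.<_) (e₁ l (+ n)) y)
    ... | no L | yes R = sC , interval k l (suc n) fill
          (λ c j → low (proj₁ (bounds c j)) (λ { refl → L j }) , subst (c ℤ.<_) (sym (e₃ l (+ n))) (<+1 (proj₂ (bounds c j))))
      where
      fill : ∀ c → l ℤ.≤ c → c ℤ.< l ℤ.+ + suc n → (k , c) ∈ verts Γ
      fill c x y with c ℤ.≟ l ℤ.+ + n
      ... | yes refl = R
      ... | no q = mid c x (high (subst (c ℤ.<_) (e₃ l (+ n)) y) q)
    ... | no L | no R = sA , interval k l n mid
          (λ c j → low (proj₁ (bounds c j)) (λ { refl → L j }) , ℤₚ.≤∧≢⇒< (proj₂ (bounds c j)) λ { refl → R j })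

  Grows : ℤ → Set
  Grows i = ∃ λ i' → i ℤ.≤ i' × rowCount Γ i' ℕ.< rowCount Γ (i' ℤ.+ + 1)

  record Spelled (i l : ℤ) (n : ℕ) : Set where
    field
      word : List Move
      ends : afterN n word ≡ 0
      covers : ∀ v → i ℤ.< row v → (v ∈ verts Γ → v ∈ below i l n word) × (v ∈ below i l n word → v ∈ verts Γ)
      contains-D : Grows i → ∃ λ w₁ → ∃ λ w₂ → word ≡ w₁ ++ sD ∷ w₂

  -- `h` bounds the depth still to be read. An empty row ends Γ, since a descent to any vertex below
  -- it would have to cross it.
  spell : ∀ h i l n → a ℤ.≤ i → RowIs i l n → (∀ {v} → v ∈ verts Γ → row v ℤ.< i ℤ.+ + h) → Spelled i l n
  spell h i l zero a≤i r top = record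
    { word = [] ; ends = refl
    ; covers = λ v lt → (λ j → ⊥-elim (empty lt j)) , λ ()
    ; contains-D = λ { (i' , le , gr) → ⊥-elim (none i' le (rowCount Γ (i' ℤ.+ + 1)) refl gr) } }
    where
    empty : ∀ {v} → i ℤ.< row v → v ∈ verts Γ → ⊥
    empty {v} lt j = go (row-crossing j (i ℤ.+ + 1) (ℤₚ.≤-<-trans a≤i (i<i+1 i)) (<⇒+1≤ lt))
      where
      l₅ : ∀ x → x ≡ x ℤ.+ + 1 ℤ.- + 1
      l₅ = solve-∀
      go : (∃ λ p → ∃ λ q → p ∈ verts Γ × q ∈ verts Γ × Dn p q × row q ≡ i ℤ.+ + 1) → ⊥
      go (p , q , ip , iq , dn d _ , e) with proj₁ (r p (trans (l₅ (row p)) (trans (cong (ℤ._- + 1) (trans (sym d) e)) (sym (l₅ i))))) ip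
      ... | ()
    none : ∀ i' → i ℤ.≤ i' → ∀ k → k ≡ rowCount Γ (i' ℤ.+ + 1) → rowCount Γ i' ℕ.< k → ⊥
    none i' le (suc k) e _ = choose (filter (λ v → row v ℤ.≟ i' ℤ.+ + 1) (verts Γ)) refl e
      where
      choose : ∀ xs → xs ≡ filter (λ v → row v ℤ.≟ i' ℤ.+ + 1) (verts Γ) → suc k ≡ length xs → ⊥
      choose (x ∷ xs) q _ =
        let (j , s) = ∈-filter⁻ (λ v → row v ℤ.≟ i' ℤ.+ + 1) {xs = verts Γ} (subst (x ∈_) q (here refl)) in
        empty (subst (i ℤ.<_) (sym s) (ℤₚ.≤-<-trans le (i<i+1 i'))) j
  spell zero i l (suc n) a≤i r top = ⊥-elim (ℤₚ.<-irrefl (sym (ℤₚ.+-identityʳ i)) (top (proj₂ (r (i , l) refl) (here refl))))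
  spell (suc h) i l (suc n) a≤i r top = go (NextRow.extend i l n a≤i r)
    where
    k = i ℤ.+ + 1
    lem : ∀ i h → i ℤ.+ (+ 1 ℤ.+ h) ≡ i ℤ.+ + 1 ℤ.+ h
    lem = solve-∀
    go : (∃ λ s → RowIs k (nextL s l) (nextN s (suc n))) → Spelled i l (suc n)
    go (s , r') = record
      { word = s ∷ word
      ; ends = ends
      ; covers = λ v lt → cov v (<⇒+1≤ lt)
      ; contains-D = λ { (i' , le , gr) → find i' le gr } }
      where
      open Spelled (spell h k (nextL s l) (nextN s (suc n)) (ℤₚ.≤-trans a≤i (ℤₚ.<⇒≤ (i<i+1 i))) r' (λ {v} j → subst (row v ℤ.<_) (lem i (+ h)) (top j)))
      R = rowV k (nextL s l) (nextN s (suc n))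
      cov : ∀ v → k ℤ.≤ row v → (v ∈ verts Γ → v ∈ R ++ below k (nextL s l) (nextN s (suc n)) word) × (v ∈ R ++ below k (nextL s l) (nextN s (suc n)) word → v ∈ verts Γ)
      cov v le with row v ℤ.≟ k
      ... | yes e = (λ j → ∈-++⁺ˡ (proj₁ (r' v e) j)) , λ j → back (∈-++⁻ R j)
        where
        back : v ∈ R ⊎ v ∈ below k (nextL s l) (nextN s (suc n)) word → v ∈ verts Γ
        back (inj₁ j) = proj₂ (r' v e) j
        back (inj₂ j) = ⊥-elim (ℤₚ.<-irrefl (sym e) (All.lookup (below-row k (nextL s l) (nextN s (suc n)) word) j))
      ... | no ne = (λ j → ∈-++⁺ʳ R (proj₁ (covers v lt) j)) , λ j → back (∈-++⁻ R j)
        where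
        lt : k ℤ.< row v
        lt = ℤₚ.≤∧≢⇒< le (ne ∘ sym)
        back : v ∈ R ⊎ v ∈ below k (nextL s l) (nextN s (suc n)) word → v ∈ verts Γ
        back (inj₁ j) = ⊥-elim (ne (All.lookup (rowV-row k (nextL s l) (nextN s (suc n))) j))
        back (inj₂ j) = proj₂ (covers v lt) j
      isD : suc n ℕ.< nextN s (suc n) → s ≡ sD
      isD = lemD s
        where
        lemD : ∀ s → suc n ℕ.< nextN s (suc n) → s ≡ sD
        lemD sA p = ⊥-elim (ℕₚ.<⇒≱ p (ℕₚ.n≤1+n n))
        lemD sB p = ⊥-elim (ℕₚ.<-irrefl refl p)
        lemD sC p = ⊥-elim (ℕₚ.<-irrefl refl p)
        lemD sD p = refl
      find : ∀ i' → i ℤ.≤ i' → rowCount Γ i' ℕ.< rowCount Γ (i' ℤ.+ + 1) → ∃ λ w₁ → ∃ λ w₂ → s ∷ word ≡ w₁ ++ sD ∷ w₂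
      find i' le gr with i' ℤ.≟ i
      ... | yes refl = [] , word , cong (_∷ word) (isD (subst₂ ℕ._<_ (rowCount-is r) (rowCount-is r') gr))
      ... | no ne = let (w₁ , w₂ , q) = contains-D (i' , <⇒+1≤ (ℤₚ.≤∧≢⇒< le (ne ∘ sym)) , gr) in s ∷ w₁ , w₂ , cong (s ∷_) q

  lowest : ∀ vs → ∃ λ h → ∀ {v} → v ∈ vs → row v ℤ.< a ℤ.+ + h
  lowest [] = 0 , λ ()
  lowest (v ∷ vs) = let (h , f) = lowest vs in suc ℤ.∣ row v ℤ.- a ∣ ℕ.+ h , λ
    { (here refl) → ℤₚ.<-≤-trans (ℤₚ.≤-<-trans (≤-by (row v) (a ℤ.+ + ℤ.∣ row v ℤ.- a ∣) (i≤∣i∣ (row v ℤ.- a)) (l₁ (row v) a (+ ℤ.∣ row v ℤ.- a ∣)))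
        (ℤₚ.+-monoʳ-< a (ℤ.+<+ (ℕₚ.n<1+n ℤ.∣ row v ℤ.- a ∣)))) (ℤₚ.+-monoʳ-≤ a (ℤ.+≤+ (ℕₚ.m≤m+n _ h)))
    ; (there j) → ℤₚ.<-≤-trans (f j) (ℤₚ.+-monoʳ-≤ a (ℤ.+≤+ (ℕₚ.m≤n+m h _))) }
    where
    l₁ : ∀ r a x → a ℤ.+ x ℤ.- r ≡ x ℤ.- (r ℤ.- a)
    l₁ = solve-∀
    i≤∣i∣ : ∀ i → i ℤ.≤ + ℤ.∣ i ∣
    i≤∣i∣ (+ n) = ℤₚ.≤-refl
    i≤∣i∣ (ℤ.-[1+ n ]) = ℤ.-≤+

  opaque
    l₀ : ℤ
    l₀ = proj₁ topRow

    n₀ : ℕ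
    n₀ = proj₁ (proj₂ topRow)

    top-is : RowIs a l₀ n₀
    top-is = proj₂ (proj₂ topRow)

    spelled : Spelled a l₀ n₀
    spelled = let (h , f) = lowest (verts Γ) in spell h a l₀ n₀ ℤₚ.≤-refl top-is f

  open Spelled spelled public

  verts↭shape : verts Γ ↭ shapeV a l₀ n₀ word
  verts↭shape = unique-↭ (unique Γ) (shape-unique a l₀ n₀ word) to from
    where
    r = top-is
    to : ∀ {v} → v ∈ verts Γ → v ∈ shapeV a l₀ n₀ word
    to {v} j with row v ℤ.≟ a
    ... | yes e = ∈-++⁺ˡ (proj₁ (r v e) j)
    ... | no ne = ∈-++⁺ʳ (rowV a l₀ n₀) (proj₁ (covers v (ℤₚ.≤∧≢⇒< (a≤ j) (ne ∘ sym))) j)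
    from : ∀ {v} → v ∈ shapeV a l₀ n₀ word → v ∈ verts Γ
    from {v} j with ∈-++⁻ (rowV a l₀ n₀) j
    ... | inj₁ q = proj₂ (r v (All.lookup (rowV-row a l₀ n₀) q)) q
    ... | inj₂ q = proj₂ (covers v (All.lookup (below-row a l₀ n₀ word) q)) q

-- The polyhedron, row by row

ilW : Move → List ℤ → List ℤ → Bool
ilW sA x y = il x y
ilW sB x y = il y x
ilW sC x y = il x y
ilW sD x y = il y x

W≡ : ∀ s x y → W s x y ≡ chi (ilW s x y) ⊗ wt x y
W≡ sA x y = refl
W≡ sB x y = refl
W≡ sC x y = refl
W≡ sD x y = refl

allIl : ℤ → ℤ → ℕ → List Move → Mono → Bool
allIl i l n [] m = true
allIl i l n (s ∷ w) m =
  ilW s (vals m (rowV i l n)) (vals m (rowV (i ℤ.+ + 1) (nextL s l) (nextN s n))) ∧ allIl (i ℤ.+ + 1) (nextL s l) (nextN s n) w m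

wts : ℤ → ℤ → ℕ → List Move → Mono → Poly
wts i l n [] m = oneP
wts i l n (s ∷ w) m =
  wt (vals m (rowV i l n)) (vals m (rowV (i ℤ.+ + 1) (nextL s l) (nextN s n))) ⊗ wts (i ℤ.+ + 1) (nextL s l) (nextN s n) w m

opaque
  unfolding _⊕_
  ⊗-interchange : ∀ a b c d → (a ⊗ b) ⊗ (c ⊗ d) ≋ (a ⊗ c) ⊗ (b ⊗ d)
  ⊗-interchange = RingSolver.solve-∀ polyACR

P≋ : ∀ i l n w m → P i l n w m ≋ chi (allIl i l n w m) ⊗ wts i l n w m
P≋ i l n [] m = ≋-sym (⊗-identityˡ oneP)
P≋ i l n (s ∷ w) m =
  ≋-trans (⊗-cong (≋-reflexive (W≡ s _ _)) (P≋ (i ℤ.+ + 1) (nextL s l) (nextN s n) w m))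
  (≋-trans (⊗-interchange _ _ _ _)
    (⊗-cong (≋-sym (chi-∧ (ilW s (vals m (rowV i l n)) (vals m (rowV (i ℤ.+ + 1) (nextL s l) (nextN s n)))) _)) ≋-refl))

-- il compares each entry of the first row with the entry of the second row
-- whose column is shifted by d, and that one with the next of the first row.
record Zig (x : V → ℤ) (p q d : ℤ) (R R' : List V) : Set where
  constructor zig
  field
    first : ∀ c → (p , c) ∈ R → (q , c ℤ.+ d) ∈ R' → x (q , c ℤ.+ d) ℤ.≤ x (p , c)
    second : ∀ c → (q , c) ∈ R' → (p , c ℤ.+ (+ 1 ℤ.- d)) ∈ R → x (p , c ℤ.+ (+ 1 ℤ.- d)) ℤ.≤ x (q , c)

module Zigzag (m : Mono) where

  private
    x = expo m
    e₁ : ∀ l d → l ℤ.+ d ℤ.+ (+ 1 ℤ.- d) ≡ l ℤ.+ + 1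
    e₁ = solve-∀
    e₂ : ∀ d → + 1 ℤ.- (+ 1 ℤ.- d) ≡ d
    e₂ = solve-∀

  il-zig : ∀ n n' p q l d → il (vals m (rowV p l n)) (vals m (rowV q (l ℤ.+ d) n')) ≡ true → Zig x p q d (rowV p l n) (rowV q (l ℤ.+ d) n')
  il-zig zero zero p q l d e = zig (λ c ()) (λ c ())
  il-zig (suc n) zero p q l d e = zig (λ c _ ()) (λ c ())
  il-zig (suc n) (suc n') p q l d e = zig f s
    where
    R = rowV p (l ℤ.+ + 1) n
    R' = rowV q (l ℤ.+ d) (suc n')
    head : x (q , l ℤ.+ d) ℤ.≤ x (p , l)
    head = ≤ᵇ-sound {x (q , l ℤ.+ d)} {x (p , l)} (proj₁ (∧-true {x (q , l ℤ.+ d) ≤ᵇ x (p , l)} e))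
    -- Exchanging the roles of the rows turns the column shift `d` into `1 - d`.
    rest : Zig x q p (+ 1 ℤ.- d) R' R
    rest = subst (λ z → Zig x q p (+ 1 ℤ.- d) R' (rowV p z n)) (e₁ l d)
      (il-zig (suc n') n q p (l ℤ.+ d) (+ 1 ℤ.- d)
        (subst (λ z → il (vals m R') (vals m (rowV p z n)) ≡ true) (sym (e₁ l d)) (proj₂ (∧-true {x (q , l ℤ.+ d) ≤ᵇ x (p , l)} e))))
    f : ∀ c → (p , c) ∈ (p , l) ∷ R → (q , c ℤ.+ d) ∈ R' → x (q , c ℤ.+ d) ℤ.≤ x (p , c)
    f c (here refl) j = head
    f c (there i) j = subst (λ z → x (q , c ℤ.+ z) ℤ.≤ x (p , c)) (e₂ d)
      (Zig.second rest c i (subst (λ z → (q , c ℤ.+ z) ∈ R') (sym (e₂ d)) j))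
    s : ∀ c → (q , c) ∈ R' → (p , c ℤ.+ (+ 1 ℤ.- d)) ∈ (p , l) ∷ R → x (p , c ℤ.+ (+ 1 ℤ.- d)) ℤ.≤ x (q , c)
    s c i (there j) = Zig.first rest c i j
    s c i (here h) = ⊥-elim (ℤₚ.<⇒≱ (i<i+1 c) (ℤₚ.≤-trans (ℤₚ.≤-reflexive eqc) (proj₁ (proj₂ (∈-rowV⁻ q (l ℤ.+ d) (suc n') i)))))
      where
      e₃ : ∀ c d → c ℤ.+ + 1 ≡ c ℤ.+ (+ 1 ℤ.- d) ℤ.+ d
      e₃ = solve-∀
      eqc : c ℤ.+ + 1 ≡ l ℤ.+ d
      eqc = trans (e₃ c d) (cong (λ v → col v ℤ.+ d) h)

  zig-il : ∀ n n' p q l d → n ≡ n' ⊎ n ≡ suc n' → Zig x p q d (rowV p l n) (rowV q (l ℤ.+ d) n') → il (vals m (rowV p l n)) (vals m (rowV q (l ℤ.+ d) n')) ≡ true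
  zig-il zero zero p q l d _ z = refl
  zig-il zero (suc n') p q l d (inj₁ ()) z
  zig-il zero (suc n') p q l d (inj₂ ()) z
  zig-il (suc zero) zero p q l d h z = refl
  zig-il (suc (suc n)) zero p q l d (inj₁ ()) z
  zig-il (suc (suc n)) zero p q l d (inj₂ ()) z
  zig-il (suc n) (suc n') p q l d h (zig f s) = cong₂ _∧_ (≤ᵇ-true (f l (here refl) (here refl)))
    (subst (λ z → il (vals m R') (vals m (rowV p z n)) ≡ true) (e₁ l d)
      (zig-il (suc n') n q p (l ℤ.+ d) (+ 1 ℤ.- d) (swap h)
        (subst (λ z → Zig x q p (+ 1 ℤ.- d) R' (rowV p z n)) (sym (e₁ l d))
          (zig (λ c i j → s c i (there j))
               (λ c i j → subst (λ z → x (q , c ℤ.+ z) ℤ.≤ x (p , c)) (sym (e₂ d)) (f c (there i) (subst (λ z → (q , c ℤ.+ z) ∈ R') (e₂ d) j)))))))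
    where
    R' = rowV q (l ℤ.+ d) (suc n')
    swap : suc n ≡ suc n' ⊎ suc n ≡ suc (suc n') → suc n' ≡ n ⊎ suc n' ≡ suc n
    swap (inj₁ e) = inj₂ (sym e)
    swap (inj₂ e) = inj₁ (sym (ℕₚ.suc-injective e))

record Between (x : V → ℤ) (i : ℤ) (R R' : List V) : Set where
  constructor between
  field
    left : ∀ c → (i , c) ∈ R → (i ℤ.+ + 1 , c) ∈ R' → x (i ℤ.+ + 1 , c) ℤ.≤ x (i , c)
    right : ∀ c → (i ℤ.+ + 1 , c) ∈ R' → (i , c ℤ.+ + 1) ∈ R → x (i , c ℤ.+ + 1) ℤ.≤ x (i ℤ.+ + 1 , c)

Ineqs : (V → ℤ) → List V → Set
Ineqs x vs = ∀ i → Between x i vs vs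

module _ (m : Mono) where
  open Zigzag m
  private
    x = expo m

    down-zig : ∀ i R R' → Zig x i (i ℤ.+ + 1) (+ 0) R R' → Between x i R R'
    down-zig i R R' (zig f s) = between
      (λ c p q → subst (λ z → x (i ℤ.+ + 1 , z) ℤ.≤ x (i , c)) (ℤₚ.+-identityʳ c) (f c p (subst (λ z → (i ℤ.+ + 1 , z) ∈ R') (sym (ℤₚ.+-identityʳ c)) q)))
      s

    zig-down : ∀ i R R' → Between x i R R' → Zig x i (i ℤ.+ + 1) (+ 0) R R'
    zig-down i R R' (between f s) = zig
      (λ c p q → subst (λ z → x (i ℤ.+ + 1 , z) ℤ.≤ x (i , c)) (sym (ℤₚ.+-identityʳ c)) (f c p (subst (λ z → (i ℤ.+ + 1 , z) ∈ R') (ℤₚ.+-identityʳ c) q)))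
      s

    up-zig : ∀ i R R' → Zig x (i ℤ.+ + 1) i (+ 1) R' R → Between x i R R'
    up-zig i R R' (zig f s) = between
      (λ c p q → subst (λ z → x (i ℤ.+ + 1 , z) ℤ.≤ x (i , c)) (ℤₚ.+-identityʳ c) (s c p (subst (λ z → (i ℤ.+ + 1 , z) ∈ R') (sym (ℤₚ.+-identityʳ c)) q)))
      f

    zig-up : ∀ i R R' → Between x i R R' → Zig x (i ℤ.+ + 1) i (+ 1) R' R
    zig-up i R R' (between f s) = zig s
      (λ c p q → subst (λ z → x (i ℤ.+ + 1 , z) ℤ.≤ x (i , c)) (sym (ℤₚ.+-identityʳ c)) (f c p (subst (λ z → (i ℤ.+ + 1 , z) ∈ R') (ℤₚ.+-identityʳ c) q)))

    -1+1 : ∀ l → l ℤ.- + 1 ℤ.+ + 1 ≡ l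
    -1+1 = solve-∀

    pred-case : ∀ n → n ≡ ℕ.pred n ⊎ n ≡ suc (ℕ.pred n)
    pred-case zero = inj₁ refl
    pred-case (suc n) = inj₂ refl

    down-sound : ∀ i l n n' → il (vals m (rowV i l n)) (vals m (rowV (i ℤ.+ + 1) l n')) ≡ true → Between x i (rowV i l n) (rowV (i ℤ.+ + 1) l n')
    down-sound i l n n' e = subst (λ z → Between x i (rowV i l n) (rowV (i ℤ.+ + 1) z n')) (ℤₚ.+-identityʳ l)
      (down-zig i _ _ (il-zig n n' i (i ℤ.+ + 1) l (+ 0) (subst (λ z → il (vals m (rowV i l n)) (vals m (rowV (i ℤ.+ + 1) z n')) ≡ true) (sym (ℤₚ.+-identityʳ l)) e)))

    down-complete : ∀ i l n n' → n ≡ n' ⊎ n ≡ suc n' → Between x i (rowV i l n) (rowV (i ℤ.+ + 1) l n') → il (vals m (rowV i l n)) (vals m (rowV (i ℤ.+ + 1) l n')) ≡ true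
    down-complete i l n n' h b = subst (λ z → il (vals m (rowV i l n)) (vals m (rowV (i ℤ.+ + 1) z n')) ≡ true) (ℤₚ.+-identityʳ l)
      (zig-il n n' i (i ℤ.+ + 1) l (+ 0) h (zig-down i _ _ (subst (λ z → Between x i (rowV i l n) (rowV (i ℤ.+ + 1) z n')) (sym (ℤₚ.+-identityʳ l)) b)))

    up-sound : ∀ i l n n' → il (vals m (rowV (i ℤ.+ + 1) (l ℤ.- + 1) n')) (vals m (rowV i l n)) ≡ true → Between x i (rowV i l n) (rowV (i ℤ.+ + 1) (l ℤ.- + 1) n')
    up-sound i l n n' e = subst (λ z → Between x i (rowV i z n) R') (-1+1 l)
      (up-zig i _ _ (il-zig n' n (i ℤ.+ + 1) i (l ℤ.- + 1) (+ 1) (subst (λ z → il (vals m R') (vals m (rowV i z n)) ≡ true) (sym (-1+1 l)) e)))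
      where R' = rowV (i ℤ.+ + 1) (l ℤ.- + 1) n'

    up-complete : ∀ i l n n' → n' ≡ n ⊎ n' ≡ suc n → Between x i (rowV i l n) (rowV (i ℤ.+ + 1) (l ℤ.- + 1) n') → il (vals m (rowV (i ℤ.+ + 1) (l ℤ.- + 1) n')) (vals m (rowV i l n)) ≡ true
    up-complete i l n n' h b = subst (λ z → il (vals m R') (vals m (rowV i z n)) ≡ true) (-1+1 l)
      (zig-il n' n (i ℤ.+ + 1) i (l ℤ.- + 1) (+ 1) h (zig-up i _ _ (subst (λ z → Between x i (rowV i z n) R') (sym (-1+1 l)) b)))
      where R' = rowV (i ℤ.+ + 1) (l ℤ.- + 1) n'

  ilW-sound : ∀ s i l n → ilW s (vals m (rowV i l n)) (vals m (rowV (i ℤ.+ + 1) (nextL s l) (nextN s n))) ≡ true →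
    Between x i (rowV i l n) (rowV (i ℤ.+ + 1) (nextL s l) (nextN s n))
  ilW-sound sA i l n = down-sound i l n (ℕ.pred n)
  ilW-sound sB i l n = up-sound i l n n
  ilW-sound sC i l n = down-sound i l n n
  ilW-sound sD i l n = up-sound i l n (suc n)

  ilW-complete : ∀ s i l n → Between x i (rowV i l n) (rowV (i ℤ.+ + 1) (nextL s l) (nextN s n)) →
    ilW s (vals m (rowV i l n)) (vals m (rowV (i ℤ.+ + 1) (nextL s l) (nextN s n))) ≡ true
  ilW-complete sA i l n = down-complete i l n (ℕ.pred n) (pred-case n)
  ilW-complete sB i l n = up-complete i l n n (inj₁ refl)
  ilW-complete sC i l n = down-complete i l n n (inj₁ refl)
  ilW-complete sD i l n = up-complete i l n (suc n) (inj₂ refl)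

  in-row : ∀ i l n w {j c} → j ≡ i → (j , c) ∈ shapeV i l n w → (j , c) ∈ rowV i l n
  in-row i l n w e h with ∈-++⁻ (rowV i l n) h
  ... | inj₁ p = p
  ... | inj₂ p = ⊥-elim (ℤₚ.<-irrefl (sym e) (All.lookup (below-row i l n w) p))

  in-below : ∀ i l n w {j c} → i ℤ.< j → (j , c) ∈ shapeV i l n w → (j , c) ∈ below i l n w
  in-below i l n w lt h with ∈-++⁻ (rowV i l n) h
  ... | inj₂ p = p
  ... | inj₁ p = ⊥-elim (ℤₚ.<-irrefl (sym (All.lookup (rowV-row i l n) p)) lt)

  shape≥ : ∀ i l n w {v} → v ∈ shapeV i l n w → i ℤ.≤ row v
  shape≥ i l n w h with ∈-++⁻ (rowV i l n) h
  ... | inj₂ p = ℤₚ.<⇒≤ (All.lookup (below-row i l n w) p)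
  ... | inj₁ p = ℤₚ.≤-reflexive (sym (All.lookup (rowV-row i l n) p))

  allIl-sound : ∀ i l n w → allIl i l n w m ≡ true → Ineqs x (shapeV i l n w)
  allIl-sound i l n [] e j = between
    (λ c p q → ⊥-elim (ℤₚ.<⇒≱ (i<i+1 j) (bad p q)))
    (λ c q p → ⊥-elim (ℤₚ.<⇒≱ (i<i+1 j) (bad p q)))
    where
    bad : ∀ {c c'} → (j , c) ∈ shapeV i l n [] → (j ℤ.+ + 1 , c') ∈ shapeV i l n [] → j ℤ.+ + 1 ℤ.≤ j
    bad p q = ℤₚ.≤-reflexive (trans (one q) (sym (one p)))
      where
      one : ∀ {v} → v ∈ shapeV i l n [] → row v ≡ i
      one h with ∈-++⁻ (rowV i l n) h
      ... | inj₁ p = All.lookup (rowV-row i l n) p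
  allIl-sound i l n (s ∷ w) e j = between
    (λ c p q → go (λ b → Between.left b c) p q (j ℤ.≟ i))
    (λ c q p → go (λ b p q → Between.right b c q p) p q (j ℤ.≟ i))
    where
    k = i ℤ.+ + 1
    l' = nextL s l
    n' = nextN s n
    b₀ : Between x i (rowV i l n) (rowV k l' n')
    b₀ = ilW-sound s i l n (proj₁ (∧-true {ilW s (vals m (rowV i l n)) (vals m (rowV k l' n'))} e))
    rec : Between x j (shapeV k l' n' w) (shapeV k l' n' w)
    rec = allIl-sound k l' n' w (proj₂ (∧-true {ilW s (vals m (rowV i l n)) (vals m (rowV k l' n'))} e)) j
    go : ∀ {c c'} {T : Set} → (∀ {R R'} → Between x j R R' → (j , c) ∈ R → (j ℤ.+ + 1 , c') ∈ R' → T) →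
      (j , c) ∈ shapeV i l n (s ∷ w) → (j ℤ.+ + 1 , c') ∈ shapeV i l n (s ∷ w) → Dec (j ≡ i) → T
    go f p q (yes refl) = f b₀ (in-row i l n (s ∷ w) refl p) (in-row k l' n' w refl (in-below i l n (s ∷ w) (i<i+1 i) q))
    go f p q (no ne) = f rec (in-below i l n (s ∷ w) lt p) (in-below i l n (s ∷ w) (ℤₚ.<-trans lt (i<i+1 j)) q)
      where
      lt : i ℤ.< j
      lt = ℤₚ.≤∧≢⇒< (shape≥ i l n (s ∷ w) p) (ne ∘ sym)

  allIl-complete : ∀ i l n w → Ineqs x (shapeV i l n w) → allIl i l n w m ≡ true
  allIl-complete i l n [] h = refl
  allIl-complete i l n (s ∷ w) h = cong₂ _∧_
    (ilW-complete s i l n (between (λ c p q → Between.left (h i) c (∈-++⁺ˡ p) (∈-++⁺ʳ (rowV i l n) (∈-++⁺ˡ q)))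
                                   (λ c q p → Between.right (h i) c (∈-++⁺ʳ (rowV i l n) (∈-++⁺ˡ q)) (∈-++⁺ˡ p))))
    (allIl-complete (i ℤ.+ + 1) (nextL s l) (nextN s n) w λ j →
      between (λ c p q → Between.left (h j) c (∈-++⁺ʳ (rowV i l n) p) (∈-++⁺ʳ (rowV i l n) q))
              (λ c q p → Between.right (h j) c (∈-++⁺ʳ (rowV i l n) q) (∈-++⁺ʳ (rowV i l n) p)))

  ineqᵇ : V → V → Bool
  ineqᵇ (i , j) (i' , j') =
    not (i' ==ℤ (i ℤ.- + 1)) ∨
    ((not (j' ==ℤ j) ∨ (texpo m (i , j) ≤ᵇ texpo m (i' , j'))) ∧
     (not (j' ==ℤ (j ℤ.+ + 1)) ∨ (texpo m (i' , j') ≤ᵇ texpo m (i , j))))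

  pairs : List V → Bool
  pairs vs = all (λ u → all (ineqᵇ u) vs) vs

  tops-ok : Subgraph → ℤ → List ℤ → Bool
  tops-ok Γ a bs = all (λ v → not (row v ==ℤ a) ∨ maybeEq (nth bs (rankTop Γ a v)) (texpo m v)) (verts Γ)

  inD≡ : ∀ Γ a bs → inD Γ a bs m ≡ offZ (memV (verts Γ)) m ∧ tops-ok Γ a bs ∧ pairs (verts Γ)
  inD≡ Γ a bs = refl

  private
    impl : ∀ {b c} → not b ∨ c ≡ true → b ≡ true → c ≡ true
    impl e refl = e

    impl⁺ : ∀ {b c} → (b ≡ true → c ≡ true) → not b ∨ c ≡ true
    impl⁺ {true} h = h refl
    impl⁺ {false} h = refl

    +1-1 : ∀ i → i ≡ i ℤ.+ + 1 ℤ.- + 1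
    +1-1 = solve-∀

  pairs-sound : ∀ vs → pairs vs ≡ true → Ineqs x vs
  pairs-sound vs e i = between
    (λ c p q → ≤ᵇ-sound {x (i ℤ.+ + 1 , c)} {x (i , c)} (impl (proj₁ (∧-true {not (c ==ℤ c) ∨ (x (i ℤ.+ + 1 , c) ≤ᵇ x (i , c))} (at' p q))) (==ℤ-refl c)))
    (λ c q p → ≤ᵇ-sound {x (i , c ℤ.+ + 1)} {x (i ℤ.+ + 1 , c)} (impl (proj₂ (∧-true {not (c ℤ.+ + 1 ==ℤ c) ∨ (x (i ℤ.+ + 1 , c) ≤ᵇ x (i , c ℤ.+ + 1))} (at' p q))) (==ℤ-refl (c ℤ.+ + 1))))
    where
    at' : ∀ {c c'} → (i , c') ∈ vs → (i ℤ.+ + 1 , c) ∈ vs →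
      (not (c' ==ℤ c) ∨ (x (i ℤ.+ + 1 , c) ≤ᵇ x (i , c'))) ∧ (not (c' ==ℤ (c ℤ.+ + 1)) ∨ (x (i , c') ≤ᵇ x (i ℤ.+ + 1 , c))) ≡ true
    at' {c} {c'} p q = impl (all-sound (ineqᵇ (i ℤ.+ + 1 , c)) vs (all-sound (λ u → all (ineqᵇ u) vs) vs e q) p) (==ℤ-complete (+1-1 i))

  pairs-complete : ∀ vs → Ineqs x vs → pairs vs ≡ true
  pairs-complete vs h = all-complete _ vs λ {u} p → all-complete _ vs λ {w} q → go u w p q
    where
    go : ∀ u w → u ∈ vs → w ∈ vs → ineqᵇ u w ≡ true
    go (i' , c) (i , c') p q = impl⁺ λ e → up (==ℤ-sound e)
      where
      -1+1' : ∀ l → l ≡ l ℤ.- + 1 ℤ.+ + 1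
      -1+1' = solve-∀
      up : i ≡ i' ℤ.- + 1 → (not (c' ==ℤ c) ∨ (x (i' , c) ≤ᵇ x (i , c'))) ∧ (not (c' ==ℤ (c ℤ.+ + 1)) ∨ (x (i , c') ≤ᵇ x (i' , c))) ≡ true
      up e = low (trans (-1+1' i') (cong (ℤ._+ + 1) (sym e))) p
        where
        low : i' ≡ i ℤ.+ + 1 → (i' , c) ∈ vs → (not (c' ==ℤ c) ∨ (x (i' , c) ≤ᵇ x (i , c'))) ∧ (not (c' ==ℤ (c ℤ.+ + 1)) ∨ (x (i , c') ≤ᵇ x (i' , c))) ≡ true
        low refl p = cong₂ _∧_
          (impl⁺ λ r → ≤ᵇ-true (L (==ℤ-sound r) q))
          (impl⁺ λ r → ≤ᵇ-true (R (==ℤ-sound r) q))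
          where
          L : ∀ {c'} → c' ≡ c → (i , c') ∈ vs → x (i ℤ.+ + 1 , c) ℤ.≤ x (i , c')
          L refl q = Between.left (h i) c q p
          R : ∀ {c'} → c' ≡ c ℤ.+ + 1 → (i , c') ∈ vs → x (i , c') ℤ.≤ x (i ℤ.+ + 1 , c)
          R refl q = Between.right (h i) c p q

Ineqs-⊆ : ∀ {x vs ws} → (∀ {v} → v ∈ ws → v ∈ vs) → Ineqs x vs → Ineqs x ws
Ineqs-⊆ s h i = between (λ c p q → Between.left (h i) c (s p) (s q)) (λ c q p → Between.right (h i) c (s q) (s p))

module Domain (Γ : Subgraph) (a : ℤ) (ord : Ordinary Γ a) (bs : List ℤ) where
  open OrdinaryGraph Γ a ord
  open Word Γ a ord

  ts : Tops
  ts = map (λ v → v , nth bs (rankTop Γ a v)) (rowV a l₀ n₀)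

  tops : ∀ {t} → t ∈ ts → proj₁ t ∈ rowV a l₀ n₀
  tops i with ∈-map⁻ _ i
  ... | v , j , refl = j

  open Shape a l₀ n₀ ts tops public using (S)

  private
    vs = shapeV a l₀ n₀ word
    to : ∀ {v} → v ∈ verts Γ → v ∈ vs
    to = ∈-resp-↭ verts↭shape
    from : ∀ {v} → v ∈ vs → v ∈ verts Γ
    from = ∈-resp-↭ (↭-sym verts↭shape)

    mem-eq : ∀ v → memV (verts Γ) v ≡ memV vs v
    mem-eq v = bool-ext (λ e → memV-complete (to (memV-sound e))) (λ e → memV-complete (from (memV-sound e)))

    off-eq : ∀ m → offZ (memV (verts Γ)) m ≡ offZ (memV vs) m
    off-eq m = bool-ext
      (λ e → offZ-complete _ m λ v q → offZ-sound _ m e v (trans (mem-eq v) q))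
      (λ e → offZ-complete _ m λ v q → offZ-sound _ m e v (trans (sym (mem-eq v)) q))

    tops-eq : ∀ m → tops-ok m Γ a bs ≡ topOK ts m
    tops-eq m = bool-ext
      (λ e → all-complete _ ts λ {t} i → go₁ e i)
      (λ e → all-complete _ (verts Γ) λ {v} i → go₂ e v i)
      where
      Q : V → Bool
      Q v = not (row v ==ℤ a) ∨ maybeEq (nth bs (rankTop Γ a v)) (expo m v)
      go₁ : all Q (verts Γ) ≡ true → ∀ {t} → t ∈ ts → maybeEq (proj₂ t) (expo m (proj₁ t)) ≡ true
      go₁ e i with ∈-map⁻ _ i
      ... | v , j , refl = trans (cong (λ b → not b ∨ maybeEq (nth bs (rankTop Γ a v)) (expo m v)) (sym (==ℤ-complete (All.lookup (rowV-row a l₀ n₀) j))))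
        (all-sound Q (verts Γ) e (from (∈-++⁺ˡ j)))
      go₂ : topOK ts m ≡ true → ∀ v → v ∈ verts Γ → Q v ≡ true
      go₂ e v i with row v ℤ.≟ a
      ... | no _ = refl
      ... | yes r = all-sound (λ { (v , b) → maybeEq b (expo m v) }) ts e (∈-map⁺ _ (in-row m a l₀ n₀ word r (to i)))

    pairs-eq : ∀ m → pairs m (verts Γ) ≡ allIl a l₀ n₀ word m
    pairs-eq m = bool-ext
      (λ e → allIl-complete m a l₀ n₀ word (Ineqs-⊆ from (pairs-sound m (verts Γ) e)))
      (λ e → pairs-complete m (verts Γ) (Ineqs-⊆ to (allIl-sound m a l₀ n₀ word e)))

  inD-shape : ∀ m → inD Γ a bs m ≡ offZ (memV vs) m ∧ topOK ts m ∧ allIl a l₀ n₀ word m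
  inD-shape m = trans (inD≡ m Γ a bs) (cong₂ _∧_ (off-eq m) (cong₂ _∧_ (tops-eq m) (pairs-eq m)))

  inD-ineqs : ∀ m → inD Γ a bs m ≡ true → Ineqs (expo m) (verts Γ)
  inD-ineqs m e = pairs-sound m (verts Γ) (proj₂ (∧-true {tops-ok m Γ a bs} (proj₂ (∧-true {offZ (memV (verts Γ)) m} (trans (sym (inD≡ m Γ a bs)) e)))))

  -- Outside the polyhedron both series are zero, so the weights have to be compared only for arrays
  -- that satisfy the inequalities.
  Scoeff≋S : (∀ m → Ineqs (expo m) (verts Γ) → weight Γ a m ≋ wts a l₀ n₀ word m) → ∀ m → Scoeff Γ a bs m ≋ S word m
  Scoeff≋S h m = ≋-trans (go (inD Γ a bs m) refl) (≋-sym rhs)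
    where
    z = offZ (memV vs) m
    t = topOK ts m
    b = allIl a l₀ n₀ word m
    go : ∀ c → c ≡ inD Γ a bs m → (if c then weight Γ a m else []) ≋ chi c ⊗ wts a l₀ n₀ word m
    go true e = ≋-trans (h m (inD-ineqs m (sym e))) (≋-sym (⊗-identityˡ _))
    go false e = ≋-sym (⊗-zeroˡ _)
    rhs : S word m ≋ chi (inD Γ a bs m) ⊗ wts a l₀ n₀ word m
    rhs = ≋-trans (⊗-cong ≋-refl (≋-trans (⊗-cong ≋-refl (P≋ a l₀ n₀ word m)) (≋-sym (⊗-assoc _ _ _))))
      (≋-trans (≋-sym (⊗-assoc _ _ _))
      (⊗-cong (≋-trans (⊗-cong ≋-refl (≋-sym (chi-∧ t b))) (≋-trans (≋-sym (chi-∧ z (t ∧ b))) (≋-reflexive (cong chi (sym (inD-shape m)))))) ≋-refl))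

-- Counting, reachability and representatives

num : {A : Set} → (A → Bool) → List A → ℕ
num p [] = 0
num p (v ∷ vs) = (if p v then 1 else 0) ℕ.+ num p vs

length-filterᵇ : {A : Set} (p : A → Bool) (vs : List A) → length (filterᵇ p vs) ≡ num p vs
length-filterᵇ p [] = refl
length-filterᵇ p (v ∷ vs) with p v
... | true = cong suc (length-filterᵇ p vs)
... | false = length-filterᵇ p vs

num-cong : {A : Set} {p q : A → Bool} (vs : List A) → (∀ {v} → v ∈ vs → p v ≡ q v) → num p vs ≡ num q vs
num-cong [] h = refl
num-cong (v ∷ vs) h = cong₂ (λ b n → (if b then 1 else 0) ℕ.+ n) (h (here refl)) (num-cong vs (h ∘ there))

num-++ : {A : Set} (p : A → Bool) (vs ws : List A) → num p (vs ++ ws) ≡ num p vs ℕ.+ num p ws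
num-++ p [] ws = refl
num-++ p (v ∷ vs) ws = trans (cong (_ ℕ.+_) (num-++ p vs ws)) (sym (ℕₚ.+-assoc (if p v then 1 else 0) _ _))

num-none : {A : Set} {p : A → Bool} (vs : List A) → (∀ {v} → v ∈ vs → p v ≡ false) → num p vs ≡ 0
num-none [] h = refl
num-none {p = p} (v ∷ vs) h = cong₂ (λ b n → (if b then 1 else 0) ℕ.+ n) (h (here refl)) (num-none vs (h ∘ there))

num≤length : {A : Set} (p : A → Bool) (vs : List A) → num p vs ℕ.≤ length vs
num≤length p [] = ℕ.z≤n
num≤length p (v ∷ vs) with p v
... | true = ℕ.s≤s (num≤length p vs)
... | false = ℕₚ.m≤n⇒m≤1+n (num≤length p vs)

num-≤ : {A : Set} {p q : A → Bool} (vs : List A) → (∀ {v} → v ∈ vs → p v ≡ true → q v ≡ true) → num p vs ℕ.≤ num q vs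
num-≤ [] h = ℕ.z≤n
num-≤ {p = p} {q} (v ∷ vs) h = ℕₚ.+-mono-≤ (one (p v) (q v) (h (here refl))) (num-≤ vs (h ∘ there))
  where
  one : ∀ b c → (b ≡ true → c ≡ true) → (if b then 1 else 0) ℕ.≤ (if c then 1 else 0)
  one false c h = ℕ.z≤n
  one true c h rewrite h refl = ℕₚ.≤-refl

num-strict : {A : Set} {p q : A → Bool} (vs : List A) → (∀ {v} → v ∈ vs → p v ≡ true → q v ≡ true) →
  num p vs ℕ.< num q vs ⊎ (∀ {v} → v ∈ vs → q v ≡ true → p v ≡ true)
num-strict [] h = inj₂ λ ()
num-strict {p = p} {q} (v ∷ vs) h with num-strict vs (h ∘ there) | bool-case (p v) | bool-case (q v)
... | inj₁ lt | inj₁ e | _ rewrite e | h (here refl) e = inj₁ (ℕ.s≤s lt)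
... | inj₁ lt | inj₂ e | inj₁ e' rewrite e | e' = inj₁ (ℕₚ.m≤n⇒m≤1+n lt)
... | inj₁ lt | inj₂ e | inj₂ e' rewrite e | e' = inj₁ lt
... | inj₂ g | inj₁ e | _ = inj₂ λ { (here refl) _ → e ; (there i) r → g i r }
... | inj₂ g | inj₂ e | inj₁ e' rewrite e | e' = inj₁ (ℕ.s≤s (num-≤ vs (h ∘ there)))
... | inj₂ g | inj₂ e | inj₂ e' = inj₂ λ { (here refl) r → ⊥-elim (true≢false r e') ; (there i) r → g i r }

-- As long as the reachable set is not closed, every step adds a vertex to it,
-- so length Γ steps suffice.
module Saturation (Γ : Subgraph) (adj : V → V → Bool) (v : V) (v∈ : v ∈ verts Γ) where

  private
    R : ℕ → V → Bool
    R n = reachN Γ adj n v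

    R-suc : ∀ n {w} → R n w ≡ true → R (suc n) w ≡ true
    R-suc n e rewrite e = refl

    R-step : ∀ n {u w} → u ∈ verts Γ → R n u ≡ true → adj u w ≡ true → R (suc n) w ≡ true
    R-step n {u} {w} i e a = trans (cong (R n w ∨_) (any-complete (λ u → R n u ∧ adj u w) (verts Γ) i (cong₂ _∧_ e a))) (Data.Bool.Properties.∨-zeroʳ (R n w))

    R-mono : ∀ {k n} → k ℕ.≤′ n → ∀ {w} → R k w ≡ true → R n w ≡ true
    R-mono ℕ.≤′-refl e = e
    R-mono {k} {suc n} (ℕ.≤′-step le) e = R-suc n (R-mono {k} {n} le e)

    Closed : ℕ → Set
    Closed k = ∀ {w} → w ∈ verts Γ → R (suc k) w ≡ true → R k w ≡ true

    grow : ∀ n → n ℕ.< num (R n) (verts Γ) ⊎ (∃ λ k → k ℕ.≤ n × Closed k)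
    grow zero = inj₁ (start (verts Γ) v∈)
      where
      start : ∀ vs → v ∈ vs → 0 ℕ.< num (v ==V_) vs
      start (_ ∷ vs) (here refl) rewrite ==V-refl v = ℕ.s≤s ℕ.z≤n
      start (_ ∷ vs) (there i) = ℕₚ.≤-trans (start vs i) (ℕₚ.m≤n+m _ _)
    grow (suc n) with grow n
    ... | inj₂ (k , le , c) = inj₂ (k , ℕₚ.m≤n⇒m≤1+n le , c)
    ... | inj₁ lt with num-strict {p = R n} {R (suc n)} (verts Γ) (λ _ → R-suc n)
    ... | inj₁ lt' = inj₁ (ℕₚ.≤-<-trans lt lt')
    ... | inj₂ c = inj₂ (n , ℕₚ.n≤1+n n , c)

  path-reach : ∀ {w} → Path Γ adj v w → w ∈ verts Γ → reach Γ adj v w ≡ true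
  path-reach {w} p j with grow (length (verts Γ))
  ... | inj₁ lt = ⊥-elim (ℕₚ.<⇒≱ lt (num≤length _ (verts Γ)))
  ... | inj₂ (k , le , c) = R-mono {k} {length (verts Γ)} (ℕₚ.≤⇒≤′ le) (go p j)
    where
    go : ∀ {w} → Path Γ adj v w → w ∈ verts Γ → R k w ≡ true
    go here j = R-mono {0} {k} (ℕₚ.≤⇒≤′ (ℕ.z≤n {k})) (==V-refl v)
    go (step p i a) j = c j (R-step k i (go p i) a)

path-trans : ∀ {Γ adj u v w} → Path Γ adj u v → Path Γ adj v w → Path Γ adj u w
path-trans p here = p
path-trans p (step q i a) = step (path-trans p q) i a

path-sym : ∀ {Γ adj} → (∀ u w → adj u w ≡ true → adj w u ≡ true) → ∀ {u w} → w ∈ verts Γ → Path Γ adj u w → Path Γ adj w u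
path-sym s j here = here
path-sym s j (step {u} {w} p i a) = path-trans (step here j (s u w a)) (path-sym s i p)

module Firsts {A : Set} (R : A → A → Bool) (U : A → Set)
  (R-refl : ∀ {u} → U u → R u u ≡ true)
  (R-sym : ∀ {u v} → U u → U v → R u v ≡ true → R v u ≡ true)
  (R-trans : ∀ {u v w} → U u → U v → U w → R u v ≡ true → R v w ≡ true → R u w ≡ true) where

  firsts-∈ : ∀ P xs {r} → r ∈ firsts P R xs → r ∈ xs × P r ≡ true
  firsts-∈ P (x ∷ xs) {r} i = go (P x) refl (∈-++⁻ (if P x then x ∷ [] else []) i)
    where
    go : ∀ b → b ≡ P x → r ∈ (if P x then x ∷ [] else []) ⊎ r ∈ firsts (λ y → P y ∧ not (P x ∧ R x y)) R xs → r ∈ x ∷ xs × P r ≡ true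
    go b e (inj₂ j) = let (k , q) = firsts-∈ _ xs j in there k , proj₁ (∧-true {P r} q)
    go true e (inj₁ j) rewrite sym e with j
    ... | here refl = here refl , sym e
    go false e (inj₁ j) rewrite sym e with j
    ... | ()

  -- Once `x` is kept, the predicate passed on rejects its whole class, so by transitivity no later
  -- representative is related to `w` if `x` is.
  firsts-one : ∀ P xs → All U xs → ∀ {w} → w ∈ xs → P w ≡ true → num (λ r → R r w) (firsts P R xs) ≡ 1
  firsts-one P (x ∷ xs) (ux ∷ us) {w} i pw = trans (num-++ (λ r → R r w) (if P x then x ∷ [] else []) _) (go i (bool-case (P x)))
    where
    P' : A → Bool
    P' y = P y ∧ not (P x ∧ R x y)
    rest : ∀ {r} → P x ≡ true → r ∈ firsts P' R xs → U r × R x r ≡ false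
    rest {r} e j = let (k , q) = firsts-∈ P' xs j in All.lookup us k , not-true (trans (cong (λ b → not (b ∧ R x r)) (sym e)) (proj₂ (∧-true {P r} q)))
      where
      not-true : ∀ {b} → not b ≡ true → b ≡ false
      not-true {false} _ = refl
    none : P x ≡ true → U w → R x w ≡ true → num (λ r → R r w) (firsts P' R xs) ≡ 0
    none e uw xw = num-none (firsts P' R xs) λ {r} j → miss (rest e j) (bool-case (R r w))
      where
      miss : ∀ {r} → U r × R x r ≡ false → R r w ≡ true ⊎ R r w ≡ false → R r w ≡ false
      miss (ur , f) (inj₁ t) = ⊥-elim (true≢false (R-trans ux uw ur xw (R-sym ur uw t)) f)
      miss _ (inj₂ f) = f
    head : P x ≡ true → U w → ∀ b → R x w ≡ b → num (λ r → R r w) (if P x then x ∷ [] else []) ≡ (if b then 1 else 0)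
    head e uw b f rewrite e | f = ℕₚ.+-identityʳ _
    P'w : P x ≡ false ⊎ R x w ≡ false → P' w ≡ true
    P'w (inj₁ e) rewrite e | pw = refl
    P'w (inj₂ e) rewrite e | pw | ∧-zeroʳ (P x) = refl
    go : w ∈ x ∷ xs → P x ≡ true ⊎ P x ≡ false → num (λ r → R r w) (if P x then x ∷ [] else []) ℕ.+ num (λ r → R r w) (firsts P' R xs) ≡ 1
    go (here refl) (inj₁ e) = cong₂ ℕ._+_ (head e ux true (R-refl ux)) (none e ux (R-refl ux))
    go (here refl) (inj₂ e) = ⊥-elim (true≢false pw e)
    go (there j) (inj₂ e) = cong₂ ℕ._+_ (no-head e) (firsts-one P' xs us j (P'w (inj₁ e)))
      where
      no-head : P x ≡ false → num (λ r → R r w) (if P x then x ∷ [] else []) ≡ 0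
      no-head e rewrite e = refl
    go (there j) (inj₁ e) with bool-case (R x w)
    ... | inj₁ t = cong₂ ℕ._+_ (head e (All.lookup us j) true t) (none e (All.lookup us j) t)
    ... | inj₂ f = cong₂ ℕ._+_ (head e (All.lookup us j) false f) (firsts-one P' xs us j (P'w (inj₂ f)))

-- Products over representatives

ΠP : {A : Set} → (A → Poly) → List A → Poly
ΠP f [] = oneP
ΠP f (x ∷ xs) = f x ⊗ ΠP f xs

ΠP-foldr : {A : Set} (f : A → Poly) (xs : List A) → foldr mulP oneP (map f xs) ≋ ΠP f xs
ΠP-foldr f [] = ≋-refl
ΠP-foldr f (x ∷ xs) = ≋-trans (≋-reflexive (sym (⊗≡mulP (f x) _))) (⊗-cong ≋-refl (ΠP-foldr f xs))

ΠP-cong : {A : Set} {f g : A → Poly} (xs : List A) → (∀ {x} → x ∈ xs → f x ≋ g x) → ΠP f xs ≋ ΠP g xs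
ΠP-cong [] h = ≋-refl
ΠP-cong (x ∷ xs) h = ⊗-cong (h (here refl)) (ΠP-cong xs (h ∘ there))

ΠP-++ : {A : Set} (f : A → Poly) (xs ys : List A) → ΠP f (xs ++ ys) ≋ ΠP f xs ⊗ ΠP f ys
ΠP-++ f [] ys = ≋-sym (⊗-identityˡ _)
ΠP-++ f (x ∷ xs) ys = ≋-trans (⊗-cong ≋-refl (ΠP-++ f xs ys)) (≋-sym (⊗-assoc _ _ _))

ΠP-concatMap : {A B : Set} (g : B → Poly) (h : A → List B) (xs : List A) → ΠP (λ x → ΠP g (h x)) xs ≋ ΠP g (concatMap h xs)
ΠP-concatMap g h [] = ≋-refl
ΠP-concatMap g h (x ∷ xs) = ≋-trans (⊗-cong ≋-refl (ΠP-concatMap g h xs)) (≋-sym (ΠP-++ g (h x) _))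

ΠP-one : {A : Set} (xs : List A) → ΠP (λ _ → oneP) xs ≋ oneP
ΠP-one [] = ≋-refl
ΠP-one (x ∷ xs) = ≋-trans (⊗-identityˡ _) (ΠP-one xs)

ΠP-⊗ : {A : Set} (f g : A → Poly) (xs : List A) → ΠP (λ x → f x ⊗ g x) xs ≋ ΠP f xs ⊗ ΠP g xs
ΠP-⊗ f g [] = ≋-sym (⊗-identityˡ _)
ΠP-⊗ f g (x ∷ xs) = ≋-trans (⊗-cong ≋-refl (ΠP-⊗ f g xs)) (⊗-interchange _ _ _ _)

ΠP-swap : {A B : Set} (f : A → B → Poly) (xs : List A) (ys : List B) →
  ΠP (λ x → ΠP (f x) ys) xs ≋ ΠP (λ y → ΠP (λ x → f x y) xs) ys
ΠP-swap f [] ys = ≋-sym (ΠP-one ys)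
ΠP-swap f (x ∷ xs) ys = ≋-trans (⊗-cong ≋-refl (ΠP-swap f xs ys)) (≋-sym (ΠP-⊗ (f x) (λ y → ΠP (λ x → f x y) xs) ys))

ΠP-pick : {A : Set} (p : A → Bool) (k : Poly) (xs : List A) → num p xs ≡ 1 → ΠP (λ x → if p x then k else oneP) xs ≋ k
ΠP-pick p k (x ∷ xs) e with p x
... | true = ≋-trans (⊗-cong ≋-refl (none xs (ℕₚ.suc-injective e))) (⊗-identityʳ k)
  where
  none : ∀ xs → num p xs ≡ 0 → ΠP (λ x → if p x then k else oneP) xs ≋ oneP
  none [] e = ≋-refl
  none (x ∷ xs) e with p x
  ... | false = ≋-trans (⊗-identityˡ _) (none xs e)
... | false = ≋-trans (⊗-identityˡ _) (ΠP-pick p k xs e)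

-- Double counting: both products equal the one over matching pairs.
ΠP-representatives : {A : Set} (E : A → A → Bool) (g : A → Poly) (xs ys : List A) →
  (∀ {u w} → u ∈ xs → w ∈ ys → E u w ≡ E w u) →
  (∀ {u w} → E u w ≡ true → g u ≡ g w) →
  (∀ {u} → u ∈ xs → num (E u) ys ≡ 1) → (∀ {w} → w ∈ ys → num (E w) xs ≡ 1) → ΠP g xs ≋ ΠP g ys
ΠP-representatives E g xs ys E-sym E-g hx hy =
  ≋-trans (ΠP-cong xs λ {u} i → ≋-sym (ΠP-pick (E u) (g u) ys (hx i)))
  (≋-trans (ΠP-swap (λ u w → if E u w then g u else oneP) xs ys)
  (ΠP-cong ys λ {w} j → ≋-trans (ΠP-cong xs λ {u} i → ≋-reflexive (match u w (E-sym i j))) (ΠP-pick (E w) (g w) xs (hy j))))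
  where
  match : ∀ u w → E u w ≡ E w u → (if E u w then g u else oneP) ≡ (if E w u then g w else oneP)
  match u w e = go (E u w) (E w u) refl e
    where
    go : ∀ b c → b ≡ E u w → b ≡ c → (if b then g u else oneP) ≡ (if c then g w else oneP)
    go true _ q refl = E-g (sym q)
    go false _ q refl = refl

num-concatMap : {A B : Set} (q : B → Bool) (h : A → List B) (p : A → Bool) (xs : List A) →
  (∀ {x} → x ∈ xs → num q (h x) ≡ (if p x then 1 else 0)) → num q (concatMap h xs) ≡ num p xs
num-concatMap q h p [] e = refl
num-concatMap q h p (x ∷ xs) e = trans (num-++ q (h x) (concatMap h xs)) (cong₂ ℕ._+_ (e (here refl)) (num-concatMap q h p xs (e ∘ there)))

-- Face weights

∈-concatMap : {A B : Set} (h : A → List B) (xs : List A) {y : B} → y ∈ concatMap h xs → ∃ λ x → x ∈ xs × y ∈ h x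
∈-concatMap h (x ∷ xs) i with ∈-++⁻ (h x) i
... | inj₁ j = x , here refl , j
... | inj₂ j = let (x' , k , l) = ∈-concatMap h xs j in x' , there k , l

-- Inside the polyhedron, equal entries of one row belong to one component of Δ, so a row together
-- with a value stands for a component that meets this row.
sameClass : (V → ℤ) → V → V → Bool
sameClass x u w = (row u ==ℤ row w) ∧ (x u ==ℤ x w)

module Lasts (x : V → ℤ) where

  -- The vertices at which `wtGo` charges its factors.
  lasts : List V → List V
  lasts [] = []
  lasts (v ∷ vs) = if elem (x v) (map x vs) then lasts vs else v ∷ lasts vs

  lasts-∈ : ∀ vs {w} → w ∈ lasts vs → w ∈ vs
  lasts-∈ (v ∷ vs) i with elem (x v) (map x vs)
  ... | true = there (lasts-∈ vs i)
  lasts-∈ (v ∷ vs) (here e) | false = here e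
  lasts-∈ (v ∷ vs) (there i) | false = there (lasts-∈ vs i)

  num-lasts : ∀ c vs → num (λ r → c ==ℤ x r) (lasts vs) ≡ (if elem c (map x vs) then 1 else 0)
  num-lasts c [] = refl
  num-lasts c (v ∷ vs) = go (elem (x v) (map x vs)) refl (c ℤ.≟ x v)
    where
    go : ∀ b → elem (x v) (map x vs) ≡ b → Dec (c ≡ x v) →
      num (λ r → c ==ℤ x r) (if b then lasts vs else v ∷ lasts vs) ≡ (if (c ==ℤ x v) ∨ elem c (map x vs) then 1 else 0)
    go true e (yes refl) rewrite ==ℤ-refl (x v) = trans (num-lasts (x v) vs) (cong (if_then 1 else 0) e)
    go true e (no ne) rewrite ==ℤ-false ne = num-lasts c vs
    go false e (yes refl) rewrite ==ℤ-refl (x v) = cong suc (trans (num-lasts (x v) vs) (cong (if_then 1 else 0) e))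
    go false e (no ne) rewrite ==ℤ-false ne = num-lasts c vs

  lasts-one : ∀ vs {w} → w ∈ vs → num (λ r → x w ==ℤ x r) (lasts vs) ≡ 1
  lasts-one vs {w} i = trans (num-lasts (x w) vs)
    (cong (if_then 1 else 0) (any-complete (x w ==ℤ_) (map x vs) (∈-map⁺ x i) (==ℤ-refl (x w))))

  wtGo-lasts : ∀ L M vs → wtGo L M (map x vs) ≋ ΠP (λ w → fac (cnt (x w) L) (cnt (x w) M)) (lasts vs)
  wtGo-lasts L M [] = ≋-refl
  wtGo-lasts L M (v ∷ vs) with elem (x v) (map x vs)
  ... | true = ≋-trans (⊗-identityˡ _) (wtGo-lasts L M vs)
  ... | false = ⊗-cong ≋-refl (wtGo-lasts L M vs)

-- A component of Δ has a single value. If it meets a row, it contains all vertices with this value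
-- in that row and in the row above. So the factors of the face weight are indexed by pairs of a row
-- and a value, and the sizes compared in them are multiplicities of values in two consecutive rows.
module Weight (Γ : Subgraph) (a : ℤ) (ord : Ordinary Γ a) (m : Mono) (ineqs : Ineqs (expo m) (verts Γ)) where
  open OrdinaryGraph Γ a ord
  open Word Γ a ord

  x : V → ℤ
  x = expo m

  open Lasts x

  adjΔ : V → V → Bool
  adjΔ u w = edgeℛ u w ∧ (x u ==ℤ x w)

  rΔ : V → V → Bool
  rΔ = reach Γ adjΔ

  PathΔ : V → V → Set
  PathΔ = Path Γ adjΔ

  adj-sym : ∀ u w → adjΔ u w ≡ true → adjΔ w u ≡ true
  adj-sym u w e = let (p , q) = ∧-true {edgeℛ u w} e in
    cong₂ _∧_ (trans (Data.Bool.Properties.∨-comm (upperEdge w u) (upperEdge u w)) p) (==ℤ-complete (sym (==ℤ-sound {x u} {x w} q)))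

  path-x : ∀ {u w} → PathΔ u w → x u ≡ x w
  path-x here = refl
  path-x (step {u} {w} p i e) = trans (path-x p) (==ℤ-sound (proj₂ (∧-true {edgeℛ u w} e)))

  rΔ-path : ∀ {u w} → rΔ u w ≡ true → PathΔ u w
  rΔ-path {u} {w} = reachN-path Γ adjΔ (length (verts Γ)) u w

  path-rΔ : ∀ {u w} → u ∈ verts Γ → w ∈ verts Γ → PathΔ u w → rΔ u w ≡ true
  path-rΔ {u} i j p = Saturation.path-reach Γ adjΔ u i p j

  flip : ∀ {u w} → w ∈ verts Γ → PathΔ u w → PathΔ w u
  flip = path-sym adj-sym

  edge : ∀ {u w} → u ∈ verts Γ → Dn u w → x u ≡ x w → PathΔ u w
  edge {u} {w} i d e = step here i (cong₂ _∧_ (edge-down u w d) (==ℤ-complete e))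

  private
    +1≤ : ∀ i d → i ℤ.+ + 1 ℤ.≤ i ℤ.+ + suc d
    +1≤ i d = ℤₚ.+-monoʳ-≤ i (ℤ.+≤+ (ℕ.s≤s ℕ.z≤n))
    sucd : ∀ c d → c ℤ.+ (+ 1 ℤ.+ d) ≡ c ℤ.+ + 1 ℤ.+ d
    sucd = solve-∀

  module Along {i c d} (p : (i , c) ∈ verts Γ) (q : (i , c ℤ.+ + suc d) ∈ verts Γ) where
    next : (i , c ℤ.+ + 1) ∈ verts Γ
    next = convex p q refl (c ℤ.+ + 1) (ℤₚ.<⇒≤ (i<i+1 c)) (+1≤ c d)
    dip : (i ℤ.+ + 1 , c) ∈ verts Γ
    dip = down-closed i c p next
    down≤ : x (i ℤ.+ + 1 , c) ℤ.≤ x (i , c)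
    down≤ = Between.left (ineqs i) c p dip
    up≤ : x (i , c ℤ.+ + 1) ℤ.≤ x (i ℤ.+ + 1 , c)
    up≤ = Between.right (ineqs i) c dip next
    q' : (i , c ℤ.+ + 1 ℤ.+ + d) ∈ verts Γ
    q' = subst (λ z → (i , z) ∈ verts Γ) (sucd c (+ d)) q

  row-antitone : ∀ d {i c} → (i , c) ∈ verts Γ → (i , c ℤ.+ + d) ∈ verts Γ → x (i , c ℤ.+ + d) ℤ.≤ x (i , c)
  row-antitone zero {i} {c} p q = ℤₚ.≤-reflexive (cong (λ z → x (i , z)) (ℤₚ.+-identityʳ c))
  row-antitone (suc d) {i} {c} p q = subst (λ z → x (i , z) ℤ.≤ x (i , c)) (sym (sucd c (+ d)))
    (ℤₚ.≤-trans (row-antitone d next q') (ℤₚ.≤-trans up≤ down≤))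
    where open Along p q

  -- Since entries decrease along the row, equal end values make all entries in between equal;
  -- neighbours are then linked through the vertex below both, whose entry is squeezed between
  -- theirs.
  row-path : ∀ d {i c} → (i , c) ∈ verts Γ → (i , c ℤ.+ + d) ∈ verts Γ → x (i , c) ≡ x (i , c ℤ.+ + d) → PathΔ (i , c) (i , c ℤ.+ + d)
  row-path zero {i} {c} p q e = subst (λ z → PathΔ (i , c) (i , z)) (sym (ℤₚ.+-identityʳ c)) here
  row-path (suc d) {i} {c} p q e = subst (λ z → PathΔ (i , c) (i , z)) (sym (sucd c (+ d)))
    (path-trans (edge p (dn refl (inj₁ refl)) (sym e₁)) (path-trans (flip dip (edge next (dn refl (inj₂ refl)) e₂))
      (row-path d next q' (trans e₂ (trans e₁ e')))))
    where
    open Along p q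
    e' : x (i , c) ≡ x (i , c ℤ.+ + 1 ℤ.+ + d)
    e' = trans e (cong (λ z → x (i , z)) (sucd c (+ d)))
    last≤ : x (i , c) ℤ.≤ x (i , c ℤ.+ + 1)
    last≤ = ℤₚ.≤-trans (ℤₚ.≤-reflexive e') (row-antitone d next q')
    e₁ : x (i ℤ.+ + 1 , c) ≡ x (i , c)
    e₁ = ℤₚ.≤-antisym down≤ (ℤₚ.≤-trans last≤ up≤)
    e₂ : x (i , c ℤ.+ + 1) ≡ x (i ℤ.+ + 1 , c)
    e₂ = ℤₚ.≤-antisym up≤ (ℤₚ.≤-trans down≤ last≤)

  private
    distance : ∀ {c c'} → c ℤ.≤ c' → ∃ λ d → c' ≡ c ℤ.+ + d
    distance {c} {c'} le = ℤ.∣ c' ℤ.- c ∣ , trans (lem c c') (cong (λ z → c ℤ.+ z) (sym (ℤₚ.0≤i⇒+∣i∣≡i (ℤₚ.i≤j⇒0≤j-i le))))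
      where
      lem : ∀ c c' → c' ≡ c ℤ.+ (c' ℤ.- c)
      lem = solve-∀

  antitone : ∀ {i c c'} → (i , c) ∈ verts Γ → (i , c') ∈ verts Γ → c ℤ.≤ c' → x (i , c') ℤ.≤ x (i , c)
  antitone p q le with distance le
  ... | d , refl = row-antitone d p q

  level : ∀ {i c c'} → (i , c) ∈ verts Γ → (i , c') ∈ verts Γ → x (i , c) ≡ x (i , c') → PathΔ (i , c) (i , c')
  level {i} {c} {c'} p q e with ℤₚ.≤-total c c'
  ... | inj₁ le with distance le
  ...   | d , refl = row-path d p q e
  level {i} {c} {c'} p q e | inj₂ le with distance le
  ...   | d , refl = flip p (row-path d q p (sym e))

  same-row : ∀ {u w} → u ∈ verts Γ → w ∈ verts Γ → row u ≡ row w → x u ≡ x w → PathΔ u w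
  same-row p q refl e = level p q e

  -- The upper neighbour of the lower vertex on the side facing `(i , c)` is in Γ, by `upper` and
  -- convexity. Its entry is squeezed between the two equal ones, and the rest of the path runs
  -- along row `i`.
  next-row : ∀ {i c k c'} → k ≡ i ℤ.+ + 1 → (i , c) ∈ verts Γ → (k , c') ∈ verts Γ → x (i , c) ≡ x (k , c') → PathΔ (i , c) (k , c')
  next-row {i} {c} {_} {c'} refl p q e = go (upper q (ℤₚ.≤-<-trans (a≤ p) (i<i+1 i)))
    where
    cancel : ∀ {j} → i ℤ.+ + 1 ≡ j ℤ.+ + 1 → j ≡ i
    cancel {j} h = trans (l₁ j) (trans (cong (ℤ._- + 1) (sym h)) (sym (l₁ i)))
      where
      l₁ : ∀ j → j ≡ j ℤ.+ + 1 ℤ.- + 1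
      l₁ = solve-∀
    via-left : (i , c') ∈ verts Γ → c ℤ.≤ c' → PathΔ (i , c) (i ℤ.+ + 1 , c')
    via-left r le = path-trans (level p r s) (edge r (dn refl (inj₁ refl)) (trans (sym s) e))
      where
      s : x (i , c) ≡ x (i , c')
      s = ℤₚ.≤-antisym (ℤₚ.≤-trans (ℤₚ.≤-reflexive e) (Between.left (ineqs i) c' r q)) (antitone p r le)
    via-right : (i , c' ℤ.+ + 1) ∈ verts Γ → c' ℤ.+ + 1 ℤ.≤ c → PathΔ (i , c) (i ℤ.+ + 1 , c')
    via-right r le = path-trans (level p r s) (edge r (dn refl (inj₂ refl)) (trans (sym s) e))
      where
      s : x (i , c) ≡ x (i , c' ℤ.+ + 1)
      s = ℤₚ.≤-antisym (antitone r p le) (ℤₚ.≤-trans (Between.right (ineqs i) c' q r) (ℤₚ.≤-reflexive (sym e)))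
    go : (∃ λ v → v ∈ verts Γ × Dn v (i ℤ.+ + 1 , c')) → PathΔ (i , c) (i ℤ.+ + 1 , c')
    go ((j , b) , r , dn h s) with cancel {j} h
    ... | refl with c ℤ.≤? c' | s
    ...   | yes le | inj₁ refl = via-left r le
    ...   | yes le | inj₂ refl = via-left (convex p r refl c' le (ℤₚ.<⇒≤ (i<i+1 c'))) le
    ...   | no gt | inj₁ refl = via-right (convex r p refl (c' ℤ.+ + 1) (ℤₚ.<⇒≤ (i<i+1 c')) (<⇒+1≤ (ℤₚ.≰⇒> gt))) (<⇒+1≤ (ℤₚ.≰⇒> gt))
    ...   | no gt | inj₂ refl = via-right r (<⇒+1≤ (ℤₚ.≰⇒> gt))

  compReps : List V
  compReps = firsts (λ _ → true) rΔ (verts Γ)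

  rowReps : V → List V
  rowReps v = firsts (λ w → rΔ v w ∧ (a <ᵇℤ row w)) (λ u w → row u ==ℤ row w) (verts Γ)

  number : ℤ → ℤ → ℕ
  number i z = num (λ w → (row w ==ℤ i) ∧ (z ==ℤ x w)) (verts Γ)

  classFactor : V → Poly
  classFactor w = fac (number (row w ℤ.- + 1) (x w)) (number (row w) (x w))

  private
    module C = Firsts rΔ (_∈ verts Γ) (λ i → path-rΔ i i here) (λ i j e → path-rΔ j i (flip j (rΔ-path e)))
      (λ i j k e f → path-rΔ i k (path-trans (rΔ-path e) (rΔ-path f)))
    module Rw = Firsts (λ u w → row u ==ℤ row w) (λ _ → Data.Unit.⊤) (λ {u} _ → ==ℤ-refl (row u))
      (λ {u} {v} _ _ e → ==ℤ-complete (sym (==ℤ-sound {row u} {row v} e)))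
      (λ {u} {v} {w} _ _ _ e f → ==ℤ-complete (trans (==ℤ-sound {row u} {row v} e) (==ℤ-sound {row v} {row w} f)))

    self : ∀ {A : Set} (xs : List A) → All (_∈ xs) xs
    self xs = All.tabulate λ i → i

    trivial : ∀ {A : Set} (xs : List A) → All (λ _ → Data.Unit.⊤) xs
    trivial xs = All.tabulate λ _ → _

  <ᵇ-sound : ∀ {i j} → (i <ᵇℤ j) ≡ true → i ℤ.< j
  <ᵇ-sound {i} {j} e = let (p , q) = ∧-true {i ≤ᵇ j} e in ℤₚ.≤∧≢⇒< (≤ᵇ-sound {i} {j} p) λ { refl → contra q }
    where
    contra : ∀ {i} → not (i ==ℤ i) ≡ true → ⊥
    contra {i} q rewrite ==ℤ-refl i with q
    ... | ()

  <ᵇ-complete : ∀ {i j} → i ℤ.< j → (i <ᵇℤ j) ≡ true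
  <ᵇ-complete {i} {j} lt = cong₂ (λ b c → b ∧ not c) (≤ᵇ-true (ℤₚ.<⇒≤ lt)) (==ℤ-false λ e → ℤₚ.<-irrefl e lt)

  compReps-∈ : ∀ {v} → v ∈ compReps → v ∈ verts Γ
  compReps-∈ i = proj₁ (C.firsts-∈ (λ _ → true) (verts Γ) i)

  rowReps-∈ : ∀ v {w} → w ∈ rowReps v → w ∈ verts Γ × rΔ v w ≡ true × a ℤ.< row w
  rowReps-∈ v {w} i = let (j , e) = Rw.firsts-∈ (λ w → rΔ v w ∧ (a <ᵇℤ row w)) (verts Γ) i
                          (p , q) = ∧-true {rΔ v w} e in j , p , <ᵇ-sound {a} {row w} q

  -- Replaces the size of a component in a row by the multiplicity of a value. It is valid in the
  -- row of `w` and in the row above it, the two rows that a factor compares.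
  count-row : ∀ {v w} → v ∈ verts Γ → w ∈ verts Γ → rΔ v w ≡ true → ∀ i → i ≡ row w ⊎ i ≡ row w ℤ.- + 1 →
    length (filterᵇ (λ u → rΔ v u ∧ (row u ==ℤ i)) (verts Γ)) ≡ number i (x w)
  count-row {v} {w} iv iw e i h = trans (length-filterᵇ _ (verts Γ)) (num-cong (verts Γ) λ {u} iu → bool-ext
    (λ t → let (p , q) = ∧-true {rΔ v u} t in cong₂ _∧_ q (==ℤ-complete (trans (sym (path-x (rΔ-path e))) (path-x (rΔ-path p)))))
    (λ t → let (p , q) = ∧-true {row u ==ℤ i} t in
       cong₂ _∧_ (path-rΔ iv iu (path-trans (rΔ-path e) (reachable iu (==ℤ-sound p) (==ℤ-sound q) h))) p))
    where
    lem : ∀ r → r ≡ r ℤ.- + 1 ℤ.+ + 1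
    lem = solve-∀
    reachable : ∀ {u} → u ∈ verts Γ → row u ≡ i → x w ≡ x u → i ≡ row w ⊎ i ≡ row w ℤ.- + 1 → PathΔ w u
    reachable iu r s (inj₁ refl) = same-row iw iu (sym r) s
    reachable iu r s (inj₂ refl) = flip iw (next-row (trans (lem (row w)) (cong (ℤ._+ + 1) (sym r))) iu iw (sym s))

  weight≋reps : weight Γ a m ≋ ΠP classFactor (concatMap rowReps compReps)
  weight≋reps = ≋-trans (ΠP-foldr _ compReps) (≋-trans (ΠP-cong compReps λ {v} i → inner v (compReps-∈ i)) (ΠP-concatMap classFactor rowReps compReps))
    where
    inner : ∀ v → v ∈ verts Γ → foldr mulP oneP (map (λ w → fac (length (filterᵇ (λ u → rΔ v u ∧ (row u ==ℤ (row w ℤ.- + 1))) (verts Γ)))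
        (length (filterᵇ (λ u → rΔ v u ∧ (row u ==ℤ row w)) (verts Γ)))) (rowReps v)) ≋ ΠP classFactor (rowReps v)
    inner v iv = ≋-trans (ΠP-foldr _ (rowReps v)) (ΠP-cong (rowReps v) λ {w} j → let (iw , e , _) = rowReps-∈ v j in
      ≋-reflexive (cong₂ fac (count-row iv iw e (row w ℤ.- + 1) (inj₂ refl)) (count-row iv iw e (row w) (inj₁ refl))))

  reps-∈ : ∀ {w} → w ∈ concatMap rowReps compReps → w ∈ verts Γ × a ℤ.< row w
  reps-∈ i = let (v , _ , j) = ∈-concatMap rowReps compReps i
                 (k , _ , l) = rowReps-∈ v j in k , l

  reps-one : ∀ {w} → w ∈ verts Γ → a ℤ.< row w → num (sameClass x w) (concatMap rowReps compReps) ≡ 1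
  reps-one {w} iw lt = trans (num-concatMap (sameClass x w) rowReps (λ v → rΔ v w) compReps λ {v} i → per v (compReps-∈ i) (bool-case (rΔ v w)))
    (C.firsts-one (λ _ → true) (verts Γ) (self (verts Γ)) iw refl)
    where
    per : ∀ v → v ∈ verts Γ → rΔ v w ≡ true ⊎ rΔ v w ≡ false → num (sameClass x w) (rowReps v) ≡ (if rΔ v w then 1 else 0)
    per v iv (inj₁ t) = trans (num-cong (rowReps v) λ {r} j → class r (proj₁ (proj₂ (rowReps-∈ v j))))
      (trans (Rw.firsts-one _ (verts Γ) (trivial (verts Γ)) iw (cong₂ _∧_ t (<ᵇ-complete lt))) (cong (if_then 1 else 0) (sym t)))
      where
      class : ∀ r → rΔ v r ≡ true → sameClass x w r ≡ (row r ==ℤ row w)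
      class r e = bool-ext
        (λ s → ==ℤ-complete (sym (==ℤ-sound (proj₁ (∧-true {row w ==ℤ row r} s)))))
        (λ s → cong₂ _∧_ (==ℤ-complete (sym (==ℤ-sound {row r} {row w} s))) (==ℤ-complete (trans (sym (path-x (rΔ-path t))) (path-x (rΔ-path e)))))
    per v iv (inj₂ f) = trans (num-none (rowReps v) λ {r} j → miss r (rowReps-∈ v j) (bool-case (sameClass x w r))) (cong (if_then 1 else 0) (sym f))
      where
      miss : ∀ r → r ∈ verts Γ × rΔ v r ≡ true × a ℤ.< row r → sameClass x w r ≡ true ⊎ sameClass x w r ≡ false → sameClass x w r ≡ false
      miss r _ (inj₂ q) = q
      miss r (ir , e , _) (inj₁ s) = let (p , q) = ∧-true {row w ==ℤ row r} s in
        ⊥-elim (true≢false (path-rΔ iv iw (path-trans (rΔ-path e) (same-row ir iw (sym (==ℤ-sound p)) (sym (==ℤ-sound q))))) f)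

  number-row : ∀ {i l n} → RowIs i l n → ∀ z → number i z ≡ cnt z (vals m (rowV i l n))
  number-row {i} {l} {n} h z = trans (num-filter (verts Γ))
    (trans (sym (length-filterᵇ (λ w → z ==ℤ x w) rows)) (trans (↭-length (filter-↭ _ rows↭)) (sym (cnt-map (rowV i l n)))))
    where
    rows = filter (λ v → row v ℤ.≟ i) (verts Γ)
    num-filter : ∀ vs → num (λ w → (row w ==ℤ i) ∧ (z ==ℤ x w)) vs ≡ num (λ w → z ==ℤ x w) (filter (λ v → row v ℤ.≟ i) vs)
    num-filter [] = refl
    num-filter (v ∷ vs) with row v ℤ.≟ i
    ... | yes _ = cong (_ ℕ.+_) (num-filter vs)
    ... | no _ = num-filter vs
    cnt-map : ∀ vs → cnt z (map x vs) ≡ length (filterᵇ (λ w → z ==ℤ x w) vs)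
    cnt-map [] = refl
    cnt-map (v ∷ vs) with z ==ℤ x v
    ... | true = cong suc (cnt-map vs)
    ... | false = cnt-map vs
    rows↭ : rows ↭ rowV i l n
    rows↭ = unique-↭ (Uniqueₚ.filter⁺ (λ v → row v ℤ.≟ i) (unique Γ)) (rowV-unique i l n)
      (λ {v} j → let (k , e) = ∈-filter⁻ (λ v → row v ℤ.≟ i) j in proj₁ (h v e) k)
      (λ {v} j → let e = All.lookup (rowV-row i l n) j in ∈-filter⁺ (λ v → row v ℤ.≟ i) (proj₂ (h v e) j) e)

  lastReps : ℤ → ℤ → ℕ → List Move → List V
  lastReps i l n [] = []
  lastReps i l n (s ∷ w) = lasts (rowV (i ℤ.+ + 1) (nextL s l) (nextN s n)) ++ lastReps (i ℤ.+ + 1) (nextL s l) (nextN s n) w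

  lastReps-∈ : ∀ i l n w {v} → v ∈ lastReps i l n w → v ∈ below i l n w
  lastReps-∈ i l n (s ∷ w) h with ∈-++⁻ (lasts (rowV (i ℤ.+ + 1) (nextL s l) (nextN s n))) h
  ... | inj₁ j = ∈-++⁺ˡ (lasts-∈ (rowV (i ℤ.+ + 1) (nextL s l) (nextN s n)) j)
  ... | inj₂ j = ∈-++⁺ʳ (rowV (i ℤ.+ + 1) (nextL s l) (nextN s n)) (lastReps-∈ (i ℤ.+ + 1) (nextL s l) (nextN s n) w j)

  lastReps-one : ∀ i l n w {v} → v ∈ below i l n w → num (sameClass x v) (lastReps i l n w) ≡ 1
  lastReps-one i l n (s ∷ w) {v} h = trans (num-++ (sameClass x v) (lasts R) (lastReps k l' n' w)) (go (∈-++⁻ R h))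
    where
    k = i ℤ.+ + 1
    l' = nextL s l
    n' = nextN s n
    R = rowV k l' n'
    inR : ∀ {r} → r ∈ lasts R → row r ≡ k
    inR j = All.lookup (rowV-row k l' n') (lasts-∈ R j)
    inB : ∀ {r} → r ∈ lastReps k l' n' w → k ℤ.< row r
    inB j = All.lookup (below-row k l' n' w) (lastReps-∈ k l' n' w j)
    off : ∀ {r} → row v ≢ row r → sameClass x v r ≡ false
    off ne rewrite ==ℤ-false ne = refl
    go : v ∈ R ⊎ v ∈ below k l' n' w → num (sameClass x v) (lasts R) ℕ.+ num (sameClass x v) (lastReps k l' n' w) ≡ 1
    go (inj₁ j) = cong₂ ℕ._+_
      (trans (num-cong (lasts R) λ {r} q → cong (_∧ (x v ==ℤ x r)) (==ℤ-complete (trans rv (sym (inR q))))) (lasts-one R j))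
      (num-none (lastReps k l' n' w) λ q → off λ e → ℤₚ.<-irrefl (trans (sym rv) e) (inB q))
      where
      rv : row v ≡ k
      rv = All.lookup (rowV-row k l' n') j
    go (inj₂ j) = cong₂ ℕ._+_
      (num-none (lasts R) λ q → off λ e → ℤₚ.<-irrefl (sym (trans e (inR q))) (All.lookup (below-row k l' n' w) j))
      (lastReps-one k l' n' w j)

  Covers : ℤ → ℤ → ℕ → List Move → Set
  Covers i l n w = ∀ v → i ℤ.< row v → (v ∈ verts Γ → v ∈ below i l n w) × (v ∈ below i l n w → v ∈ verts Γ)

  wts≋reps : ∀ i l n w → RowIs i l n → Covers i l n w → wts i l n w m ≋ ΠP classFactor (lastReps i l n w)
  wts≋reps i l n [] r c = ≋-refl
  wts≋reps i l n (s ∷ w) r c = ≋-trans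
    (⊗-cong (≋-trans (wtGo-lasts (vals m (rowV i l n)) (vals m R) R)
                     (ΠP-cong (lasts R) λ {v} j → ≋-reflexive (sym (factor v (All.lookup (rowV-row k l' n') (lasts-∈ R j))))))
            (wts≋reps k l' n' w r' c'))
    (≋-sym (ΠP-++ classFactor (lasts R) (lastReps k l' n' w)))
    where
    k = i ℤ.+ + 1
    l' = nextL s l
    n' = nextN s n
    R = rowV k l' n'
    lem : ∀ i → i ℤ.+ + 1 ℤ.- + 1 ≡ i
    lem = solve-∀
    r' : RowIs k l' n'
    r' v e = (λ j → inR (∈-++⁻ R (proj₁ (c v lt) j))) , λ j → proj₂ (c v lt) (∈-++⁺ˡ j)
      where
      lt : i ℤ.< row v
      lt = subst (i ℤ.<_) (sym e) (i<i+1 i)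
      inR : v ∈ R ⊎ v ∈ below k l' n' w → v ∈ R
      inR (inj₁ j) = j
      inR (inj₂ j) = ⊥-elim (ℤₚ.<-irrefl (sym e) (All.lookup (below-row k l' n' w) j))
    c' : Covers k l' n' w
    c' v lt = (λ j → inB (∈-++⁻ R (proj₁ (c v lt') j))) , λ j → proj₂ (c v lt') (∈-++⁺ʳ R j)
      where
      lt' : i ℤ.< row v
      lt' = ℤₚ.<-trans (i<i+1 i) lt
      inB : v ∈ R ⊎ v ∈ below k l' n' w → v ∈ below k l' n' w
      inB (inj₂ j) = j
      inB (inj₁ j) = ⊥-elim (ℤₚ.<-irrefl (sym (All.lookup (rowV-row k l' n') j)) lt)
    factor : ∀ v → row v ≡ k → classFactor v ≡ fac (cnt (x v) (vals m (rowV i l n))) (cnt (x v) (vals m R))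
    factor v e = cong₂ fac
      (trans (cong (λ z → number z (x v)) (trans (cong (ℤ._- + 1) e) (lem i))) (number-row r (x v)))
      (trans (cong (λ z → number z (x v)) e) (number-row r' (x v)))

  -- Both sides are products of `classFactor` over lists that contain exactly one member of every
  -- class below the top row; only the chosen members differ.
  weight≋wts : weight Γ a m ≋ wts a l₀ n₀ word m
  weight≋wts = ≋-trans weight≋reps (≋-trans
    (ΠP-representatives (sameClass x) classFactor (concatMap rowReps compReps) (lastReps a l₀ n₀ word)
      (λ {u} {w} _ _ → cong₂ _∧_ (==-sym (row u) (row w)) (==-sym (x u) (x w)))
      (λ {u} {w} e → let (p , q) = ∧-true {row u ==ℤ row w} e in
        cong₂ (λ r z → fac (number (r ℤ.- + 1) z) (number r z)) (==ℤ-sound p) (==ℤ-sound q))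
      (λ {u} i → let (j , lt) = reps-∈ i in lastReps-one a l₀ n₀ word (proj₁ (covers u lt) j))
      (λ {w} i → let j = lastReps-∈ a l₀ n₀ word i
                     lt = All.lookup (below-row a l₀ n₀ word) j in reps-one (proj₂ (covers w lt) j) lt))
    (≋-sym (wts≋reps a l₀ n₀ word top-is covers)))
    where
    ==-sym : ∀ y z → (y ==ℤ z) ≡ (z ==ℤ y)
    ==-sym y z = bool-ext (λ e → ==ℤ-complete (sym (==ℤ-sound {y} {z} e))) (λ e → ==ℤ-complete (sym (==ℤ-sound {z} {y} e)))

-- From null functions to rational functions

module Quotient (Γ : Subgraph) (a : ℤ) (bs : List ℤ) where

  private
    f : Mono → Poly
    f = Scoeff Γ a bs

  QScoeff≋ : ∀ Q m → QScoeff Γ a bs Q m ≋ mulF Q f m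
  QScoeff≋ [] m = ≋-refl
  QScoeff≋ ((c , μ) ∷ Q) m = ≋-trans
    (addP-cong (≋-reflexive (sym (⊗≡mulP c (f (m -ᴹ μ))))) (QScoeff≋ Q m))
    (≋-reflexive (sym (⊕≡addP _ _)))

  mulF-++ : ∀ A B h m → mulF (A ++ B) h m ≋ mulF A h m ⊕ mulF B h m
  mulF-++ [] B h m = ≋-sym (⊕-identityˡ _)
  mulF-++ ((c , μ) ∷ A) B h m = ≋-trans (⊕-cong ≋-refl (mulF-++ A B h m)) (≋-sym (⊕-assoc _ _ _))

  opaque
    unfolding _⊕_
    ⊖-⊗ : ∀ c p q → (⊖ c) ⊗ p ⊕ ⊖ q ≋ ⊖ (c ⊗ p ⊕ q)
    ⊖-⊗ = RingSolver.solve-∀ polyACR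

  mulF-neg-shift : ∀ w A {h} → Resp h → ∀ m → mulF (negL (shiftL w A)) h m ≋ ⊖ mulF A h (m -ᴹ w)
  mulF-neg-shift w [] r m = ≋-sym ⊖-zero
  mulF-neg-shift w ((c , μ) ∷ A) r m = ≋-trans
    (⊕-cong (⊗-cong ≋-refl (r (minus-++ m w μ))) (mulF-neg-shift w A r m)) (⊖-⊗ c _ _)

  unitL : LPoly
  unitL = (oneP , []) ∷ []

  mulF-unit : ∀ ws {h} → Resp h → ∀ m → mulF (actsL ws unitL) h m ≋ acts ws h m
  mulF-unit [] r m = ≋-trans (⊕-identityʳ _) (≋-trans (⊗-identityˡ _) (r (minus-[] m)))
  mulF-unit (w ∷ ws) r m = ≋-trans (mulF-++ (actsL ws unitL) (negL (shiftL w (actsL ws unitL))) _ m)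
    (⊕-cong (mulF-unit ws r m) (≋-trans (mulF-neg-shift w (actsL ws unitL) r m) (⊖-cong (mulF-unit ws r (m -ᴹ w)))))

  private
    nzmap : ∀ vs → All NZ vs → All X.Nonzero (map Fh vs)
    nzmap [] [] = []
    nzmap (v ∷ vs) (p ∷ ps) = p ∷ nzmap vs ps

  -- The product `Q₀` of the tame factors is one admissible denominator, with numerator `R₀`. For
  -- any other pair, `Q₀ R = Q R₀`, both being `Q₀ Q` times the series. Under `F` the right side
  -- vanishes and the factors of `Q₀` can be cancelled, which leaves `F R = 0`.
  vanishes : Resp f → Null f → PsiVanishes Γ a bs
  vanishes rf N =
    (Q₀ , R₀ , (λ m → at (≋-trans (QScoeff≋ Q₀ m) (≋-trans (mulF-unit ws rf m) (≋-sym (sum-eq m))))) , Q₀-nonzero) ,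
    λ Q R e _ n → at (≋-trans (coeff-F R n) (R-zero Q R e n))
    where
    open Tame (Null.tame N) renaming (eq to sum-eq)
    Q₀ = actsL ws unitL
    R₀ = sum
    Q₀-nonzero : ¬ XIsZero (F Q₀)
    Q₀-nonzero z = one≢0 (at (≋-trans (≋-sym (≋-trans (X.coeff-hit oneP [] [] [] X.≈-refl) (⊕-identityʳ oneP)))
      (X.acts-injective (map Fh ws) (FL unitL) (nzmap ws nz)
        (λ n → ≋-trans (≋-sym (HF.coeff-mapL-actsL φF ws unitL n)) (≋-trans (≋-sym (coeff-F Q₀ n)) (mk≋ (z n)))) [])) 0)
      where
      one≢0 : + 1 ≡ + 0 → ⊥
      one≢0 ()
    R-zero : ∀ Q R → IsProductQS Γ a bs Q R → ZeroX (FL R)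
    R-zero Q R e = X.acts-injective (map Fh ws) (FL R) (nzmap ws nz) λ n →
      ≋-trans (≋-sym (HF.coeff-mapL-actsL φF ws R n))
      (≋-trans (HF.push-eq Fh (HF.hom-cong φF) (actsL ws R) (mulL Q R₀) n (λ m _ → same m))
      (≋-trans (HF.coeff-mapL-mulL φF Q R₀ n) (X.mulF-zero (HF.mapL Fh Q) (Null.vanishes N) n)))
      where
      same : ∀ m → coeffL (actsL ws R) m ≋ coeffL (mulL Q R₀) m
      same m = ≋-trans (coeff-actsL ws R m)
        (≋-trans (acts-cong ws (λ m → ≋-trans (≋-sym (mk≋ (e m))) (QScoeff≋ Q m)) m)
        (≋-trans (mulF-acts Q ws rf m) (≋-sym (≋-trans (coeff-mulL Q R₀ m) (mulF-cong Q sum-eq m)))))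

module _ (a : ℤ) (l : ℤ) (n : ℕ) (ts : Tops) (tops : ∀ {t} → t ∈ ts → proj₁ t ∈ rowV a l n) where
  open Shape a l n ts tops using (S)

  S-resp : ∀ w → Resp (S w)
  S-resp w {m} {m'} e = ⊗-cong
    (≋-reflexive (cong chi (bool-ext
      (λ q → offZ-complete _ m' λ v r → trans (sym (on e v)) (offZ-sound _ m q v r))
      (λ q → offZ-complete _ m λ v r → trans (on e v) (offZ-sound _ m' q v r)))))
    (⊗-cong (≋-reflexive (cong chi (topOK-ord ts m m' λ {v} {b} _ → cong (b ==ℤ_) (on e v))))
            (≋-reflexive (P-vals a l n w m m' λ {v} _ → on e v)))

theorem8 : (Γ : Subgraph) (a : ℤ) → Ordinary Γ a →
  (∃ λ i → a ≤ i × rowCount Γ (i + + 1) > rowCount Γ i) →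
  (bs : List ℤ) → length bs ≡ rowCount Γ a → Linked (λ x y → y ≤ x) bs →
  PsiVanishes Γ a bs
theorem8 Γ a ord grows bs _ _ = Quotient.vanishes Γ a bs
  (λ {m} {m'} e → ≋-trans (same m) (≋-trans (S-resp a l₀ n₀ ts tops word e) (≋-sym (same m'))))
  (Null-cong (λ m → ≋-sym (same m)) (null (contains-D grows)))
  where
  open Word Γ a ord
  open Domain Γ a ord bs
  same : ∀ m → Scoeff Γ a bs m ≋ S word m
  same = Scoeff≋S λ m h → Weight.weight≋wts Γ a ord m h
  null : (∃ λ w₁ → ∃ λ w₂ → word ≡ w₁ ++ sD ∷ w₂) → Null (S word)
  null (w₁ , w₂ , e) = subst (λ w → Null (S w)) (sym e)
    (Shape.null-D a l₀ n₀ ts tops w₂ w₁ (subst (λ w → afterN n₀ w ℕ.≤ 1) e (subst (ℕ._≤ 1) (sym ends) ℕ.z≤n)))
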